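{- Let $s\ge 2$ be a fixed integer. For $i=1,\ldots,s$ let $E_i$ be an elliptic curve over $\mathbb{Q}$ (not necessarily distinct) given by a short Weierstrass equation $y^2=x^3+a_ix+b_i$ with $a_i,b_i\in\mathbb{Z}$, let $P_i\in E_i(\mathbb{Q})$ be a non-torsion point and let $Q_i\in E_i(\mathbb{Q})$ be an arbitrary point. For $M\ge 0$ and $N\ge 1$ let $D^*_{\mathsf P,\mathsf Q}(M,N)$ be the number of integer $s$-tuples $(n_1,\ldots,n_s)\in(M,M+N]^s$ such that $d_{n_1P_1+Q_1},\ldots,d_{n_sP_s+Q_s}$ are multiplicatively dependent of maximal rank, and let $X^*_{\mathsf P,\mathsf Q}(M,N)$ be the number of integer $s$-tuples $(n_1,\ldots,n_s)\in(M,M+N]^s$ such that $x(n_1P_1+Q_1),\ldots,x(n_sP_s+Q_s)$ are multiplicatively dependent of maximal rank. Then, uniformly over $M\ge 0$, \[ D^*_{\mathsf P,\mathsf Q}(M,N)\ll N^{6s/7}, \] and if moreover $b_i\neq 0$ for all $i=1,\ldots,s$, then, uniformly over $M\ge0$, \[ X^*_{\mathsf P,\mathsf Q}(M,N)\ll N^{6s/7}. \] Here the implied constants depend only on $s$ and on the points $P_1,\ldots,P_s,Q_1,\ldots,Q_s$ (hence on the curves), and not on $M$ or $N$.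
   Context: For an elliptic curve $E$ over $\mathbb{Q}$ given by $y^2=x^3+ax+b$ with $a,b\in\mathbb{Z}$, every point $R\in E(\mathbb{Q})$ other than the point at infinity is written in lowest form as $R=(a_R/d_R^2,\; b_R/d_R^3)$ with $d_R\in\mathbb{N}$, $a_R,b_R\in\mathbb{Z}$ and $\gcd(a_Rb_R,d_R)=1$; $d_R$ is called the denominator of $R$ and $x(R)=a_R/d_R^2$ is its $x$-coordinate. Nonzero complex numbers $\gamma_1,\ldots,\gamma_s$ are multiplicatively dependent if there are integers $k_1,\ldots,k_s$, not all zero, with $\gamma_1^{k_1}\cdots\gamma_s^{k_s}=1$; they are multiplicatively dependent of maximal rank if they are multiplicatively dependent and no proper sub-tuple of $(\gamma_1,\ldots,\gamma_s)$ is multiplicatively dependent. The notation $U\ll V$ means $|U|\le cV$ for some constant $c>0$. -}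

module Defs where

open import Data.Nat as ℕ using (ℕ; zero; suc; _≤ᵇ_)
open import Data.Integer as ℤ using (ℤ; +_; -[1+_])
open import Data.Rational as ℚ using (ℚ; 0ℚ; 1ℚ; _+_; _*_; _-_; -_; 1/_; ↧ₙ_; NonZero; ≢-nonZero; _/_)
open import Data.Rational.Properties using (_≟_)
open import Data.Fin using (Fin; zero; suc)
open import Data.Vec using (Vec; lookup)
open import Data.Bool using (Bool; true; false; if_then_else_)
open import Data.Product using (Σ; ∃; _×_; _,_)
open import Relation.Nullary using (¬_; yes; no)
open import Relation.Binary.PropositionalEquality using (_≡_; _≢_)

record Curve : Set where
  field
    a b : ℤ
    nonsingular : (+ 4) ℤ.* (a ℤ.* a ℤ.* a) ℤ.+ (+ 27) ℤ.* (b ℤ.* b) ≢ + 0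
open Curve public

data Pt : Set where
  O   : Pt
  aff : ℚ → ℚ → Pt

ℤ→ℚ : ℤ → ℚ
ℤ→ℚ z = z / 1

ℕ→ℚ : ℕ → ℚ
ℕ→ℚ n = ℤ→ℚ (+ n)

OnCurve : Curve → Pt → Set
OnCurve E O         = Data.Unit.⊤ where import Data.Unit
OnCurve E (aff x y) = y * y ≡ x * x * x + ℤ→ℚ (a E) * x + ℤ→ℚ (b E)

-- total division on ℚ (only ever used with nonzero divisor below)
_÷'_ : ℚ → ℚ → ℚ
p ÷' q with q ≟ 0ℚ
... | yes _  = 0ℚ
... | no q≢0 = p * (1/_ q {{≢-nonZero q≢0}})

add : Curve → Pt → Pt → Pt
add E O Q = Q
add E P O = P
add E (aff x₁ y₁) (aff x₂ y₂) with x₁ ≟ x₂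
... | no _ = let l = (y₂ - y₁) ÷' (x₂ - x₁)
                 x₃ = l * l - x₁ - x₂
             in aff x₃ (l * (x₁ - x₃) - y₁)
... | yes _ with y₁ + y₂ ≟ 0ℚ
...   | yes _ = O
...   | no _  = let l = (ℕ→ℚ 3 * x₁ * x₁ + ℤ→ℚ (a E)) ÷' (ℕ→ℚ 2 * y₁)
                    x₃ = l * l - x₁ - x₂
                in aff x₃ (l * (x₁ - x₃) - y₁)

mul : Curve → ℕ → Pt → Pt
mul E zero    P = O
mul E (suc n) P = add E P (mul E n P)

NonTorsion : Curve → Pt → Set
NonTorsion E P = (n : ℕ) → mul E (suc n) P ≢ O

-- x-coordinate and denominator d_R (with x(R) = a_R / d_R² in lowest terms).
-- Junk value 0 at the point at infinity; since multiplicative dependence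
-- is only defined for nonzero numbers, such tuples are never counted.

xcoord : Pt → ℚ
xcoord O         = 0ℚ
xcoord (aff x _) = x

isqrt : ℕ → ℕ
isqrt m = go m
  where
  go : ℕ → ℕ
  go zero    = zero
  go (suc k) = if suc k ℕ.* suc k ≤ᵇ m then suc k else go k

-- d_R : the denominator of x(R) is d_R², so d_R = √(denominator of x(R))
den : Pt → ℕ
den O         = 0
den (aff x _) = isqrt (↧ₙ x)

-- integer powers on ℚ (γ^k for γ ≠ 0; junk 0 otherwise)
_^ℕ_ : ℚ → ℕ → ℚ
γ ^ℕ zero  = 1ℚ
γ ^ℕ suc n = γ * (γ ^ℕ n)

_^ℤ_ : ℚ → ℤ → ℚ
γ ^ℤ (+ n)     = γ ^ℕ n
γ ^ℤ -[1+ n ]  = 1ℚ ÷' (γ ^ℕ suc n)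

prodFin : (s : ℕ) → (Fin s → ℚ) → ℚ
prodFin zero    f = 1ℚ
prodFin (suc s) f = f zero * prodFin s (λ i → f (suc i))

-- γ restricted to the indices in S (given as a predicate S : Fin s → Bool)
-- is multiplicatively dependent: there are integers k_i (i ∈ S), not all
-- zero, with ∏_{i∈S} γ_i^{k_i} = 1 (exponents outside S are set to 0).
-- Taking S = everything gives the usual notion for the full tuple.
SubMultDep : (s : ℕ) → (Fin s → ℚ) → (Fin s → Bool) → Set
SubMultDep s γ S =
  Σ (Fin s → ℤ) λ k →
    ((i : Fin s) → S i ≡ false → k i ≡ + 0) ×
    (∃ λ i → k i ≢ + 0) ×
    prodFin s (λ i → γ i ^ℤ k i) ≡ 1ℚ

MultDep : (s : ℕ) → (Fin s → ℚ) → Set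
MultDep s γ = SubMultDep s γ (λ _ → true)

Proper : (s : ℕ) → (Fin s → Bool) → Set
Proper s S = ∃ λ i → S i ≡ false

MaxRankDep : (s : ℕ) → (Fin s → ℚ) → Set
MaxRankDep s γ =
  ((i : Fin s) → γ i ≢ 0ℚ) ×
  MultDep s γ ×
  ((S : Fin s → Bool) → Proper s S → ¬ SubMultDep s γ S)

InBox : {s : ℕ} → ℕ → ℕ → Vec ℕ s → Set
InBox {s} M N v = (i : Fin s) → M ℕ.< lookup v i × lookup v i ℕ.≤ M ℕ.+ N

pts : {s : ℕ} → (Fin s → Curve) → (Fin s → Pt) → (Fin s → Pt) → Vec ℕ s → Fin s → Pt
pts E P Q v i = add (E i) (mul (E i) (lookup v i) (P i)) (Q i)

DStarProp : {s : ℕ} → (Fin s → Curve) → (Fin s → Pt) → (Fin s → Pt) → Vec ℕ s → Set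
DStarProp {s} E P Q v = MaxRankDep s (λ i → ℕ→ℚ (den (pts E P Q v i)))

XStarProp : {s : ℕ} → (Fin s → Curve) → (Fin s → Pt) → (Fin s → Pt) → Vec ℕ s → Set
XStarProp {s} E P Q v = MaxRankDep s (λ i → xcoord (pts E P Q v i))

-- The points n Pᵢ + Qᵢ have quadratically growing heights (near-parallelogram law), while
-- the points whose denominators are divisible by D form cosets of a subgroup: if D divides
-- two denominators, it divides that of a multiple of Pᵢ by the difference of the indices,
-- whose logarithm is at most quadratic in that difference. The same repulsion holds at the
-- archimedean place. Hence, if N ≈ B⁷ and S is the set of primes dividing the denominators
-- of m Pᵢ for m ≤ B², the number of n in an interval of length N with all primes in S is
-- O(B⁶): a dyadic decomposition of the interval bounds what |S| places contribute to the
-- heights, and |S| log N = O(B⁶). A prime outside S divides the denominators of at most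
-- N / B² = O(B⁵) of the points; the numerators are treated alike when b ≠ 0.
--
-- In a dependent tuple of maximal rank no exponent vanishes. Choosing coordinates one at a
-- time, at least half of those divisible by a prime outside S are confined, by a prime
-- dividing the coordinates chosen earlier, to O(B⁵) values. Free and confined coordinates
-- together have B⁷ B⁵ = (B⁶)² choices, so the number of tuples is O(B^{6 s}) = O(N^{6 s / 7}).
module Submission where

-- The exponent comes from balancing one parameter, the window `w`. The first `w` multiples produce
-- a set `S` of logarithmic weight `w³`, which governs the smooth values, while a prime outside `S`
-- leaves about `N / w` values. A free coordinate with a confined one costs no more than two smooth
-- ones if `N · N / w = (w³)²`, that is `w = N^(2/7)` and `w³ = N^(6/7)`. The logarithm lost in the
-- dyadic decomposition is regained because a number of logarithm `X` has only `O(X / log X)` prime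
-- divisors.
--
-- The exponents of the relation are unknown and a partial product may involve many primes. Gaussian
-- elimination supplies at most `s` primes, independent of these exponents, that witness its
-- nontriviality; this keeps the branching bounded in terms of `s`.
--
-- Heights are rounded binary logarithms with a parallelogram law up to a constant. A multiple of
-- `Pᵢ` whose height exceeds that constant makes them strictly convex along progressions, which
-- replaces the canonical height. Reduction modulo `D` is replaced by the quadratic equation for the
-- abscissae of `A + B` and `A - B`.

-- Reflective proofs of polynomial identities

module RingIdentity where

  open import Algebra.Bundles using (CommutativeRing)
  open import Algebra.Structures using (IsCommutativeRing)
  import Algebra.Properties.CommutativeSemigroup as CSG
  import Algebra.Properties.Ring as RingProps
  open import Data.Bool using (Bool; true; false; if_then_else_)
  open import Data.Nat as ℕ using (ℕ; zero; suc; _≡ᵇ_; _<ᵇ_)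
  import Data.Nat.Properties as ℕ
  open import Data.Integer as ℤ using (ℤ; +_; -[1+_])
  open import Data.Fin using (toℕ)
  open import Data.Vec using (tabulate)
  open import Data.Vec.N-ary using (N-ary; _$ⁿ_)
  open import Data.List using (List; []; _∷_; length)
  open import Data.Product using (_×_; _,_; proj₁; proj₂)
  open import Data.Unit using (tt)
  open import Function using (case_of_)
  open import Level using (0ℓ)
  open import Relation.Binary.PropositionalEquality

  -- Equality of polynomial expressions over ℤ is decided on sparse polynomials,
  -- i.e. lists of coefficient-exponent pairs in decreasing lexicographic order.

  infix 4 _⊜_
  infixl 6 _⊕_ _⊖_
  infixl 7 _⊗_
  infix 8 ⊝_
  infix 9 #_

  data Expr : Set where
    indet   : ℕ → Expr
    const   : ℤ → Expr
    _⊕_ _⊗_ : Expr → Expr → Expr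
    ⊝_      : Expr → Expr

  _⊖_ : Expr → Expr → Expr
  e ⊖ f = e ⊕ (⊝ f)

  #_ : ℕ → Expr
  # n = const (+ n)

  _⊜_ : Expr → Expr → Expr × Expr
  _⊜_ = _,_

  generic : ∀ n → N-ary n Expr (Expr × Expr) → Expr × Expr
  generic n equation = equation $ⁿ tabulate {n = n} (λ i → indet (toℕ i))

  private
    Mono Poly : Set
    Mono = List ℕ
    Poly = List (ℤ × Mono)

    data Order : Set where less equal greater : Order

    -- An exponent list stands for its extension by zeros, so trailing zeros must not distinguish
    -- two monomials.
    compareMono : Mono → Mono → Order
    compareMono [] [] = equal
    compareMono [] (b ∷ n) = if b ≡ᵇ 0 then compareMono [] n else less
    compareMono (a ∷ m) [] = if a ≡ᵇ 0 then compareMono m [] else greater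
    compareMono (a ∷ m) (b ∷ n) =
      if a ≡ᵇ b then compareMono m n else if a <ᵇ b then less else greater

    mulMono : Mono → Mono → Mono
    mulMono [] n = n
    mulMono (a ∷ m) [] = a ∷ m
    mulMono (a ∷ m) (b ∷ n) = a ℕ.+ b ∷ mulMono m n

    unit : ℕ → Mono
    unit zero = 1 ∷ []
    unit (suc i) = 0 ∷ unit i

    -- Dropping zero coefficients makes a polynomial that cancels normalise to the literal `[]`
    -- demanded by `identity`.
    cons : ℤ → Mono → Poly → Poly
    cons (+ 0) _ p = p
    cons c m p = (c , m) ∷ p

    -- Merging two sorted lists recurses now on one, now on the other. With the addition of the
    -- remaining terms as the continuation `k`, each recursion is structural.
    insert : ℤ → Mono → (Poly → Poly) → Poly → Poly
    insert c m k [] = (c , m) ∷ k []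
    insert c m k ((d , n) ∷ q) with compareMono m n
    ... | less    = (d , n) ∷ insert c m k q
    ... | equal   = cons (c ℤ.+ d) m (k q)
    ... | greater = (c , m) ∷ k ((d , n) ∷ q)

    addPoly : Poly → Poly → Poly
    addPoly [] = λ q → q
    addPoly ((c , m) ∷ p) = insert c m (addPoly p)

    mulTerm : ℤ → Mono → Poly → Poly
    mulTerm c m [] = []
    mulTerm c m ((d , n) ∷ p) = (c ℤ.* d , mulMono m n) ∷ mulTerm c m p

    mulPoly : Poly → Poly → Poly
    mulPoly [] q = []
    mulPoly ((c , m) ∷ p) q = addPoly (mulTerm c m q) (mulPoly p q)

  normal : Expr → Poly
  normal (indet i) = (+ 1 , unit i) ∷ []
  normal (const c) = cons c [] []
  normal (e ⊕ f) = addPoly (normal e) (normal f)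
  normal (e ⊗ f) = mulPoly (normal e) (normal f)
  normal (⊝ e) = mulTerm -[1+ 0 ] [] (normal e)

  module Semantics
    {R : Set} {_+_ _*_ : R → R → R} { -_ : R → R} {0# 1# : R}
    (isCR : IsCommutativeRing _≡_ _+_ _*_ -_ 0# 1#)
    (⟦_⟧ : ℤ → R)
    (⟦+⟧ : ∀ i j → ⟦ i ℤ.+ j ⟧ ≡ ⟦ i ⟧ + ⟦ j ⟧)
    (⟦*⟧ : ∀ i j → ⟦ i ℤ.* j ⟧ ≡ ⟦ i ⟧ * ⟦ j ⟧)
    (⟦0⟧ : ⟦ + 0 ⟧ ≡ 0#) (⟦1⟧ : ⟦ + 1 ⟧ ≡ 1#) (⟦-1⟧ : ⟦ -[1+ 0 ] ⟧ ≡ - 1#)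
    where

    private
      CR : CommutativeRing 0ℓ 0ℓ
      CR = record { isCommutativeRing = isCR }
      open CommutativeRing CR using (+-assoc; +-comm; *-assoc; *-comm; +-identityˡ; +-identityʳ;
        *-identityˡ; *-identityʳ; zeroˡ; zeroʳ; distribˡ; distribʳ; -‿inverseʳ;
        +-commutativeSemigroup; *-commutativeSemigroup)
      open CSG +-commutativeSemigroup using () renaming (x∙yz≈y∙xz to +-left-comm; interchange to +-interchange)
      open CSG *-commutativeSemigroup using () renaming (interchange to *-interchange)
      open RingProps (CommutativeRing.ring CR) using (-1*x≈-x)

      power : R → ℕ → R
      power x zero = 1#
      power x (suc n) = x * power x n

      -- Indeterminates beyond the environment take the value 1, here as in `lookup`; the soundness
      -- lemmas then hold for environments of every length.
      mono : Mono → List R → R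
      mono (a ∷ m) (x ∷ ρ) = power x a * mono m ρ
      mono _ _ = 1#

      poly : Poly → List R → R
      poly [] ρ = 0#
      poly ((c , m) ∷ p) ρ = (⟦ c ⟧ * mono m ρ) + poly p ρ

    lookup : List R → ℕ → R
    lookup [] _ = 1#
    lookup (x ∷ _) zero = x
    lookup (_ ∷ ρ) (suc i) = lookup ρ i

    eval : Expr → List R → R
    eval (indet i) ρ = lookup ρ i
    eval (const c) ρ = ⟦ c ⟧
    eval (e ⊕ f) ρ = eval e ρ + eval f ρ
    eval (e ⊗ f) ρ = eval e ρ * eval f ρ
    eval (⊝ e) ρ = - eval e ρ

    private
      nil : ∀ ρ → mono [] ρ ≡ 1#
      nil [] = refl
      nil (_ ∷ _) = refl

      power-+ : ∀ x a b → power x (a ℕ.+ b) ≡ power x a * power x b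
      power-+ x zero b = sym (*-identityˡ _)
      power-+ x (suc a) b = trans (cong (x *_) (power-+ x a b)) (sym (*-assoc _ _ _))

      compareMono-sound : ∀ m n ρ → compareMono m n ≡ equal → mono m ρ ≡ mono n ρ
      compareMono-sound [] [] ρ e = refl
      compareMono-sound [] (b ∷ n) [] e = refl
      compareMono-sound [] (zero ∷ n) (x ∷ ρ) e = trans (sym (nil ρ)) (trans (compareMono-sound [] n ρ e) (sym (*-identityˡ _)))
      compareMono-sound (a ∷ m) [] [] e = refl
      compareMono-sound (zero ∷ m) [] (x ∷ ρ) e = trans (*-identityˡ _) (trans (compareMono-sound m [] ρ e) (nil ρ))
      compareMono-sound (a ∷ m) (b ∷ n) [] e = refl
      compareMono-sound (a ∷ m) (b ∷ n) (x ∷ ρ) e with a ≡ᵇ b in ab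
      ... | true = cong₂ _*_ (cong (power x) (ℕ.≡ᵇ⇒≡ a b (subst Data.Bool.T (sym ab) tt))) (compareMono-sound m n ρ e)
      ... | false with a <ᵇ b
      ...   | true  = case e of λ ()
      ...   | false = case e of λ ()

      mulMono-sound : ∀ m n ρ → mono (mulMono m n) ρ ≡ mono m ρ * mono n ρ
      mulMono-sound [] n ρ = sym (trans (cong (λ u → u * mono n ρ) (nil ρ)) (*-identityˡ _))
      mulMono-sound (a ∷ m) [] ρ = sym (trans (cong (λ u → mono (a ∷ m) ρ * u) (nil ρ)) (*-identityʳ _))
      mulMono-sound (a ∷ m) (b ∷ n) [] = sym (*-identityˡ _)
      mulMono-sound (a ∷ m) (b ∷ n) (x ∷ ρ) =
        trans (cong₂ _*_ (power-+ x a b) (mulMono-sound m n ρ)) (*-interchange _ _ _ _)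

      unit-sound : ∀ i ρ → mono (unit i) ρ ≡ lookup ρ i
      unit-sound zero [] = refl
      unit-sound zero (x ∷ ρ) = trans (cong (λ u → (x * 1#) * u) (nil ρ)) (trans (*-identityʳ _) (*-identityʳ _))
      unit-sound (suc i) [] = refl
      unit-sound (suc i) (x ∷ ρ) = trans (*-identityˡ _) (unit-sound i ρ)

      cons-sound : ∀ c m p ρ → poly (cons c m p) ρ ≡ (⟦ c ⟧ * mono m ρ) + poly p ρ
      cons-sound (+ 0) m p ρ = sym (trans (cong (λ u → u + poly p ρ) (trans (cong (λ u → u * mono m ρ) ⟦0⟧) (zeroˡ _))) (+-identityˡ _))
      cons-sound ℤ.+[1+ _ ] m p ρ = refl
      cons-sound -[1+ _ ] m p ρ = refl

      insert-sound : ∀ c m p k ρ → (∀ q → poly (k q) ρ ≡ poly p ρ + poly q ρ) →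
                     ∀ q → poly (insert c m k q) ρ ≡ ((⟦ c ⟧ * mono m ρ) + poly p ρ) + poly q ρ
      insert-sound c m p k ρ h [] = trans (cong (λ u → _ + u) (h [])) (sym (+-assoc _ _ _))
      insert-sound c m p k ρ h ((d , n) ∷ q) with compareMono m n in eq
      ... | less = trans (cong (λ u → _ + u) (insert-sound c m p k ρ h q)) (+-left-comm _ _ _)
      ... | greater = trans (cong (λ u → _ + u) (h ((d , n) ∷ q))) (sym (+-assoc _ _ _))
      ... | equal = begin
        poly (cons (c ℤ.+ d) m (k q)) ρ                     ≡⟨ cons-sound (c ℤ.+ d) m (k q) ρ ⟩
        (⟦ c ℤ.+ d ⟧ * mono m ρ) + poly (k q) ρ             ≡⟨ cong₂ _+_ (trans (cong (λ u → u * mono m ρ) (⟦+⟧ c d)) (distribʳ _ _ _)) (h q) ⟩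
        ((⟦ c ⟧ * mono m ρ) + (⟦ d ⟧ * mono m ρ)) + (poly p ρ + poly q ρ)
          ≡⟨ cong (λ u → ((⟦ c ⟧ * mono m ρ) + (⟦ d ⟧ * u)) + (poly p ρ + poly q ρ)) (compareMono-sound m n ρ eq) ⟩
        ((⟦ c ⟧ * mono m ρ) + (⟦ d ⟧ * mono n ρ)) + (poly p ρ + poly q ρ) ≡⟨ +-interchange _ _ _ _ ⟩
        ((⟦ c ⟧ * mono m ρ) + poly p ρ) + ((⟦ d ⟧ * mono n ρ) + poly q ρ) ∎
        where open ≡-Reasoning

      addPoly-sound : ∀ p q ρ → poly (addPoly p q) ρ ≡ poly p ρ + poly q ρ
      addPoly-sound [] q ρ = sym (+-identityˡ _)
      addPoly-sound ((c , m) ∷ p) q ρ = insert-sound c m p (addPoly p) ρ (λ q → addPoly-sound p q ρ) q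

      mulTerm-sound : ∀ c m p ρ → poly (mulTerm c m p) ρ ≡ (⟦ c ⟧ * mono m ρ) * poly p ρ
      mulTerm-sound c m [] ρ = sym (zeroʳ _)
      mulTerm-sound c m ((d , n) ∷ p) ρ = trans
        (cong₂ _+_ (trans (cong₂ _*_ (⟦*⟧ c d) (mulMono-sound m n ρ)) (*-interchange _ _ _ _)) (mulTerm-sound c m p ρ))
        (sym (distribˡ _ _ _))

      mulPoly-sound : ∀ p q ρ → poly (mulPoly p q) ρ ≡ poly p ρ * poly q ρ
      mulPoly-sound [] q ρ = sym (zeroˡ _)
      mulPoly-sound ((c , m) ∷ p) q ρ = trans (addPoly-sound (mulTerm c m q) (mulPoly p q) ρ)
        (trans (cong₂ _+_ (mulTerm-sound c m q ρ) (mulPoly-sound p q ρ)) (sym (distribʳ _ _ _)))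

      normal-sound : ∀ e ρ → poly (normal e) ρ ≡ eval e ρ
      normal-sound (indet i) ρ = trans (+-identityʳ _) (trans (cong₂ _*_ ⟦1⟧ (unit-sound i ρ)) (*-identityˡ _))
      normal-sound (const c) ρ = trans (cons-sound c [] [] ρ) (trans (+-identityʳ _) (trans (cong (λ u → _ * u) (nil ρ)) (*-identityʳ _)))
      normal-sound (e ⊕ f) ρ = trans (addPoly-sound (normal e) (normal f) ρ) (cong₂ _+_ (normal-sound e ρ) (normal-sound f ρ))
      normal-sound (e ⊗ f) ρ = trans (mulPoly-sound (normal e) (normal f) ρ) (cong₂ _*_ (normal-sound e ρ) (normal-sound f ρ))
      normal-sound (⊝ e) ρ = trans (mulTerm-sound -[1+ 0 ] [] (normal e) ρ)
        (trans (cong₂ _*_ (trans (cong₂ _*_ ⟦-1⟧ (nil ρ)) (*-identityʳ _)) (normal-sound e ρ)) (-1*x≈-x _))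

    -- The hypothesis is closed by `refl` at each use: the check is an evaluation of `normal` on
    -- closed syntax, whatever the ring.
    identity : ∀ (ρ : List R) e f → normal (e ⊕ (⊝ f)) ≡ [] → eval e ρ ≡ eval f ρ
    identity ρ e f h = begin
      eval e ρ                                ≡⟨ +-identityʳ _ ⟨
      eval e ρ + 0#                           ≡⟨ cong (λ u → eval e ρ + u) (-‿inverseˡ (eval f ρ)) ⟨
      eval e ρ + ((- eval f ρ) + eval f ρ)    ≡⟨ +-assoc _ _ _ ⟨
      (eval e ρ + (- eval f ρ)) + eval f ρ    ≡⟨ cong (λ u → u + eval f ρ) (normal-sound (e ⊕ (⊝ f)) ρ) ⟨
      poly (normal (e ⊕ (⊝ f))) ρ + eval f ρ  ≡⟨ cong (λ p → poly p ρ + eval f ρ) h ⟩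
      0# + eval f ρ                           ≡⟨ +-identityˡ _ ⟩
      eval f ρ                                ∎
      where
      open ≡-Reasoning
      open CommutativeRing CR using (-‿inverseˡ)

    solve : (ρ : List R) (equation : N-ary (length ρ) Expr (Expr × Expr)) →
      let (e , f) = generic (length ρ) equation in
      normal (e ⊕ (⊝ f)) ≡ [] → eval e ρ ≡ eval f ρ
    solve ρ equation = identity ρ (proj₁ sides) (proj₂ sides)
      where sides = generic (length ρ) equation

-- Field arithmetic of ℚ and linear combinations of equations

module Rationals where

  open import Defs
  open import Data.Rational using (ℚ; mkℚ; 0ℚ; 1ℚ; _+_; _*_; _-_; -_; ↥_; ↧_; ≢-nonZero; toℚᵘ)
  open import Data.Rational.Properties
  import Data.Rational.Unnormalised as ℚᵘ
  import Data.Rational.Unnormalised.Properties as ℚᵘ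
  open import Data.Integer as ℤ using (ℤ; +_)
  import Data.Integer.Properties as ℤ
  open import Data.List using ([]; _∷_)
  open RingIdentity
  open import Data.Sum using (_⊎_; inj₁; inj₂)
  open import Relation.Nullary using (yes; no; contradiction)
  open import Relation.Binary.PropositionalEquality

  ℤ→ℚ-toℚᵘ : ∀ i → toℚᵘ (ℤ→ℚ i) ℚᵘ.≃ ℚᵘ.mkℚᵘ i 0
  ℤ→ℚ-toℚᵘ i = toℚᵘ-fromℚᵘ (ℚᵘ.mkℚᵘ i 0)

  ℤ→ℚ-+ : ∀ i j → ℤ→ℚ (i ℤ.+ j) ≡ ℤ→ℚ i + ℤ→ℚ j
  ℤ→ℚ-+ i j = toℚᵘ-injective (begin
    toℚᵘ (ℤ→ℚ (i ℤ.+ j))                   ≈⟨ ℤ→ℚ-toℚᵘ (i ℤ.+ j) ⟩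
    ℚᵘ.mkℚᵘ (i ℤ.+ j) 0                     ≈⟨ ℚᵘ.*≡* (cong (ℤ._* + 1) (cong₂ ℤ._+_ (sym (ℤ.*-identityʳ i)) (sym (ℤ.*-identityʳ j)))) ⟩
    ℚᵘ.mkℚᵘ i 0 ℚᵘ.+ ℚᵘ.mkℚᵘ j 0            ≈⟨ ℚᵘ.+-cong (ℚᵘ.≃-sym (ℤ→ℚ-toℚᵘ i)) (ℚᵘ.≃-sym (ℤ→ℚ-toℚᵘ j)) ⟩
    toℚᵘ (ℤ→ℚ i) ℚᵘ.+ toℚᵘ (ℤ→ℚ j)          ≈⟨ ℚᵘ.≃-sym (toℚᵘ-homo-+ (ℤ→ℚ i) (ℤ→ℚ j)) ⟩
    toℚᵘ (ℤ→ℚ i + ℤ→ℚ j)                    ∎)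
    where open ℚᵘ.≃-Reasoning

  ℤ→ℚ-* : ∀ i j → ℤ→ℚ (i ℤ.* j) ≡ ℤ→ℚ i * ℤ→ℚ j
  ℤ→ℚ-* i j = toℚᵘ-injective (begin
    toℚᵘ (ℤ→ℚ (i ℤ.* j))                   ≈⟨ ℤ→ℚ-toℚᵘ (i ℤ.* j) ⟩
    ℚᵘ.mkℚᵘ i 0 ℚᵘ.* ℚᵘ.mkℚᵘ j 0            ≈⟨ ℚᵘ.*-cong (ℚᵘ.≃-sym (ℤ→ℚ-toℚᵘ i)) (ℚᵘ.≃-sym (ℤ→ℚ-toℚᵘ j)) ⟩
    toℚᵘ (ℤ→ℚ i) ℚᵘ.* toℚᵘ (ℤ→ℚ j)          ≈⟨ ℚᵘ.≃-sym (toℚᵘ-homo-* (ℤ→ℚ i) (ℤ→ℚ j)) ⟩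
    toℚᵘ (ℤ→ℚ i * ℤ→ℚ j)                    ∎)
    where open ℚᵘ.≃-Reasoning

  ℤ→ℚ-injective : ∀ {i j} → ℤ→ℚ i ≡ ℤ→ℚ j → i ≡ j
  ℤ→ℚ-injective {i} {j} e = trans (sym (ℤ.*-identityʳ i)) (trans (ℚᵘ.drop-*≡* (fromℚᵘ-injective {ℚᵘ.mkℚᵘ i 0} {ℚᵘ.mkℚᵘ j 0} e)) (ℤ.*-identityʳ j))

  module Semℚ = Semantics +-*-isCommutativeRing ℤ→ℚ ℤ→ℚ-+ ℤ→ℚ-* refl refl refl

  open Semℚ public using () renaming (solve to identityℚ)

  *-cancel-0 : ∀ {x y} → x ≢ 0ℚ → x * y ≡ 0ℚ → y ≡ 0ℚ
  *-cancel-0 {x} {y} x≢0 xy = begin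
    y ≡⟨ *-identityˡ y ⟨
    1ℚ * y ≡⟨ cong (_* y) (*-inverseˡ x) ⟨
    (1/ x * x) * y ≡⟨ *-assoc (1/ x) x y ⟩
    1/ x * (x * y) ≡⟨ cong (1/ x *_) xy ⟩
    1/ x * 0ℚ ≡⟨ *-zeroʳ (1/ x) ⟩
    0ℚ ∎
    where
    open ≡-Reasoning
    open Data.Rational using (1/_)
    instance _ = ≢-nonZero x≢0

  *-≢0 : ∀ {x y} → x ≢ 0ℚ → y ≢ 0ℚ → x * y ≢ 0ℚ
  *-≢0 x≢0 y≢0 xy = y≢0 (*-cancel-0 x≢0 xy)

  *-zero-split : ∀ {x y} → x * y ≡ 0ℚ → x ≡ 0ℚ ⊎ y ≡ 0ℚ
  *-zero-split {x} xy with x ≟ 0ℚ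
  ... | yes x0 = inj₁ x0
  ... | no x≢0 = inj₂ (*-cancel-0 x≢0 xy)

  -‿≡0 : ∀ {x y} → x ≡ y → x - y ≡ 0ℚ
  -‿≡0 {x} refl = +-inverseʳ x

  ≡-from-‿ : ∀ {x y} → x - y ≡ 0ℚ → x ≡ y
  ≡-from-‿ {x} {y} e = begin
    x ≡⟨ (identityℚ (x ∷ y ∷ []) (λ x y → x ⊜ x ⊖ y ⊕ y) refl) ⟩
    (x - y) + y ≡⟨ cong (_+ y) e ⟩
    0ℚ + y ≡⟨ +-identityˡ y ⟩
    y ∎
    where open ≡-Reasoning

  -‿≢0 : ∀ {x y} → x ≢ y → x - y ≢ 0ℚ
  -‿≢0 x≢y e = x≢y (≡-from-‿ e)

  ÷'-* : ∀ p {q} → q ≢ 0ℚ → (p ÷' q) * q ≡ p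
  ÷'-* p {q} q≢0 with q ≟ 0ℚ
  ... | yes q≡0 = contradiction q≡0 q≢0
  ... | no  q≢0′ = trans (*-assoc p (1/ q) q) (trans (cong (p *_) (*-inverseˡ q)) (*-identityʳ p))
    where
    open Data.Rational using (1/_)
    instance _ = ≢-nonZero q≢0′

  via : ∀ {x y z : ℚ} → y ≡ z → x ≡ y → x ≡ z
  via e p = trans p e

  -- Linear combinations: u ≡ v follows from the equations lᵢ ≡ rᵢ once u - v is
  -- an explicit combination Σ cᵢ * (lᵢ - rᵢ).
  infixl 4 _⊞_
  infix 5 _·_

  _·_ : ∀ {l r} c → l ≡ r → c * (l - r) ≡ 0ℚ
  c · e = trans (cong (c *_) (-‿≡0 e)) (*-zeroʳ c)

  _⊞_ : ∀ {x y} → x ≡ 0ℚ → y ≡ 0ℚ → x + y ≡ 0ℚ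
  p ⊞ q = cong₂ _+_ p q

  linear : ∀ {u v s} → s ≡ 0ℚ → u - v ≡ s → u ≡ v
  linear p e = ≡-from-‿ (trans e p)

  *-cancel : ∀ {x y z} → z ≢ 0ℚ → z * x ≡ z * y → x ≡ y
  *-cancel {x} {y} {z} z≢0 e = ≡-from-‿ (*-cancel-0 z≢0 (linear (1ℚ · e) (identityℚ (z ∷ x ∷ y ∷ []) (λ z x y → z ⊗ (x ⊖ y) ⊖ # 0 ⊜ # 1 ⊗ (z ⊗ x ⊖ z ⊗ y)) refl)))

  ℤ→ℚ-neg : ∀ i → ℤ→ℚ (ℤ.- i) ≡ - ℤ→ℚ i
  ℤ→ℚ-neg i = linear (1ℚ · i-i) (identityℚ ((ℤ→ℚ (ℤ.- i)) ∷ (ℤ→ℚ i) ∷ []) (λ u v → u ⊖ ⊝ v ⊜ # 1 ⊗ (v ⊕ u ⊖ # 0)) refl)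
    where
    i-i : ℤ→ℚ i + ℤ→ℚ (ℤ.- i) ≡ 0ℚ
    i-i = trans (sym (ℤ→ℚ-+ i (ℤ.- i))) (cong ℤ→ℚ (ℤ.+-inverseʳ i))

  2≢0 : ℕ→ℚ 2 ≢ 0ℚ
  2≢0 e with ℤ→ℚ-injective {+ 2} {+ 0} e
  ... | ()

  *-↧ : ∀ x → x * ℤ→ℚ (↧ x) ≡ ℤ→ℚ (↥ x)
  *-↧ x = toℚᵘ-injective (begin
    toℚᵘ (x * ℤ→ℚ (↧ x))                  ≈⟨ toℚᵘ-homo-* x (ℤ→ℚ (↧ x)) ⟩
    toℚᵘ x ℚᵘ.* toℚᵘ (ℤ→ℚ (↧ x))          ≈⟨ ℚᵘ.*-cong (ℚᵘ.≃-refl {toℚᵘ x}) (ℤ→ℚ-toℚᵘ (↧ x)) ⟩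
    toℚᵘ x ℚᵘ.* ℚᵘ.mkℚᵘ (↧ x) 0           ≈⟨ lem x ⟩
    ℚᵘ.mkℚᵘ (↥ x) 0                       ≈⟨ ℚᵘ.≃-sym (ℤ→ℚ-toℚᵘ (↥ x)) ⟩
    toℚᵘ (ℤ→ℚ (↥ x))                      ∎)
    where
    open ℚᵘ.≃-Reasoning
    lem : ∀ x → toℚᵘ x ℚᵘ.* ℚᵘ.mkℚᵘ (↧ x) 0 ℚᵘ.≃ ℚᵘ.mkℚᵘ (↥ x) 0
    lem x@(mkℚ _ _ _) = ℚᵘ.*≡* (trans (ℤ.*-identityʳ (↥ x ℤ.* ↧ x)) (cong (↥ x ℤ.*_) (sym (ℤ.*-identityʳ (↧ x)))))

-- Lines meeting the cubic, in terms of Vieta's relations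

module CollinearTriples where

  open RingIdentity using (_⊕_; _⊗_; ⊝_; _⊖_; #_; _⊜_)
  open import Data.List using ([]; _∷_)
  open import Defs using (ℕ→ℚ)
  open Rationals
  open import Data.Rational using (ℚ; 0ℚ; 1ℚ; _+_; _*_; _-_; -_)
  open import Data.Rational.Properties
  open import Data.Sum as Sum using (_⊎_)
  open import Function using (id)
  open import Relation.Binary.PropositionalEquality

  module _ (a b : ℚ) where

    -- The line Y = l X + ν meets the curve in the three points (with
    -- multiplicity): X³ + a X + b − (l X + ν)² = (X − x₁) (X − x₂) (X − x₃).
    record Collinear (x₁ y₁ x₂ y₂ x₃ y₃ : ℚ) : Set where
      constructor collinear
      field
        l ν : ℚ
        on₁ : y₁ ≡ l * x₁ + ν
        on₂ : y₂ ≡ l * x₂ + ν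
        on₃ : y₃ ≡ l * x₃ + ν
        σ₁ : x₁ + x₂ + x₃ ≡ l * l
        σ₂ : x₁ * x₂ + x₁ * x₃ + x₂ * x₃ ≡ a - ℕ→ℚ 2 * (l * ν)
        σ₃ : x₁ * x₂ * x₃ ≡ ν * ν - b

  module _ {a b : ℚ} where

    swap₁₂ : ∀ {x₁ y₁ x₂ y₂ x₃ y₃} → Collinear a b x₁ y₁ x₂ y₂ x₃ y₃ → Collinear a b x₂ y₂ x₁ y₁ x₃ y₃
    swap₁₂ {x₁} {_} {x₂} {_} {x₃} (collinear l ν on₁ on₂ on₃ σ₁ σ₂ σ₃) = collinear l ν on₂ on₁ on₃
      (via σ₁ (identityℚ (x₂ ∷ x₁ ∷ x₃ ∷ []) (λ x₂ x₁ x₃ → x₂ ⊕ x₁ ⊕ x₃ ⊜ x₁ ⊕ x₂ ⊕ x₃) refl))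
      (via σ₂ (identityℚ (x₂ ∷ x₁ ∷ x₃ ∷ []) (λ x₂ x₁ x₃ → x₂ ⊗ x₁ ⊕ x₂ ⊗ x₃ ⊕ x₁ ⊗ x₃ ⊜ x₁ ⊗ x₂ ⊕ x₁ ⊗ x₃ ⊕ x₂ ⊗ x₃) refl))
      (via σ₃ (identityℚ (x₂ ∷ x₁ ∷ x₃ ∷ []) (λ x₂ x₁ x₃ → x₂ ⊗ x₁ ⊗ x₃ ⊜ x₁ ⊗ x₂ ⊗ x₃) refl))

    swap₂₃ : ∀ {x₁ y₁ x₂ y₂ x₃ y₃} → Collinear a b x₁ y₁ x₂ y₂ x₃ y₃ → Collinear a b x₁ y₁ x₃ y₃ x₂ y₂
    swap₂₃ {x₁} {_} {x₂} {_} {x₃} (collinear l ν on₁ on₂ on₃ σ₁ σ₂ σ₃) = collinear l ν on₁ on₃ on₂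
      (via σ₁ (identityℚ (x₁ ∷ x₃ ∷ x₂ ∷ []) (λ x₁ x₃ x₂ → x₁ ⊕ x₃ ⊕ x₂ ⊜ x₁ ⊕ x₂ ⊕ x₃) refl))
      (via σ₂ (identityℚ (x₁ ∷ x₃ ∷ x₂ ∷ []) (λ x₁ x₃ x₂ → x₁ ⊗ x₃ ⊕ x₁ ⊗ x₂ ⊕ x₃ ⊗ x₂ ⊜ x₁ ⊗ x₂ ⊕ x₁ ⊗ x₃ ⊕ x₂ ⊗ x₃) refl))
      (via σ₃ (identityℚ (x₁ ∷ x₃ ∷ x₂ ∷ []) (λ x₁ x₃ x₂ → x₁ ⊗ x₃ ⊗ x₂ ⊜ x₁ ⊗ x₂ ⊗ x₃) refl))

    negate : ∀ {x₁ y₁ x₂ y₂ x₃ y₃} → Collinear a b x₁ y₁ x₂ y₂ x₃ y₃ →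
             Collinear a b x₁ (- y₁) x₂ (- y₂) x₃ (- y₃)
    negate (collinear l ν on₁ on₂ on₃ σ₁ σ₂ σ₃) = collinear (- l) (- ν)
      (neg-on on₁) (neg-on on₂) (neg-on on₃)
      (trans σ₁ (identityℚ (l ∷ []) (λ l → l ⊗ l ⊜ ⊝ l ⊗ ⊝ l) refl))
      (trans σ₂ (identityℚ (a ∷ l ∷ ν ∷ []) (λ a l ν → a ⊖ # 2 ⊗ (l ⊗ ν) ⊜ a ⊖ # 2 ⊗ (⊝ l ⊗ ⊝ ν)) refl))
      (trans σ₃ (identityℚ (ν ∷ b ∷ []) (λ ν b → ν ⊗ ν ⊖ b ⊜ ⊝ ν ⊗ ⊝ ν ⊖ b) refl))
      where
      neg-on : ∀ {x y} → y ≡ l * x + ν → - y ≡ (- l) * x + (- ν)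
      neg-on {x} e = trans (cong -_ e) (identityℚ (l ∷ x ∷ ν ∷ []) (λ l x ν → ⊝ (l ⊗ x ⊕ ν) ⊜ ⊝ l ⊗ x ⊖ ν) refl)

    -- The Vieta factorisation evaluated at its root `x₁`. After a permutation of the points this
    -- shows that the curve is closed under addition.
    collinear⇒curve : ∀ {x₁ y₁ x₂ y₂ x₃ y₃} → Collinear a b x₁ y₁ x₂ y₂ x₃ y₃ → y₁ * y₁ ≡ x₁ * x₁ * x₁ + a * x₁ + b
    collinear⇒curve {x₁} {y₁} {x₂} {_} {x₃} (collinear l ν on₁ _ _ σ₁ σ₂ σ₃) =
      linear ((y₁ + (l * x₁ + ν)) · on₁ ⊞ (- (x₁ * x₁)) · σ₁ ⊞ x₁ · σ₂ ⊞ (- 1ℚ) · σ₃)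
          (identityℚ (y₁ ∷ x₁ ∷ a ∷ b ∷ l ∷ ν ∷ x₂ ∷ x₃ ∷ []) (λ y₁ x₁ a b l ν x₂ x₃ →
              y₁ ⊗ y₁ ⊖ (x₁ ⊗ x₁ ⊗ x₁ ⊕ a ⊗ x₁ ⊕ b)
              ⊜ (y₁ ⊕ (l ⊗ x₁ ⊕ ν)) ⊗ (y₁ ⊖ (l ⊗ x₁ ⊕ ν)) ⊕ ⊝ (x₁ ⊗ x₁) ⊗ (x₁ ⊕ x₂ ⊕ x₃ ⊖ l ⊗ l)
                ⊕ x₁ ⊗ (x₁ ⊗ x₂ ⊕ x₁ ⊗ x₃ ⊕ x₂ ⊗ x₃ ⊖ (a ⊖ # 2 ⊗ (l ⊗ ν))) ⊕ ⊝ # 1 ⊗ (x₁ ⊗ x₂ ⊗ x₃ ⊖ (ν ⊗ ν ⊖ b))) refl)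

    chord : ∀ {x₁ y₁ x₂ y₂} l → x₁ ≢ x₂ → y₁ * y₁ ≡ x₁ * x₁ * x₁ + a * x₁ + b → y₂ * y₂ ≡ x₂ * x₂ * x₂ + a * x₂ + b →
            l * (x₂ - x₁) ≡ y₂ - y₁ →
            let x₃ = l * l - x₁ - x₂ in Collinear a b x₁ y₁ x₂ y₂ x₃ (l * x₃ + (y₁ - l * x₁))
    chord {x₁} {y₁} {x₂} {y₂} l x₁≢x₂ h₁ h₂ hl = collinear l (y₁ - l * x₁)
      (identityℚ (y₁ ∷ l ∷ x₁ ∷ []) (λ y₁ l x₁ → y₁ ⊜ l ⊗ x₁ ⊕ (y₁ ⊖ l ⊗ x₁)) refl)
      (linear ((- 1ℚ) · hl)
        (identityℚ (y₂ ∷ l ∷ x₂ ∷ y₁ ∷ x₁ ∷ []) (λ y₂ l x₂ y₁ x₁ → y₂ ⊖ (l ⊗ x₂ ⊕ (y₁ ⊖ l ⊗ x₁)) ⊜ ⊝ # 1 ⊗ (l ⊗ (x₂ ⊖ x₁) ⊖ (y₂ ⊖ y₁))) refl))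
      refl
      (identityℚ (x₁ ∷ x₂ ∷ l ∷ []) (λ x₁ x₂ l → x₁ ⊕ x₂ ⊕ (l ⊗ l ⊖ x₁ ⊖ x₂) ⊜ l ⊗ l) refl)
      σ₂
      (linear ((- 1ℚ) · h₁ ⊞ x₁ · σ₂)
        (identityℚ (x₁ ∷ x₂ ∷ l ∷ y₁ ∷ b ∷ a ∷ []) (λ x₁ x₂ l y₁ b a →
            x₁ ⊗ x₂ ⊗ (l ⊗ l ⊖ x₁ ⊖ x₂) ⊖ ((y₁ ⊖ l ⊗ x₁) ⊗ (y₁ ⊖ l ⊗ x₁) ⊖ b)
            ⊜ ⊝ # 1 ⊗ (y₁ ⊗ y₁ ⊖ (x₁ ⊗ x₁ ⊗ x₁ ⊕ a ⊗ x₁ ⊕ b))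
              ⊕ x₁ ⊗ (x₁ ⊗ x₂ ⊕ x₁ ⊗ (l ⊗ l ⊖ x₁ ⊖ x₂) ⊕ x₂ ⊗ (l ⊗ l ⊖ x₁ ⊖ x₂) ⊖ (a ⊖ # 2 ⊗ (l ⊗ (y₁ ⊖ l ⊗ x₁))))) refl))
      where
      σ₂ : x₁ * x₂ + x₁ * (l * l - x₁ - x₂) + x₂ * (l * l - x₁ - x₂) ≡ a - ℕ→ℚ 2 * (l * (y₁ - l * x₁))
      -- Both points satisfy the cubic obtained by substituting the line. The difference of the two
      -- equations is this relation multiplied by `x₁ - x₂`.
      σ₂ = *-cancel (-‿≢0 x₁≢x₂)
        (linear (1ℚ · h₁ ⊞ (- 1ℚ) · h₂ ⊞ (- (l * x₂ + (y₁ - l * x₁) + y₂)) · hl)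
            (identityℚ (x₁ ∷ x₂ ∷ l ∷ a ∷ y₁ ∷ b ∷ y₂ ∷ []) (λ x₁ x₂ l a y₁ b y₂ →
                (x₁ ⊖ x₂) ⊗ (x₁ ⊗ x₂ ⊕ x₁ ⊗ (l ⊗ l ⊖ x₁ ⊖ x₂) ⊕ x₂ ⊗ (l ⊗ l ⊖ x₁ ⊖ x₂)) ⊖ (x₁ ⊖ x₂) ⊗ (a ⊖ # 2 ⊗ (l ⊗ (y₁ ⊖ l ⊗ x₁)))
                ⊜ # 1 ⊗ (y₁ ⊗ y₁ ⊖ (x₁ ⊗ x₁ ⊗ x₁ ⊕ a ⊗ x₁ ⊕ b)) ⊕ ⊝ # 1 ⊗ (y₂ ⊗ y₂ ⊖ (x₂ ⊗ x₂ ⊗ x₂ ⊕ a ⊗ x₂ ⊕ b))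
                  ⊕ ⊝ (l ⊗ x₂ ⊕ (y₁ ⊖ l ⊗ x₁) ⊕ y₂) ⊗ (l ⊗ (x₂ ⊖ x₁) ⊖ (y₂ ⊖ y₁))) refl))

    tangent : ∀ {x₁ y₁} l → y₁ * y₁ ≡ x₁ * x₁ * x₁ + a * x₁ + b → l * (ℕ→ℚ 2 * y₁) ≡ ℕ→ℚ 3 * x₁ * x₁ + a →
              let x₃ = l * l - x₁ - x₁ in Collinear a b x₁ y₁ x₁ y₁ x₃ (l * x₃ + (y₁ - l * x₁))
    tangent {x₁} {y₁} l h₁ hl = collinear l (y₁ - l * x₁)
      (identityℚ (y₁ ∷ l ∷ x₁ ∷ []) (λ y₁ l x₁ → y₁ ⊜ l ⊗ x₁ ⊕ (y₁ ⊖ l ⊗ x₁)) refl)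
      (identityℚ (y₁ ∷ l ∷ x₁ ∷ []) (λ y₁ l x₁ → y₁ ⊜ l ⊗ x₁ ⊕ (y₁ ⊖ l ⊗ x₁)) refl)
      refl
      (identityℚ (x₁ ∷ l ∷ []) (λ x₁ l → x₁ ⊕ x₁ ⊕ (l ⊗ l ⊖ x₁ ⊖ x₁) ⊜ l ⊗ l) refl)
      σ₂
      (linear ((- 1ℚ) · h₁ ⊞ x₁ · σ₂)
        (identityℚ (x₁ ∷ l ∷ y₁ ∷ b ∷ a ∷ []) (λ x₁ l y₁ b a →
            x₁ ⊗ x₁ ⊗ (l ⊗ l ⊖ x₁ ⊖ x₁) ⊖ ((y₁ ⊖ l ⊗ x₁) ⊗ (y₁ ⊖ l ⊗ x₁) ⊖ b)
            ⊜ ⊝ # 1 ⊗ (y₁ ⊗ y₁ ⊖ (x₁ ⊗ x₁ ⊗ x₁ ⊕ a ⊗ x₁ ⊕ b))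
              ⊕ x₁ ⊗ (x₁ ⊗ x₁ ⊕ x₁ ⊗ (l ⊗ l ⊖ x₁ ⊖ x₁) ⊕ x₁ ⊗ (l ⊗ l ⊖ x₁ ⊖ x₁) ⊖ (a ⊖ # 2 ⊗ (l ⊗ (y₁ ⊖ l ⊗ x₁))))) refl))
      where
      σ₂ : x₁ * x₁ + x₁ * (l * l - x₁ - x₁) + x₁ * (l * l - x₁ - x₁) ≡ a - ℕ→ℚ 2 * (l * (y₁ - l * x₁))
      -- At a double root the relation for the coefficient of X is the tangent condition itself.
      σ₂ = linear (1ℚ · hl)
        (identityℚ (x₁ ∷ l ∷ a ∷ y₁ ∷ []) (λ x₁ l a y₁ →
            x₁ ⊗ x₁ ⊕ x₁ ⊗ (l ⊗ l ⊖ x₁ ⊖ x₁) ⊕ x₁ ⊗ (l ⊗ l ⊖ x₁ ⊖ x₁) ⊖ (a ⊖ # 2 ⊗ (l ⊗ (y₁ ⊖ l ⊗ x₁)))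
            ⊜ # 1 ⊗ (l ⊗ (# 2 ⊗ y₁) ⊖ (# 3 ⊗ x₁ ⊗ x₁ ⊕ a))) refl)

    collinear-chord : ∀ {x₁ y₁ x₂ y₂ x₃ y₃} (c : Collinear a b x₁ y₁ x₂ y₂ x₃ y₃) →
                      Collinear.l c * (x₂ - x₁) ≡ y₂ - y₁
    collinear-chord {x₁} {y₁} {x₂} {y₂} (collinear l ν on₁ on₂ _ _ _ _) =
      linear (1ℚ · on₁ ⊞ (- 1ℚ) · on₂)
        (identityℚ (l ∷ x₂ ∷ x₁ ∷ y₂ ∷ y₁ ∷ ν ∷ []) (λ l x₂ x₁ y₂ y₁ ν →
            l ⊗ (x₂ ⊖ x₁) ⊖ (y₂ ⊖ y₁)
            ⊜ # 1 ⊗ (y₁ ⊖ (l ⊗ x₁ ⊕ ν)) ⊕ ⊝ # 1 ⊗ (y₂ ⊖ (l ⊗ x₂ ⊕ ν))) refl)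

    -- Vieta's relations with a repeated root say that the derivatives agree there, so the slope is
    -- the tangent slope that `add` uses, however the line was obtained.
    collinear-tangent : ∀ {x₁ y₁ y₂ x₃ y₃} (c : Collinear a b x₁ y₁ x₁ y₂ x₃ y₃) →
                        Collinear.l c * (ℕ→ℚ 2 * y₁) ≡ ℕ→ℚ 3 * x₁ * x₁ + a
    collinear-tangent {x₁} {y₁} {_} {x₃} (collinear l ν on₁ _ _ σ₁ σ₂ _) =
      linear ((ℕ→ℚ 2 * l) · on₁ ⊞ (- (ℕ→ℚ 2 * x₁)) · σ₁ ⊞ 1ℚ · σ₂)
        (identityℚ (l ∷ y₁ ∷ x₁ ∷ a ∷ ν ∷ x₃ ∷ []) (λ l y₁ x₁ a ν x₃ →
            l ⊗ (# 2 ⊗ y₁) ⊖ (# 3 ⊗ x₁ ⊗ x₁ ⊕ a)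
            ⊜ # 2 ⊗ l ⊗ (y₁ ⊖ (l ⊗ x₁ ⊕ ν)) ⊕ ⊝ (# 2 ⊗ x₁) ⊗ (x₁ ⊕ x₁ ⊕ x₃ ⊖ l ⊗ l)
              ⊕ # 1 ⊗ (x₁ ⊗ x₁ ⊕ x₁ ⊗ x₃ ⊕ x₁ ⊗ x₃ ⊖ (a ⊖ # 2 ⊗ (l ⊗ ν)))) refl)

    collinear-x₃ : ∀ {x₁ y₁ x₂ y₂ x₃ y₃} (c : Collinear a b x₁ y₁ x₂ y₂ x₃ y₃) →
                   let l = Collinear.l c in l * l - x₁ - x₂ ≡ x₃
    collinear-x₃ {x₁} {_} {x₂} {_} {x₃} (collinear l _ _ _ _ σ₁ _ _) =
      linear ((- 1ℚ) · σ₁) (identityℚ (l ∷ x₁ ∷ x₂ ∷ x₃ ∷ []) (λ l x₁ x₂ x₃ → l ⊗ l ⊖ x₁ ⊖ x₂ ⊖ x₃ ⊜ ⊝ # 1 ⊗ (x₁ ⊕ x₂ ⊕ x₃ ⊖ l ⊗ l)) refl)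

    collinear-y₃ : ∀ {x₁ y₁ x₂ y₂ x₃ y₃} (c : Collinear a b x₁ y₁ x₂ y₂ x₃ y₃) →
                   let l = Collinear.l c in l * (x₁ - x₃) - y₁ ≡ - y₃
    collinear-y₃ {x₁} {y₁} {_} {_} {x₃} {y₃} (collinear l ν on₁ _ on₃ _ _ _) =
      linear ((- 1ℚ) · on₁ ⊞ 1ℚ · on₃)
        (identityℚ (l ∷ x₁ ∷ x₃ ∷ y₁ ∷ y₃ ∷ ν ∷ []) (λ l x₁ x₃ y₁ y₃ ν →
            l ⊗ (x₁ ⊖ x₃) ⊖ y₁ ⊖ ⊝ y₃
            ⊜ ⊝ # 1 ⊗ (y₁ ⊖ (l ⊗ x₁ ⊕ ν)) ⊕ # 1 ⊗ (y₃ ⊖ (l ⊗ x₃ ⊕ ν))) refl)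

    curve-± : ∀ {x₁ y₁ x₂ y₂} → y₁ * y₁ ≡ x₁ * x₁ * x₁ + a * x₁ + b → y₂ * y₂ ≡ x₂ * x₂ * x₂ + a * x₂ + b → x₁ ≡ x₂ → y₁ ≡ y₂ ⊎ y₁ + y₂ ≡ 0ℚ
    curve-± {x₁} {y₁} {_} {y₂} h₁ h₂ refl =
      Sum.map ≡-from-‿ id (*-zero-split {y₁ - y₂} {y₁ + y₂} (linear (1ℚ · h₁ ⊞ (- 1ℚ) · h₂)
        (identityℚ (y₁ ∷ y₂ ∷ x₁ ∷ a ∷ b ∷ []) (λ y₁ y₂ x₁ a b →
            (y₁ ⊖ y₂) ⊗ (y₁ ⊕ y₂) ⊖ # 0
            ⊜ # 1 ⊗ (y₁ ⊗ y₁ ⊖ (x₁ ⊗ x₁ ⊗ x₁ ⊕ a ⊗ x₁ ⊕ b)) ⊕ ⊝ # 1 ⊗ (y₂ ⊗ y₂ ⊖ (x₁ ⊗ x₁ ⊗ x₁ ⊕ a ⊗ x₁ ⊕ b))) refl)))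

    -- A line through a point of order two and tangent there would make the curve singular.
    no-double-2-torsion : ∀ {x₁ y₁ x₂ y₂ x₃ y₃} → Collinear a b x₁ y₁ x₂ y₂ x₃ y₃ → x₂ ≡ x₃ → y₂ + y₃ ≡ 0ℚ →
      (ℕ→ℚ 4 * (a * a * a) + ℕ→ℚ 27 * (b * b)) ≡ 0ℚ
    no-double-2-torsion {x₁} {_} {t} {y₂} {_} {y₃} (collinear l ν on₁ on₂ on₃ σ₁ σ₂ σ₃) refl y₂+y₃ =
      trans (cong₂ (λ u v → ℕ→ℚ 4 * (u * u * u) + ℕ→ℚ 27 * (v * v)) a≡ b≡) (singular t)
      where
      singular : ∀ t → ℕ→ℚ 4 * ((- (ℕ→ℚ 3 * (t * t))) * (- (ℕ→ℚ 3 * (t * t))) * (- (ℕ→ℚ 3 * (t * t)))) + ℕ→ℚ 27 * ((ℕ→ℚ 2 * (t * t * t)) * (ℕ→ℚ 2 * (t * t * t))) ≡ 0ℚ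
      singular t =
        identityℚ (t ∷ []) (λ t →
            # 4 ⊗ (⊝ (# 3 ⊗ (t ⊗ t)) ⊗ ⊝ (# 3 ⊗ (t ⊗ t)) ⊗ ⊝ (# 3 ⊗ (t ⊗ t))) ⊕ # 27 ⊗ (# 2 ⊗ (t ⊗ t ⊗ t) ⊗ (# 2 ⊗ (t ⊗ t ⊗ t)))
            ⊜ # 0) refl
      -- Both ordinates are the value of the line at `t`, so they are equal as well as opposite.
      0+ : l * t + ν ≡ 0ℚ
      0+ = *-cancel-0 {ℕ→ℚ 2} 2≢0 (linear ((- 1ℚ) · on₂ ⊞ (- 1ℚ) · on₃ ⊞ 1ℚ · y₂+y₃)
        (identityℚ (l ∷ t ∷ ν ∷ y₂ ∷ y₃ ∷ []) (λ l t ν y₂ y₃ →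
            # 2 ⊗ (l ⊗ t ⊕ ν) ⊖ # 0
            ⊜ ⊝ # 1 ⊗ (y₂ ⊖ (l ⊗ t ⊕ ν)) ⊕ ⊝ # 1 ⊗ (y₃ ⊖ (l ⊗ t ⊕ ν)) ⊕ # 1 ⊗ (y₂ ⊕ y₃ ⊖ # 0)) refl))
      -- The cubic becomes `(X - t)² (X + 2t)`, whose coefficients make the discriminant vanish.
      a≡ : a ≡ - (ℕ→ℚ 3 * (t * t))
      a≡ = linear ((ℕ→ℚ 2 * t) · σ₁ ⊞ (- 1ℚ) · σ₂ ⊞ (ℕ→ℚ 2 * l) · 0+)
        (identityℚ (a ∷ t ∷ x₁ ∷ l ∷ ν ∷ []) (λ a t x₁ l ν →
            a ⊖ ⊝ (# 3 ⊗ (t ⊗ t))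
            ⊜ # 2 ⊗ t ⊗ (x₁ ⊕ t ⊕ t ⊖ l ⊗ l) ⊕ ⊝ # 1 ⊗ (x₁ ⊗ t ⊕ x₁ ⊗ t ⊕ t ⊗ t ⊖ (a ⊖ # 2 ⊗ (l ⊗ ν)))
              ⊕ # 2 ⊗ l ⊗ (l ⊗ t ⊕ ν ⊖ # 0)) refl)
      b≡ : b ≡ ℕ→ℚ 2 * (t * t * t)
      b≡ = linear ((- (t * t)) · σ₁ ⊞ 1ℚ · σ₃ ⊞ (ν - l * t) · 0+)
        (identityℚ (b ∷ t ∷ x₁ ∷ l ∷ ν ∷ []) (λ b t x₁ l ν →
            b ⊖ # 2 ⊗ (t ⊗ t ⊗ t)
            ⊜ ⊝ (t ⊗ t) ⊗ (x₁ ⊕ t ⊕ t ⊖ l ⊗ l) ⊕ # 1 ⊗ (x₁ ⊗ t ⊗ t ⊖ (ν ⊗ ν ⊖ b)) ⊕ (ν ⊖ l ⊗ t) ⊗ (l ⊗ t ⊕ ν ⊖ # 0)) refl)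

-- Associativity in general position, by an interpolating parabola

module Associativity where

  open RingIdentity using (_⊕_; _⊗_; ⊝_; _⊖_; #_; _⊜_)
  open import Data.List using ([]; _∷_)
  open import Defs using (ℕ→ℚ; _÷'_)
  open Rationals
  open CollinearTriples
  open import Data.Rational using (ℚ; 0ℚ; 1ℚ; _+_; _*_; _-_; -_)
  open import Data.Rational.Properties
  open import Data.Product using (_,_; _×_)
  open import Data.Sum using (_⊎_; inj₁; inj₂)
  open import Relation.Binary.PropositionalEquality

  open Collinear using (l; ν)

  module _ {a b : ℚ} where

    -- Let A + B = -U and let S be the third point on the line through -U and C.
    -- With e the sum of the slopes, the quadratic q = l X + ν + (X - xA) (X - xB) / e
    -- interpolates A, B, C and S, and this is the condition that it passes through C.
    interpolation : ∀ {xA yA xB yB xC yC xU yU xS yS} →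
      (c : Collinear a b xA yA xB yB xU yU) (d : Collinear a b xU (- yU) xC yC xS yS) →
      (l d + l c) * (yC - (l c * xC + ν c)) ≡ (xC - xA) * (xC - xB)
    interpolation {xA} {yA} {xB} {yB} {xC} {yC} {xU} {yU} {xS} (collinear l ν _ _ onU σ₁ σ₂ _) (collinear m μ onU′ onC _ τ₁ τ₂ _) =
      linear ((m + l) · onC ⊞ (xC + xU) · σ₁ ⊞ (- (xC + xU)) · τ₁ ⊞ (- 1ℚ) · σ₂ ⊞ 1ℚ · τ₂
              ⊞ (m - l) · onU ⊞ (m - l) · onU′)
                (identityℚ (m ∷ l ∷ yC ∷ xC ∷ ν ∷ xA ∷ xB ∷ μ ∷ xU ∷ xS ∷ a ∷ yU ∷ []) (λ m l yC xC ν xA xB μ xU xS a yU →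
                    (m ⊕ l) ⊗ (yC ⊖ (l ⊗ xC ⊕ ν)) ⊖ (xC ⊖ xA) ⊗ (xC ⊖ xB)
                    ⊜ (m ⊕ l) ⊗ (yC ⊖ (m ⊗ xC ⊕ μ)) ⊕ (xC ⊕ xU) ⊗ (xA ⊕ xB ⊕ xU ⊖ l ⊗ l) ⊕ ⊝ (xC ⊕ xU) ⊗ (xU ⊕ xC ⊕ xS ⊖ m ⊗ m)
                      ⊕ ⊝ # 1 ⊗ (xA ⊗ xB ⊕ xA ⊗ xU ⊕ xB ⊗ xU ⊖ (a ⊖ # 2 ⊗ (l ⊗ ν)))
                      ⊕ # 1 ⊗ (xU ⊗ xC ⊕ xU ⊗ xS ⊕ xC ⊗ xS ⊖ (a ⊖ # 2 ⊗ (m ⊗ μ))) ⊕ (m ⊖ l) ⊗ (yU ⊖ (l ⊗ xU ⊕ ν))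
                      ⊕ (m ⊖ l) ⊗ (⊝ yU ⊖ (m ⊗ xU ⊕ μ))) refl)

    module _ {xA yA xB yB xC yC xU yU xS yS xV yV xS′ yS′ : ℚ}
      (c : Collinear a b xA yA xB yB xU yU) (d : Collinear a b xU (- yU) xC yC xS yS)
      (c′ : Collinear a b xC yC xB yB xV yV) (d′ : Collinear a b xV (- yV) xA yA xS′ yS′)
      (A≢C : xA ≢ xC) (B≢C : xB ≢ xC)
      (A≢B : xA ≢ xB ⊎ xA ≡ xB × yA ≡ yB × yA ≢ 0ℚ) where

      private
        open Collinear c using (on₁; on₂; on₃; σ₁; σ₂)
        open Collinear c′ using () renaming (l to l′; ν to ν′; on₁ to on₁′; on₂ to on₂′; on₃ to on₃′; σ₁ to σ₁′; σ₂ to σ₂′)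
        open Collinear d using () renaming (l to m; ν to μ; on₁ to p₁; on₃ to p₃; σ₁ to τ₁)
        open Collinear d′ using () renaming (l to m′; ν to μ′; on₁ to p₁′; on₂ to p₂′; on₃ to p₃′; σ₁ to τ₁′)
        l₀ ν₀ e e′ t : ℚ
        l₀ = Collinear.l c
        ν₀ = Collinear.ν c
        e = m + l₀
        e′ = m′ + l′
        t = (yC - yA) ÷' (xC - xA)

        C≢A : xC - xA ≢ 0ℚ
        C≢A h = A≢C (sym (≡-from-‿ h))

        t-def : t * (xC - xA) ≡ yC - yA
        t-def = ÷'-* (yC - yA) C≢A

        -- `t` is the divided difference of the interpolating parabola along AC; multiplying by `e`
        -- clears its leading coefficient `1 / e`.
        e*[t-l] : e * (t - l₀) ≡ xC - xB
        e*[t-l] = *-cancel C≢A (lemma {t} {e} {l₀} {ν₀} t-def (interpolation c d) on₁)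
          where
          lemma : ∀ {t e l ν} → t * (xC - xA) ≡ yC - yA → e * (yC - (l * xC + ν)) ≡ (xC - xA) * (xC - xB) →
                  yA ≡ l * xA + ν → (xC - xA) * (e * (t - l)) ≡ (xC - xA) * (xC - xB)
          lemma {t} {e} {l} {ν} h k on = linear (e · h ⊞ 1ℚ · k ⊞ (- e) · on)
            (identityℚ (xC ∷ xA ∷ e ∷ t ∷ l ∷ xB ∷ yC ∷ yA ∷ ν ∷ []) (λ xC xA e t l xB yC yA ν →
                (xC ⊖ xA) ⊗ (e ⊗ (t ⊖ l)) ⊖ (xC ⊖ xA) ⊗ (xC ⊖ xB)
                ⊜ e ⊗ (t ⊗ (xC ⊖ xA) ⊖ (yC ⊖ yA)) ⊕ # 1 ⊗ (e ⊗ (yC ⊖ (l ⊗ xC ⊕ ν)) ⊖ (xC ⊖ xA) ⊗ (xC ⊖ xB))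
                  ⊕ ⊝ e ⊗ (yA ⊖ (l ⊗ xA ⊕ ν))) refl)

        e′*[t-l′] : e′ * (t - l′) ≡ xA - xB
        e′*[t-l′] = *-cancel C≢A (lemma {t} {e′} {l′} {ν′} t-def (interpolation c′ d′) on₁′)
          where
          lemma : ∀ {t e l ν} → t * (xC - xA) ≡ yC - yA → e * (yA - (l * xA + ν)) ≡ (xA - xC) * (xA - xB) →
                  yC ≡ l * xC + ν → (xC - xA) * (e * (t - l)) ≡ (xC - xA) * (xA - xB)
          lemma {t} {e} {l} {ν} h k on = linear (e · h ⊞ (- 1ℚ) · k ⊞ e · on)
            (identityℚ (xC ∷ xA ∷ e ∷ t ∷ l ∷ xB ∷ yC ∷ yA ∷ ν ∷ []) (λ xC xA e t l xB yC yA ν →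
                (xC ⊖ xA) ⊗ (e ⊗ (t ⊖ l)) ⊖ (xC ⊖ xA) ⊗ (xA ⊖ xB)
                ⊜ e ⊗ (t ⊗ (xC ⊖ xA) ⊖ (yC ⊖ yA)) ⊕ ⊝ # 1 ⊗ (e ⊗ (yA ⊖ (l ⊗ xA ⊕ ν)) ⊖ (xA ⊖ xC) ⊗ (xA ⊖ xB))
                  ⊕ e ⊗ (yC ⊖ (l ⊗ xC ⊕ ν))) refl)

        e≢0 : e ≢ 0ℚ
        e≢0 h = *-≢0 C≢A (-‿≢0 (λ q → B≢C (sym q)))
          (trans (sym (interpolation c d)) (trans (cong (_* (yC - (l₀ * xC + ν₀))) h) (*-zeroˡ (yC - (l₀ * xC + ν₀)))))

        -- The parabolas of the two bracketings both pass through A, B and C, which now have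
        -- distinct abscissae, so their leading coefficients agree.
        chord-case : xA ≢ xB → e ≡ e′
        chord-case xA≢xB = sym (≡-from-‿ (*-cancel-0 (*-≢0 (-‿≢0 (λ q → B≢C (sym q))) (-‿≢0 (λ q → xA≢xB (sym q))))
                (lemma {t} {e} {e′} {l₀} {ν₀} {l′} {ν′} t-def on₁ on₂ on₁′ on₂′ e*[t-l] e′*[t-l′])))
          where
          lemma : ∀ {t e e′ l ν l′ ν′} → t * (xC - xA) ≡ yC - yA → yA ≡ l * xA + ν → yB ≡ l * xB + ν →
            yC ≡ l′ * xC + ν′ → yB ≡ l′ * xB + ν′ → e * (t - l) ≡ xC - xB → e′ * (t - l′) ≡ xA - xB →
            (xC - xB) * (xB - xA) * (e′ - e) ≡ 0ℚ
          lemma {t} {e} {e′} {l} {ν} {l′} {ν′} h h₁ h₂ h₁′ h₂′ k k′ =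
            linear ((e * e′) · h ⊞ (- (e * e′)) · h₁ ⊞ (e * e′) · h₂ ⊞ (e * e′) · h₁′ ⊞ (- (e * e′)) · h₂′
                    ⊞ (- (e′ * (xB - xA))) · k ⊞ (- (e * (xC - xB))) · k′)
                      (identityℚ (xC ∷ xB ∷ xA ∷ e′ ∷ e ∷ t ∷ yC ∷ yA ∷ l ∷ ν ∷ yB ∷ l′ ∷ ν′ ∷ []) (λ xC xB xA e′ e t yC yA l ν yB l′ ν′ →
                          (xC ⊖ xB) ⊗ (xB ⊖ xA) ⊗ (e′ ⊖ e) ⊖ # 0
                          ⊜ e ⊗ e′ ⊗ (t ⊗ (xC ⊖ xA) ⊖ (yC ⊖ yA)) ⊕ ⊝ (e ⊗ e′) ⊗ (yA ⊖ (l ⊗ xA ⊕ ν)) ⊕ e ⊗ e′ ⊗ (yB ⊖ (l ⊗ xB ⊕ ν))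
                            ⊕ e ⊗ e′ ⊗ (yC ⊖ (l′ ⊗ xC ⊕ ν′)) ⊕ ⊝ (e ⊗ e′) ⊗ (yB ⊖ (l′ ⊗ xB ⊕ ν′))
                            ⊕ ⊝ (e′ ⊗ (xB ⊖ xA)) ⊗ (e ⊗ (t ⊖ l) ⊖ (xC ⊖ xB)) ⊕ ⊝ (e ⊗ (xC ⊖ xB)) ⊗ (e′ ⊗ (t ⊖ l′) ⊖ (xA ⊖ xB))) refl)

        -- For A = B the parabola is determined by A, C and the tangent at A. The chord AC is then
        -- the line through C and B, whence `t ≡ l′`.
        tangent-case : xA ≡ xB → yA ≡ yB → yA ≢ 0ℚ → e ≡ e′
        tangent-case xA≡xB yA≡yB yA≢0 = sym (≡-from-‿ (*-cancel-0 l≢l′ (lemma₃ {e} {e′} {t} {l₀} {l′} e*[t-l] xA≡xB t≡l′ e′*[l-l′])))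
          where
          tan : ∀ {xA yA xB yB xU yU} (c : Collinear a b xA yA xB yB xU yU) → xA ≡ xB → yA ≡ yB →
                l c * (ℕ→ℚ 2 * yA) ≡ ℕ→ℚ 3 * xA * xA + a
          tan c refl refl = collinear-tangent c
          t≡l′ : t ≡ l′
          t≡l′ = *-cancel C≢A (lemma₁ {t} {l′} {ν′} t-def on₁′ on₂′ xA≡xB yA≡yB)
            where
            lemma₁ : ∀ {t l ν} → t * (xC - xA) ≡ yC - yA → yC ≡ l * xC + ν → yB ≡ l * xB + ν → xA ≡ xB → yA ≡ yB →
                     (xC - xA) * t ≡ (xC - xA) * l
            lemma₁ {t} {l} {ν} h k k′ x= y= = linear (1ℚ · h ⊞ 1ℚ · k ⊞ (- 1ℚ) · k′ ⊞ l · x= ⊞ (- 1ℚ) · y=)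
              (identityℚ (xC ∷ xA ∷ t ∷ l ∷ yC ∷ yA ∷ ν ∷ yB ∷ xB ∷ []) (λ xC xA t l yC yA ν yB xB →
                  (xC ⊖ xA) ⊗ t ⊖ (xC ⊖ xA) ⊗ l
                  ⊜ # 1 ⊗ (t ⊗ (xC ⊖ xA) ⊖ (yC ⊖ yA)) ⊕ # 1 ⊗ (yC ⊖ (l ⊗ xC ⊕ ν)) ⊕ ⊝ # 1 ⊗ (yB ⊖ (l ⊗ xB ⊕ ν)) ⊕ l ⊗ (xA ⊖ xB)
                    ⊕ ⊝ # 1 ⊗ (yA ⊖ yB)) refl)
          e′*[l-l′] : e′ * (l₀ - l′) ≡ xA - xC
          e′*[l-l′] = *-cancel (*-≢0 2≢0 yA≢0) (lemma₂ {l₀} {l′} {ν′} {m′} {μ′} (tan c xA≡xB yA≡yB) on₂′ on₃′ p₁′ p₂′ σ₁′ (Collinear.σ₂ c′) xA≡xB yA≡yB)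
            where
            lemma₂ : ∀ {l l′ ν′ m′ μ′} → l * (ℕ→ℚ 2 * yA) ≡ ℕ→ℚ 3 * xA * xA + a →
              yB ≡ l′ * xB + ν′ → yV ≡ l′ * xV + ν′ → - yV ≡ m′ * xV + μ′ → yA ≡ m′ * xA + μ′ →
              xC + xB + xV ≡ l′ * l′ → xC * xB + xC * xV + xB * xV ≡ a - ℕ→ℚ 2 * (l′ * ν′) → xA ≡ xB → yA ≡ yB →
              (ℕ→ℚ 2 * yA) * ((m′ + l′) * (l - l′)) ≡ (ℕ→ℚ 2 * yA) * (xA - xC)
            lemma₂ {l} {l′} {ν′} {m′} {μ′} h k₂ k₃ q₁ q₂ s₁ s₂ refl refl =
              linear ((m′ + l′) · h ⊞ (- (m′ + l′)) · derivative ⊞ (xA - xC) · W)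
                (identityℚ (yA ∷ m′ ∷ l′ ∷ l ∷ xA ∷ xC ∷ a ∷ xV ∷ []) (λ yA m′ l′ l xA xC a xV →
                    # 2 ⊗ yA ⊗ ((m′ ⊕ l′) ⊗ (l ⊖ l′)) ⊖ # 2 ⊗ yA ⊗ (xA ⊖ xC)
                    ⊜ (m′ ⊕ l′) ⊗ (l ⊗ (# 2 ⊗ yA) ⊖ (# 3 ⊗ xA ⊗ xA ⊕ a))
                      ⊕ ⊝ (m′ ⊕ l′) ⊗ (# 2 ⊗ yA ⊗ l′ ⊕ (xA ⊖ xC) ⊗ (xA ⊖ xV) ⊖ (# 3 ⊗ xA ⊗ xA ⊕ a))
                      ⊕ (xA ⊖ xC) ⊗ ((m′ ⊕ l′) ⊗ (xA ⊖ xV) ⊖ # 2 ⊗ yA)) refl)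
              where
              derivative : ℕ→ℚ 2 * yA * l′ + (xA - xC) * (xA - xV) ≡ ℕ→ℚ 3 * xA * xA + a
              derivative = linear ((ℕ→ℚ 2 * l′) · k₂ ⊞ (- (ℕ→ℚ 2 * xA)) · s₁ ⊞ 1ℚ · s₂)
                (identityℚ (yA ∷ l′ ∷ xA ∷ xC ∷ xV ∷ a ∷ ν′ ∷ []) (λ yA l′ xA xC xV a ν′ →
                    # 2 ⊗ yA ⊗ l′ ⊕ (xA ⊖ xC) ⊗ (xA ⊖ xV) ⊖ (# 3 ⊗ xA ⊗ xA ⊕ a)
                    ⊜ # 2 ⊗ l′ ⊗ (yA ⊖ (l′ ⊗ xA ⊕ ν′)) ⊕ ⊝ (# 2 ⊗ xA) ⊗ (xC ⊕ xA ⊕ xV ⊖ l′ ⊗ l′)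
                      ⊕ # 1 ⊗ (xC ⊗ xA ⊕ xC ⊗ xV ⊕ xA ⊗ xV ⊖ (a ⊖ # 2 ⊗ (l′ ⊗ ν′)))) refl)
              W : (m′ + l′) * (xA - xV) ≡ ℕ→ℚ 2 * yA
              W = linear ((- 1ℚ) · q₂ ⊞ 1ℚ · q₁ ⊞ (- 1ℚ) · k₂ ⊞ 1ℚ · k₃)
                (identityℚ (m′ ∷ l′ ∷ xA ∷ xV ∷ yA ∷ μ′ ∷ yV ∷ ν′ ∷ []) (λ m′ l′ xA xV yA μ′ yV ν′ →
                    (m′ ⊕ l′) ⊗ (xA ⊖ xV) ⊖ # 2 ⊗ yA
                    ⊜ ⊝ # 1 ⊗ (yA ⊖ (m′ ⊗ xA ⊕ μ′)) ⊕ # 1 ⊗ (⊝ yV ⊖ (m′ ⊗ xV ⊕ μ′)) ⊕ ⊝ # 1 ⊗ (yA ⊖ (l′ ⊗ xA ⊕ ν′))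
                      ⊕ # 1 ⊗ (yV ⊖ (l′ ⊗ xV ⊕ ν′))) refl)
          lemma₃ : ∀ {e e′ t l l′} → e * (t - l) ≡ xC - xB → xA ≡ xB → t ≡ l′ → e′ * (l - l′) ≡ xA - xC → (l - l′) * (e′ - e) ≡ 0ℚ
          lemma₃ {e} {e′} {t} {l} {l′} h x= k k′ = linear (1ℚ · h ⊞ 1ℚ · x= ⊞ (- e) · k ⊞ 1ℚ · k′)
            (identityℚ (l ∷ l′ ∷ e′ ∷ e ∷ t ∷ xC ∷ xB ∷ xA ∷ []) (λ l l′ e′ e t xC xB xA →
                (l ⊖ l′) ⊗ (e′ ⊖ e) ⊖ # 0
                ⊜ # 1 ⊗ (e ⊗ (t ⊖ l) ⊖ (xC ⊖ xB)) ⊕ # 1 ⊗ (xA ⊖ xB) ⊕ ⊝ e ⊗ (t ⊖ l′) ⊕ # 1 ⊗ (e′ ⊗ (l ⊖ l′) ⊖ (xA ⊖ xC))) refl)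
          l≢l′ : l₀ - l′ ≢ 0ℚ
          l≢l′ h = A≢C (≡-from-‿ (trans (sym e′*[l-l′]) (trans (cong (e′ *_) h) (*-zeroʳ e′))))

        e≡e′ : e ≡ e′
        e≡e′ = by A≢B
          where
          by : xA ≢ xB ⊎ xA ≡ xB × yA ≡ yB × yA ≢ 0ℚ → e ≡ e′
          by (inj₁ x≢) = chord-case x≢
          by (inj₂ (x= , y= , y≢0)) = tangent-case x= y= y≢0

        e*[l-l′] : e * (l₀ - l′) ≡ xA - xC
        e*[l-l′] = lemma {e} {e′} {t} {l₀} {l′} e*[t-l] e′*[t-l′] e≡e′
          where
          lemma : ∀ {e e′ t l l′} → e * (t - l) ≡ xC - xB → e′ * (t - l′) ≡ xA - xB → e ≡ e′ → e * (l - l′) ≡ xA - xC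
          lemma {e} {e′} {t} {l} {l′} h h′ q = linear ((- 1ℚ) · h ⊞ 1ℚ · h′ ⊞ (t - l′) · q)
            (identityℚ (e ∷ l ∷ l′ ∷ xA ∷ xC ∷ t ∷ xB ∷ e′ ∷ []) (λ e l l′ xA xC t xB e′ →
                e ⊗ (l ⊖ l′) ⊖ (xA ⊖ xC)
                ⊜ ⊝ # 1 ⊗ (e ⊗ (t ⊖ l) ⊖ (xC ⊖ xB)) ⊕ # 1 ⊗ (e′ ⊗ (t ⊖ l′) ⊖ (xA ⊖ xB)) ⊕ (t ⊖ l′) ⊗ (e ⊖ e′)) refl)

      -- S and S′ are the remaining intersection of the common parabola with the curve: Vieta's
      -- relations of the four lines express both abscissae through the slopes, and `e≡e′`
      -- identifies them.
      third-x : xS ≡ xS′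
      third-x = lemma {l₀} {m} {l′} {m′} e*[l-l′] e≡e′ σ₁ τ₁ σ₁′ τ₁′
        where
        lemma : ∀ {l m l′ m′} → (m + l) * (l - l′) ≡ xA - xC → m + l ≡ m′ + l′ → xA + xB + xU ≡ l * l → xU + xC + xS ≡ m * m →
          xC + xB + xV ≡ l′ * l′ → xV + xA + xS′ ≡ m′ * m′ → xS ≡ xS′
        lemma {l} {m} {l′} {m′} h q s t s′ t′ =
          linear ((- ℕ→ℚ 2) · h ⊞ (m + m′ + l - l′) · q ⊞ (- 1ℚ) · s ⊞ 1ℚ · t ⊞ 1ℚ · s′ ⊞ (- 1ℚ) · t′)
            (identityℚ (xS ∷ xS′ ∷ m ∷ l ∷ l′ ∷ xA ∷ xC ∷ m′ ∷ xB ∷ xU ∷ xV ∷ []) (λ xS xS′ m l l′ xA xC m′ xB xU xV →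
                xS ⊖ xS′
                ⊜ ⊝ # 2 ⊗ ((m ⊕ l) ⊗ (l ⊖ l′) ⊖ (xA ⊖ xC)) ⊕ (m ⊕ m′ ⊕ l ⊖ l′) ⊗ (m ⊕ l ⊖ (m′ ⊕ l′)) ⊕ ⊝ # 1 ⊗ (xA ⊕ xB ⊕ xU ⊖ l ⊗ l)
                  ⊕ # 1 ⊗ (xU ⊕ xC ⊕ xS ⊖ m ⊗ m) ⊕ # 1 ⊗ (xC ⊕ xB ⊕ xV ⊖ l′ ⊗ l′) ⊕ ⊝ # 1 ⊗ (xV ⊕ xA ⊕ xS′ ⊖ m′ ⊗ m′)) refl)

      -- `e` is nonzero because C differs in abscissa from A and B. After multiplication by it, the
      -- ordinates differ by a combination of the line equations and the relations behind `third-x`.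
      third-y : yS ≡ yS′
      third-y = *-cancel e≢0 (lemma {l₀} {ν₀} {m} {μ} {l′} {ν′} {m′} {μ′} e*[l-l′] e≡e′ σ₁ τ₁ σ₁′ τ₁′ on₂ on₂′ on₃ on₃′ p₁ p₃ p₁′ p₃′ third-x)
        where
        lemma : ∀ {l ν m μ l′ ν′ m′ μ′} → (m + l) * (l - l′) ≡ xA - xC → m + l ≡ m′ + l′ → xA + xB + xU ≡ l * l → xU + xC + xS ≡ m * m →
          xC + xB + xV ≡ l′ * l′ → xV + xA + xS′ ≡ m′ * m′ → yB ≡ l * xB + ν → yB ≡ l′ * xB + ν′ → yU ≡ l * xU + ν → yV ≡ l′ * xV + ν′ →
          - yU ≡ m * xU + μ → yS ≡ m * xS + μ → - yV ≡ m′ * xV + μ′ → yS′ ≡ m′ * xS′ + μ′ → xS ≡ xS′ → (m + l) * yS ≡ (m + l) * yS′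
        lemma {l} {ν} {m} {μ} {l′} {ν′} {m′} {μ′} h q s t s′ t′ kB kB′ kU kV r₁ r₃ r₁′ r₃′ refl = step
          where
          y₁ : yS ≡ (m + l) * (xS - xU) - l * xS - ν
          y₁ = linear (1ℚ · r₃ ⊞ (- 1ℚ) · r₁ ⊞ (- 1ℚ) · kU)
            (identityℚ (yS ∷ m ∷ l ∷ xS ∷ xU ∷ ν ∷ μ ∷ yU ∷ []) (λ yS m l xS xU ν μ yU →
                yS ⊖ ((m ⊕ l) ⊗ (xS ⊖ xU) ⊖ l ⊗ xS ⊖ ν)
                ⊜ # 1 ⊗ (yS ⊖ (m ⊗ xS ⊕ μ)) ⊕ ⊝ # 1 ⊗ (⊝ yU ⊖ (m ⊗ xU ⊕ μ)) ⊕ ⊝ # 1 ⊗ (yU ⊖ (l ⊗ xU ⊕ ν))) refl)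
          y₂ : yS′ ≡ (m + l) * (xS - xV) - l′ * xS - ν′
          y₂ = linear (1ℚ · r₃′ ⊞ (- 1ℚ) · r₁′ ⊞ (- 1ℚ) · kV ⊞ (- (xS - xV)) · q)
            (identityℚ (yS′ ∷ m ∷ l ∷ xS ∷ xV ∷ l′ ∷ ν′ ∷ m′ ∷ μ′ ∷ yV ∷ []) (λ yS′ m l xS xV l′ ν′ m′ μ′ yV →
                yS′ ⊖ ((m ⊕ l) ⊗ (xS ⊖ xV) ⊖ l′ ⊗ xS ⊖ ν′)
                ⊜ # 1 ⊗ (yS′ ⊖ (m′ ⊗ xS ⊕ μ′)) ⊕ ⊝ # 1 ⊗ (⊝ yV ⊖ (m′ ⊗ xV ⊕ μ′)) ⊕ ⊝ # 1 ⊗ (yV ⊖ (l′ ⊗ xV ⊕ ν′))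
                  ⊕ ⊝ (xS ⊖ xV) ⊗ (m ⊕ l ⊖ (m′ ⊕ l′))) refl)
          step : (m + l) * yS ≡ (m + l) * yS′
          step = linear ((m + l) · y₁ ⊞ (- (m + l)) · y₂
            ⊞ ((xA - xC) - (m + l) * (l + l′) - (xS - xB)) · h
            ⊞ ((xA - xC) - (m + l) * (m + l)) · s ⊞ ((m + l) * (m + l)) · s′
            ⊞ (m + l) · kB ⊞ (- (m + l)) · kB′ ⊞ (- (xA - xC)) · t)
              (identityℚ (m ∷ l ∷ yS ∷ yS′ ∷ xS ∷ xU ∷ ν ∷ xV ∷ l′ ∷ ν′ ∷ xA ∷ xC ∷ xB ∷ yB ∷ []) (λ m l yS yS′ xS xU ν xV l′ ν′ xA xC xB yB →
                  (m ⊕ l) ⊗ yS ⊖ (m ⊕ l) ⊗ yS′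
                  ⊜ (m ⊕ l) ⊗ (yS ⊖ ((m ⊕ l) ⊗ (xS ⊖ xU) ⊖ l ⊗ xS ⊖ ν)) ⊕ ⊝ (m ⊕ l) ⊗ (yS′ ⊖ ((m ⊕ l) ⊗ (xS ⊖ xV) ⊖ l′ ⊗ xS ⊖ ν′))
                    ⊕ (xA ⊖ xC ⊖ (m ⊕ l) ⊗ (l ⊕ l′) ⊖ (xS ⊖ xB)) ⊗ ((m ⊕ l) ⊗ (l ⊖ l′) ⊖ (xA ⊖ xC))
                    ⊕ (xA ⊖ xC ⊖ (m ⊕ l) ⊗ (m ⊕ l)) ⊗ (xA ⊕ xB ⊕ xU ⊖ l ⊗ l) ⊕ (m ⊕ l) ⊗ (m ⊕ l) ⊗ (xC ⊕ xB ⊕ xV ⊖ l′ ⊗ l′)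
                    ⊕ (m ⊕ l) ⊗ (yB ⊖ (l ⊗ xB ⊕ ν)) ⊕ ⊝ (m ⊕ l) ⊗ (yB ⊖ (l′ ⊗ xB ⊕ ν′)) ⊕ ⊝ (xA ⊖ xC) ⊗ (xU ⊕ xC ⊕ xS ⊖ m ⊗ m)) refl)

-- The group law of the curve

module GroupLaw where

  open RingIdentity using (_⊕_; _⊗_; ⊝_; _⊖_; #_; _⊜_)
  open import Data.List using ([]; _∷_)
  open import Defs
  open Rationals
  open CollinearTriples
  open Associativity
  open import Data.Nat as ℕ using (ℕ; zero; suc)
  import Data.Nat.Properties as ℕ
  open import Data.Integer as ℤ using (ℤ; +_)
  open import Data.Rational using (ℚ; 0ℚ; 1ℚ; _+_; _*_; _-_; -_)
  open import Data.Rational.Properties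
  open import Data.Product using (_,_; _×_; ∃₂)
  open import Data.Sum as Sum using (_⊎_; inj₁; inj₂)
  open import Data.Unit using (tt)
  open import Relation.Nullary using (Dec; yes; no; contradiction; ¬_)
  open import Relation.Binary.PropositionalEquality

  opposite : Pt → Pt
  opposite O = O
  opposite (aff x y) = aff x (- y)

  neg-involutive : ∀ x → - (- x) ≡ x
  neg-involutive x = identityℚ (x ∷ []) (λ x → ⊝ (⊝ x) ⊜ x) refl

  neg-unique : ∀ {x y} → x + y ≡ 0ℚ → - y ≡ x
  neg-unique {x} {y} q = linear ((- 1ℚ) · q) (identityℚ (y ∷ x ∷ []) (λ y x → ⊝ y ⊖ x ⊜ ⊝ # 1 ⊗ (x ⊕ y ⊖ # 0)) refl)

  opposite-involutive : ∀ A → opposite (opposite A) ≡ A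
  opposite-involutive O = refl
  opposite-involutive (aff x y) = cong (aff x) (neg-involutive y)

  2y≢0 : ∀ {y} → y + y ≢ 0ℚ → ℕ→ℚ 2 * y ≢ 0ℚ
  2y≢0 {y} h e = h (linear (1ℚ · e) (identityℚ (y ∷ []) (λ y → y ⊕ y ⊖ # 0 ⊜ # 1 ⊗ (# 2 ⊗ y ⊖ # 0)) refl))

  module _ (E : Curve) where

    private
      𝔞 𝔟 : ℚ
      𝔞 = ℤ→ℚ (a E)
      𝔟 = ℤ→ℚ (b E)
      infixl 6 _∔_
      _∔_ : Pt → Pt → Pt
      _∔_ = add E
      On : Pt → Set
      On = OnCurve E

    Line : ℚ → ℚ → ℚ → ℚ → ℚ → ℚ → Set
    Line = Collinear 𝔞 𝔟

    discriminant≢0 : ℕ→ℚ 4 * (𝔞 * 𝔞 * 𝔞) + ℕ→ℚ 27 * (𝔟 * 𝔟) ≢ 0ℚ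
    discriminant≢0 h = nonsingular E (ℤ→ℚ-injective {j = + 0} (trans
      (trans (ℤ→ℚ-+ (+ 4 ℤ.* (a E ℤ.* a E ℤ.* a E)) (+ 27 ℤ.* (b E ℤ.* b E))) (cong₂ _+_
        (trans (ℤ→ℚ-* (+ 4) (a E ℤ.* a E ℤ.* a E)) (cong (ℕ→ℚ 4 *_) (trans (ℤ→ℚ-* (a E ℤ.* a E) (a E)) (cong (_* 𝔞) (ℤ→ℚ-* (a E) (a E))))))
        (trans (ℤ→ℚ-* (+ 27) (b E ℤ.* b E)) (cong (ℕ→ℚ 27 *_) (ℤ→ℚ-* (b E) (b E)))))) h))

    opposite-on : ∀ {A} → On A → On (opposite A)
    opposite-on {O} _ = tt
    opposite-on {aff x y} h = trans (lemma y) h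
      where
      lemma : ∀ y → - y * - y ≡ y * y
      lemma y = identityℚ (y ∷ []) (λ y → ⊝ y ⊗ ⊝ y ⊜ y ⊗ y) refl

    add-identityʳ : ∀ A → A ∔ O ≡ A
    add-identityʳ O = refl
    add-identityʳ (aff _ _) = refl

    add-opposite : ∀ {x₁ x₂} y₁ y₂ → x₁ ≡ x₂ → y₁ + y₂ ≡ 0ℚ → aff x₁ y₁ ∔ aff x₂ y₂ ≡ O
    add-opposite {x₁} {x₂} y₁ y₂ x= y= with x₁ ≟ x₂
    ... | no x≢ = contradiction x= x≢
    ... | yes _ with y₁ + y₂ ≟ 0ℚ
    ...   | yes _ = refl
    ...   | no y≢ = contradiction y= y≢

    add-chord : ∀ {x₁ y₁ x₂ y₂} → x₁ ≢ x₂ →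
      let l = (y₂ - y₁) ÷' (x₂ - x₁); x₃ = l * l - x₁ - x₂ in
      aff x₁ y₁ ∔ aff x₂ y₂ ≡ aff x₃ (l * (x₁ - x₃) - y₁)
    add-chord {x₁} {y₁} {x₂} {y₂} x≢ with x₁ ≟ x₂
    ... | no _ = refl
    ... | yes x= = contradiction x= x≢

    add-tangent : ∀ {x₁ y₁ x₂ y₂} → x₁ ≡ x₂ → y₁ + y₂ ≢ 0ℚ →
      let l = (ℕ→ℚ 3 * x₁ * x₁ + 𝔞) ÷' (ℕ→ℚ 2 * y₁); x₃ = l * l - x₁ - x₂ in
      aff x₁ y₁ ∔ aff x₂ y₂ ≡ aff x₃ (l * (x₁ - x₃) - y₁)
    add-tangent {x₁} {y₁} {x₂} {y₂} x= y≢ with x₁ ≟ x₂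
    ... | no x≢ = contradiction x= x≢
    ... | yes _ with y₁ + y₂ ≟ 0ℚ
    ...   | yes y= = contradiction y= y≢
    ...   | no _ = refl

    -- Exactly the affine case in which `add` returns `O`; for points of the curve, every other
    -- affine sum is described by a `Line`.
    record Opp (x₁ y₁ x₂ y₂ : ℚ) : Set where
      constructor opp
      field
        x= : x₁ ≡ x₂
        y= : y₁ + y₂ ≡ 0ℚ

    opp? : ∀ x₁ y₁ x₂ y₂ → Dec (Opp x₁ y₁ x₂ y₂)
    opp? x₁ y₁ x₂ y₂ with x₁ ≟ x₂ | y₁ + y₂ ≟ 0ℚ
    ... | yes p | yes q = yes (opp p q)
    ... | no ¬p | _ = no λ (opp p _) → ¬p p
    ... | _ | no ¬q = no λ (opp _ q) → ¬q q

    -- A line determines its slope both as a chord and as a tangent, so after this lemma the two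
    -- branches of `add` need not be told apart.
    collinear⇒add : ∀ {x₁ y₁ x₂ y₂ x₃ y₃} → Line x₁ y₁ x₂ y₂ x₃ y₃ → ¬ Opp x₁ y₁ x₂ y₂ →
                    aff x₁ y₁ ∔ aff x₂ y₂ ≡ aff x₃ (- y₃)
    collinear⇒add {x₁} {y₁} {x₂} {y₂} {x₃} {y₃} c ¬opp = by (x₁ ≟ x₂)
      where
      finish : ∀ l → l ≡ Collinear.l c →
        aff (l * l - x₁ - x₂) (l * (x₁ - (l * l - x₁ - x₂)) - y₁) ≡ aff x₃ (- y₃)
      finish _ refl = trans (cong (λ x → aff x (Collinear.l c * (x₁ - x) - y₁)) (collinear-x₃ c))
                          (cong (aff x₃) (collinear-y₃ c))
      by : Dec (x₁ ≡ x₂) → aff x₁ y₁ ∔ aff x₂ y₂ ≡ aff x₃ (- y₃)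
      by (no x≢) = trans (add-chord {x₁} {y₁} {x₂} {y₂} x≢) (finish ((y₂ - y₁) ÷' (x₂ - x₁)) (*-cancel Δ≢0
          (trans (*-comm (x₂ - x₁) _) (trans (trans (÷'-* (y₂ - y₁) Δ≢0) (sym (collinear-chord c))) (*-comm _ (x₂ - x₁))))))
        where
        Δ≢0 : x₂ - x₁ ≢ 0ℚ
        Δ≢0 = -‿≢0 (λ e → x≢ (sym e))
      by (yes refl) = trans (add-tangent {x₁} {y₁} {x₁} {y₂} refl y+≢0) (finish ((ℕ→ℚ 3 * x₁ * x₁ + 𝔞) ÷' (ℕ→ℚ 2 * y₁)) (*-cancel 2y≢
          (trans (*-comm (ℕ→ℚ 2 * y₁) _) (trans (trans (÷'-* (ℕ→ℚ 3 * x₁ * x₁ + 𝔞) 2y≢) (sym (collinear-tangent c))) (*-comm _ (ℕ→ℚ 2 * y₁))))))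
        where
        y≡ : y₁ ≡ y₂
        y≡ = trans (Collinear.on₁ c) (sym (Collinear.on₂ c))
        y+≢0 : y₁ + y₂ ≢ 0ℚ
        y+≢0 e = ¬opp (opp refl e)
        2y≢ : ℕ→ℚ 2 * y₁ ≢ 0ℚ
        2y≢ = 2y≢0 {y₁} (subst (λ y → y₁ + y ≢ 0ℚ) (sym y≡) y+≢0)

    line-through : ∀ {x₁ y₁ x₂ y₂} → On (aff x₁ y₁) → On (aff x₂ y₂) → ¬ Opp x₁ y₁ x₂ y₂ →
                   ∃₂ λ x₃ y₃ → Line x₁ y₁ x₂ y₂ x₃ y₃
    line-through {x₁} {y₁} {x₂} {y₂} h₁ h₂ ¬opp = by (x₁ ≟ x₂)
      where
      by : Dec (x₁ ≡ x₂) → ∃₂ λ x₃ y₃ → Line x₁ y₁ x₂ y₂ x₃ y₃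
      by (no x≢) = _ , _ , chord {x₁ = x₁} {y₁} {x₂} {y₂} ((y₂ - y₁) ÷' (x₂ - x₁)) x≢ h₁ h₂ (÷'-* (y₂ - y₁) (-‿≢0 (λ e → x≢ (sym e))))
      by (yes refl) = subst (λ y → ∃₂ λ x₃ y₃ → Line x₁ y₁ x₁ y x₃ y₃) y≡ (_ , _ ,
          tangent {x₁ = x₁} ((ℕ→ℚ 3 * x₁ * x₁ + 𝔞) ÷' (ℕ→ℚ 2 * y₁)) h₁ (÷'-* (ℕ→ℚ 3 * x₁ * x₁ + 𝔞) (2y≢0 {y₁} (subst (λ y → y₁ + y ≢ 0ℚ) (sym y≡) (λ e → ¬opp (opp refl e))))))
        where
        y≡ : y₁ ≡ y₂
        y≡ = Sum.fromInj₁ (λ e → contradiction (opp refl e) ¬opp) (curve-± {𝔞} {𝔟} {x₁} h₁ h₂ refl)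

    opp-sym : ∀ {x₁ y₁ x₂ y₂} → Opp x₁ y₁ x₂ y₂ → Opp x₂ y₂ x₁ y₁
    opp-sym {y₁ = y₁} {y₂ = y₂} (opp p q) = opp (sym p) (trans (+-comm y₂ y₁) q)

    add-comm : ∀ A B → On A → On B → A ∔ B ≡ B ∔ A
    add-comm O B _ _ = sym (add-identityʳ B)
    add-comm (aff x y) O _ _ = refl
    add-comm (aff x₁ y₁) (aff x₂ y₂) h₁ h₂ with opp? x₁ y₁ x₂ y₂
    ... | yes (opp p q) = trans (add-opposite y₁ y₂ p q) (sym (add-opposite y₂ y₁ (sym p) (trans (+-comm y₂ y₁) q)))
    ... | no ¬opp with line-through h₁ h₂ ¬opp
    ...   | _ , _ , c = trans (collinear⇒add c ¬opp) (sym (collinear⇒add (swap₁₂ c) (λ o → ¬opp (opp-sym o))))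

    add-on : ∀ A B → On A → On B → On (A ∔ B)
    add-on O B _ hB = hB
    add-on (aff _ _) O hA _ = hA
    add-on (aff x₁ y₁) (aff x₂ y₂) h₁ h₂ with opp? x₁ y₁ x₂ y₂
    ... | yes (opp p q) = subst On (sym (add-opposite y₁ y₂ p q)) tt
    ... | no ¬opp with line-through h₁ h₂ ¬opp
    ...   | x₃ , y₃ , c = subst On (sym (collinear⇒add c ¬opp))
            (opposite-on {aff x₃ y₃} (collinear⇒curve (swap₁₂ (swap₂₃ c))))

    add-inverseʳ : ∀ A → A ∔ opposite A ≡ O
    add-inverseʳ O = refl
    add-inverseʳ (aff x y) = add-opposite {x} y (- y) refl (+-inverseʳ y)

    opposite-add : ∀ A B → On A → On B → opposite (A ∔ B) ≡ opposite A ∔ opposite B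
    opposite-add O B _ _ = refl
    opposite-add (aff _ _) O _ _ = refl
    opposite-add (aff x₁ y₁) (aff x₂ y₂) h₁ h₂ with opp? x₁ y₁ x₂ y₂
    ... | yes (opp p q) = trans (cong opposite (add-opposite y₁ y₂ p q))
            (sym (add-opposite (- y₁) (- y₂) p (trans (sym (neg-distrib-+ y₁ y₂)) (cong -_ q))))
    ... | no ¬opp with line-through h₁ h₂ ¬opp
    ...   | x₃ , y₃ , c = trans (cong opposite (collinear⇒add c ¬opp))
            (sym (collinear⇒add (negate c) (λ (opp p q) → ¬opp (opp p (neg-injective (trans (neg-distrib-+ y₁ y₂) q))))))

    -- Proved ahead of associativity, whose degenerate cases rest on it: negating the line through A
    -- and B and permuting its points gives the line through A + B and -B.
    cancelʳ : ∀ A B → On A → On B → (A ∔ B) ∔ opposite B ≡ A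
    cancelʳ A O hA _ = trans (add-identityʳ (A ∔ O)) (add-identityʳ A)
    cancelʳ O B@(aff _ _) _ _ = add-inverseʳ B
    cancelʳ (aff x₁ y₁) (aff x₂ y₂) h₁ h₂ with opp? x₁ y₁ x₂ y₂
    ... | yes (opp refl q) = trans (cong (_∔ aff x₁ (- y₂)) (add-opposite {x₁} y₁ y₂ refl q))
            (cong (aff x₁) (neg-unique q))
    ... | no ¬opp with line-through h₁ h₂ ¬opp
    ...   | x₃ , y₃ , c = trans (cong (_∔ aff x₂ (- y₂)) (collinear⇒add c ¬opp))
            (trans (collinear⇒add (swap₁₂ (swap₂₃ (swap₁₂ (negate c)))) ¬opp′) (cong (aff x₁) (neg-involutive y₁)))
      where
      -- Otherwise the line would be tangent to the curve at a point of order two. Within the group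
      -- law, nonsingularity enters only here.
      ¬opp′ : ¬ Opp x₃ (- y₃) x₂ (- y₂)
      ¬opp′ (opp p q) = discriminant≢0 (no-double-2-torsion c (sym p)
        (neg-injective (trans (neg-distrib-+ y₂ y₃) (trans (+-comm (- y₂) (- y₃)) q))))

    private
      -- The abscissa of C differs from those of A and B, but A = B is allowed. If an intermediate
      -- sum meets its opposite, the line already drawn also gives the other bracketing.
      affine-assoc : ∀ {x₁ y₁ x₂ y₂ x₃ y₃} → let A = aff x₁ y₁; B = aff x₂ y₂; C = aff x₃ y₃ in
        On A → On B → On C → x₁ ≢ x₃ → ¬ Opp x₂ y₂ x₃ y₃ → ¬ Opp x₁ y₁ x₂ y₂ → x₂ ≢ x₃ → (A ∔ B) ∔ C ≡ A ∔ (B ∔ C)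
      affine-assoc {xA} {yA} {xB} {yB} {xC} {yC} hA hB hC A≢C ¬BC ¬AB B≢C = lemma (line-through hA hB ¬AB) (line-through hC hB ¬CB)
        where
        open ≡-Reasoning
        A B C : Pt
        A = aff xA yA
        B = aff xB yB
        C = aff xC yC
        ¬CB : ¬ Opp xC yC xB yB
        ¬CB o = ¬BC (opp-sym o)
        A≢B : xA ≢ xB ⊎ xA ≡ xB × yA ≡ yB × yA ≢ 0ℚ
        A≢B with xA ≟ xB
        ... | no x≢ = inj₁ x≢
        ... | yes x= with curve-± {𝔞} {𝔟} hA hB x=
        ...   | inj₂ y+ = contradiction (opp x= y+) ¬AB
        ...   | inj₁ y= = inj₂ (x= , y= , λ y0 → ¬AB (opp x= (cong₂ _+_ y0 (trans (sym y=) y0))))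
        lemma : (∃₂ λ xU yU → Line xA yA xB yB xU yU) → (∃₂ λ xV yV → Line xC yC xB yB xV yV) → (A ∔ B) ∔ C ≡ A ∔ (B ∔ C)
        lemma (xU , yU , c) (xV , yV , c′) = begin
          (A ∔ B) ∔ C ≡⟨ cong (_∔ C) (collinear⇒add c ¬AB) ⟩
          U ∔ C       ≡⟨ U+C (opp? xU (- yU) xC yC) ⟩
          A ∔ V       ≡⟨ cong (A ∔_) (trans (sym (collinear⇒add c′ ¬CB)) (add-comm C B hC hB)) ⟩
          A ∔ (B ∔ C) ∎
          where
          U V : Pt
          U = aff xU (- yU)
          V = aff xV (- yV)
          hU : On U
          hU = subst On (collinear⇒add c ¬AB) (add-on A B hA hB)
          hV : On V
          hV = subst On (collinear⇒add c′ ¬CB) (add-on C B hC hB)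
          ¬BU : ¬ Opp xB yB xU yU → B ∔ aff xU yU ≡ opposite A
          ¬BU ¬o = collinear⇒add (swap₂₃ (swap₁₂ c)) ¬o
          ¬BV : ¬ Opp xB yB xV yV → B ∔ aff xV yV ≡ opposite C
          ¬BV ¬o = collinear⇒add (swap₂₃ (swap₁₂ c′)) ¬o
          U+C : Dec (Opp xU (- yU) xC yC) → U ∔ C ≡ A ∔ V
          U+C (yes (opp refl q)) = trans (add-opposite {xC} (- yU) yC refl q) (sym (begin
            A ∔ V                  ≡⟨ cong (A ∔_) (trans (sym (collinear⇒add c′ ¬CB)) (add-comm C B hC hB)) ⟩
            A ∔ (B ∔ C)            ≡⟨ cong (λ y → A ∔ (B ∔ aff xU y)) yC≡yU ⟩
            A ∔ (B ∔ aff xU yU)    ≡⟨ cong (A ∔_) (¬BU (λ (opp p r) → ¬BC (opp p (trans (cong (λ y → yB + y) yC≡yU) r)))) ⟩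
            A ∔ opposite A         ≡⟨ add-inverseʳ A ⟩
            O                      ∎))
            where
            yC≡yU : yC ≡ yU
            yC≡yU = trans (sym (neg-unique (trans (+-comm yC (- yU)) q))) (neg-involutive yU)
          U+C (no ¬UC) = A+V (opp? xV (- yV) xA yA)
            where
            A+V : Dec (Opp xV (- yV) xA yA) → U ∔ C ≡ A ∔ V
            A+V (yes (opp refl q)) = trans (begin
              U ∔ C                           ≡⟨ cong (_∔ C) (trans (sym (collinear⇒add c ¬AB)) (add-comm A B hA hB)) ⟩
              (B ∔ A) ∔ C                     ≡⟨ cong (λ y → (B ∔ aff xV y) ∔ C) yA≡yV ⟩
              (B ∔ aff xV yV) ∔ C             ≡⟨ cong (_∔ C) (¬BV (λ (opp p r) → ¬AB (opp-sym (opp p (trans (cong (λ y → yB + y) yA≡yV) r))))) ⟩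
              opposite C ∔ C                  ≡⟨ cong (opposite C ∔_) (sym (opposite-involutive C)) ⟩
              opposite C ∔ opposite (opposite C) ≡⟨ add-inverseʳ (opposite C) ⟩
              O                               ∎) (sym (trans (add-comm A V hA hV) (add-opposite {xA} (- yV) yA refl q)))
              where
              yA≡yV : yA ≡ yV
              yA≡yV = trans (sym (neg-unique (trans (+-comm yA (- yV)) q))) (neg-involutive yV)
            A+V (no ¬VA) = last (line-through hU hC ¬UC) (line-through hV hA ¬VA)
              where
              last : (∃₂ λ xS yS → Line xU (- yU) xC yC xS yS) → (∃₂ λ xS yS → Line xV (- yV) xA yA xS yS) → U ∔ C ≡ A ∔ V
              last (xS , yS , d) (xS′ , yS′ , d′) = begin
                U ∔ C          ≡⟨ collinear⇒add d ¬UC ⟩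
                aff xS (- yS)  ≡⟨ cong₂ (λ x y → aff x (- y)) (third-x c d c′ d′ A≢C B≢C A≢B) (third-y c d c′ d′ A≢C B≢C A≢B) ⟩
                aff xS′ (- yS′) ≡⟨ collinear⇒add d′ ¬VA ⟨
                V ∔ A          ≡⟨ add-comm V A hV hA ⟩
                A ∔ V          ∎

      -- The two bracketings of a sum are exchanged by reversing its terms.
      reverse : ∀ {A B C} → On A → On B → On C → (C ∔ B) ∔ A ≡ C ∔ (B ∔ A) → (A ∔ B) ∔ C ≡ A ∔ (B ∔ C)
      reverse {A} {B} {C} hA hB hC e = begin
        (A ∔ B) ∔ C ≡⟨ add-comm (A ∔ B) C (add-on A B hA hB) hC ⟩
        C ∔ (A ∔ B) ≡⟨ cong (C ∔_) (add-comm A B hA hB) ⟩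
        C ∔ (B ∔ A) ≡⟨ e ⟨
        (C ∔ B) ∔ A ≡⟨ add-comm (C ∔ B) A (add-on C B hC hB) hA ⟩
        A ∔ (C ∔ B) ≡⟨ cong (A ∔_) (add-comm C B hC hB) ⟩
        A ∔ (B ∔ C) ∎
        where open ≡-Reasoning

      opp⇒≡ : ∀ {x₁ y₁ x₂ y₂} → Opp x₁ y₁ x₂ y₂ → aff x₂ y₂ ≡ opposite (aff x₁ y₁)
      opp⇒≡ {x₁} {y₁} {x₂} {y₂} (opp refl q) = cong (aff x₁) (sym (neg-unique (trans (+-comm y₂ y₁) q)))

      cancel-opp : ∀ {A B C} → On A → On B → On C → B ≡ opposite A → (A ∔ B) ∔ C ≡ A ∔ (B ∔ C)
      cancel-opp {A} {_} {C} hA hB hC refl = begin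
        (A ∔ opposite A) ∔ C                       ≡⟨ cong (_∔ C) (add-inverseʳ A) ⟩
        C                                          ≡⟨ cancelʳ C (opposite A) hC hB ⟨
        (C ∔ opposite A) ∔ opposite (opposite A)   ≡⟨ cong ((C ∔ opposite A) ∔_) (opposite-involutive A) ⟩
        (C ∔ opposite A) ∔ A                       ≡⟨ add-comm _ A (add-on C (opposite A) hC hB) hA ⟩
        A ∔ (C ∔ opposite A)                       ≡⟨ cong (A ∔_) (add-comm C (opposite A) hC hB) ⟩
        A ∔ (opposite A ∔ C)                       ∎
        where open ≡-Reasoning

      conjugate : ∀ {A B C} → On A → On B → On C → C ≡ opposite A → (A ∔ B) ∔ C ≡ A ∔ (B ∔ C)
      conjugate {A} {B} hA hB hC refl = begin
        (A ∔ B) ∔ opposite A                     ≡⟨ cong (_∔ opposite A) (add-comm A B hA hB) ⟩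
        (B ∔ A) ∔ opposite A                     ≡⟨ cancelʳ B A hB hA ⟩
        B                                        ≡⟨ cancelʳ B (opposite A) hB hC ⟨
        (B ∔ opposite A) ∔ opposite (opposite A) ≡⟨ cong ((B ∔ opposite A) ∔_) (opposite-involutive A) ⟩
        (B ∔ opposite A) ∔ A                     ≡⟨ add-comm _ A (add-on B (opposite A) hB hC) hA ⟩
        A ∔ (B ∔ opposite A)                     ∎
        where open ≡-Reasoning

      same-ends : ∀ {A B C} → On A → On B → C ≡ A → (A ∔ B) ∔ C ≡ A ∔ (B ∔ C)
      same-ends {A} {B} hA hB refl = trans (add-comm (A ∔ B) A (add-on A B hA hB) hA) (cong (A ∔_) (add-comm A B hA hB))

    add-assoc : ∀ A B C → On A → On B → On C → (A ∔ B) ∔ C ≡ A ∔ (B ∔ C)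
    add-assoc O B C _ _ _ = refl
    add-assoc (aff _ _) O C _ _ _ = refl
    add-assoc A@(aff _ _) B@(aff _ _) O _ _ _ = trans (add-identityʳ (A ∔ B)) (cong (A ∔_) (sym (add-identityʳ B)))
    add-assoc A@(aff x₁ y₁) B@(aff x₂ y₂) C@(aff x₃ y₃) h₁ h₂ h₃ =
      cases (opp? x₁ y₁ x₂ y₂) (opp? x₂ y₂ x₃ y₃) (x₁ ≟ x₃) (x₂ ≟ x₃)
      where
      Goal : Set
      Goal = (A ∔ B) ∔ C ≡ A ∔ (B ∔ C)
      ends : x₁ ≡ x₃ → y₁ ≡ y₃ ⊎ y₁ + y₃ ≡ 0ℚ → Goal
      ends x= (inj₁ y=) = same-ends {A} {B} {C} h₁ h₂ (cong₂ aff (sym x=) (sym y=))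
      ends x= (inj₂ y+) = conjugate {A} {B} {C} h₁ h₂ h₃ (opp⇒≡ (opp x= y+))
      cases : Dec (Opp x₁ y₁ x₂ y₂) → Dec (Opp x₂ y₂ x₃ y₃) → Dec (x₁ ≡ x₃) → Dec (x₂ ≡ x₃) → Goal
      cases (yes o) _ _ _ = cancel-opp {A} {B} {C} h₁ h₂ h₃ (opp⇒≡ o)
      cases (no _) (yes o) _ _ = reverse {A} {B} {C} h₁ h₂ h₃ (cancel-opp {C} {B} {A} h₃ h₂ h₁ (opp⇒≡ (opp-sym {x₂} {y₂} o)))
      cases (no _) (no _) (yes x=) _ = ends x= (curve-± {𝔞} {𝔟} h₁ h₃ x=)
      cases (no ¬12) (no ¬23) (no 1≢3) (no 2≢3) = affine-assoc {x₁} {y₁} {x₂} {y₂} {x₃} {y₃} h₁ h₂ h₃ 1≢3 ¬23 ¬12 2≢3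
      -- Reversal moves the coincidence of B and C to the first two terms, where `affine-assoc`
      -- admits a tangent.
      cases (no ¬12) (no ¬23) (no 1≢3) (yes 2=3) = reverse {A} {B} {C} h₁ h₂ h₃ (affine-assoc {x₃} {y₃} {x₂} {y₂} {x₁} {y₁} h₃ h₂ h₁
        (λ e → 1≢3 (sym e)) (λ o → ¬12 (opp-sym {x₂} {y₂} o)) (λ o → ¬23 (opp-sym {x₃} {y₃} o)) (λ e → 1≢3 (trans (sym e) 2=3)))

    sub : Pt → Pt → Pt
    sub A B = add E A (opposite B)

    add-sub : ∀ A B → On A → On B → sub (A ∔ B) B ≡ A
    add-sub = cancelʳ

    mul-on : ∀ {P} n → On P → On (mul E n P)
    mul-on zero h = tt
    mul-on {P} (suc n) h = add-on P (mul E n P) h (mul-on n h)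

    mul-+ : ∀ {P} m n → On P → mul E (m ℕ.+ n) P ≡ mul E m P ∔ mul E n P
    mul-+ zero n h = refl
    mul-+ {P} (suc m) n h = trans (cong (P ∔_) (mul-+ m n h)) (sym (add-assoc P (mul E m P) (mul E n P) h (mul-on m h) (mul-on n h)))

    translate : ∀ {P Q} m n → On P → On Q → mul E (m ℕ.+ n) P ∔ Q ≡ mul E m P ∔ (mul E n P ∔ Q)
    translate {P} {Q} m n hP hQ = trans (cong (_∔ Q) (mul-+ m n hP)) (add-assoc (mul E m P) (mul E n P) Q (mul-on m hP) (mul-on n hP) hQ)

-- Integer identities, divisibility and absolute values of polynomials

module Integers where

  open import Defs using (ℤ→ℚ)
  open RingIdentity
  open Rationals hiding (_·_; _⊞_; linear)
  open import Data.Nat as ℕ using (ℕ; zero; suc; _≤_)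
  import Data.Nat.Properties as ℕ
  open import Data.Integer as ℤ using (ℤ; +_; ∣_∣)
  import Data.Integer.Properties as ℤ
  import Data.Integer.Divisibility.Signed as ℤ∣
  open import Algebra.Structures using (IsCommutativeRing)
  open import Data.Nat.Divisibility using (_∣_)
  open import Data.List using (List; []; _∷_; map)
  open import Data.List.Relation.Binary.Pointwise using (Pointwise; []; _∷_)
  open import Data.Rational using () renaming (-_ to -ℚ_; _+_ to _+ℚ_; _*_ to _*ℚ_)
  open import Data.Sum using (_⊎_)
  open import Relation.Binary.PropositionalEquality

  infixl 6 _-_
  infix 4 _∣ℤ_

  -- Opaque copies of the operations of ℤ: conversion checking of polynomial
  -- expressions would otherwise unfold signs and absolute values.
  module Opaqueℤ where
    infixl 6 _+_
    infixl 7 _*_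
    infix 8 -_

    opaque
      _+_ _*_ : ℤ → ℤ → ℤ
      _+_ = ℤ._+_
      _*_ = ℤ._*_

      -_ : ℤ → ℤ
      -_ = ℤ.-_

  open Opaqueℤ public

  _-_ : ℤ → ℤ → ℤ
  i - j = i + (- j)

  _∣ℤ_ : ℕ → ℤ → Set
  d ∣ℤ i = d ∣ ∣ i ∣

  opaque
    unfolding _+_ _*_ -_

    isCommutativeRing : IsCommutativeRing _≡_ _+_ _*_ -_ (+ 0) (+ 1)
    isCommutativeRing = ℤ.+-*-isCommutativeRing

    +-def : ∀ i j → i ℤ.+ j ≡ i + j
    +-def i j = refl

    *-def : ∀ i j → i ℤ.* j ≡ i * j
    *-def i j = refl

    neg-def : ∀ i → ℤ.- i ≡ - i
    neg-def i = refl

    *-zeroʳ : ∀ i → i * + 0 ≡ + 0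
    *-zeroʳ = ℤ.*-zeroʳ

    *-comm : ∀ i j → i * j ≡ j * i
    *-comm = ℤ.*-comm

    *-zero-splitℤ : ∀ i {j} → i * j ≡ + 0 → i ≡ + 0 ⊎ j ≡ + 0
    *-zero-splitℤ i = ℤ.i*j≡0⇒i≡0∨j≡0 i

    i≡j⇒i-j≡0 : ∀ {i j} → i ≡ j → i - j ≡ + 0
    i≡j⇒i-j≡0 = ℤ.i≡j⇒i-j≡0

    i-j≡0⇒i≡j : ∀ i j → i - j ≡ + 0 → i ≡ j
    i-j≡0⇒i≡j = ℤ.i-j≡0⇒i≡j

    cancelℤ : ∀ {k i j} → k ≢ + 0 → k * i ≡ k * j → i ≡ j
    cancelℤ {k} {i} {j} k≢0 = ℤ.*-cancelˡ-≡ k i j {{ℤ.≢-nonZero k≢0}}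

    pos-* : ∀ m n → + (m ℕ.* n) ≡ + m * + n
    pos-* = ℤ.pos-*

    abs-* : ∀ i j → ∣ i * j ∣ ≡ ∣ i ∣ ℕ.* ∣ j ∣
    abs-* = ℤ.abs-*

    abs-neg : ∀ i → ∣ - i ∣ ≡ ∣ i ∣
    abs-neg = ℤ.∣-i∣≡∣i∣

    abs-+ : ∀ i j → ∣ i + j ∣ ≤ ∣ i ∣ ℕ.+ ∣ j ∣
    abs-+ = ℤ.∣i+j∣≤∣i∣+∣j∣

    ∣-intro : ∀ {d i} q → i ≡ q * + d → d ∣ℤ i
    ∣-intro {d} {i} q e = ℤ∣.∣⇒∣ᵤ {+ d} {i} (ℤ∣.divides q e)

    ∣ℤ-*ʳ : ∀ {d i} j → d ∣ℤ i → d ∣ℤ i * j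
    ∣ℤ-*ʳ {d} {i} j h = ℤ∣.∣⇒∣ᵤ {+ d} {i ℤ.* j} (ℤ∣.∣m⇒∣m*n {+ d} {i} j (ℤ∣.∣ᵤ⇒∣ {+ d} {i} h))

    ∣ℤ-*ˡ : ∀ {d i} j → d ∣ℤ i → d ∣ℤ j * i
    ∣ℤ-*ˡ {d} {i} j h = ℤ∣.∣⇒∣ᵤ {+ d} {j ℤ.* i} (ℤ∣.∣n⇒∣m*n {+ d} j {i} (ℤ∣.∣ᵤ⇒∣ {+ d} {i} h))

    ∣ℤ-+-cancelʳ : ∀ {d} i j → d ∣ℤ i + j → d ∣ℤ j → d ∣ℤ i
    ∣ℤ-+-cancelʳ {d} i j h k = ℤ∣.∣⇒∣ᵤ {+ d} {i} (ℤ∣.∣m+n∣n⇒∣m {+ d} {i} {j} (ℤ∣.∣ᵤ⇒∣ {+ d} {i ℤ.+ j} h) (ℤ∣.∣ᵤ⇒∣ {+ d} {j} k))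

  module Semℤ = Semantics isCommutativeRing (λ i → i) +-def *-def refl refl (neg-def (+ 1))
  open Semℤ public using () renaming (solve to identityℤ)

  private
    lookup-map : ∀ ρ i → ℤ→ℚ (Semℤ.lookup ρ i) ≡ Semℚ.lookup (map ℤ→ℚ ρ) i
    lookup-map [] i = refl
    lookup-map (x ∷ ρ) zero = refl
    lookup-map (x ∷ ρ) (suc i) = lookup-map ρ i

  eval-ℤ→ℚ : ∀ e ρ → ℤ→ℚ (Semℤ.eval e ρ) ≡ Semℚ.eval e (map ℤ→ℚ ρ)
  eval-ℤ→ℚ (indet i) ρ = lookup-map ρ i
  eval-ℤ→ℚ (const c) ρ = refl
  eval-ℤ→ℚ (e ⊕ f) ρ = trans (cong ℤ→ℚ (sym (+-def (Semℤ.eval e ρ) (Semℤ.eval f ρ)))) (trans (ℤ→ℚ-+ (Semℤ.eval e ρ) (Semℤ.eval f ρ)) (cong₂ _+ℚ_ (eval-ℤ→ℚ e ρ) (eval-ℤ→ℚ f ρ)))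
  eval-ℤ→ℚ (e ⊗ f) ρ = trans (cong ℤ→ℚ (sym (*-def (Semℤ.eval e ρ) (Semℤ.eval f ρ)))) (trans (ℤ→ℚ-* (Semℤ.eval e ρ) (Semℤ.eval f ρ)) (cong₂ _*ℚ_ (eval-ℤ→ℚ e ρ) (eval-ℤ→ℚ f ρ)))
  eval-ℤ→ℚ (⊝ e) ρ = trans (cong ℤ→ℚ (sym (neg-def (Semℤ.eval e ρ)))) (trans (ℤ→ℚ-neg (Semℤ.eval e ρ)) (cong -ℚ_ (eval-ℤ→ℚ e ρ)))

  -- Formulas are derived over ℚ, where the slopes live, and pulled back to ℤ, where divisibility
  -- lives.
  transfer-ℚ : ∀ ρ e f → Semℚ.eval e (map ℤ→ℚ ρ) ≡ Semℚ.eval f (map ℤ→ℚ ρ) → Semℤ.eval e ρ ≡ Semℤ.eval f ρ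
  transfer-ℚ ρ e f h = ℤ→ℚ-injective (trans (eval-ℤ→ℚ e ρ) (trans h (sym (eval-ℤ→ℚ f ρ))))

  -- All signs are made positive, so that the triangle inequality bounds a value without expanding
  -- the polynomial.
  majorant : Expr → List ℕ → ℕ
  majorant (indet i) ρ = lookup ρ i
    where
    lookup : List ℕ → ℕ → ℕ
    lookup [] _ = 1
    lookup (x ∷ _) zero = x
    lookup (_ ∷ ρ) (suc i) = lookup ρ i
  majorant (const c) ρ = ∣ c ∣
  majorant (e ⊕ f) ρ = majorant e ρ ℕ.+ majorant f ρ
  majorant (e ⊗ f) ρ = majorant e ρ ℕ.* majorant f ρ
  majorant (⊝ e) ρ = majorant e ρ

  eval≤majorant : ∀ e {ρ ρ′} → Pointwise (λ i n → ∣ i ∣ ≤ n) ρ ρ′ → ∣ Semℤ.eval e ρ ∣ ≤ majorant e ρ′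
  eval≤majorant (indet i) = go i
    where
    go : ∀ i {ρ ρ′} → Pointwise (λ i n → ∣ i ∣ ≤ n) ρ ρ′ → ∣ Semℤ.eval (indet i) ρ ∣ ≤ majorant (indet i) ρ′
    go i [] = ℕ.≤-refl
    go zero (h ∷ hs) = h
    go (suc i) (h ∷ hs) = go i hs
  eval≤majorant (const c) hs = ℕ.≤-refl
  eval≤majorant (e ⊕ f) {ρ} hs = ℕ.≤-trans (abs-+ (Semℤ.eval e ρ) (Semℤ.eval f ρ)) (ℕ.+-mono-≤ (eval≤majorant e hs) (eval≤majorant f hs))
  eval≤majorant (e ⊗ f) {ρ} hs = ℕ.≤-trans (ℕ.≤-reflexive (abs-* (Semℤ.eval e ρ) (Semℤ.eval f ρ))) (ℕ.*-mono-≤ (eval≤majorant e hs) (eval≤majorant f hs))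
  eval≤majorant (⊝ e) {ρ} hs = ℕ.≤-trans (ℕ.≤-reflexive (abs-neg (Semℤ.eval e ρ))) (eval≤majorant e hs)

  module Linearℤ where

    infixl 4 _⊞_
    infix 5 _·_

    _·_ : ∀ {l r} c → l ≡ r → c * (l - r) ≡ + 0
    _·_ c e = trans (cong (c *_) (i≡j⇒i-j≡0 e)) (*-zeroʳ c)

    _⊞_ : ∀ {x y} → x ≡ + 0 → y ≡ + 0 → x + y ≡ + 0
    p ⊞ q = trans (cong₂ _+_ p q) (sym (+-def (+ 0) (+ 0)))

    linear : ∀ {u v s} → s ≡ + 0 → u - v ≡ s → u ≡ v
    linear {u} {v} p e = i-j≡0⇒i≡j u v (trans e p)

-- Abscissae of sums, differences and doubles with denominators cleared

module AdditionFormulas where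

  open import Defs
  open RingIdentity
  open Rationals
  open Integers hiding (_+_; _*_; _-_; -_)
  open Integers using () renaming (_+_ to _ℤ+_; _*_ to _ℤ*_)
  open GroupLaw
  open import Data.Integer using (ℤ; +_)
  open import Data.Rational using (ℚ; 0ℚ; _+_; _*_; _-_; -_; ↥_; ↧_)
  open import Data.Rational.Properties
  open import Data.List using (List; []; _∷_)
  open import Data.Product using (_,_; _×_; ∃₂)
  open import Data.Sum using (_⊎_; inj₁; inj₂)
  open import Relation.Nullary using (Dec; yes; no)
  open import Relation.Binary.PropositionalEquality

  𝐚 𝐛 𝐧₁ 𝐦₁ 𝐧₂ 𝐦₂ : Expr
  𝐚 = indet 0
  𝐛 = indet 1
  𝐧₁ = indet 2
  𝐦₁ = indet 3
  𝐧₂ = indet 4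
  𝐦₂ = indet 5

  -- For x₁ = n₁ / m₁ and x₂ = n₂ / m₂ the abscissae of A + B and A - B are the
  -- roots of Q₀ X² - Q₁ X + Q₂.
  Q₀ Q₁ Q₂ : Expr
  Q₀ = (𝐧₁ ⊗ 𝐦₂ ⊖ 𝐧₂ ⊗ 𝐦₁) ⊗ (𝐧₁ ⊗ 𝐦₂ ⊖ 𝐧₂ ⊗ 𝐦₁)
  Q₁ = # 2 ⊗ (𝐧₁ ⊗ 𝐦₂ ⊕ 𝐧₂ ⊗ 𝐦₁) ⊗ (𝐚 ⊗ 𝐦₁ ⊗ 𝐦₂ ⊕ 𝐧₁ ⊗ 𝐧₂) ⊕ # 4 ⊗ 𝐛 ⊗ (𝐦₁ ⊗ 𝐦₂) ⊗ (𝐦₁ ⊗ 𝐦₂)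
  Q₂ = (𝐧₁ ⊗ 𝐧₂ ⊖ 𝐚 ⊗ 𝐦₁ ⊗ 𝐦₂) ⊗ (𝐧₁ ⊗ 𝐧₂ ⊖ 𝐚 ⊗ 𝐦₁ ⊗ 𝐦₂) ⊖ # 4 ⊗ 𝐛 ⊗ (𝐦₁ ⊗ 𝐦₂) ⊗ (𝐧₁ ⊗ 𝐦₂ ⊕ 𝐧₂ ⊗ 𝐦₁)

  -- x(2A) = F / G for x(A) = n₁ / m₁.
  F G : Expr
  F = 𝐧₁ ⊗ 𝐧₁ ⊗ 𝐧₁ ⊗ 𝐧₁ ⊖ # 2 ⊗ 𝐚 ⊗ 𝐧₁ ⊗ 𝐧₁ ⊗ 𝐦₁ ⊗ 𝐦₁ ⊖ # 8 ⊗ 𝐛 ⊗ 𝐧₁ ⊗ 𝐦₁ ⊗ 𝐦₁ ⊗ 𝐦₁ ⊕ 𝐚 ⊗ 𝐚 ⊗ 𝐦₁ ⊗ 𝐦₁ ⊗ 𝐦₁ ⊗ 𝐦₁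
  G = # 4 ⊗ (𝐧₁ ⊗ 𝐧₁ ⊗ 𝐧₁ ⊗ 𝐦₁ ⊕ 𝐚 ⊗ 𝐧₁ ⊗ 𝐦₁ ⊗ 𝐦₁ ⊗ 𝐦₁ ⊕ 𝐛 ⊗ 𝐦₁ ⊗ 𝐦₁ ⊗ 𝐦₁ ⊗ 𝐦₁)

  module _ (E : Curve) where

    private
      𝔞 𝔟 : ℚ
      𝔞 = ℤ→ℚ (a E)
      𝔟 = ℤ→ℚ (b E)

    coordinates : ℚ → ℚ → List ℤ
    coordinates x₁ x₂ = a E ∷ b E ∷ ↥ x₁ ∷ ↧ x₁ ∷ ↥ x₂ ∷ ↧ x₂ ∷ []

    private
      line-sum-product : ∀ {a b x₁ y₁ x₂ y₂ l l′} → y₁ * y₁ ≡ x₁ * x₁ * x₁ + a * x₁ + b → y₂ * y₂ ≡ x₂ * x₂ * x₂ + a * x₂ + b →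
        l * (x₂ - x₁) ≡ y₂ - y₁ → l′ * (x₂ - x₁) ≡ - y₂ - y₁ → x₁ ≢ x₂ →
        let X = l * l - x₁ - x₂; X′ = l′ * l′ - x₁ - x₂ in
        (x₁ - x₂) * (x₁ - x₂) * (X + X′) ≡ ℕ→ℚ 2 * (x₁ + x₂) * (a + x₁ * x₂) + ℕ→ℚ 4 * b
        × (x₁ - x₂) * (x₁ - x₂) * (X * X′) ≡ (x₁ * x₂ - a) * (x₁ * x₂ - a) - ℕ→ℚ 4 * b * (x₁ + x₂)
      line-sum-product {a} {b} {x₁} {y₁} {x₂} {y₂} {l} {l′} h₁ h₂ k k′ x≢ =
          linear ((l * (x₂ - x₁) + (y₂ - y₁)) · k ⊞ (l′ * (x₂ - x₁) + (- y₂ - y₁)) · k′ ⊞ ℕ→ℚ 2 · h₁ ⊞ ℕ→ℚ 2 · h₂)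
            (identityℚ (x₁ ∷ x₂ ∷ l ∷ l′ ∷ a ∷ b ∷ y₂ ∷ y₁ ∷ []) (λ x₁ x₂ l l′ a b y₂ y₁ →
                (x₁ ⊖ x₂) ⊗ (x₁ ⊖ x₂) ⊗ (l ⊗ l ⊖ x₁ ⊖ x₂ ⊕ (l′ ⊗ l′ ⊖ x₁ ⊖ x₂)) ⊖ (# 2 ⊗ (x₁ ⊕ x₂) ⊗ (a ⊕ x₁ ⊗ x₂) ⊕ # 4 ⊗ b)
                ⊜ (l ⊗ (x₂ ⊖ x₁) ⊕ (y₂ ⊖ y₁)) ⊗ (l ⊗ (x₂ ⊖ x₁) ⊖ (y₂ ⊖ y₁))
                  ⊕ (l′ ⊗ (x₂ ⊖ x₁) ⊕ (⊝ y₂ ⊖ y₁)) ⊗ (l′ ⊗ (x₂ ⊖ x₁) ⊖ (⊝ y₂ ⊖ y₁)) ⊕ # 2 ⊗ (y₁ ⊗ y₁ ⊖ (x₁ ⊗ x₁ ⊗ x₁ ⊕ a ⊗ x₁ ⊕ b))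
                  ⊕ # 2 ⊗ (y₂ ⊗ y₂ ⊖ (x₂ ⊗ x₂ ⊗ x₂ ⊕ a ⊗ x₂ ⊕ b))) refl)
        -- Clearing both squared slopes costs `(x₁ - x₂)⁴`, and one square cancels from the
        -- resulting identity.
        , *-cancel (*-≢0 (-‿≢0 x≢) (-‿≢0 x≢)) (linear
            ( (l′ * l′ * ((x₂ - x₁) * (x₂ - x₁)) - (x₁ + x₂) * ((x₁ - x₂) * (x₁ - x₂))) · sq {l} {y₂ - y₁} k
            ⊞ ((y₂ - y₁) * (y₂ - y₁) - (x₁ + x₂) * ((x₁ - x₂) * (x₁ - x₂))) · sq {l′} { - y₂ - y₁} k′
            ⊞ (y₂ * y₂ + (x₂ * x₂ * x₂ + a * x₂ + b) - ℕ→ℚ 2 * y₁ * y₁ - ℕ→ℚ 2 * ((x₁ + x₂) * ((x₁ - x₂) * (x₁ - x₂)))) · h₂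
            ⊞ (y₁ * y₁ + (x₁ * x₁ * x₁ + a * x₁ + b) - ℕ→ℚ 2 * (x₂ * x₂ * x₂ + a * x₂ + b) - ℕ→ℚ 2 * ((x₁ + x₂) * ((x₁ - x₂) * (x₁ - x₂)))) · h₁)
              (identityℚ (x₁ ∷ x₂ ∷ l ∷ l′ ∷ a ∷ b ∷ y₂ ∷ y₁ ∷ []) (λ x₁ x₂ l l′ a b y₂ y₁ →
                  (x₁ ⊖ x₂) ⊗ (x₁ ⊖ x₂) ⊗ ((x₁ ⊖ x₂) ⊗ (x₁ ⊖ x₂) ⊗ ((l ⊗ l ⊖ x₁ ⊖ x₂) ⊗ (l′ ⊗ l′ ⊖ x₁ ⊖ x₂)))
                    ⊖ (x₁ ⊖ x₂) ⊗ (x₁ ⊖ x₂) ⊗ ((x₁ ⊗ x₂ ⊖ a) ⊗ (x₁ ⊗ x₂ ⊖ a) ⊖ # 4 ⊗ b ⊗ (x₁ ⊕ x₂))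
                  ⊜ (l′ ⊗ l′ ⊗ ((x₂ ⊖ x₁) ⊗ (x₂ ⊖ x₁)) ⊖ (x₁ ⊕ x₂) ⊗ ((x₁ ⊖ x₂) ⊗ (x₁ ⊖ x₂))) ⊗ (l ⊗ l ⊗ ((x₂ ⊖ x₁) ⊗ (x₂ ⊖ x₁))
                    ⊖ (y₂ ⊖ y₁) ⊗ (y₂ ⊖ y₁)) ⊕ ((y₂ ⊖ y₁) ⊗ (y₂ ⊖ y₁)
                    ⊖ (x₁ ⊕ x₂) ⊗ ((x₁ ⊖ x₂) ⊗ (x₁ ⊖ x₂))) ⊗ (l′ ⊗ l′ ⊗ ((x₂ ⊖ x₁) ⊗ (x₂ ⊖ x₁)) ⊖ (⊝ y₂ ⊖ y₁) ⊗ (⊝ y₂ ⊖ y₁))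
                    ⊕ (y₂ ⊗ y₂ ⊕ (x₂ ⊗ x₂ ⊗ x₂ ⊕ a ⊗ x₂ ⊕ b) ⊖ # 2 ⊗ y₁ ⊗ y₁ ⊖ # 2 ⊗ ((x₁ ⊕ x₂) ⊗ ((x₁ ⊖ x₂) ⊗ (x₁ ⊖ x₂)))) ⊗ (y₂ ⊗ y₂
                    ⊖ (x₂ ⊗ x₂ ⊗ x₂ ⊕ a ⊗ x₂ ⊕ b)) ⊕ (y₁ ⊗ y₁ ⊕ (x₁ ⊗ x₁ ⊗ x₁ ⊕ a ⊗ x₁ ⊕ b) ⊖ # 2 ⊗ (x₂ ⊗ x₂ ⊗ x₂ ⊕ a ⊗ x₂ ⊕ b)
                    ⊖ # 2 ⊗ ((x₁ ⊕ x₂) ⊗ ((x₁ ⊖ x₂) ⊗ (x₁ ⊖ x₂)))) ⊗ (y₁ ⊗ y₁ ⊖ (x₁ ⊗ x₁ ⊗ x₁ ⊕ a ⊗ x₁ ⊕ b))) refl))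
        where
        sq : ∀ {l c} → l * (x₂ - x₁) ≡ c → l * l * ((x₂ - x₁) * (x₂ - x₁)) ≡ c * c
        sq {l} {c} k = linear ((l * (x₂ - x₁) + c) · k)
          (identityℚ (l ∷ x₂ ∷ x₁ ∷ c ∷ []) (λ l x₂ x₁ c →
              l ⊗ l ⊗ ((x₂ ⊖ x₁) ⊗ (x₂ ⊖ x₁)) ⊖ c ⊗ c
              ⊜ (l ⊗ (x₂ ⊖ x₁) ⊕ c) ⊗ (l ⊗ (x₂ ⊖ x₁) ⊖ c)) refl)

      clear-sum : ∀ {a b x₁ m₁ n₁ x₂ m₂ n₂ X M N X′ M′ N′} → x₁ * m₁ ≡ n₁ → x₂ * m₂ ≡ n₂ → X * M ≡ N → X′ * M′ ≡ N′ →
        (x₁ - x₂) * (x₁ - x₂) * (X + X′) ≡ ℕ→ℚ 2 * (x₁ + x₂) * (a + x₁ * x₂) + ℕ→ℚ 4 * b →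
        (n₁ * m₂ - n₂ * m₁) * (n₁ * m₂ - n₂ * m₁) * (N * M′ + N′ * M) ≡
        (ℕ→ℚ 2 * (n₁ * m₂ + n₂ * m₁) * (a * m₁ * m₂ + n₁ * n₂) + ℕ→ℚ 4 * b * (m₁ * m₂) * (m₁ * m₂)) * (M * M′)
      clear-sum {a} {b} {x₁} {m₁} {_} {x₂} {m₂} {_} {X} {M} {_} {X′} {M′} refl refl refl refl h =
        linear ((m₁ * m₂ * (m₁ * m₂) * (M * M′)) · h)
          (identityℚ (x₁ ∷ m₁ ∷ m₂ ∷ x₂ ∷ X ∷ M ∷ M′ ∷ X′ ∷ a ∷ b ∷ []) (λ x₁ m₁ m₂ x₂ X M M′ X′ a b →
              (x₁ ⊗ m₁ ⊗ m₂ ⊖ x₂ ⊗ m₂ ⊗ m₁) ⊗ (x₁ ⊗ m₁ ⊗ m₂ ⊖ x₂ ⊗ m₂ ⊗ m₁) ⊗ (X ⊗ M ⊗ M′ ⊕ X′ ⊗ M′ ⊗ M)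
                ⊖ (# 2 ⊗ (x₁ ⊗ m₁ ⊗ m₂ ⊕ x₂ ⊗ m₂ ⊗ m₁) ⊗ (a ⊗ m₁ ⊗ m₂ ⊕ x₁ ⊗ m₁ ⊗ (x₂ ⊗ m₂))
                ⊕ # 4 ⊗ b ⊗ (m₁ ⊗ m₂) ⊗ (m₁ ⊗ m₂)) ⊗ (M ⊗ M′)
              ⊜ m₁ ⊗ m₂ ⊗ (m₁ ⊗ m₂) ⊗ (M ⊗ M′) ⊗ ((x₁ ⊖ x₂) ⊗ (x₁ ⊖ x₂) ⊗ (X ⊕ X′) ⊖ (# 2 ⊗ (x₁ ⊕ x₂) ⊗ (a ⊕ x₁ ⊗ x₂) ⊕ # 4 ⊗ b))) refl)

      clear-product : ∀ {a b x₁ m₁ n₁ x₂ m₂ n₂ X M N X′ M′ N′} → x₁ * m₁ ≡ n₁ → x₂ * m₂ ≡ n₂ → X * M ≡ N → X′ * M′ ≡ N′ →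
        (x₁ - x₂) * (x₁ - x₂) * (X * X′) ≡ (x₁ * x₂ - a) * (x₁ * x₂ - a) - ℕ→ℚ 4 * b * (x₁ + x₂) →
        (n₁ * m₂ - n₂ * m₁) * (n₁ * m₂ - n₂ * m₁) * (N * N′) ≡
        ((n₁ * n₂ - a * m₁ * m₂) * (n₁ * n₂ - a * m₁ * m₂) - ℕ→ℚ 4 * b * (m₁ * m₂) * (n₁ * m₂ + n₂ * m₁)) * (M * M′)
      clear-product {a} {b} {x₁} {m₁} {_} {x₂} {m₂} {_} {X} {M} {_} {X′} {M′} refl refl refl refl h =
        linear ((m₁ * m₂ * (m₁ * m₂) * (M * M′)) · h)
          (identityℚ (x₁ ∷ m₁ ∷ m₂ ∷ x₂ ∷ X ∷ M ∷ X′ ∷ M′ ∷ a ∷ b ∷ []) (λ x₁ m₁ m₂ x₂ X M X′ M′ a b →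
              (x₁ ⊗ m₁ ⊗ m₂ ⊖ x₂ ⊗ m₂ ⊗ m₁) ⊗ (x₁ ⊗ m₁ ⊗ m₂ ⊖ x₂ ⊗ m₂ ⊗ m₁) ⊗ (X ⊗ M ⊗ (X′ ⊗ M′))
                ⊖ ((x₁ ⊗ m₁ ⊗ (x₂ ⊗ m₂) ⊖ a ⊗ m₁ ⊗ m₂) ⊗ (x₁ ⊗ m₁ ⊗ (x₂ ⊗ m₂) ⊖ a ⊗ m₁ ⊗ m₂)
                ⊖ # 4 ⊗ b ⊗ (m₁ ⊗ m₂) ⊗ (x₁ ⊗ m₁ ⊗ m₂ ⊕ x₂ ⊗ m₂ ⊗ m₁)) ⊗ (M ⊗ M′)
              ⊜ m₁ ⊗ m₂ ⊗ (m₁ ⊗ m₂) ⊗ (M ⊗ M′) ⊗ ((x₁ ⊖ x₂) ⊗ (x₁ ⊖ x₂) ⊗ (X ⊗ X′)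
                ⊖ ((x₁ ⊗ x₂ ⊖ a) ⊗ (x₁ ⊗ x₂ ⊖ a) ⊖ # 4 ⊗ b ⊗ (x₁ ⊕ x₂)))) refl)

    SumDifference : ℚ → ℚ → ℚ → ℚ → Set
    SumDifference x₁ x₂ X X′ =
      Semℤ.eval Q₀ (coordinates x₁ x₂) ℤ* (↥ X ℤ* ↧ X′ ℤ+ ↥ X′ ℤ* ↧ X) ≡ Semℤ.eval Q₁ (coordinates x₁ x₂) ℤ* (↧ X ℤ* ↧ X′)
      × Semℤ.eval Q₀ (coordinates x₁ x₂) ℤ* (↥ X ℤ* ↥ X′) ≡ Semℤ.eval Q₂ (coordinates x₁ x₂) ℤ* (↧ X ℤ* ↧ X′)

    -- A point is written as the pair of its coordinates here because A and B are affine.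
    sum-difference : ∀ {x₁ y₁ x₂ y₂} → OnCurve E (aff x₁ y₁) → OnCurve E (aff x₂ y₂) → x₁ ≢ x₂ →
      ∃₂ λ X Y → ∃₂ λ X′ Y′ → add E (aff x₁ y₁) (aff x₂ y₂) ≡ aff X Y × add E (aff x₁ y₁) (aff x₂ (- y₂)) ≡ aff X′ Y′
        × SumDifference x₁ x₂ X X′
    sum-difference {x₁} {y₁} {x₂} {y₂} h₁ h₂ x≢ = _ , _ , _ , _ , add-chord E {x₁} {y₁} {x₂} {y₂} x≢ , add-chord E {x₁} {y₁} {x₂} { - y₂} x≢ ,
        finish {(y₂ - y₁) ÷' (x₂ - x₁)} {(- y₂ - y₁) ÷' (x₂ - x₁)} (÷'-* (y₂ - y₁) Δ) (÷'-* (- y₂ - y₁) Δ)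
      where
      Δ : x₂ - x₁ ≢ 0ℚ
      Δ = -‿≢0 (λ e → x≢ (sym e))
      finish : ∀ {l l′} → l * (x₂ - x₁) ≡ y₂ - y₁ → l′ * (x₂ - x₁) ≡ - y₂ - y₁ → SumDifference x₁ x₂ (l * l - x₁ - x₂) (l′ * l′ - x₁ - x₂)
      finish {l} {l′} k k′ = integral (l * l - x₁ - x₂) (l′ * l′ - x₁ - x₂) (line-sum-product {𝔞} {𝔟} {x₁} {y₁} {x₂} {y₂} {l} {l′} h₁ h₂ k k′ x≢)
        where
        integral : ∀ X X′ →
          (x₁ - x₂) * (x₁ - x₂) * (X + X′) ≡ ℕ→ℚ 2 * (x₁ + x₂) * (𝔞 + x₁ * x₂) + ℕ→ℚ 4 * 𝔟
          × (x₁ - x₂) * (x₁ - x₂) * (X * X′) ≡ (x₁ * x₂ - 𝔞) * (x₁ * x₂ - 𝔞) - ℕ→ℚ 4 * 𝔟 * (x₁ + x₂) → SumDifference x₁ x₂ X X′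
        integral X X′ (s , p) = to-ℤ (clear-sum {𝔞} {𝔟} {x₁} {_} {_} {x₂} {_} {_} {X} {_} {_} {X′} (*-↧ x₁) (*-↧ x₂) (*-↧ X) (*-↧ X′) s) (clear-product {𝔞} {𝔟} {x₁} {_} {_} {x₂} {_} {_} {X} {_} {_} {X′} (*-↧ x₁) (*-↧ x₂) (*-↧ X) (*-↧ X′) p)
          where
          to-ℤ : _ → _ → SumDifference x₁ x₂ X X′
          to-ℤ s p = transfer-ℚ ρ (Q₀ ⊗ (indet 6 ⊗ indet 9 ⊕ indet 8 ⊗ indet 7)) (Q₁ ⊗ (indet 7 ⊗ indet 9)) s
                   , transfer-ℚ ρ (Q₀ ⊗ (indet 6 ⊗ indet 8)) (Q₂ ⊗ (indet 7 ⊗ indet 9)) p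
            where
            ρ : List ℤ
            ρ = a E ∷ b E ∷ ↥ x₁ ∷ ↧ x₁ ∷ ↥ x₂ ∷ ↧ x₂ ∷ ↥ X ∷ ↧ X ∷ ↥ X′ ∷ ↧ X′ ∷ []

    private
      line-double : ∀ {a b x y l} → y * y ≡ x * x * x + a * x + b → l * (ℕ→ℚ 2 * y) ≡ ℕ→ℚ 3 * x * x + a →
        let X = l * l - x - x in
        X * (ℕ→ℚ 4 * (x * x * x + a * x + b)) ≡ x * x * x * x - ℕ→ℚ 2 * a * x * x - ℕ→ℚ 8 * b * x + a * a
      line-double {a} {b} {x} {y} {l} h k =
        linear ((l * (ℕ→ℚ 2 * y) + (ℕ→ℚ 3 * x * x + a)) · k ⊞ (- (ℕ→ℚ 4 * (l * l))) · h)
          (identityℚ (l ∷ x ∷ a ∷ b ∷ y ∷ []) (λ l x a b y →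
              (l ⊗ l ⊖ x ⊖ x) ⊗ (# 4 ⊗ (x ⊗ x ⊗ x ⊕ a ⊗ x ⊕ b)) ⊖ (x ⊗ x ⊗ x ⊗ x ⊖ # 2 ⊗ a ⊗ x ⊗ x ⊖ # 8 ⊗ b ⊗ x ⊕ a ⊗ a)
              ⊜ (l ⊗ (# 2 ⊗ y) ⊕ (# 3 ⊗ x ⊗ x ⊕ a)) ⊗ (l ⊗ (# 2 ⊗ y) ⊖ (# 3 ⊗ x ⊗ x ⊕ a))
                ⊕ ⊝ (# 4 ⊗ (l ⊗ l)) ⊗ (y ⊗ y ⊖ (x ⊗ x ⊗ x ⊕ a ⊗ x ⊕ b))) refl)

      clear-double : ∀ {a b x m n X M N} → x * m ≡ n → X * M ≡ N →
        X * (ℕ→ℚ 4 * (x * x * x + a * x + b)) ≡ x * x * x * x - ℕ→ℚ 2 * a * x * x - ℕ→ℚ 8 * b * x + a * a →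
        M * (n * n * n * n - ℕ→ℚ 2 * a * n * n * m * m - ℕ→ℚ 8 * b * n * m * m * m + a * a * m * m * m * m) ≡
        N * (ℕ→ℚ 4 * (n * n * n * m + a * n * m * m * m + b * m * m * m * m))
      clear-double {a} {b} {x} {m} {_} {X} {M} refl refl h = linear ((- (m * m * m * m * M)) · h)
        (identityℚ (M ∷ x ∷ m ∷ a ∷ b ∷ X ∷ []) (λ M x m a b X →
            M ⊗ (x ⊗ m ⊗ (x ⊗ m) ⊗ (x ⊗ m) ⊗ (x ⊗ m) ⊖ # 2 ⊗ a ⊗ (x ⊗ m) ⊗ (x ⊗ m) ⊗ m ⊗ m ⊖ # 8 ⊗ b ⊗ (x ⊗ m) ⊗ m ⊗ m ⊗ m
              ⊕ a ⊗ a ⊗ m ⊗ m ⊗ m ⊗ m) ⊖ X ⊗ M ⊗ (# 4 ⊗ (x ⊗ m ⊗ (x ⊗ m) ⊗ (x ⊗ m) ⊗ m ⊕ a ⊗ (x ⊗ m) ⊗ m ⊗ m ⊗ m ⊕ b ⊗ m ⊗ m ⊗ m ⊗ m))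
            ⊜ ⊝ (m ⊗ m ⊗ m ⊗ m ⊗ M) ⊗ (X ⊗ (# 4 ⊗ (x ⊗ x ⊗ x ⊕ a ⊗ x ⊕ b))
              ⊖ (x ⊗ x ⊗ x ⊗ x ⊖ # 2 ⊗ a ⊗ x ⊗ x ⊖ # 8 ⊗ b ⊗ x ⊕ a ⊗ a))) refl)

      two-torsion : ∀ {a b x y m n} → x * m ≡ n → y * y ≡ x * x * x + a * x + b → y + y ≡ 0ℚ →
        ℕ→ℚ 4 * (n * n * n * m + a * n * m * m * m + b * m * m * m * m) ≡ 0ℚ
      two-torsion {a} {b} {x} {y} {m} refl h y+y = linear ((- (ℕ→ℚ 4 * (m * m * m * m))) · h ⊞ ((y + y) * (m * m * m * m)) · y+y)
        (identityℚ (x ∷ m ∷ a ∷ b ∷ y ∷ []) (λ x m a b y →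
            # 4 ⊗ (x ⊗ m ⊗ (x ⊗ m) ⊗ (x ⊗ m) ⊗ m ⊕ a ⊗ (x ⊗ m) ⊗ m ⊗ m ⊗ m ⊕ b ⊗ m ⊗ m ⊗ m ⊗ m) ⊖ # 0
            ⊜ ⊝ (# 4 ⊗ (m ⊗ m ⊗ m ⊗ m)) ⊗ (y ⊗ y ⊖ (x ⊗ x ⊗ x ⊕ a ⊗ x ⊕ b)) ⊕ (y ⊕ y) ⊗ (m ⊗ m ⊗ m ⊗ m) ⊗ (y ⊕ y ⊖ # 0)) refl)

    -- The double has abscissa `[F : G]` on the projective line. The case `O` records `G = 0`, so
    -- that duplication can later be treated by one formula.
    double : ∀ {x y} → OnCurve E (aff x y) →
      (add E (aff x y) (aff x y) ≡ O × Semℤ.eval G (coordinates x x) ≡ + 0)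
      ⊎ (∃₂ λ X Y → add E (aff x y) (aff x y) ≡ aff X Y
          × ↧ X ℤ* Semℤ.eval F (coordinates x x) ≡ ↥ X ℤ* Semℤ.eval G (coordinates x x))
    double {x} {y} h = by (y + y ≟ 0ℚ)
      where
      by : Dec (y + y ≡ 0ℚ) → _
      by (yes y+y) = inj₁ (add-opposite E {x} y y refl y+y , transfer-ℚ (coordinates x x) G (const (+ 0)) (two-torsion {𝔞} {𝔟} {x} {y} (*-↧ x) h y+y))
      by (no y+y≢0) = inj₂ (_ , _ , add-tangent E {x} {y} {x} {y} refl y+y≢0 ,
        integral (slope * slope - x - x) (line-double {𝔞} {𝔟} {x} {y} {slope} h (÷'-* (ℕ→ℚ 3 * x * x + 𝔞) (2y≢0 {y} y+y≢0))))
        where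
        slope : ℚ
        slope = (ℕ→ℚ 3 * x * x + 𝔞) ÷' (ℕ→ℚ 2 * y)
        integral : ∀ X → X * (ℕ→ℚ 4 * (x * x * x + 𝔞 * x + 𝔟)) ≡ x * x * x * x - ℕ→ℚ 2 * 𝔞 * x * x - ℕ→ℚ 8 * 𝔟 * x + 𝔞 * 𝔞 →
          ↧ X ℤ* Semℤ.eval F (coordinates x x) ≡ ↥ X ℤ* Semℤ.eval G (coordinates x x)
        integral X e = transfer-ℚ (a E ∷ b E ∷ ↥ x ∷ ↧ x ∷ ↥ X ∷ ↧ X ∷ []) (indet 5 ⊗ F) (indet 4 ⊗ G) (clear-double {𝔞} {𝔟} {x} {_} {_} {X} (*-↧ x) (*-↧ X) e)

-- Divisibility of denominators under subtraction

module Denominators where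

  open import Defs
  open RingIdentity
  open Integers
  open GroupLaw
  open AdditionFormulas
  open import Data.Nat as ℕ using (ℕ)
  import Data.Nat.Properties as ℕ
  open import Data.Nat.Divisibility as ℕ∣ using (_∣_; divides)
  open import Data.Nat.GCD using (gcd; gcd[m,n]∣m; gcd[m,n]∣n; gcd-greatest; gcd[m,n]≢0)
  open import Data.Nat.Coprimality as Coprime using (Coprime; coprime-divisor)
  open import Data.Nat.Primality using (Prime; euclidsLemma; prime⇒nonTrivial)
  open import Data.Integer as ℤ using (ℤ; +_; ∣_∣)
  import Data.Integer.Properties as ℤ
  open import Data.Rational using (ℚ; mkℚ; 0ℚ; ↥_; ↧_; ↧ₙ_) renaming (-_ to -ℚ_; _+_ to _+ℚ_)
  import Data.Rational.Properties as ℚ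
  open import Data.List using ([]; _∷_)
  open import Data.Product using (_,_; _×_; ∃; ∃₂)
  open import Data.Sum as Sum using (_⊎_; inj₁; inj₂)
  open import Relation.Nullary using (Dec; yes; no; contradiction; ¬_)
  open import Relation.Binary.PropositionalEquality
  open Linearℤ
  open CollinearTriples using (curve-±)

  -- 0 at O, so that every integer divides it.
  denominator : Pt → ℕ
  denominator O = 0
  denominator (aff x _) = ↧ₙ x

  ↥↧-coprime : ∀ x → Coprime ∣ ↥ x ∣ (↧ₙ x)
  ↥↧-coprime (mkℚ n d-1 c) = Coprime.recompute c

  +-nonzero : ∀ {n} → n ≢ 0 → + n ≢ + 0
  +-nonzero n≢0 e = n≢0 (ℤ.+-injective e)

  gcd-split : ∀ D M → M ≢ 0 → ∃ λ g → ∃₂ λ D′ M′ → g ≢ 0 × D ≡ D′ ℕ.* g × M ≡ M′ ℕ.* g × Coprime D′ M′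
  gcd-split D M M≢0 with gcd[m,n]∣m D M | gcd[m,n]∣n D M
  ... | divides D′ D= | divides M′ M= = g , D′ , M′ , g≢0 , D= , M= , coprime
    where
    g : ℕ
    g = gcd D M
    g≢0 : g ≢ 0
    g≢0 = gcd[m,n]≢0 D M (inj₂ M≢0)
    coprime : Coprime D′ M′
    coprime {d} (d∣D′ , d∣M′) = ℕ∣.∣1⇒≡1 (ℕ∣.*-cancelʳ-∣ g {{ℕ.≢-nonZero g≢0}} (subst (d ℕ.* g ∣_) (sym (ℕ.*-identityˡ g))
      (gcd-greatest (subst (d ℕ.* g ∣_) (sym D=) (ℕ∣.*-monoˡ-∣ g d∣D′)) (subst (d ℕ.* g ∣_) (sym M=) (ℕ∣.*-monoˡ-∣ g d∣M′)))))

  private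
    coprime-∣ : ∀ {d m n} → Coprime n m → d ∣ m → Coprime d n
    coprime-∣ c d∣m (e∣d , e∣n) = c (e∣n , ℕ∣.∣-trans e∣d d∣m)

    unit-square : ∀ {d n₁ n₂} → Coprime d ∣ n₁ ∣ → Coprime d ∣ n₂ ∣ → d ∣ ∣ n₁ * n₂ * (n₁ * n₂) ∣ → d ≡ 1
    unit-square {d} {n₁} {n₂} c₁ c₂ h = ℕ∣.∣1⇒≡1 (coprime-divisor c₁ (coprime-divisor c₂ (coprime-divisor c₁ (coprime-divisor c₂
        (subst (d ∣_) e h)))))
      where
      e : ∣ n₁ * n₂ * (n₁ * n₂) ∣ ≡ ∣ n₂ ∣ ℕ.* (∣ n₁ ∣ ℕ.* (∣ n₂ ∣ ℕ.* (∣ n₁ ∣ ℕ.* 1)))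
      e = trans (cong ∣_∣ {n₁ * n₂ * (n₁ * n₂)} {n₂ * (n₁ * (n₂ * (n₁ * + 1)))}
        (identityℤ (n₁ ∷ n₂ ∷ []) (λ n₁ n₂ → n₁ ⊗ n₂ ⊗ (n₁ ⊗ n₂) ⊜ n₂ ⊗ (n₁ ⊗ (n₂ ⊗ (n₁ ⊗ # 1)))) refl))
        (trans (abs-* n₂ _) (cong (∣ n₂ ∣ ℕ.*_) (trans (abs-* n₁ _) (cong (∣ n₁ ∣ ℕ.*_) (trans (abs-* n₂ _) (cong (∣ n₂ ∣ ℕ.*_) (abs-* n₁ (+ 1))))))))

  -- Only the residues of the coefficients matter: q₀ ≡ 0 mod D², q₁ ≡ 0 mod D
  -- while q₂ is a unit mod D.
  root-denominator : ∀ {D M : ℕ} {q₀ r₀ q₁ r₁ q₂ n₁ n₂ s N : ℤ} → M ≢ 0 →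
    q₀ ≡ + D * + D * r₀ → q₁ ≡ + D * r₁ → q₂ ≡ n₁ * n₂ * (n₁ * n₂) + + D * s →
    Coprime D ∣ n₁ ∣ → Coprime D ∣ n₂ ∣ →
    q₀ * (N * N) + q₂ * (+ M * + M) ≡ q₁ * (N * + M) → D ∣ M
  root-denominator {D} {M} {q₀} {r₀} {q₁} {r₁} {q₂} {n₁} {n₂} {s} {N} M≢0 refl refl refl c₁ c₂ root
    with gcd-split D M M≢0
  ... | g , D′ , M′ , g≢0 , refl , refl , D′⊥M′ = subst (λ d → d ℕ.* g ∣ M′ ℕ.* g) (sym D′≡1) (ℕ∣.*-monoˡ-∣ g (ℕ∣.1∣ M′))
    where
    Q : ℤ
    Q = n₁ * n₂ * (n₁ * n₂) + + (D′ ℕ.* g) * s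
    lemma : ∀ {D′ g M′ q} →
      D′ * g * (D′ * g) * r₀ * (N * N) + q * (M′ * g * (M′ * g)) ≡ D′ * g * r₁ * (N * (M′ * g)) →
      g * g * (M′ * (M′ * q)) ≡ g * g * (D′ * (N * (r₁ * M′ - D′ * r₀ * N)))
    lemma {D′} {g} {M′} {q} e = linear (+ 1 · e)
      (identityℤ (g ∷ M′ ∷ q ∷ D′ ∷ N ∷ r₁ ∷ r₀ ∷ []) (λ g M′ q D′ N r₁ r₀ →
          g ⊗ g ⊗ (M′ ⊗ (M′ ⊗ q)) ⊖ g ⊗ g ⊗ (D′ ⊗ (N ⊗ (r₁ ⊗ M′ ⊖ D′ ⊗ r₀ ⊗ N)))
          ⊜ # 1 ⊗ (D′ ⊗ g ⊗ (D′ ⊗ g) ⊗ r₀ ⊗ (N ⊗ N) ⊕ q ⊗ (M′ ⊗ g ⊗ (M′ ⊗ g)) ⊖ D′ ⊗ g ⊗ r₁ ⊗ (N ⊗ (M′ ⊗ g)))) refl)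
    g² : + g * + g ≢ + 0
    g² e = Sum.[ +-nonzero g≢0 , +-nonzero g≢0 ] (*-zero-splitℤ (+ g) e)
    -- With `D = D′ g` and `M = M′ g`, the root equation divided by `g²` makes `D′` divide `M′² Q`,
    -- hence `Q`. But `Q` is a unit modulo `D`, so `D′` is 1.
    D′∣ : D′ ∣ℤ + M′ * (+ M′ * Q)
    D′∣ = ∣-intro (N * (r₁ * + M′ - + D′ * r₀ * N)) (trans (cancelℤ g² (lemma {+ D′} {+ g} {+ M′} {Q} (subst₂
      (λ d m → d * d * r₀ * (N * N) + Q * (m * m) ≡ d * r₁ * (N * m)) (pos-* D′ g) (pos-* M′ g) root))) (*-comm (+ D′) _))
    D′∣Q : D′ ∣ ∣ Q ∣
    D′∣Q = coprime-divisor D′⊥M′ (coprime-divisor D′⊥M′ (subst (D′ ∣_) (trans (abs-* (+ M′) (+ M′ * Q)) (cong (M′ ℕ.*_) (abs-* (+ M′) Q))) D′∣))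
    D′∣D : D′ ∣ D′ ℕ.* g
    D′∣D = ℕ∣.m∣m*n g
    D′∣n : D′ ∣ℤ n₁ * n₂ * (n₁ * n₂)
    D′∣n = ∣ℤ-+-cancelʳ (n₁ * n₂ * (n₁ * n₂)) (+ (D′ ℕ.* g) * s) D′∣Q (∣ℤ-*ʳ {D′} {+ (D′ ℕ.* g)} s D′∣D)
    shrink : ∀ {n} → Coprime (D′ ℕ.* g) n → Coprime D′ n
    shrink c (e∣d , e∣n) = c (ℕ∣.∣-trans e∣d D′∣D , e∣n)
    D′≡1 : D′ ≡ 1
    D′≡1 = unit-square {D′} {n₁} {n₂} (shrink c₁) (shrink c₂) D′∣n

  module _ (E : Curve) where

    -- Eliminating the abscissa `X` of the sum from Vieta's relations leaves the quadratic equation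
    -- for the difference.
    root : ∀ {x₁ x₂ X X′} → SumDifference E x₁ x₂ X X′ → let ρ = coordinates E x₁ x₂ in
      Semℤ.eval Q₀ ρ * (↥ X′ * ↥ X′) + Semℤ.eval Q₂ ρ * (↧ X′ * ↧ X′) ≡ Semℤ.eval Q₁ ρ * (↥ X′ * ↧ X′)
    root {x₁} {x₂} {X} {X′} (s , p) = cancelℤ {↧ X} (λ ()) (lemma {Semℤ.eval Q₀ (coordinates E x₁ x₂)} {Semℤ.eval Q₁ (coordinates E x₁ x₂)} {Semℤ.eval Q₂ (coordinates E x₁ x₂)} {↥ X} {↧ X} {↥ X′} {↧ X′} s p)
      where
      lemma : ∀ {q₀ q₁ q₂ N M N′ M′} → q₀ * (N * M′ + N′ * M) ≡ q₁ * (M * M′) → q₀ * (N * N′) ≡ q₂ * (M * M′) →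
        M * (q₀ * (N′ * N′) + q₂ * (M′ * M′)) ≡ M * (q₁ * (N′ * M′))
      lemma {q₀} {q₁} {q₂} {N} {M} {N′} {M′} s p = linear (N′ · s ⊞ (- M′) · p)
        (identityℤ (M ∷ q₀ ∷ N′ ∷ q₂ ∷ M′ ∷ q₁ ∷ N ∷ []) (λ M q₀ N′ q₂ M′ q₁ N →
            M ⊗ (q₀ ⊗ (N′ ⊗ N′) ⊕ q₂ ⊗ (M′ ⊗ M′)) ⊖ M ⊗ (q₁ ⊗ (N′ ⊗ M′))
            ⊜ N′ ⊗ (q₀ ⊗ (N ⊗ M′ ⊕ N′ ⊗ M) ⊖ q₁ ⊗ (M ⊗ M′)) ⊕ ⊝ M′ ⊗ (q₀ ⊗ (N ⊗ N′) ⊖ q₂ ⊗ (M ⊗ M′))) refl)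

    same-x : ∀ {x₁ y₁ x₂ y₂} → OnCurve E (aff x₁ y₁) → OnCurve E (aff x₂ y₂) → x₁ ≡ x₂ →
      add E (aff x₁ y₁) (opposite (aff x₂ y₂)) ≡ O ⊎ add E (aff x₁ y₁) (opposite (aff x₂ y₂)) ≡ add E (aff x₁ y₁) (aff x₁ y₁)
    same-x {x} {y₁} {_} {y₂} h₁ h₂ refl = by (curve-± {ℤ→ℚ (a E)} {ℤ→ℚ (b E)} {x} h₁ h₂ refl)
      where
      by : y₁ ≡ y₂ ⊎ y₁ +ℚ y₂ ≡ 0ℚ → _
      by (inj₁ refl) = inj₁ (add-inverseʳ E (aff x y₁))
      by (inj₂ q) = inj₂ (cong (λ y → add E (aff x y₁) (aff x y)) (neg-unique q))

    private
      ∣-root : ∀ {D x₁ x₂ X X′} → D ∣ ↧ₙ x₁ → D ∣ ↧ₙ x₂ → SumDifference E x₁ x₂ X X′ → D ∣ ↧ₙ X′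
      ∣-root {D} {x₁} {x₂} {X} {X′} D∣₁@(divides k₁ e₁) D∣₂@(divides k₂ e₂) sd =
        root-denominator {D} {↧ₙ X′} {_} {r₀} {_} {r₁} {_} {↥ x₁} {↥ x₂} {s} {↥ X′} (λ ()) (eq₀ e₁′ e₂′) (eq₁ e₁′ e₂′) (eq₂ e₁′ e₂′)
          (coprime-∣ (↥↧-coprime x₁) D∣₁) (coprime-∣ (↥↧-coprime x₂) D∣₂) (root {x₁} {x₂} {X} {X′} sd)
        where
        e₁′ : ↧ x₁ ≡ + k₁ * + D
        e₁′ = trans (cong +_ e₁) (pos-* k₁ D)
        e₂′ : ↧ x₂ ≡ + k₂ * + D
        e₂′ = trans (cong +_ e₂) (pos-* k₂ D)
        R₀ R₁ R₂ : (a b n₁ m₁ k₁ n₂ m₂ k₂ : ℤ) → ℤ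
        R₀ a b n₁ m₁ k₁ n₂ m₂ k₂ = (n₁ * k₂ - n₂ * k₁) * (n₁ * k₂ - n₂ * k₁)
        R₁ a b n₁ m₁ k₁ n₂ m₂ k₂ = + 2 * (n₁ * k₂ + n₂ * k₁) * (a * m₁ * m₂ + n₁ * n₂) + + 4 * b * (m₁ * m₂) * (m₁ * k₂)
        R₂ a b n₁ m₁ k₁ n₂ m₂ k₂ = - (+ 2 * a * n₁ * n₂ * m₁ * k₂) + a * a * m₁ * m₁ * m₂ * k₂ - + 4 * b * (m₁ * k₂) * (n₁ * m₂ + n₂ * m₁)
        r₀ r₁ s : ℤ
        r₀ = R₀ (a E) (b E) (↥ x₁) (↧ x₁) (+ k₁) (↥ x₂) (↧ x₂) (+ k₂)
        r₁ = R₁ (a E) (b E) (↥ x₁) (↧ x₁) (+ k₁) (↥ x₂) (↧ x₂) (+ k₂)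
        s  = R₂ (a E) (b E) (↥ x₁) (↧ x₁) (+ k₁) (↥ x₂) (↧ x₂) (+ k₂)
        eq₀ : ∀ {n₁ m₁ n₂ m₂ D k₁ k₂} → m₁ ≡ k₁ * D → m₂ ≡ k₂ * D →
          (n₁ * m₂ - n₂ * m₁) * (n₁ * m₂ - n₂ * m₁) ≡ D * D * ((n₁ * k₂ - n₂ * k₁) * (n₁ * k₂ - n₂ * k₁))
        eq₀ {n₁} {_} {n₂} {_} {D} {k₁} {k₂} refl refl =
          identityℤ (n₁ ∷ k₂ ∷ D ∷ n₂ ∷ k₁ ∷ []) (λ n₁ k₂ D n₂ k₁ →
              (n₁ ⊗ (k₂ ⊗ D) ⊖ n₂ ⊗ (k₁ ⊗ D)) ⊗ (n₁ ⊗ (k₂ ⊗ D) ⊖ n₂ ⊗ (k₁ ⊗ D))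
              ⊜ D ⊗ D ⊗ ((n₁ ⊗ k₂ ⊖ n₂ ⊗ k₁) ⊗ (n₁ ⊗ k₂ ⊖ n₂ ⊗ k₁))) refl
        eq₁ : ∀ {a b n₁ m₁ n₂ m₂ D k₁ k₂} → m₁ ≡ k₁ * D → m₂ ≡ k₂ * D →
          + 2 * (n₁ * m₂ + n₂ * m₁) * (a * m₁ * m₂ + n₁ * n₂) + + 4 * b * (m₁ * m₂) * (m₁ * m₂) ≡
          D * (+ 2 * (n₁ * k₂ + n₂ * k₁) * (a * m₁ * m₂ + n₁ * n₂) + + 4 * b * (m₁ * m₂) * (m₁ * k₂))
        eq₁ {a} {b} {n₁} {_} {n₂} {_} {D} {k₁} {k₂} refl refl =
          identityℤ (n₁ ∷ k₂ ∷ D ∷ n₂ ∷ k₁ ∷ a ∷ b ∷ []) (λ n₁ k₂ D n₂ k₁ a b →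
              # 2 ⊗ (n₁ ⊗ (k₂ ⊗ D) ⊕ n₂ ⊗ (k₁ ⊗ D)) ⊗ (a ⊗ (k₁ ⊗ D) ⊗ (k₂ ⊗ D) ⊕ n₁ ⊗ n₂)
                ⊕ # 4 ⊗ b ⊗ (k₁ ⊗ D ⊗ (k₂ ⊗ D)) ⊗ (k₁ ⊗ D ⊗ (k₂ ⊗ D))
              ⊜ D ⊗ (# 2 ⊗ (n₁ ⊗ k₂ ⊕ n₂ ⊗ k₁) ⊗ (a ⊗ (k₁ ⊗ D) ⊗ (k₂ ⊗ D) ⊕ n₁ ⊗ n₂)
                ⊕ # 4 ⊗ b ⊗ (k₁ ⊗ D ⊗ (k₂ ⊗ D)) ⊗ (k₁ ⊗ D ⊗ k₂))) refl
        eq₂ : ∀ {a b n₁ m₁ n₂ m₂ D k₁ k₂} → m₁ ≡ k₁ * D → m₂ ≡ k₂ * D →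
          (n₁ * n₂ - a * m₁ * m₂) * (n₁ * n₂ - a * m₁ * m₂) - + 4 * b * (m₁ * m₂) * (n₁ * m₂ + n₂ * m₁) ≡
          n₁ * n₂ * (n₁ * n₂) + D * (- (+ 2 * a * n₁ * n₂ * m₁ * k₂) + a * a * m₁ * m₁ * m₂ * k₂ - + 4 * b * (m₁ * k₂) * (n₁ * m₂ + n₂ * m₁))
        eq₂ {a} {b} {n₁} {_} {n₂} {_} {D} {k₁} {k₂} refl refl =
          identityℤ (n₁ ∷ n₂ ∷ a ∷ k₁ ∷ D ∷ k₂ ∷ b ∷ []) (λ n₁ n₂ a k₁ D k₂ b →
              (n₁ ⊗ n₂ ⊖ a ⊗ (k₁ ⊗ D) ⊗ (k₂ ⊗ D)) ⊗ (n₁ ⊗ n₂ ⊖ a ⊗ (k₁ ⊗ D) ⊗ (k₂ ⊗ D))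
                ⊖ # 4 ⊗ b ⊗ (k₁ ⊗ D ⊗ (k₂ ⊗ D)) ⊗ (n₁ ⊗ (k₂ ⊗ D) ⊕ n₂ ⊗ (k₁ ⊗ D))
              ⊜ n₁ ⊗ n₂ ⊗ (n₁ ⊗ n₂) ⊕ D ⊗ (⊝ (# 2 ⊗ a ⊗ n₁ ⊗ n₂ ⊗ (k₁ ⊗ D) ⊗ k₂) ⊕ a ⊗ a ⊗ (k₁ ⊗ D) ⊗ (k₁ ⊗ D) ⊗ (k₂ ⊗ D) ⊗ k₂
                ⊖ # 4 ⊗ b ⊗ (k₁ ⊗ D ⊗ k₂) ⊗ (n₁ ⊗ (k₂ ⊗ D) ⊕ n₂ ⊗ (k₁ ⊗ D)))) refl

      -- Modulo `D` the form `F` is the unit `n⁴` while `G` vanishes, so `D` must go into the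
      -- denominator of `F / G`.
      ∣-double : ∀ {D x X} → D ∣ ↧ₙ x → ↧ X * Semℤ.eval F (coordinates E x x) ≡ ↥ X * Semℤ.eval G (coordinates E x x) → D ∣ ↧ₙ X
      ∣-double {D} {x} {X} D∣@(divides k e) h = coprime-divisor D⊥F (subst (D ∣_) (trans (abs-* (↧ X) f) (ℕ.*-comm (↧ₙ X) ∣ f ∣)) D∣MF)
        where
        n m f g : ℤ
        n = ↥ x
        m = ↧ x
        f = Semℤ.eval F (coordinates E x x)
        g = Semℤ.eval G (coordinates E x x)
        e′ : ↧ x ≡ + k * + D
        e′ = trans (cong +_ e) (pos-* k D)
        D⊥n : Coprime D ∣ n ∣
        D⊥n = coprime-∣ (↥↧-coprime x) D∣
        g= : ∀ {a b n m k d} → m ≡ k * d →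
          + 4 * (n * n * n * m + a * n * m * m * m + b * m * m * m * m) ≡ + 4 * (n * n * n * k + a * n * k * m * m + b * k * m * m * m) * d
        g= {a} {b} {n} {_} {k} {d} refl =
          identityℤ (n ∷ k ∷ d ∷ a ∷ b ∷ []) (λ n k d a b →
              # 4 ⊗ (n ⊗ n ⊗ n ⊗ (k ⊗ d) ⊕ a ⊗ n ⊗ (k ⊗ d) ⊗ (k ⊗ d) ⊗ (k ⊗ d) ⊕ b ⊗ (k ⊗ d) ⊗ (k ⊗ d) ⊗ (k ⊗ d) ⊗ (k ⊗ d))
              ⊜ # 4 ⊗ (n ⊗ n ⊗ n ⊗ k ⊕ a ⊗ n ⊗ k ⊗ (k ⊗ d) ⊗ (k ⊗ d) ⊕ b ⊗ k ⊗ (k ⊗ d) ⊗ (k ⊗ d) ⊗ (k ⊗ d)) ⊗ d) refl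
        f= : ∀ {a b n m k d} → m ≡ k * d →
          n * n * n * n - + 2 * a * n * n * m * m - + 8 * b * n * m * m * m + a * a * m * m * m * m ≡
          n * n * (n * n) + (- (+ 2 * a * n * n * k * m) - + 8 * b * n * k * m * m + a * a * k * m * m * m) * d
        f= {a} {b} {n} {_} {k} {d} refl =
          identityℤ (n ∷ a ∷ k ∷ d ∷ b ∷ []) (λ n a k d b →
              n ⊗ n ⊗ n ⊗ n ⊖ # 2 ⊗ a ⊗ n ⊗ n ⊗ (k ⊗ d) ⊗ (k ⊗ d) ⊖ # 8 ⊗ b ⊗ n ⊗ (k ⊗ d) ⊗ (k ⊗ d) ⊗ (k ⊗ d)
                ⊕ a ⊗ a ⊗ (k ⊗ d) ⊗ (k ⊗ d) ⊗ (k ⊗ d) ⊗ (k ⊗ d)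
              ⊜ n ⊗ n ⊗ (n ⊗ n) ⊕ (⊝ (# 2 ⊗ a ⊗ n ⊗ n ⊗ k ⊗ (k ⊗ d)) ⊖ # 8 ⊗ b ⊗ n ⊗ k ⊗ (k ⊗ d) ⊗ (k ⊗ d)
                ⊕ a ⊗ a ⊗ k ⊗ (k ⊗ d) ⊗ (k ⊗ d) ⊗ (k ⊗ d)) ⊗ d) refl
        D∣MF : D ∣ℤ ↧ X * f
        D∣MF = subst (D ∣ℤ_) (sym h) (∣ℤ-*ˡ {i = g} (↥ X) (∣-intro _ (g= {a E} {b E} {n} e′)))
        D⊥F : Coprime D ∣ f ∣
        D⊥F {d} (d∣D , d∣f) = unit-square {d} {n} {n} (λ (p , q) → D⊥n (ℕ∣.∣-trans p d∣D , q)) (λ (p , q) → D⊥n (ℕ∣.∣-trans p d∣D , q))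
          (∣ℤ-+-cancelʳ _ _ (subst (d ∣ℤ_) (f= {a E} {b E} {n} e′) d∣f) (∣ℤ-*ˡ {d} {+ D} _ d∣D))

    -- The points reducing to the origin modulo `D` form a subgroup. The modulus is arbitrary
    -- because prime powers will measure the exponent shared by two denominators.
    denominator-sub : ∀ {D} A B → OnCurve E A → OnCurve E B → D ∣ denominator A → D ∣ denominator B → D ∣ denominator (sub E A B)
    denominator-sub {D} O O _ _ _ _ = D ℕ∣.∣0
    denominator-sub O (aff _ _) _ _ _ d = d
    denominator-sub (aff _ _) O _ _ d _ = d
    denominator-sub {D} A@(aff x₁ y₁) B@(aff x₂ y₂) h₁ h₂ d₁ d₂ = by (x₁ ℚ.≟ x₂)
      where
      doubled : (add E A A ≡ O × _) ⊎ (∃₂ λ X Y → add E A A ≡ aff X Y × _) → D ∣ denominator (add E A A)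
      doubled (inj₁ (e , _)) = subst (λ R → D ∣ denominator R) (sym e) (D ℕ∣.∣0)
      doubled (inj₂ (X , Y , e , eq)) = subst (λ R → D ∣ denominator R) (sym e) (∣-double {D} {x₁} {X} d₁ eq)
      equal-x : sub E A B ≡ O ⊎ sub E A B ≡ add E A A → D ∣ denominator (sub E A B)
      equal-x (inj₁ e) = subst (λ R → D ∣ denominator R) (sym e) (D ℕ∣.∣0)
      equal-x (inj₂ e) = subst (λ R → D ∣ denominator R) (sym e) (doubled (double E {x₁} {y₁} h₁))
      by : Dec (x₁ ≡ x₂) → D ∣ denominator (sub E A B)
      by (yes x=) = equal-x (same-x h₁ h₂ x=)
      by (no x≢) = let X , _ , X′ , _ , _ , e , sd = sum-difference E {x₁} {y₁} {x₂} {y₂} h₁ h₂ x≢ in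
        subst (λ R → D ∣ denominator R) (sym e) (∣-root {D} {x₁} {x₂} {X} {X′} d₁ d₂ sd)

    -- Modulo p the sum-difference equation with p ∣ n₁, n₂ reads 4 b m₁² m₂² M M′ ≡ 0.
    numerator-sum-difference : ∀ {p} A B → OnCurve E A → OnCurve E B → Prime p → ¬ p ∣ 2 ℕ.* ∣ b E ∣ →
      p ∣ ∣ ↥ xcoord A ∣ → p ∣ ∣ ↥ xcoord B ∣ → A ≢ O → B ≢ O → (p ∣ denominator (add E A B)) ⊎ (p ∣ denominator (sub E A B))
    numerator-sum-difference O _ _ _ _ _ _ _ A≢O _ = contradiction refl A≢O
    numerator-sum-difference (aff _ _) O _ _ _ _ _ _ _ B≢O = contradiction refl B≢O
    numerator-sum-difference {p} A@(aff x₁ y₁) B@(aff x₂ y₂) h₁ h₂ p-prime p∤2b p∣n₁ p∣n₂ _ _ = by (x₁ ℚ.≟ x₂)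
      where
      Goal : Set
      Goal = (p ∣ denominator (add E A B)) ⊎ (p ∣ denominator (sub E A B))
      equal-x : x₁ ≡ x₂ → y₁ ≡ y₂ ⊎ y₁ +ℚ y₂ ≡ 0ℚ → Goal
      equal-x refl (inj₁ refl) = inj₂ (subst (λ R → p ∣ denominator R) (sym (add-inverseʳ E A)) (p ℕ∣.∣0))
      equal-x refl (inj₂ q) = inj₁ (subst (λ R → p ∣ denominator R) (sym (add-opposite E {x₁} y₁ y₂ refl q)) (p ℕ∣.∣0))
      p∤m : ∀ {x} → p ∣ ∣ ↥ x ∣ → ¬ p ∣ ↧ₙ x
      p∤m {x} p∣n p∣m = ℕ.<⇒≢ (ℕ.nonTrivial⇒n>1 p {{prime⇒nonTrivial p-prime}}) (sym (↥↧-coprime x (p∣n , p∣m)))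
      p∤-* : ∀ {i j} → ¬ p ∣ i → ¬ p ∣ j → ¬ p ∣ i ℕ.* j
      p∤-* {i} {j} u v h = Sum.[ u , v ] (euclidsLemma i j p-prime h)
      product : ∀ {X X′} → SumDifference E x₁ x₂ X X′ → (p ∣ ↧ₙ X) ⊎ (p ∣ ↧ₙ X′)
      product {X} {X′} (s , _) =
          Sum.[ (λ h → contradiction h p∤U) , euclidsLemma (↧ₙ X) (↧ₙ X′) p-prime ] (euclidsLemma ∣ U ∣ (↧ₙ X ℕ.* ↧ₙ X′) p-prime p∣unit)
        where
        p∤₁ : ¬ p ∣ ↧ₙ x₁
        p∤₁ = p∤m {x₁} p∣n₁
        p∤₂ : ¬ p ∣ ↧ₙ x₂
        p∤₂ = p∤m {x₂} p∣n₂
        p∤2 : ¬ p ∣ 2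
        p∤2 h = p∤2b (ℕ∣.∣m⇒∣m*n ∣ b E ∣ h)
        U : ℤ
        U = + 2 * b E * (+ 2 * (↧ x₁ * ↧ x₂ * (↧ x₁ * ↧ x₂)))
        split : ∀ {a b n₁ m₁ n₂ m₂ N M N′ M′} →
          (n₁ * m₂ - n₂ * m₁) * (n₁ * m₂ - n₂ * m₁) * (N * M′ + N′ * M) ≡
          (+ 2 * (n₁ * m₂ + n₂ * m₁) * (a * m₁ * m₂ + n₁ * n₂) + + 4 * b * (m₁ * m₂) * (m₁ * m₂)) * (M * M′) →
          + 2 * b * (+ 2 * (m₁ * m₂ * (m₁ * m₂))) * (M * M′) + n₁ * ((+ 2 * m₂ * (a * m₁ * m₂ + n₁ * n₂)) * (M * M′) - m₂ * (n₁ * m₂ - n₂ * m₁) * (N * M′ + N′ * M))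
          ≡ n₂ * (- (+ 2 * m₁ * (a * m₁ * m₂ + n₁ * n₂)) * (M * M′) - m₁ * (n₁ * m₂ - n₂ * m₁) * (N * M′ + N′ * M))
        split {a} {b} {n₁} {m₁} {n₂} {m₂} {N} {M} {N′} {M′} s = linear (- (+ 1) · s)
          (identityℤ (b ∷ m₁ ∷ m₂ ∷ M ∷ M′ ∷ n₁ ∷ a ∷ n₂ ∷ N ∷ N′ ∷ []) (λ b m₁ m₂ M M′ n₁ a n₂ N N′ →
              # 2 ⊗ b ⊗ (# 2 ⊗ (m₁ ⊗ m₂ ⊗ (m₁ ⊗ m₂))) ⊗ (M ⊗ M′)
                ⊕ n₁ ⊗ (# 2 ⊗ m₂ ⊗ (a ⊗ m₁ ⊗ m₂ ⊕ n₁ ⊗ n₂) ⊗ (M ⊗ M′) ⊖ m₂ ⊗ (n₁ ⊗ m₂ ⊖ n₂ ⊗ m₁) ⊗ (N ⊗ M′ ⊕ N′ ⊗ M))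
                ⊖ n₂ ⊗ (⊝ (# 2 ⊗ m₁ ⊗ (a ⊗ m₁ ⊗ m₂ ⊕ n₁ ⊗ n₂)) ⊗ (M ⊗ M′) ⊖ m₁ ⊗ (n₁ ⊗ m₂ ⊖ n₂ ⊗ m₁) ⊗ (N ⊗ M′ ⊕ N′ ⊗ M))
              ⊜ ⊝ # 1 ⊗ ((n₁ ⊗ m₂ ⊖ n₂ ⊗ m₁) ⊗ (n₁ ⊗ m₂ ⊖ n₂ ⊗ m₁) ⊗ (N ⊗ M′ ⊕ N′ ⊗ M)
                ⊖ (# 2 ⊗ (n₁ ⊗ m₂ ⊕ n₂ ⊗ m₁) ⊗ (a ⊗ m₁ ⊗ m₂ ⊕ n₁ ⊗ n₂) ⊕ # 4 ⊗ b ⊗ (m₁ ⊗ m₂) ⊗ (m₁ ⊗ m₂)) ⊗ (M ⊗ M′))) refl)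
        p∣unit : p ∣ ∣ U ∣ ℕ.* (↧ₙ X ℕ.* ↧ₙ X′)
        p∣unit = subst (p ∣_) (trans (abs-* U (↧ X * ↧ X′)) (cong (∣ U ∣ ℕ.*_) (abs-* (↧ X) (↧ X′))))
          (∣ℤ-+-cancelʳ (U * (↧ X * ↧ X′)) _
            (subst (p ∣ℤ_) (sym (split {a E} {b E} {↥ x₁} {↧ x₁} {↥ x₂} {↧ x₂} {↥ X} {↧ X} {↥ X′} {↧ X′} s)) (∣ℤ-*ʳ {p} {↥ x₂} _ p∣n₂))
            (∣ℤ-*ʳ {p} {↥ x₁} _ p∣n₁))
        abs-U : ∣ U ∣ ≡ 2 ℕ.* ∣ b E ∣ ℕ.* (2 ℕ.* (↧ₙ x₁ ℕ.* ↧ₙ x₂ ℕ.* (↧ₙ x₁ ℕ.* ↧ₙ x₂)))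
        abs-U = trans (abs-* (+ 2 * b E) _) (cong₂ ℕ._*_ (abs-* (+ 2) (b E)) (trans (abs-* (+ 2) _) (cong (2 ℕ.*_)
          (trans (abs-* (↧ x₁ * ↧ x₂) _) (cong₂ ℕ._*_ (abs-* (↧ x₁) (↧ x₂)) (abs-* (↧ x₁) (↧ x₂)))))))
        p∤U : ¬ p ∣ ∣ U ∣
        p∤U h = p∤-* p∤2b (p∤-* p∤2 (p∤-* (p∤-* p∤₁ p∤₂) (p∤-* p∤₁ p∤₂))) (subst (p ∣_) abs-U h)
      by : Dec (x₁ ≡ x₂) → Goal
      by (yes x=) = equal-x x= (curve-± {ℤ→ℚ (a E)} {ℤ→ℚ (b E)} {x₁} h₁ h₂ x=)
      by (no x≢) = let X , _ , X′ , _ , e , e′ , sd = sum-difference E {x₁} {y₁} {x₂} {y₂} h₁ h₂ x≢ in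
        Sum.map (subst (λ R → p ∣ denominator R) (sym e)) (subst (λ R → p ∣ denominator R) (sym e′)) (product {X} {X′} sd)

-- Binary logarithms rounded up

module BinaryLog where

  open import Data.Nat
  open import Data.Nat.Properties
  open import Data.Nat.Tactic.RingSolver using (solve-∀)
  open import Relation.Nullary using (yes; no)
  open import Relation.Binary.PropositionalEquality

  opaque
    -- The ceiling of the binary logarithm, with the value 0 at 0.
    lg : ℕ → ℕ
    lg zero = 0
    lg (suc n) with suc n ≤? 2 ^ lg n
    ... | yes _ = lg n
    ... | no _  = suc (lg n)

    ≤2^lg : ∀ n → n ≤ 2 ^ lg n
    ≤2^lg zero = z≤n
    ≤2^lg (suc n) with suc n ≤? 2 ^ lg n
    ... | yes h = h
    ... | no _ with n
    ...   | zero = s≤s z≤n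
    ...   | n@(suc n′) = begin
      suc n           ≤⟨ s≤s (m≤n+m n n′) ⟩
      n + n           ≤⟨ +-mono-≤ (≤2^lg n) (≤2^lg n) ⟩
      2 ^ lg n + 2 ^ lg n ≡⟨ cong (2 ^ lg n +_) (+-identityʳ (2 ^ lg n)) ⟨
      2 ^ suc (lg n)  ∎
      where open ≤-Reasoning

    2^lg< : ∀ n → 1 ≤ n → 2 ^ lg n < 2 * n
    2^lg< (suc n) _ with suc n ≤? 2 ^ lg n
    2^lg< (suc zero) _ | yes _ = ≤-refl
    2^lg< (suc n@(suc _)) _ | yes _ = <-≤-trans (2^lg< n (s≤s z≤n)) (*-monoʳ-≤ 2 (n≤1+n n))
    ... | no h = *-monoʳ-< 2 (≰⇒> h)

    lg-least : ∀ {n k} → n ≤ 2 ^ k → lg n ≤ k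
    lg-least {zero} _ = z≤n
    lg-least {n@(suc _)} {k} h = ≮⇒≥ λ k<lg → <⇒≱ (2^lg< n (s≤s z≤n))
      (≤-trans (*-monoʳ-≤ 2 h) (^-monoʳ-≤ 2 k<lg))

    lg-1 : lg 1 ≡ 0
    lg-1 = refl

  lg-mono : ∀ {m n} → m ≤ n → lg m ≤ lg n
  lg-mono {_} {n} h = lg-least (≤-trans h (≤2^lg n))

  lg-2^ : ∀ k → lg (2 ^ k) ≡ k
  lg-2^ k = ≤-antisym (lg-least ≤-refl) (≮⇒≥ λ h → <⇒≱ (^-monoʳ-< 2 (s≤s (s≤s z≤n)) h) (≤2^lg (2 ^ k)))

  lg-* : ∀ m n → lg (m * n) ≤ lg m + lg n
  lg-* m n = lg-least (≤-trans (*-mono-≤ (≤2^lg m) (≤2^lg n)) (≤-reflexive (sym (^-distribˡ-+-* 2 (lg m) (lg n)))))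

  -- Each ceiling exceeds the true logarithm by less than one, which the additive 2 absorbs.
  lg-*-≥ : ∀ m n → 1 ≤ m → 1 ≤ n → lg m + lg n ≤ lg (m * n) + 2
  lg-*-≥ m n 1≤m 1≤n = ≮⇒≥ λ h → <⇒≱ (begin-strict
    2 ^ (lg m + lg n)   ≡⟨ ^-distribˡ-+-* 2 (lg m) (lg n) ⟩
    2 ^ lg m * 2 ^ lg n <⟨ *-mono-< (2^lg< m 1≤m) (2^lg< n 1≤n) ⟩
    2 * m * (2 * n)     ≡⟨ rearrange m n ⟩
    m * n * 4           ≤⟨ *-monoˡ-≤ 4 (≤2^lg (m * n)) ⟩
    2 ^ lg (m * n) * 2 ^ 2 ≡⟨ ^-distribˡ-+-* 2 (lg (m * n)) 2 ⟨
    2 ^ (lg (m * n) + 2) ∎) (^-monoʳ-≤ 2 (<⇒≤ h))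
    where
    open ≤-Reasoning
    rearrange : ∀ m n → 2 * m * (2 * n) ≡ m * n * 4
    rearrange = solve-∀

-- Heights of sums, differences and doubles

module Heights where

  open import Defs
  open RingIdentity
  open Integers
  open GroupLaw
  open AdditionFormulas
  open Denominators
  open import Data.Nat as ℕ using (ℕ; suc; _≤_; z≤n; s≤s; _⊔_)
  import Data.Nat.Properties as ℕ
  open import Data.Nat.Tactic.RingSolver using (solve-∀)
  open import Data.Nat.Divisibility as ℕ∣ using (_∣_; divides)
  open import Data.Nat.Coprimality as Coprime using (Coprime; coprime-divisor; coprime-factors)
  open import Data.Integer as ℤ using (ℤ; +_; ∣_∣)
  import Data.Integer.Properties as ℤ
  open import Data.Rational using (ℚ; ↥_; ↧_; ↧ₙ_) renaming (-_ to -ℚ_; _+_ to _+ℚ_)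
  import Data.Rational as ℚ
  import Data.Rational.Properties as ℚ
  open import Data.List using (List; []; _∷_)
  open import Data.List.Relation.Binary.Pointwise using ([]; _∷_)
  open import Data.Product using (_,_; _×_; ∃; ∃₂)
  open import Data.Sum as Sum using (_⊎_; inj₁; inj₂)
  open import Relation.Binary.PropositionalEquality
  open Linearℤ

  H : ℚ → ℕ
  H x = ∣ ↥ x ∣ ⊔ ↧ₙ x

  height : Pt → ℕ
  height O = 1
  height (aff x _) = H x

  1≤H : ∀ x → 1 ≤ H x
  1≤H x = ℕ.≤-trans (s≤s z≤n) (ℕ.m≤n⊔m ∣ ↥ x ∣ (↧ₙ x))

  1≤height : ∀ A → 1 ≤ height A
  1≤height O = s≤s z≤n
  1≤height (aff x _) = 1≤H x

  ∣-split : ∀ {d i} → d ∣ℤ i → ∃ λ q → i ≡ q * + d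
  ∣-split {d} {i} (divides q e) = go (ℤ.+∣i∣≡i⊎+∣i∣≡-i i)
    where
    ∣i∣ : + ∣ i ∣ ≡ + q * + d
    ∣i∣ = trans (cong +_ e) (pos-* q d)
    negative : ∀ {i q d} → q * d ≡ - i → i ≡ (- q) * d
    negative {i} {q} {d} e = linear (+ 1 · e) (identityℤ (i ∷ q ∷ d ∷ []) (λ i q d → i ⊖ ⊝ q ⊗ d ⊜ # 1 ⊗ (q ⊗ d ⊖ ⊝ i)) refl)
    go : + ∣ i ∣ ≡ i ⊎ + ∣ i ∣ ≡ ℤ.- i → ∃ λ q → i ≡ q * + d
    go (inj₁ h) = + q , trans (sym h) ∣i∣
    go (inj₂ h) = - (+ q) , negative (trans (sym ∣i∣) (trans h (neg-def i)))

  ∣*∣ : ∀ {d} i j → d ∣ℤ i * j → d ∣ ∣ i ∣ ℕ.* ∣ j ∣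
  ∣*∣ {d} i j = subst (d ∣_) (abs-* i j)

  -- Gauss's lemma for the content of (M X - N) (M′ X - N′).
  content : ∀ {q₀ q₁ q₂ N N′ : ℤ} {M M′ : ℕ} → M ≢ 0 → M′ ≢ 0 → Coprime ∣ N ∣ M → Coprime ∣ N′ ∣ M′ →
    q₀ * (N * + M′ + N′ * + M) ≡ q₁ * (+ M * + M′) → q₀ * (N * N′) ≡ q₂ * (+ M * + M′) →
    ∃ λ t → q₀ ≡ t * (+ M * + M′) × q₁ ≡ t * (N * + M′ + N′ * + M) × q₂ ≡ t * (N * N′)
  content {q₀} {q₁} {q₂} {N} {N′} {M} {M′} M≢0 M′≢0 c c′ s p = first (∣-split M∣q₀)
    where
    -- `M` divides both `N N′ q₀` and `N M′ q₀`. It is coprime to `N`, and `N′` and `M′` are coprime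
    -- to each other.
    M∣q₀ : M ∣ℤ q₀
    M∣q₀ = coprime-factors c′
      ( coprime-divisor (Coprime.sym c) (subst (M ∣_) (trans (abs-* N _) (cong (∣ N ∣ ℕ.*_) (abs-* N′ q₀)))
          (∣-intro (q₂ * + M′) (eq₂ p)))
      , coprime-divisor (Coprime.sym c) (subst (M ∣_) (trans (abs-* N _) (cong (∣ N ∣ ℕ.*_) (abs-* (+ M′) q₀)))
          (∣-intro (q₁ * + M′ - q₀ * N′) (eq₁ s))))
      where
      eq₁ : ∀ {q₀ q₁ N N′ M M′} → q₀ * (N * M′ + N′ * M) ≡ q₁ * (M * M′) → N * (M′ * q₀) ≡ (q₁ * M′ - q₀ * N′) * M
      eq₁ {q₀} {q₁} {N} {N′} {M} {M′} s = linear (+ 1 · s)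
        (identityℤ (N ∷ M′ ∷ q₀ ∷ q₁ ∷ N′ ∷ M ∷ []) (λ N M′ q₀ q₁ N′ M →
            N ⊗ (M′ ⊗ q₀) ⊖ (q₁ ⊗ M′ ⊖ q₀ ⊗ N′) ⊗ M
            ⊜ # 1 ⊗ (q₀ ⊗ (N ⊗ M′ ⊕ N′ ⊗ M) ⊖ q₁ ⊗ (M ⊗ M′))) refl)
      eq₂ : ∀ {q₀ q₂ N N′ M M′} → q₀ * (N * N′) ≡ q₂ * (M * M′) → N * (N′ * q₀) ≡ (q₂ * M′) * M
      eq₂ {q₀} {q₂} {N} {N′} {M} {M′} p = linear (+ 1 · p)
        (identityℤ (N ∷ N′ ∷ q₀ ∷ q₂ ∷ M′ ∷ M ∷ []) (λ N N′ q₀ q₂ M′ M →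
            N ⊗ (N′ ⊗ q₀) ⊖ q₂ ⊗ M′ ⊗ M
            ⊜ # 1 ⊗ (q₀ ⊗ (N ⊗ N′) ⊖ q₂ ⊗ (M ⊗ M′))) refl)
    first : (∃ λ r → q₀ ≡ r * + M) → _
    first (r , refl) = second (∣-split M′∣r)
      where
      s′ : r * (N * + M′ + N′ * + M) ≡ q₁ * + M′
      s′ = cancelℤ (+-nonzero M≢0) (lemma s)
        where
        lemma : ∀ {r q₁ S M M′} → r * M * S ≡ q₁ * (M * M′) → M * (r * S) ≡ M * (q₁ * M′)
        lemma {r} {q₁} {S} {M} {M′} s = linear (+ 1 · s)
          (identityℤ (M ∷ r ∷ S ∷ q₁ ∷ M′ ∷ []) (λ M r S q₁ M′ → M ⊗ (r ⊗ S) ⊖ M ⊗ (q₁ ⊗ M′) ⊜ # 1 ⊗ (r ⊗ M ⊗ S ⊖ q₁ ⊗ (M ⊗ M′))) refl)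
      p′ : r * (N * N′) ≡ q₂ * + M′
      p′ = cancelℤ (+-nonzero M≢0) (lemma p)
        where
        lemma : ∀ {r q₁ S M M′} → r * M * S ≡ q₁ * (M * M′) → M * (r * S) ≡ M * (q₁ * M′)
        lemma {r} {q₁} {S} {M} {M′} s = linear (+ 1 · s)
          (identityℤ (M ∷ r ∷ S ∷ q₁ ∷ M′ ∷ []) (λ M r S q₁ M′ → M ⊗ (r ⊗ S) ⊖ M ⊗ (q₁ ⊗ M′) ⊜ # 1 ⊗ (r ⊗ M ⊗ S ⊖ q₁ ⊗ (M ⊗ M′))) refl)
      M′∣r : M′ ∣ℤ r
      M′∣r = coprime-factors c
        ( coprime-divisor (Coprime.sym c′) (subst (M′ ∣_) (trans (abs-* N′ _) (cong (∣ N′ ∣ ℕ.*_) (abs-* N r)))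
            (∣-intro q₂ (eq₂ p′)))
        , coprime-divisor (Coprime.sym c′) (subst (M′ ∣_) (trans (abs-* N′ _) (cong (∣ N′ ∣ ℕ.*_) (abs-* (+ M) r)))
            (∣-intro (q₁ - r * N) (eq₁ s′))))
        where
        eq₁ : ∀ {r q₁ N N′ M M′} → r * (N * M′ + N′ * M) ≡ q₁ * M′ → N′ * (M * r) ≡ (q₁ - r * N) * M′
        eq₁ {r} {q₁} {N} {N′} {M} {M′} s = linear (+ 1 · s)
          (identityℤ (N′ ∷ M ∷ r ∷ q₁ ∷ N ∷ M′ ∷ []) (λ N′ M r q₁ N M′ →
              N′ ⊗ (M ⊗ r) ⊖ (q₁ ⊖ r ⊗ N) ⊗ M′
              ⊜ # 1 ⊗ (r ⊗ (N ⊗ M′ ⊕ N′ ⊗ M) ⊖ q₁ ⊗ M′)) refl)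
        eq₂ : ∀ {r q₂ N N′ M′} → r * (N * N′) ≡ q₂ * M′ → N′ * (N * r) ≡ q₂ * M′
        eq₂ {r} {q₂} {N} {N′} {M′} p = linear (+ 1 · p)
          (identityℤ (N′ ∷ N ∷ r ∷ q₂ ∷ M′ ∷ []) (λ N′ N r q₂ M′ → N′ ⊗ (N ⊗ r) ⊖ q₂ ⊗ M′ ⊜ # 1 ⊗ (r ⊗ (N ⊗ N′) ⊖ q₂ ⊗ M′)) refl)
      second : (∃ λ t → r ≡ t * + M′) → _
      second (t , refl) = t , eq₀ , cancelℤ (+-nonzero M′≢0) (lemma s′) , cancelℤ (+-nonzero M′≢0) (lemma p′)
        where
        eq₀ : t * + M′ * + M ≡ t * (+ M * + M′)
        eq₀ = identityℤ (t ∷ (+ M′) ∷ (+ M) ∷ []) (λ t u v → t ⊗ u ⊗ v ⊜ t ⊗ (v ⊗ u)) refl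
        lemma : ∀ {t S q M′} → t * M′ * S ≡ q * M′ → M′ * q ≡ M′ * (t * S)
        lemma {t} {S} {q} {M′} e = linear (- (+ 1) · e) (identityℤ (M′ ∷ q ∷ t ∷ S ∷ []) (λ M′ q t S → M′ ⊗ q ⊖ M′ ⊗ (t ⊗ S) ⊜ ⊝ # 1 ⊗ (t ⊗ M′ ⊗ S ⊖ q ⊗ M′)) refl)

  ∣∣-factor : ∀ {q t u : ℤ} → t ≢ + 0 → q ≡ t * u → ∣ u ∣ ≤ ∣ q ∣
  ∣∣-factor {_} {t} {u} t≢0 refl = ℕ.≤-trans (ℕ.m≤n*m ∣ u ∣ ∣ t ∣ {{ℕ.≢-nonZero (λ e → t≢0 (ℤ.∣i∣≡0⇒i≡0 e))}})
    (ℕ.≤-reflexive (sym (abs-* t u)))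

  private
    -- If `u` exceeded `2K`, then `v` would exceed `K`, and the product of the two would exceed
    -- `K²`.
    cross-term : ∀ {u v w K} → u ≤ v ℕ.+ K → u ℕ.* v ≤ K ℕ.* K → w ≡ u → w ≤ K ℕ.+ K
    cross-term {u} {v} {_} {K} u≤ uv≤ refl = ℕ.≮⇒≥ λ h →
      let K<v = ℕ.+-cancelʳ-< K K v (ℕ.<-≤-trans h u≤)
      in ℕ.<⇒≱ (ℕ.*-mono-< (ℕ.≤-<-trans (ℕ.m≤m+n K K) h) K<v) uv≤

  -- A Gelfond inequality for the product of the linear forms `M X - N` and `M′ X - N′`. For maxima
  -- of mixed type the middle coefficient controls the difference of the two cross terms, and the
  -- outer coefficients control their product.
  product-height : ∀ (N N′ : ℤ) (M M′ K : ℕ) → M ℕ.* M′ ≤ K → ∣ N * + M′ + N′ * + M ∣ ≤ K → ∣ N ∣ ℕ.* ∣ N′ ∣ ≤ K →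
    (∣ N ∣ ⊔ M) ℕ.* (∣ N′ ∣ ⊔ M′) ≤ K ℕ.+ K
  product-height N N′ M M′ K MM S NN with ℕ.⊔-sel ∣ N ∣ M | ℕ.⊔-sel ∣ N′ ∣ M′
  ... | inj₁ e | inj₁ e′ = subst₂ (λ u v → u ℕ.* v ≤ K ℕ.+ K) (sym e) (sym e′) (ℕ.≤-trans NN (ℕ.m≤m+n K K))
  ... | inj₂ e | inj₂ e′ = subst₂ (λ u v → u ℕ.* v ≤ K ℕ.+ K) (sym e) (sym e′) (ℕ.≤-trans MM (ℕ.m≤m+n K K))
  ... | inj₁ e | inj₂ e′ = subst₂ (λ u v → u ℕ.* v ≤ K ℕ.+ K) (sym e) (sym e′) (cross-term (triangle N N′ M M′ S) (mix NN MM) refl)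
    where
    triangle : ∀ N N′ M M′ → ∣ N * + M′ + N′ * + M ∣ ≤ K → ∣ N ∣ ℕ.* M′ ≤ ∣ N′ ∣ ℕ.* M ℕ.+ K
    triangle N N′ M M′ S = begin
      ∣ N ∣ ℕ.* M′                               ≡⟨ abs-* N (+ M′) ⟨
      ∣ N * + M′ ∣                               ≡⟨ cong ∣_∣ {N * + M′} {N * + M′ + N′ * + M + - (N′ * + M)}
        (identityℤ (N ∷ (+ M′) ∷ N′ ∷ (+ M) ∷ []) (λ N u N′ v → N ⊗ u ⊜ N ⊗ u ⊕ N′ ⊗ v ⊖ N′ ⊗ v) refl) ⟩
      ∣ N * + M′ + N′ * + M + - (N′ * + M) ∣     ≤⟨ abs-+ _ _ ⟩
      ∣ N * + M′ + N′ * + M ∣ ℕ.+ ∣ - (N′ * + M) ∣ ≤⟨ ℕ.+-monoˡ-≤ _ S ⟩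
      K ℕ.+ ∣ - (N′ * + M) ∣                     ≡⟨ cong (K ℕ.+_) (trans (abs-neg (N′ * + M)) (abs-* N′ (+ M))) ⟩
      K ℕ.+ ∣ N′ ∣ ℕ.* M                         ≡⟨ ℕ.+-comm K _ ⟩
      ∣ N′ ∣ ℕ.* M ℕ.+ K                         ∎
      where open ℕ.≤-Reasoning
    mix : ∣ N ∣ ℕ.* ∣ N′ ∣ ≤ K → M ℕ.* M′ ≤ K → ∣ N ∣ ℕ.* M′ ℕ.* (∣ N′ ∣ ℕ.* M) ≤ K ℕ.* K
    mix p q = ℕ.≤-trans (ℕ.≤-reflexive (rearrange (∣ N ∣) M′ (∣ N′ ∣) M)) (ℕ.*-mono-≤ p q)
      where
      rearrange : ∀ a b c d → a ℕ.* b ℕ.* (c ℕ.* d) ≡ a ℕ.* c ℕ.* (d ℕ.* b)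
      rearrange = solve-∀
  ... | inj₂ e | inj₁ e′ = subst (_≤ K ℕ.+ K) (ℕ.*-comm (∣ N′ ∣ ⊔ M′) (∣ N ∣ ⊔ M))
      (subst₂ (λ u v → u ℕ.* v ≤ K ℕ.+ K) (sym e′) (sym e) (cross-term (triangle N N′ M M′ S) (mix NN MM) refl))
    where
    triangle : ∀ N N′ M M′ → ∣ N * + M′ + N′ * + M ∣ ≤ K → ∣ N′ ∣ ℕ.* M ≤ ∣ N ∣ ℕ.* M′ ℕ.+ K
    triangle N N′ M M′ S = begin
      ∣ N′ ∣ ℕ.* M                               ≡⟨ abs-* N′ (+ M) ⟨
      ∣ N′ * + M ∣                               ≡⟨ cong ∣_∣ {N′ * + M} {N * + M′ + N′ * + M + - (N * + M′)}
        (identityℤ (N′ ∷ (+ M) ∷ N ∷ (+ M′) ∷ []) (λ N′ u N v → N′ ⊗ u ⊜ N ⊗ v ⊕ N′ ⊗ u ⊖ N ⊗ v) refl) ⟩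
      ∣ N * + M′ + N′ * + M + - (N * + M′) ∣     ≤⟨ abs-+ _ _ ⟩
      ∣ N * + M′ + N′ * + M ∣ ℕ.+ ∣ - (N * + M′) ∣ ≤⟨ ℕ.+-monoˡ-≤ _ S ⟩
      K ℕ.+ ∣ - (N * + M′) ∣                     ≡⟨ cong (K ℕ.+_) (trans (abs-neg (N * + M′)) (abs-* N (+ M′))) ⟩
      K ℕ.+ ∣ N ∣ ℕ.* M′                         ≡⟨ ℕ.+-comm K _ ⟩
      ∣ N ∣ ℕ.* M′ ℕ.+ K                         ∎
      where open ℕ.≤-Reasoning
    mix : ∣ N ∣ ℕ.* ∣ N′ ∣ ≤ K → M ℕ.* M′ ≤ K → ∣ N′ ∣ ℕ.* M ℕ.* (∣ N ∣ ℕ.* M′) ≤ K ℕ.* K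
    mix p q = ℕ.≤-trans (ℕ.≤-reflexive (rearrange (∣ N′ ∣) M (∣ N ∣) M′)) (ℕ.*-mono-≤ p q)
      where
      rearrange : ∀ a b c d → a ℕ.* b ℕ.* (c ℕ.* d) ≡ c ℕ.* a ℕ.* (b ℕ.* d)
      rearrange = solve-∀

  -- Degrees in (n₁, m₁) and (n₂, m₂).
  deg₁ deg₂ : Expr → ℕ
  deg₁ (indet 2) = 1
  deg₁ (indet 3) = 1
  deg₁ (indet _) = 0
  deg₁ (const _) = 0
  deg₁ (e ⊕ f) = deg₁ e ⊔ deg₁ f
  deg₁ (e ⊗ f) = deg₁ e ℕ.+ deg₁ f
  deg₁ (⊝ e) = deg₁ e
  deg₂ (indet 4) = 1
  deg₂ (indet 5) = 1
  deg₂ (indet _) = 0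
  deg₂ (const _) = 0
  deg₂ (e ⊕ f) = deg₂ e ⊔ deg₂ f
  deg₂ (e ⊗ f) = deg₂ e ℕ.+ deg₂ f
  deg₂ (⊝ e) = deg₂ e

  coprime-* : ∀ {i j k} → Coprime i k → Coprime j k → Coprime (i ℕ.* j) k
  coprime-* {i} c c′ {d} (d∣ij , d∣k) = c′ (coprime-divisor (λ (e∣d , e∣i) → c (e∣i , ℕ∣.∣-trans e∣d d∣k)) d∣ij , d∣k)

  private
    𝐧 𝐦 : Expr
    𝐧 = 𝐧₁
    𝐦 = 𝐦₁

    -- F₁ F - G₁ G = 4 Δ m⁷ and F₂ F + G₂ G = 4 Δ n⁷ with Δ = 4 a³ + 27 b².
    F₁ G₁ F₂ G₂ : Expr
    F₁ = # 12 ⊗ 𝐧 ⊗ 𝐧 ⊗ 𝐦 ⊕ # 16 ⊗ 𝐚 ⊗ 𝐦 ⊗ 𝐦 ⊗ 𝐦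
    G₁ = # 3 ⊗ 𝐧 ⊗ 𝐧 ⊗ 𝐧 ⊖ # 5 ⊗ 𝐚 ⊗ 𝐧 ⊗ 𝐦 ⊗ 𝐦 ⊖ # 27 ⊗ 𝐛 ⊗ 𝐦 ⊗ 𝐦 ⊗ 𝐦
    F₂ = # 4 ⊗ (# 4 ⊗ (𝐚 ⊗ 𝐚 ⊗ 𝐚) ⊕ # 27 ⊗ (𝐛 ⊗ 𝐛)) ⊗ 𝐧 ⊗ 𝐧 ⊗ 𝐧 ⊖ # 4 ⊗ 𝐚 ⊗ 𝐚 ⊗ 𝐛 ⊗ 𝐧 ⊗ 𝐧 ⊗ 𝐦
         ⊕ # 4 ⊗ 𝐚 ⊗ (# 3 ⊗ 𝐚 ⊗ 𝐚 ⊗ 𝐚 ⊕ # 22 ⊗ 𝐛 ⊗ 𝐛) ⊗ 𝐧 ⊗ 𝐦 ⊗ 𝐦 ⊕ # 12 ⊗ 𝐛 ⊗ (𝐚 ⊗ 𝐚 ⊗ 𝐚 ⊕ # 8 ⊗ 𝐛 ⊗ 𝐛) ⊗ 𝐦 ⊗ 𝐦 ⊗ 𝐦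
    G₂ = 𝐚 ⊗ 𝐚 ⊗ 𝐛 ⊗ 𝐧 ⊗ 𝐧 ⊗ 𝐧 ⊕ 𝐚 ⊗ (# 5 ⊗ 𝐚 ⊗ 𝐚 ⊗ 𝐚 ⊕ # 32 ⊗ 𝐛 ⊗ 𝐛) ⊗ 𝐧 ⊗ 𝐧 ⊗ 𝐦
         ⊕ # 2 ⊗ 𝐛 ⊗ (# 13 ⊗ 𝐚 ⊗ 𝐚 ⊗ 𝐚 ⊕ # 96 ⊗ 𝐛 ⊗ 𝐛) ⊗ 𝐧 ⊗ 𝐦 ⊗ 𝐦 ⊖ # 3 ⊗ 𝐚 ⊗ 𝐚 ⊗ (𝐚 ⊗ 𝐚 ⊗ 𝐚 ⊕ # 8 ⊗ 𝐛 ⊗ 𝐛) ⊗ 𝐦 ⊗ 𝐦 ⊗ 𝐦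

    Δ⁴ : Expr
    Δ⁴ = # 4 ⊗ (# 4 ⊗ (𝐚 ⊗ 𝐚 ⊗ 𝐚) ⊕ # 27 ⊗ (𝐛 ⊗ 𝐛))

    resultant₁ : ∀ ρ → Semℤ.eval (F₁ ⊗ F ⊖ G₁ ⊗ G) ρ ≡ Semℤ.eval (Δ⁴ ⊗ (𝐦 ⊗ (𝐦 ⊗ (𝐦 ⊗ (𝐦 ⊗ (𝐦 ⊗ (𝐦 ⊗ 𝐦))))))) ρ
    resultant₁ ρ = Semℤ.identity ρ (F₁ ⊗ F ⊖ G₁ ⊗ G) (Δ⁴ ⊗ (𝐦 ⊗ (𝐦 ⊗ (𝐦 ⊗ (𝐦 ⊗ (𝐦 ⊗ (𝐦 ⊗ 𝐦))))))) refl

    resultant₂ : ∀ ρ → Semℤ.eval (F₂ ⊗ F ⊕ G₂ ⊗ G) ρ ≡ Semℤ.eval (Δ⁴ ⊗ (𝐧 ⊗ (𝐧 ⊗ (𝐧 ⊗ (𝐧 ⊗ (𝐧 ⊗ (𝐧 ⊗ 𝐧))))))) ρ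
    resultant₂ ρ = Semℤ.identity ρ (F₂ ⊗ F ⊕ G₂ ⊗ G) (Δ⁴ ⊗ (𝐧 ⊗ (𝐧 ⊗ (𝐧 ⊗ (𝐧 ⊗ (𝐧 ⊗ (𝐧 ⊗ 𝐧))))))) refl

    seventh : ℕ → ℕ
    seventh n = n ℕ.* (n ℕ.* (n ℕ.* (n ℕ.* (n ℕ.* (n ℕ.* n)))))

    coprime-seventh : ∀ {m n} → Coprime m n → Coprime (seventh m) (seventh n)
    coprime-seventh {m} {n} c = Coprime.sym (power (Coprime.sym (power c)))
      where
      power : ∀ {i j} → Coprime i j → Coprime (seventh i) j
      power {i} {j} c = coprime-* {i} c (coprime-* {i} c (coprime-* {i} c (coprime-* {i} c (coprime-* {i} c (coprime-* {i} c c)))))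

    abs-seventh : ∀ i → ∣ i * (i * (i * (i * (i * (i * i))))) ∣ ≡ seventh (∣ i ∣)
    abs-seventh i = step (step (step (step (step (abs-* i i)))))
      where
      step : ∀ {j k} → ∣ j ∣ ≡ k → ∣ i * j ∣ ≡ ∣ i ∣ ℕ.* k
      step {j} e = trans (abs-* i j) (cong (∣ i ∣ ℕ.*_) e)

    -- Terms of lower degree are absorbed since `h` and `k` are at least 1; what remains is the
    -- value at 1, which depends on the curve alone.
    majorant-scale : ∀ {A B h k} → 1 ≤ h → 1 ≤ k → ∀ e →
      majorant e (A ∷ B ∷ h ∷ h ∷ k ∷ k ∷ []) ≤ majorant e (A ∷ B ∷ 1 ∷ 1 ∷ 1 ∷ 1 ∷ []) ℕ.* (h ℕ.^ deg₁ e ℕ.* k ℕ.^ deg₂ e)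
    majorant-scale _ _ (indet 0) = ℕ.≤-reflexive (sym (ℕ.*-identityʳ _))
    majorant-scale _ _ (indet 1) = ℕ.≤-reflexive (sym (ℕ.*-identityʳ _))
    majorant-scale {h = h} _ _ (indet 2) = ℕ.≤-reflexive (lemma h)
      where
      lemma : ∀ h → h ≡ h ℕ.* 1 ℕ.* 1 ℕ.+ 0
      lemma = solve-∀
    majorant-scale {h = h} _ _ (indet 3) = ℕ.≤-reflexive (lemma h)
      where
      lemma : ∀ h → h ≡ h ℕ.* 1 ℕ.* 1 ℕ.+ 0
      lemma = solve-∀
    majorant-scale {k = k} _ _ (indet 4) = ℕ.≤-reflexive (lemma k)
      where
      lemma : ∀ h → h ≡ h ℕ.* 1 ℕ.+ 0 ℕ.+ 0
      lemma = solve-∀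
    majorant-scale {k = k} _ _ (indet 5) = ℕ.≤-reflexive (lemma k)
      where
      lemma : ∀ h → h ≡ h ℕ.* 1 ℕ.+ 0 ℕ.+ 0
      lemma = solve-∀
    majorant-scale _ _ (indet (suc (suc (suc (suc (suc (suc _))))))) = ℕ.≤-refl
    majorant-scale _ _ (const c) = ℕ.≤-reflexive (sym (ℕ.*-identityʳ _))
    majorant-scale {A} {B} {h@(suc _)} {k@(suc _)} 1≤h 1≤k (e ⊕ f) = begin
      majorant e ρ ℕ.+ majorant f ρ                      ≤⟨ ℕ.+-mono-≤ (majorant-scale 1≤h 1≤k e) (majorant-scale 1≤h 1≤k f) ⟩
      u ℕ.* s e ℕ.+ v ℕ.* s f                            ≤⟨ ℕ.+-mono-≤ (ℕ.*-monoʳ-≤ u s≤) (ℕ.*-monoʳ-≤ v s≤′) ⟩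
      u ℕ.* s (e ⊕ f) ℕ.+ v ℕ.* s (e ⊕ f)                ≡⟨ ℕ.*-distribʳ-+ (s (e ⊕ f)) u v ⟨
      (u ℕ.+ v) ℕ.* s (e ⊕ f)                            ∎
      where
      open ℕ.≤-Reasoning
      ρ : List ℕ
      ρ = A ∷ B ∷ h ∷ h ∷ k ∷ k ∷ []
      s : Expr → ℕ
      s e = h ℕ.^ deg₁ e ℕ.* k ℕ.^ deg₂ e
      u v : ℕ
      u = majorant e (A ∷ B ∷ 1 ∷ 1 ∷ 1 ∷ 1 ∷ [])
      v = majorant f (A ∷ B ∷ 1 ∷ 1 ∷ 1 ∷ 1 ∷ [])
      s≤ : s e ≤ s (e ⊕ f)
      s≤ = ℕ.*-mono-≤ (ℕ.^-monoʳ-≤ h (ℕ.m≤m⊔n (deg₁ e) (deg₁ f))) (ℕ.^-monoʳ-≤ k (ℕ.m≤m⊔n (deg₂ e) (deg₂ f)))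
      s≤′ : s f ≤ s (e ⊕ f)
      s≤′ = ℕ.*-mono-≤ (ℕ.^-monoʳ-≤ h (ℕ.m≤n⊔m (deg₁ e) (deg₁ f))) (ℕ.^-monoʳ-≤ k (ℕ.m≤n⊔m (deg₂ e) (deg₂ f)))
    majorant-scale {A} {B} {h} {k} 1≤h 1≤k (e ⊗ f) = ℕ.≤-trans
      (ℕ.*-mono-≤ (majorant-scale 1≤h 1≤k e) (majorant-scale 1≤h 1≤k f))
      (ℕ.≤-reflexive (trans (rearrange (majorant e ρ) (h ℕ.^ deg₁ e) (k ℕ.^ deg₂ e) (majorant f ρ) (h ℕ.^ deg₁ f) (k ℕ.^ deg₂ f))
        (cong (majorant e ρ ℕ.* majorant f ρ ℕ.*_) (cong₂ ℕ._*_ (sym (ℕ.^-distribˡ-+-* h (deg₁ e) (deg₁ f))) (sym (ℕ.^-distribˡ-+-* k (deg₂ e) (deg₂ f)))))))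
      where
      ρ : List ℕ
      ρ = A ∷ B ∷ 1 ∷ 1 ∷ 1 ∷ 1 ∷ []
      rearrange : ∀ u a b v c d → u ℕ.* (a ℕ.* b) ℕ.* (v ℕ.* (c ℕ.* d)) ≡ u ℕ.* v ℕ.* (a ℕ.* c ℕ.* (b ℕ.* d))
      rearrange = solve-∀
    majorant-scale 1≤h 1≤k (⊝ e) = majorant-scale 1≤h 1≤k e

  module Bounds (E : Curve) where

    private
      A B : ℕ
      A = ∣ a E ∣
      B = ∣ b E ∣

    -- Includes the factor 4 of the resultant identities.
    Δ : ℤ
    Δ = Semℤ.eval Δ⁴ (a E ∷ b E ∷ [])

    opaque
      unfolding _+_ _*_

      discriminant : + 4 * (a E * a E * a E) + + 27 * (b E * b E) ≢ + 0
      discriminant = nonsingular E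

    Δ≢0 : Δ ≢ + 0
    Δ≢0 e = discriminant (cancelℤ {+ 4} (λ ()) (trans e (sym (*-zeroʳ (+ 4)))))

    opaque
      norm : Expr → ℕ
      norm e = majorant e (A ∷ B ∷ 1 ∷ 1 ∷ 1 ∷ 1 ∷ [])

      eval-bound : ∀ e {n₁ m₁ n₂ m₂ : ℤ} {α β} → 1 ≤ α → 1 ≤ β → ∣ n₁ ∣ ≤ α → ∣ m₁ ∣ ≤ α → ∣ n₂ ∣ ≤ β → ∣ m₂ ∣ ≤ β →
        ∣ Semℤ.eval e (a E ∷ b E ∷ n₁ ∷ m₁ ∷ n₂ ∷ m₂ ∷ []) ∣ ≤ norm e ℕ.* (α ℕ.^ deg₁ e ℕ.* β ℕ.^ deg₂ e)
      eval-bound e 1≤α 1≤β h₁ h₂ h₃ h₄ = ℕ.≤-trans (eval≤majorant e (ℕ.≤-refl ∷ ℕ.≤-refl ∷ h₁ ∷ h₂ ∷ h₃ ∷ h₄ ∷ [])) (majorant-scale 1≤α 1≤β e)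

    H-bound : ∀ e x₁ x₂ → ∣ Semℤ.eval e (coordinates E x₁ x₂) ∣ ≤ norm e ℕ.* (H x₁ ℕ.^ deg₁ e ℕ.* H x₂ ℕ.^ deg₂ e)
    H-bound e x₁ x₂ = eval-bound e (1≤H x₁) (1≤H x₂) (ℕ.m≤m⊔n _ _) (ℕ.m≤n⊔m _ _) (ℕ.m≤m⊔n _ _) (ℕ.m≤n⊔m _ _)

    κ : ℕ
    κ = norm Q₀ ℕ.+ norm Q₁ ℕ.+ norm Q₂

    Q₀≢0 : ∀ {x₁ x₂} → x₁ ≢ x₂ → Semℤ.eval Q₀ (coordinates E x₁ x₂) ≢ + 0
    Q₀≢0 {x₁} {x₂} x≢ e = x≢ (ℚ.≃⇒≡ (ℚ.*≡* (trans (*-def (↥ x₁) (↧ x₂)) (trans (i-j≡0⇒i≡j (↥ x₁ * ↧ x₂) (↥ x₂ * ↧ x₁) zero²) (sym (*-def (↥ x₂) (↧ x₁)))))))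
      where
      zero² : ↥ x₁ * ↧ x₂ - ↥ x₂ * ↧ x₁ ≡ + 0
      zero² = Sum.[ (λ h → h) , (λ h → h) ]′ (*-zero-splitℤ (↥ x₁ * ↧ x₂ - ↥ x₂ * ↧ x₁) e)

    -- By `content` the quadratic `Q₀ X² - Q₁ X + Q₂` is a nonzero integral multiple of the product
    -- of the linear forms of the two abscissae, so its coefficients dominate those of the product.
    sum-difference-height : ∀ {x₁ x₂ X X′} → x₁ ≢ x₂ → SumDifference E x₁ x₂ X X′ →
      H X ℕ.* H X′ ≤ 2 ℕ.* κ ℕ.* (H x₁ ℕ.^ 2 ℕ.* H x₂ ℕ.^ 2)
    sum-difference-height {x₁} {x₂} {X} {X′} x≢ (s , p) =
      bound (content {q₀} {q₁} {q₂} {↥ X} {↥ X′} {↧ₙ X} {↧ₙ X′} (λ ()) (λ ()) (↥↧-coprime X) (↥↧-coprime X′) s p)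
      where
      q₀ q₁ q₂ : ℤ
      q₀ = Semℤ.eval Q₀ (coordinates E x₁ x₂)
      q₁ = Semℤ.eval Q₁ (coordinates E x₁ x₂)
      q₂ = Semℤ.eval Q₂ (coordinates E x₁ x₂)
      K : ℕ
      K = κ ℕ.* (H x₁ ℕ.^ 2 ℕ.* H x₂ ℕ.^ 2)
      double-K : K ℕ.+ K ≡ 2 ℕ.* κ ℕ.* (H x₁ ℕ.^ 2 ℕ.* H x₂ ℕ.^ 2)
      double-K = lemma κ (H x₁ ℕ.^ 2 ℕ.* H x₂ ℕ.^ 2)
        where
        lemma : ∀ u v → u ℕ.* v ℕ.+ u ℕ.* v ≡ 2 ℕ.* u ℕ.* v
        lemma = solve-∀
      bound : (∃ λ t → q₀ ≡ t * (↧ X * ↧ X′) × q₁ ≡ t * (↥ X * ↧ X′ + ↥ X′ * ↧ X) × q₂ ≡ t * (↥ X * ↥ X′)) →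
        H X ℕ.* H X′ ≤ 2 ℕ.* κ ℕ.* (H x₁ ℕ.^ 2 ℕ.* H x₂ ℕ.^ 2)
      bound (t , e₀ , e₁ , e₂) = ℕ.≤-trans (product-height (↥ X) (↥ X′) (↧ₙ X) (↧ₙ X′) K
          (ℕ.≤-trans (ℕ.≤-reflexive (sym (abs-* (↧ X) (↧ X′)))) (coefficient e₀ (H-bound Q₀ x₁ x₂) (ℕ.≤-trans (ℕ.m≤m+n (norm Q₀) (norm Q₁)) (ℕ.m≤m+n _ (norm Q₂)))))
          (coefficient e₁ (H-bound Q₁ x₁ x₂) (ℕ.≤-trans (ℕ.m≤n+m (norm Q₁) (norm Q₀)) (ℕ.m≤m+n _ (norm Q₂))))
          (ℕ.≤-trans (ℕ.≤-reflexive (sym (abs-* (↥ X) (↥ X′)))) (coefficient e₂ (H-bound Q₂ x₁ x₂) (ℕ.m≤n+m (norm Q₂) (norm Q₀ ℕ.+ norm Q₁)))))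
          (ℕ.≤-reflexive double-K)
        where
        zero-* : ∀ {u v : ℤ} → + 0 * (u * v) ≡ + 0
        zero-* {u} {v} = identityℤ (u ∷ v ∷ []) (λ u v → # 0 ⊗ (u ⊗ v) ⊜ # 0) refl
        t≢0 : t ≢ + 0
        t≢0 refl = Q₀≢0 x≢ (trans e₀ (zero-* {↧ X} {↧ X′}))
        coefficient : ∀ {q u : ℤ} {c} → q ≡ t * u → ∣ q ∣ ≤ c ℕ.* (H x₁ ℕ.^ 2 ℕ.* H x₂ ℕ.^ 2) → c ≤ κ → ∣ u ∣ ≤ K
        coefficient e h c≤κ = ℕ.≤-trans (∣∣-factor t≢0 e) (ℕ.≤-trans h (ℕ.*-monoˡ-≤ _ c≤κ))

    -- The abscissa of the double is `N : M` in lowest terms, and `g` is what cancels from `F : G`.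
    -- The point `O` is `1 : 0`, in accordance with its height 1.
    record Doubled (x : ℚ) (R : Pt) : Set where
      field
        g N : ℤ
        M : ℕ
        F= : Semℤ.eval F (coordinates E x x) ≡ g * N
        G= : Semℤ.eval G (coordinates E x x) ≡ g * + M
        height= : height R ≡ ∣ N ∣ ⊔ M

    doubled : ∀ {x y} → OnCurve E (aff x y) → Doubled x (add E (aff x y) (aff x y))
    doubled {x} {y} h = by (double E {x} {y} h)
      where
      f g : ℤ
      f = Semℤ.eval F (coordinates E x x)
      g = Semℤ.eval G (coordinates E x x)
      times-1 : ∀ f → f ≡ f * + 1
      times-1 f = identityℤ (f ∷ []) (λ f → f ⊜ f ⊗ # 1) refl
      by : (add E (aff x y) (aff x y) ≡ O × g ≡ + 0) ⊎ (∃₂ λ X Y → add E (aff x y) (aff x y) ≡ aff X Y × ↧ X * f ≡ ↥ X * g) →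
        Doubled x (add E (aff x y) (aff x y))
      by (inj₁ (e , g≡0)) = record { g = f ; N = + 1 ; M = 0 ; F= = times-1 f ; G= = trans g≡0 (sym (*-zeroʳ f)) ; height= = cong height e }
      by (inj₂ (X , _ , e , eq)) = split (∣-split M∣g)
        where
        M∣g : ↧ₙ X ∣ℤ g
        M∣g = coprime-divisor (Coprime.sym (↥↧-coprime X)) (∣*∣ (↥ X) g (∣-intro f (trans (sym eq) (*-comm (↧ X) f))))
        split : (∃ λ t → g ≡ t * ↧ X) → Doubled x (add E (aff x y) (aff x y))
        split (t , g=) = record { g = t ; N = ↥ X ; M = ↧ₙ X ; F= = cancelℤ {↧ X} (λ ()) (lemma eq g=) ; G= = g= ; height= = cong height e }
          where
          lemma : ∀ {M f N g t} → M * f ≡ N * g → g ≡ t * M → M * f ≡ M * (t * N)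
          lemma {M} {f} {N} {g} {t} e g= = linear (+ 1 · e ⊞ N · g=)
            (identityℤ (M ∷ f ∷ t ∷ N ∷ g ∷ []) (λ M f t N g → M ⊗ f ⊖ M ⊗ (t ⊗ N) ⊜ # 1 ⊗ (M ⊗ f ⊖ N ⊗ g) ⊕ N ⊗ (g ⊖ t ⊗ M)) refl)

    c₂ : ℕ
    c₂ = norm F₁ ℕ.+ norm G₁ ℕ.+ (norm F₂ ℕ.+ norm G₂)

    module Duplication {x y} (h : OnCurve E (aff x y)) where

      private
        open Doubled (doubled {x} {y} h)
        ρ : List ℤ
        ρ = coordinates E x x
        H₂ : ℕ
        H₂ = ∣ N ∣ ⊔ M
        n m : ℤ
        n = ↥ x
        m = ↧ x

        factor : ∀ {s g N M f₁ g₁ f g′ D : ℤ} → f ≡ g * N → g′ ≡ g * M → f₁ * f + s * (g₁ * g′) ≡ D → g * (f₁ * N + s * (g₁ * M)) ≡ D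
        factor {s} {g} {N} {M} {f₁} {g₁} {f} {g′} {D} e e′ r = linear (+ 1 · r ⊞ (- f₁) · e ⊞ (- (s * g₁)) · e′)
          (identityℤ (g ∷ f₁ ∷ N ∷ s ∷ g₁ ∷ M ∷ D ∷ f ∷ g′ ∷ []) (λ g f₁ N s g₁ M D f g′ →
              g ⊗ (f₁ ⊗ N ⊕ s ⊗ (g₁ ⊗ M)) ⊖ D
              ⊜ # 1 ⊗ (f₁ ⊗ f ⊕ s ⊗ (g₁ ⊗ g′) ⊖ D) ⊕ ⊝ f₁ ⊗ (f ⊖ g ⊗ N) ⊕ ⊝ (s ⊗ g₁) ⊗ (g′ ⊖ g ⊗ M)) refl)

        minus : ∀ {u v D : ℤ} → u - v ≡ D → u + (- (+ 1)) * v ≡ D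
        minus {u} {v} {D} e = linear (+ 1 · e) (identityℤ (u ∷ v ∷ D ∷ []) (λ u v D → u ⊕ ⊝ # 1 ⊗ v ⊖ D ⊜ # 1 ⊗ (u ⊖ v ⊖ D)) refl)
        plus : ∀ {u v D : ℤ} → u + v ≡ D → u + + 1 * v ≡ D
        plus {u} {v} {D} e = linear (+ 1 · e) (identityℤ (u ∷ v ∷ D ∷ []) (λ u v D → u ⊕ # 1 ⊗ v ⊖ D ⊜ # 1 ⊗ (u ⊕ v ⊖ D)) refl)

        f₁ g₁ f₂ g₂ r₁ r₂ n⁷ m⁷ : ℤ
        f₁ = Semℤ.eval F₁ ρ
        g₁ = Semℤ.eval G₁ ρ
        f₂ = Semℤ.eval F₂ ρ
        g₂ = Semℤ.eval G₂ ρ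
        r₁ = f₁ * N + (- (+ 1)) * (g₁ * + M)
        r₂ = f₂ * N + + 1 * (g₂ * + M)
        n⁷ = n * (n * (n * (n * (n * (n * n)))))
        m⁷ = m * (m * (m * (m * (m * (m * m)))))

        res₁ : g * r₁ ≡ Δ * m⁷
        res₁ = factor {s = - (+ 1)} F= G= (minus (resultant₁ ρ))
        res₂ : g * r₂ ≡ Δ * n⁷
        res₂ = factor {s = + 1} F= G= (plus (resultant₂ ρ))

        abs-res : ∀ {r z : ℤ} → g * r ≡ Δ * (z * (z * (z * (z * (z * (z * z)))))) → ∣ g ∣ ℕ.* ∣ r ∣ ≡ ∣ Δ ∣ ℕ.* seventh (∣ z ∣)
        abs-res {r} {z} e = trans (sym (abs-* g r)) (trans (cong ∣_∣ e) (trans (abs-* Δ _) (cong (∣ Δ ∣ ℕ.*_) (abs-seventh z))))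

        ∣Δ∣≢0 : ∣ Δ ∣ ≢ 0
        ∣Δ∣≢0 e = Δ≢0 (ℤ.∣i∣≡0⇒i≡0 e)

        g≢0 : g ≢ + 0
        g≢0 e = m*n≢0 (trans (sym (abs-res {r₁} {m} res₁)) (cong (ℕ._* ∣ r₁ ∣) (cong ∣_∣ e)))
          where
          m*n≢0 : ∣ Δ ∣ ℕ.* seventh (∣ m ∣) ≢ 0
          m*n≢0 e = Sum.[ ∣Δ∣≢0 , (λ ()) ]′ (ℕ.m*n≡0⇒m≡0∨n≡0 ∣ Δ ∣ e)

        -- `g` divides `Δ n⁷` and `Δ m⁷`, and `n`, `m` are coprime: the cancellation in duplication
        -- is bounded by the discriminant.
        g∣Δ : (∣ g ∣) ∣ (∣ Δ ∣)
        g∣Δ = coprime-factors (coprime-seventh (↥↧-coprime x)) (divides′ {r₂} {n} res₂ , divides′ {r₁} {m} res₁)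
          where
          divides′ : ∀ {r z : ℤ} → g * r ≡ Δ * (z * (z * (z * (z * (z * (z * z)))))) → (∣ g ∣) ∣ (seventh (∣ z ∣) ℕ.* (∣ Δ ∣))
          divides′ {r} {z} e = divides (∣ r ∣) (trans (ℕ.*-comm (seventh (∣ z ∣)) (∣ Δ ∣)) (trans (sym (abs-res {r} {z} e)) (ℕ.*-comm (∣ g ∣) (∣ r ∣))))

        g≤Δ : ∣ g ∣ ≤ ∣ Δ ∣
        g≤Δ = ℕ∣.∣⇒≤ {{ℕ.≢-nonZero ∣Δ∣≢0}} g∣Δ

      private
        -- Serves both resultant identities, `s` being the sign of the term with `G`. The bound on
        -- `g` lets `Δ` cancel from the two sides.
        seventh≤ : ∀ e f (s : ℤ) {z : ℤ} → ∣ s ∣ ≡ 1 → deg₁ e ≡ 3 → deg₂ e ≡ 0 → deg₁ f ≡ 3 → deg₂ f ≡ 0 → norm e ℕ.+ norm f ≤ c₂ →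
          g * (Semℤ.eval e ρ * N + s * (Semℤ.eval f ρ * + M)) ≡ Δ * (z * (z * (z * (z * (z * (z * z)))))) →
          seventh (∣ z ∣) ≤ c₂ ℕ.* (H x ℕ.^ 3 ℕ.* H₂)
        seventh≤ e f s {z} s=1 d₁ d₂ d₃ d₄ c≤ eq = ℕ.*-cancelˡ-≤ ∣ Δ ∣ {{ℕ.≢-nonZero ∣Δ∣≢0}} (begin
          ∣ Δ ∣ ℕ.* seventh (∣ z ∣)                   ≡⟨ abs-res {r} {z} eq ⟨
          ∣ g ∣ ℕ.* ∣ r ∣                           ≤⟨ ℕ.*-mono-≤ g≤Δ r≤ ⟩
          ∣ Δ ∣ ℕ.* (c₂ ℕ.* (H x ℕ.^ 3 ℕ.* H₂))     ∎)
          where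
          open ℕ.≤-Reasoning
          u v r : ℤ
          u = Semℤ.eval e ρ
          v = Semℤ.eval f ρ
          r = u * N + s * (v * + M)
          cube : ∀ e → deg₁ e ≡ 3 → deg₂ e ≡ 0 → ∣ Semℤ.eval e ρ ∣ ≤ norm e ℕ.* (H x ℕ.^ 3)
          cube e p q = subst₂ (λ i j → ∣ Semℤ.eval e ρ ∣ ≤ norm e ℕ.* (H x ℕ.^ i ℕ.* H x ℕ.^ j)) p q (H-bound e x x) ⟨≤⟩ ℕ.≤-reflexive (cong (norm e ℕ.*_) (ℕ.*-identityʳ _))
            where
            _⟨≤⟩_ : ∀ {i j k} → i ≤ j → j ≤ k → i ≤ k
            _⟨≤⟩_ = ℕ.≤-trans
          r≤ : ∣ r ∣ ≤ c₂ ℕ.* (H x ℕ.^ 3 ℕ.* H₂)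
          r≤ = begin
            ∣ r ∣                                                 ≤⟨ abs-+ (u * N) (s * (v * + M)) ⟩
            ∣ u * N ∣ ℕ.+ ∣ s * (v * + M) ∣                       ≡⟨ cong₂ ℕ._+_ (abs-* u N) (trans (abs-* s _) (trans (cong (ℕ._* ∣ v * + M ∣) s=1) (trans (ℕ.*-identityˡ _) (abs-* v (+ M))))) ⟩
            ∣ u ∣ ℕ.* ∣ N ∣ ℕ.+ ∣ v ∣ ℕ.* M                       ≤⟨ ℕ.+-mono-≤ (ℕ.*-mono-≤ (cube e d₁ d₂) (ℕ.m≤m⊔n ∣ N ∣ M)) (ℕ.*-mono-≤ (cube f d₃ d₄) (ℕ.m≤n⊔m ∣ N ∣ M)) ⟩
            norm e ℕ.* H x ℕ.^ 3 ℕ.* H₂ ℕ.+ norm f ℕ.* H x ℕ.^ 3 ℕ.* H₂ ≡⟨ collect (norm e) (norm f) (H x ℕ.^ 3) H₂ ⟩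
            (norm e ℕ.+ norm f) ℕ.* (H x ℕ.^ 3 ℕ.* H₂)            ≤⟨ ℕ.*-monoˡ-≤ _ c≤ ⟩
            c₂ ℕ.* (H x ℕ.^ 3 ℕ.* H₂)                             ∎
            where
            collect : ∀ a b c d → a ℕ.* c ℕ.* d ℕ.+ b ℕ.* c ℕ.* d ≡ (a ℕ.+ b) ℕ.* (c ℕ.* d)
            collect = solve-∀

        seventh-H : seventh (H x) ≤ c₂ ℕ.* (H x ℕ.^ 3 ℕ.* H₂)
        seventh-H = Sum.[ (λ e → subst (λ z → seventh z ≤ c₂ ℕ.* (H x ℕ.^ 3 ℕ.* H₂)) (sym e) (seventh≤ F₂ G₂ (+ 1) {n} refl refl refl refl refl (ℕ.m≤n+m _ (norm F₁ ℕ.+ norm G₁)) res₂))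
                        , (λ e → subst (λ z → seventh z ≤ c₂ ℕ.* (H x ℕ.^ 3 ℕ.* H₂)) (sym e) (seventh≤ F₁ G₁ (- (+ 1)) {m} (abs-neg (+ 1)) refl refl refl refl (ℕ.m≤m+n _ _) res₁)) ]′
                        (ℕ.⊔-sel ∣ n ∣ (↧ₙ x))

      lower : H x ℕ.^ 4 ≤ c₂ ℕ.* height (add E (aff x y) (aff x y))
      lower = ℕ.*-cancelˡ-≤ (H x ℕ.^ 3) {{ℕ.>-nonZero (ℕ.m^n>0 (H x) {{ℕ.>-nonZero (1≤H x)}} 3)}} (begin
        H x ℕ.^ 3 ℕ.* H x ℕ.^ 4        ≡⟨ power (H x) ⟩
        seventh (H x)                  ≤⟨ seventh-H ⟩
        c₂ ℕ.* (H x ℕ.^ 3 ℕ.* H₂)      ≡⟨ swap c₂ (H x ℕ.^ 3) H₂ ⟩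
        H x ℕ.^ 3 ℕ.* (c₂ ℕ.* H₂)      ≡⟨ cong (λ u → H x ℕ.^ 3 ℕ.* (c₂ ℕ.* u)) height= ⟨
        H x ℕ.^ 3 ℕ.* (c₂ ℕ.* height (add E (aff x y) (aff x y))) ∎)
        where
        open ℕ.≤-Reasoning
        power : ∀ h → h ℕ.* (h ℕ.* (h ℕ.* 1)) ℕ.* (h ℕ.* (h ℕ.* (h ℕ.* (h ℕ.* 1)))) ≡ h ℕ.* (h ℕ.* (h ℕ.* (h ℕ.* (h ℕ.* (h ℕ.* h)))))
        power = solve-∀
        swap : ∀ a b c → a ℕ.* (b ℕ.* c) ≡ b ℕ.* (a ℕ.* c)
        swap = solve-∀

      upper : height (add E (aff x y) (aff x y)) ≤ (norm F ℕ.+ norm G) ℕ.* H x ℕ.^ 4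
      upper = subst (_≤ (norm F ℕ.+ norm G) ℕ.* H x ℕ.^ 4) (sym height=) (ℕ.⊔-lub
        (bound F N F= refl refl (ℕ.m≤m+n (norm F) (norm G))) (bound G (+ M) G= refl refl (ℕ.m≤n+m (norm G) (norm F))))
        where
        bound : ∀ e u → Semℤ.eval e ρ ≡ g * u → deg₁ e ≡ 4 → deg₂ e ≡ 0 → norm e ≤ norm F ℕ.+ norm G → ∣ u ∣ ≤ (norm F ℕ.+ norm G) ℕ.* H x ℕ.^ 4
        bound e u eq p q c≤ = ℕ.≤-trans (∣∣-factor g≢0 eq) (ℕ.≤-trans
          (subst₂ (λ i j → ∣ Semℤ.eval e ρ ∣ ≤ norm e ℕ.* (H x ℕ.^ i ℕ.* H x ℕ.^ j)) p q (H-bound e x x))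
          (ℕ.≤-trans (ℕ.≤-reflexive (cong (norm e ℕ.*_) (ℕ.*-identityʳ (H x ℕ.^ 4)))) (ℕ.*-monoˡ-≤ (H x ℕ.^ 4) c≤)))

-- Repulsion of points at the archimedean place

module Archimedean where

  open import Defs
  open RingIdentity
  open Integers
  open GroupLaw
  open AdditionFormulas
  open Denominators
  open Heights
  open import Data.Nat as ℕ using (ℕ; zero; suc; _≤_; z≤n; s≤s)
  import Data.Nat.Properties as ℕ
  open import Data.Nat.Tactic.RingSolver using (solve-∀)
  open import Data.Integer using (ℤ; +_; ∣_∣)
  open import Data.Rational using (ℚ; ↥_; ↧_; ↧ₙ_) renaming (-_ to -ℚ_; _+_ to _+ℚ_)
  import Data.Rational.Properties as ℚ
  open import Data.List using (List; []; _∷_)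
  open import Data.Product using (_,_; _×_; ∃₂)
  open import Data.Sum using (_⊎_; inj₁; inj₂)
  open import Relation.Nullary using (Dec; yes; no; contradiction)
  open import Relation.Binary.PropositionalEquality
  open Linearℤ

  private
    S : Expr
    S = 𝐚 ⊗ 𝐦₁ ⊗ 𝐦₂ ⊕ 𝐧₁ ⊗ 𝐧₂

    -- Up to the leading term (n₁ n₂)² of Q₂ and n₁⁴ of F, every monomial of Q₀, Q₁, Q₂
    -- contains m₁ or m₂, and every monomial of F and G contains m₁.
    U₀ V₀ U₁ V₁ V₂ Vf Vg : Expr
    U₀ = 𝐧₁ ⊗ (𝐧₁ ⊗ 𝐦₂ ⊖ 𝐧₂ ⊗ 𝐦₁)
    V₀ = ⊝ 𝐧₂ ⊗ (𝐧₁ ⊗ 𝐦₂ ⊖ 𝐧₂ ⊗ 𝐦₁)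
    U₁ = # 2 ⊗ 𝐧₁ ⊗ S
    V₁ = # 2 ⊗ 𝐧₂ ⊗ S ⊕ # 4 ⊗ 𝐛 ⊗ 𝐦₂ ⊗ (𝐦₁ ⊗ 𝐦₂)
    V₂ = ⊝ (# 2 ⊗ 𝐚 ⊗ 𝐧₁ ⊗ 𝐧₂ ⊗ 𝐦₂) ⊕ 𝐚 ⊗ 𝐚 ⊗ 𝐦₁ ⊗ 𝐦₂ ⊗ 𝐦₂ ⊖ # 4 ⊗ 𝐛 ⊗ 𝐦₂ ⊗ (𝐧₁ ⊗ 𝐦₂ ⊕ 𝐧₂ ⊗ 𝐦₁)
    Vf = ⊝ (# 2 ⊗ 𝐚 ⊗ 𝐧₁ ⊗ 𝐧₁ ⊗ 𝐦₁) ⊖ # 8 ⊗ 𝐛 ⊗ 𝐧₁ ⊗ 𝐦₁ ⊗ 𝐦₁ ⊕ 𝐚 ⊗ 𝐚 ⊗ 𝐦₁ ⊗ 𝐦₁ ⊗ 𝐦₁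
    Vg = # 4 ⊗ (𝐧₁ ⊗ 𝐧₁ ⊗ 𝐧₁ ⊕ 𝐚 ⊗ 𝐧₁ ⊗ 𝐦₁ ⊗ 𝐦₁ ⊕ 𝐛 ⊗ 𝐦₁ ⊗ 𝐦₁ ⊗ 𝐦₁)

    Q₀= : ∀ ρ → Semℤ.eval Q₀ ρ ≡ Semℤ.eval (𝐦₂ ⊗ U₀ ⊕ 𝐦₁ ⊗ V₀) ρ
    Q₀= ρ = Semℤ.identity ρ Q₀ (𝐦₂ ⊗ U₀ ⊕ 𝐦₁ ⊗ V₀) refl
    Q₁= : ∀ ρ → Semℤ.eval Q₁ ρ ≡ Semℤ.eval (𝐦₂ ⊗ U₁ ⊕ 𝐦₁ ⊗ V₁) ρ
    Q₁= ρ = Semℤ.identity ρ Q₁ (𝐦₂ ⊗ U₁ ⊕ 𝐦₁ ⊗ V₁) refl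
    Q₂= : ∀ ρ → Semℤ.eval Q₂ ρ ≡ Semℤ.eval (𝐧₁ ⊗ 𝐧₂ ⊗ (𝐧₁ ⊗ 𝐧₂) ⊕ 𝐦₁ ⊗ V₂) ρ
    Q₂= ρ = Semℤ.identity ρ Q₂ (𝐧₁ ⊗ 𝐧₂ ⊗ (𝐧₁ ⊗ 𝐧₂) ⊕ 𝐦₁ ⊗ V₂) refl
    F= : ∀ ρ → Semℤ.eval F ρ ≡ Semℤ.eval (𝐧₁ ⊗ 𝐧₁ ⊗ (𝐧₁ ⊗ 𝐧₁) ⊕ 𝐦₁ ⊗ Vf) ρ
    F= ρ = Semℤ.identity ρ F (𝐧₁ ⊗ 𝐧₁ ⊗ (𝐧₁ ⊗ 𝐧₁) ⊕ 𝐦₁ ⊗ Vf) refl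
    G= : ∀ ρ → Semℤ.eval G ρ ≡ Semℤ.eval (𝐦₁ ⊗ Vg) ρ
    G= ρ = Semℤ.identity ρ G (𝐦₁ ⊗ Vg) refl

    isolate : ∀ {q₀ q₁ q₂ L s N M} → q₀ * (N * N) + q₂ * (M * M) ≡ q₁ * (N * M) → q₂ ≡ L + s →
      L * (M * M) ≡ q₁ * (N * M) + (- (q₀ * (N * N)) + - (s * (M * M)))
    isolate {q₀} {q₁} {q₂} {L} {s} {N} {M = M} r e = linear (+ 1 · r ⊞ (- (M * M)) · e)
      (identityℤ (L ∷ M ∷ q₁ ∷ N ∷ q₀ ∷ s ∷ q₂ ∷ []) (λ L M q₁ N q₀ s q₂ →
          L ⊗ (M ⊗ M) ⊖ (q₁ ⊗ (N ⊗ M) ⊕ (⊝ (q₀ ⊗ (N ⊗ N)) ⊖ s ⊗ (M ⊗ M)))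
          ⊜ # 1 ⊗ (q₀ ⊗ (N ⊗ N) ⊕ q₂ ⊗ (M ⊗ M) ⊖ q₁ ⊗ (N ⊗ M)) ⊕ ⊝ (M ⊗ M) ⊗ (q₂ ⊖ (L ⊕ s))) refl)

    isolate-double : ∀ {f g L s N M} → M * f ≡ N * g → f ≡ L + s → L * M ≡ N * g + - (s * M)
    isolate-double {f} {g} {L} {s} {N} {M = M} r e = linear (+ 1 · r ⊞ (- M) · e)
      (identityℤ (L ∷ M ∷ N ∷ g ∷ s ∷ f ∷ []) (λ L M N g s f → L ⊗ M ⊖ (N ⊗ g ⊖ s ⊗ M) ⊜ # 1 ⊗ (M ⊗ f ⊖ N ⊗ g) ⊕ ⊝ M ⊗ (f ⊖ (L ⊕ s))) refl)

  module _ (E : Curve) where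

    open Bounds E

    archimedean-constant : ℕ
    archimedean-constant = (norm U₁ ℕ.+ norm V₁) ℕ.+ ((norm U₀ ℕ.+ norm V₀) ℕ.+ norm V₂) ℕ.+ (norm Vg ℕ.+ norm Vf)

    private
      module Large {x₁ x₂ : ℚ} {T : ℕ} (1≤T : 1 ≤ T) (T₁ : T ℕ.* ↧ₙ x₁ ≤ ∣ ↥ x₁ ∣) (T₂ : T ℕ.* ↧ₙ x₂ ≤ ∣ ↥ x₂ ∣) where
        ρ : List ℤ
        ρ = coordinates E x₁ x₂
        α β : ℕ
        α = ∣ ↥ x₁ ∣
        β = ∣ ↥ x₂ ∣
        m≤ : ∀ {m n} → T ℕ.* m ≤ n → m ≤ n
        m≤ {m} h = ℕ.≤-trans (ℕ.m≤n*m m T {{ℕ.>-nonZero 1≤T}}) h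
        1≤α : 1 ≤ α
        1≤α = ℕ.≤-trans (s≤s z≤n) (m≤ T₁)
        1≤β : 1 ≤ β
        1≤β = ℕ.≤-trans (s≤s z≤n) (m≤ T₂)
        bound : ∀ e → ∣ Semℤ.eval e ρ ∣ ≤ norm e ℕ.* (α ℕ.^ deg₁ e ℕ.* β ℕ.^ deg₂ e)
        bound e = eval-bound e 1≤α 1≤β ℕ.≤-refl (m≤ T₁) ℕ.≤-refl (m≤ T₂)

        -- A factor `m₁` counts for at most `n₁ / T`, so a term containing it is smaller by `T` than
        -- its degree suggests.
        times-m₁ : ∀ e {i j} → deg₁ e ≡ i → deg₂ e ≡ j → T ℕ.* ∣ ↧ x₁ * Semℤ.eval e ρ ∣ ≤ norm e ℕ.* (α ℕ.^ suc i ℕ.* β ℕ.^ j)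
        times-m₁ e refl refl = begin
          T ℕ.* ∣ ↧ x₁ * Semℤ.eval e ρ ∣                 ≡⟨ trans (cong (T ℕ.*_) (abs-* (↧ x₁) _)) (sym (ℕ.*-assoc T (↧ₙ x₁) _)) ⟩
          T ℕ.* ↧ₙ x₁ ℕ.* ∣ Semℤ.eval e ρ ∣              ≤⟨ ℕ.*-mono-≤ T₁ (bound e) ⟩
          α ℕ.* (norm e ℕ.* (α ℕ.^ deg₁ e ℕ.* β ℕ.^ deg₂ e)) ≡⟨ rearrange α (norm e) (α ℕ.^ deg₁ e) (β ℕ.^ deg₂ e) ⟩
          norm e ℕ.* (α ℕ.* α ℕ.^ deg₁ e ℕ.* β ℕ.^ deg₂ e)   ∎
          where
          open ℕ.≤-Reasoning
          rearrange : ∀ a n b c → a ℕ.* (n ℕ.* (b ℕ.* c)) ≡ n ℕ.* (a ℕ.* b ℕ.* c)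
          rearrange = solve-∀

        times-m₂ : ∀ e {i j} → deg₁ e ≡ i → deg₂ e ≡ j → T ℕ.* ∣ ↧ x₂ * Semℤ.eval e ρ ∣ ≤ norm e ℕ.* (α ℕ.^ i ℕ.* β ℕ.^ suc j)
        times-m₂ e refl refl = begin
          T ℕ.* ∣ ↧ x₂ * Semℤ.eval e ρ ∣                 ≡⟨ trans (cong (T ℕ.*_) (abs-* (↧ x₂) _)) (sym (ℕ.*-assoc T (↧ₙ x₂) _)) ⟩
          T ℕ.* ↧ₙ x₂ ℕ.* ∣ Semℤ.eval e ρ ∣              ≤⟨ ℕ.*-mono-≤ T₂ (bound e) ⟩
          β ℕ.* (norm e ℕ.* (α ℕ.^ deg₁ e ℕ.* β ℕ.^ deg₂ e)) ≡⟨ rearrange β (norm e) (α ℕ.^ deg₁ e) (β ℕ.^ deg₂ e) ⟩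
          norm e ℕ.* (α ℕ.^ deg₁ e ℕ.* (β ℕ.* β ℕ.^ deg₂ e))   ∎
          where
          open ℕ.≤-Reasoning
          rearrange : ∀ a n b c → a ℕ.* (n ℕ.* (b ℕ.* c)) ≡ n ℕ.* (b ℕ.* (a ℕ.* c))
          rearrange = solve-∀

        T-+ : ∀ {u v : ℤ} c d Z → T ℕ.* ∣ u ∣ ≤ c ℕ.* Z → T ℕ.* ∣ v ∣ ≤ d ℕ.* Z → T ℕ.* ∣ u + v ∣ ≤ (c ℕ.+ d) ℕ.* Z
        T-+ {u} {v} c d Z h k = begin
          T ℕ.* ∣ u + v ∣              ≤⟨ ℕ.*-monoʳ-≤ T (abs-+ u v) ⟩
          T ℕ.* (∣ u ∣ ℕ.+ ∣ v ∣)      ≡⟨ ℕ.*-distribˡ-+ T (∣ u ∣) (∣ v ∣) ⟩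
          T ℕ.* ∣ u ∣ ℕ.+ T ℕ.* ∣ v ∣  ≤⟨ ℕ.+-mono-≤ h k ⟩
          c ℕ.* Z ℕ.+ d ℕ.* Z          ≡⟨ ℕ.*-distribʳ-+ Z c d ⟨
          (c ℕ.+ d) ℕ.* Z              ∎
          where open ℕ.≤-Reasoning

        T-neg : ∀ {u : ℤ} {Z} → T ℕ.* ∣ u ∣ ≤ Z → T ℕ.* ∣ - u ∣ ≤ Z
        T-neg {u} h = subst (λ z → T ℕ.* z ≤ _) (sym (abs-neg u)) h

        T-* : ∀ {u w : ℤ} c Z W → T ℕ.* ∣ u ∣ ≤ c ℕ.* Z → ∣ w ∣ ≤ W → T ℕ.* ∣ u * w ∣ ≤ c ℕ.* (Z ℕ.* W)
        T-* {u} {w} c Z W h k = begin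
          T ℕ.* ∣ u * w ∣          ≡⟨ trans (cong (T ℕ.*_) (abs-* u w)) (sym (ℕ.*-assoc T (∣ u ∣) (∣ w ∣))) ⟩
          T ℕ.* ∣ u ∣ ℕ.* ∣ w ∣    ≤⟨ ℕ.*-mono-≤ h k ⟩
          c ℕ.* Z ℕ.* W            ≡⟨ ℕ.*-assoc c Z W ⟩
          c ℕ.* (Z ℕ.* W)          ∎
          where open ℕ.≤-Reasoning

        finish : ∀ {L w : ℤ} c Z W → 1 ≤ Z → 1 ≤ ∣ w ∣ → ∣ L ∣ ≡ Z → T ℕ.* ∣ L * w ∣ ≤ c ℕ.* (Z ℕ.* W) → T ≤ c ℕ.* W
        finish {L} {w} c Z W 1≤Z 1≤w refl h = ℕ.*-cancelˡ-≤ Z {{ℕ.>-nonZero 1≤Z}} (begin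
          Z ℕ.* T                  ≡⟨ ℕ.*-comm Z T ⟩
          T ℕ.* Z                  ≤⟨ ℕ.*-monoʳ-≤ T (ℕ.m≤m*n Z (∣ w ∣) {{ℕ.>-nonZero 1≤w}}) ⟩
          T ℕ.* (Z ℕ.* ∣ w ∣)      ≡⟨ cong (T ℕ.*_) (abs-* L w) ⟨
          T ℕ.* ∣ L * w ∣          ≤⟨ h ⟩
          c ℕ.* (Z ℕ.* W)          ≡⟨ rearrange c Z W ⟩
          Z ℕ.* (c ℕ.* W)          ∎)
          where
          open ℕ.≤-Reasoning
          rearrange : ∀ c z w → c ℕ.* (z ℕ.* w) ≡ z ℕ.* (c ℕ.* w)
          rearrange = solve-∀

        power-positive : ∀ {n} k → 1 ≤ n → 1 ≤ n ℕ.^ k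
        power-positive {n} k h = ℕ.m^n>0 n {{ℕ.>-nonZero h}} k

        -- In the quadratic for `X′ = N / M` the leading term `(n₁ n₂)² M²` is balanced by terms
        -- that are smaller by a factor `T`, up to a constant times `H X′ ^ 2`.
        chord-large : ∀ {X X′} → SumDifference E x₁ x₂ X X′ → T ≤ archimedean-constant ℕ.* (H X′ ℕ.^ 2)
        chord-large {X} {X′} sd = ℕ.≤-trans (finish {L = ↥ x₁ * ↥ x₂ * (↥ x₁ * ↥ x₂)} {w = ↧ X′ * ↧ X′} (C₁ ℕ.+ (C₀ ℕ.+ norm V₂)) Z W
            (ℕ.*-mono-≤ (power-positive 2 1≤α) (power-positive 2 1≤β))
            (subst (1 ≤_) (sym (abs-* (↧ X′) (↧ X′))) (s≤s z≤n)) lead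
            (subst (λ z → T ℕ.* ∣ z ∣ ≤ (C₁ ℕ.+ (C₀ ℕ.+ norm V₂)) ℕ.* (Z ℕ.* W)) (sym (isolate {q₀} {q₁} (root E {x₁} {x₂} {X} {X′} sd) (Q₂= ρ)))
              (T-+ C₁ (C₀ ℕ.+ norm V₂) (Z ℕ.* W) (T-* C₁ Z W q₁≤ NM) (T-+ C₀ (norm V₂) (Z ℕ.* W) (T-neg {q₀ * _} (T-* C₀ Z W q₀≤ NN))
                (T-neg {↧ x₁ * Semℤ.eval V₂ ρ * _} (T-* {↧ x₁ * Semℤ.eval V₂ ρ} (norm V₂) Z W (times-m₁ V₂ refl refl) MM))))))
            (ℕ.*-monoˡ-≤ (H X′ ℕ.^ 2) (ℕ.m≤m+n (C₁ ℕ.+ (C₀ ℕ.+ norm V₂)) (norm Vg ℕ.+ norm Vf)))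
          where
          C₀ C₁ Z W : ℕ
          C₀ = norm U₀ ℕ.+ norm V₀
          C₁ = norm U₁ ℕ.+ norm V₁
          Z = α ℕ.^ 2 ℕ.* β ℕ.^ 2
          W = H X′ ℕ.^ 2
          q₀ q₁ : ℤ
          q₀ = Semℤ.eval Q₀ ρ
          q₁ = Semℤ.eval Q₁ ρ
          lead : ∣ ↥ x₁ * ↥ x₂ * (↥ x₁ * ↥ x₂) ∣ ≡ α ℕ.^ 2 ℕ.* β ℕ.^ 2
          lead = trans (abs-* (↥ x₁ * ↥ x₂) _) (trans (cong₂ ℕ._*_ (abs-* (↥ x₁) (↥ x₂)) (abs-* (↥ x₁) (↥ x₂))) (square α β))
            where
            square : ∀ a b → a ℕ.* b ℕ.* (a ℕ.* b) ≡ a ℕ.* (a ℕ.* 1) ℕ.* (b ℕ.* (b ℕ.* 1))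
            square = solve-∀
          q₀≤ : T ℕ.* ∣ q₀ ∣ ≤ (norm U₀ ℕ.+ norm V₀) ℕ.* (α ℕ.^ 2 ℕ.* β ℕ.^ 2)
          q₀≤ = subst (λ z → T ℕ.* ∣ z ∣ ≤ C₀ ℕ.* Z) (sym (Q₀= ρ)) (T-+ (norm U₀) (norm V₀) Z (times-m₂ U₀ refl refl) (times-m₁ V₀ refl refl))
          q₁≤ : T ℕ.* ∣ q₁ ∣ ≤ (norm U₁ ℕ.+ norm V₁) ℕ.* (α ℕ.^ 2 ℕ.* β ℕ.^ 2)
          q₁≤ = subst (λ z → T ℕ.* ∣ z ∣ ≤ C₁ ℕ.* Z) (sym (Q₁= ρ)) (T-+ (norm U₁) (norm V₁) Z (times-m₂ U₁ refl refl) (times-m₁ V₁ refl refl))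
          W≤ : ∀ {i j} → ∣ i ∣ ≤ H X′ → ∣ j ∣ ≤ H X′ → ∣ i * j ∣ ≤ H X′ ℕ.^ 2
          W≤ {i} {j} h k = ℕ.≤-trans (ℕ.≤-reflexive (abs-* i j)) (ℕ.≤-trans (ℕ.*-mono-≤ h k) (ℕ.≤-reflexive (cong (H X′ ℕ.*_) (sym (ℕ.*-identityʳ (H X′))))))
          N≤ : ∣ ↥ X′ ∣ ≤ H X′
          N≤ = ℕ.m≤m⊔n _ _
          M≤ : ∣ ↧ X′ ∣ ≤ H X′
          M≤ = ℕ.m≤n⊔m _ _
          NM : ∣ ↥ X′ * ↧ X′ ∣ ≤ H X′ ℕ.^ 2
          NM = W≤ {↥ X′} {↧ X′} N≤ M≤
          NN : ∣ ↥ X′ * ↥ X′ ∣ ≤ H X′ ℕ.^ 2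
          NN = W≤ {↥ X′} {↥ X′} N≤ N≤
          MM : ∣ ↧ X′ * ↧ X′ ∣ ≤ H X′ ℕ.^ 2
          MM = W≤ {↧ X′} {↧ X′} M≤ M≤

        double-large : ∀ {X} → ↧ X * Semℤ.eval F ρ ≡ ↥ X * Semℤ.eval G ρ → T ≤ archimedean-constant ℕ.* (H X ℕ.^ 2)
        double-large {X} eq = ℕ.≤-trans (finish {L = ↥ x₁ * ↥ x₁ * (↥ x₁ * ↥ x₁)} {w = ↧ X} (norm Vg ℕ.+ norm Vf) Z (H X)
            (ℕ.*-mono-≤ (power-positive 4 1≤α) (s≤s z≤n)) (s≤s z≤n) lead
            (subst (λ z → T ℕ.* ∣ z ∣ ≤ (norm Vg ℕ.+ norm Vf) ℕ.* (Z ℕ.* H X)) (sym (trans (isolate-double eq (F= ρ)) (cong (_+ - (↧ x₁ * Semℤ.eval Vf ρ * ↧ X)) (*-comm (↥ X) _))))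
              (T-+ (norm Vg) (norm Vf) (Z ℕ.* H X) (T-* {Semℤ.eval G ρ} {↥ X} (norm Vg) Z (H X) g≤ (ℕ.m≤m⊔n (∣ ↥ X ∣) (↧ₙ X)))
                (T-neg {↧ x₁ * Semℤ.eval Vf ρ * ↧ X} (T-* {↧ x₁ * Semℤ.eval Vf ρ} {↧ X} (norm Vf) Z (H X) (times-m₁ Vf refl refl) (ℕ.m≤n⊔m (∣ ↥ X ∣) (↧ₙ X)))))))
            (ℕ.*-mono-≤ (ℕ.m≤n+m (norm Vg ℕ.+ norm Vf) ((norm U₁ ℕ.+ norm V₁) ℕ.+ ((norm U₀ ℕ.+ norm V₀) ℕ.+ norm V₂))) (ℕ.m≤m*n (H X) (H X ℕ.* 1) {{ℕ.>-nonZero (ℕ.≤-trans (1≤H X) (ℕ.≤-reflexive (sym (ℕ.*-identityʳ (H X)))))}}))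
          where
          Z : ℕ
          Z = α ℕ.^ 4 ℕ.* β ℕ.^ 0
          lead : ∣ ↥ x₁ * ↥ x₁ * (↥ x₁ * ↥ x₁) ∣ ≡ α ℕ.^ 4 ℕ.* β ℕ.^ 0
          lead = trans (abs-* (↥ x₁ * ↥ x₁) _) (trans (cong₂ ℕ._*_ (abs-* (↥ x₁) (↥ x₁)) (abs-* (↥ x₁) (↥ x₁))) (fourth α))
            where
            fourth : ∀ a → a ℕ.* a ℕ.* (a ℕ.* a) ≡ a ℕ.* (a ℕ.* (a ℕ.* (a ℕ.* 1))) ℕ.* 1
            fourth = solve-∀
          g≤ : T ℕ.* ∣ Semℤ.eval G ρ ∣ ≤ norm Vg ℕ.* (α ℕ.^ 4 ℕ.* β ℕ.^ 0)
          g≤ = subst (λ z → T ℕ.* ∣ z ∣ ≤ norm Vg ℕ.* Z) (sym (G= ρ)) (times-m₁ Vg refl refl)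

    -- The counterpart of `denominator-sub` at the real place: points with large abscissae are near
    -- the origin, hence so is their difference, and a nonzero rational point near the origin has
    -- large height.
    archimedean : ∀ {x₁ y₁ x₂ y₂ T} → OnCurve E (aff x₁ y₁) → OnCurve E (aff x₂ y₂) →
      T ℕ.* ↧ₙ x₁ ≤ ∣ ↥ x₁ ∣ → T ℕ.* ↧ₙ x₂ ≤ ∣ ↥ x₂ ∣ → sub E (aff x₁ y₁) (aff x₂ y₂) ≢ O →
      T ≤ archimedean-constant ℕ.* height (sub E (aff x₁ y₁) (aff x₂ y₂)) ℕ.^ 2
    archimedean {T = zero} _ _ _ _ _ = z≤n
    archimedean {x₁} {y₁} {x₂} {y₂} {T@(suc _)} h₁ h₂ T₁ T₂ A-B≢O = by (x₁ ℚ.≟ x₂)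
      where
      A B : Pt
      A = aff x₁ y₁
      B = aff x₂ y₂
      Goal : Pt → Set
      Goal R = T ≤ archimedean-constant ℕ.* height R ℕ.^ 2
      doubled-case : sub E A B ≡ add E A A →
        (add E A A ≡ O × _) ⊎ (∃₂ λ X Y → add E A A ≡ aff X Y × ↧ X * Semℤ.eval F (coordinates E x₁ x₁) ≡ ↥ X * Semℤ.eval G (coordinates E x₁ x₁)) → Goal (sub E A B)
      doubled-case e (inj₁ (e′ , _)) = contradiction (trans e e′) A-B≢O
      doubled-case e (inj₂ (X , _ , e′ , eq)) = subst Goal (sym (trans e e′)) (Large.double-large {x₁} {x₁} (s≤s z≤n) T₁ T₁ {X} eq)
      equal-x : sub E A B ≡ O ⊎ sub E A B ≡ add E A A → Goal (sub E A B)
      equal-x (inj₁ e) = contradiction e A-B≢O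
      equal-x (inj₂ e) = doubled-case e (double E {x₁} {y₁} h₁)
      by : Dec (x₁ ≡ x₂) → Goal (sub E A B)
      by (yes x=) = equal-x (same-x E h₁ h₂ x=)
      by (no x≢) = let X , _ , X′ , _ , _ , e , sd = sum-difference E {x₁} {y₁} {x₂} {y₂} h₁ h₂ x≢ in
        subst Goal (sym e) (Large.chord-large {x₁} {x₂} (s≤s z≤n) T₁ T₂ {X} {X′} sd)

-- Logarithmic heights and the approximate parallelogram law

module LogHeights where

  open import Defs
  open GroupLaw
  open AdditionFormulas
  open Denominators
  open Heights
  open Archimedean
  open BinaryLog
  open CollinearTriples using (curve-±)
  open import Data.Nat as ℕ using (ℕ; zero; suc; _≤_; z≤n; s≤s; _⊓_; _+_; _*_; _^_)
  import Data.Nat.Properties as ℕ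
  open import Data.Nat.DivMod using (_/_; m≡m%n+[m/n]*n; m%n<n; m/n*n≤m)
  open import Data.Nat.Tactic.RingSolver using (solve-∀)
  open import Data.Integer using (+_; ∣_∣)
  open import Data.Rational as ℚ using (ℚ; 0ℚ; ↥_; ↧ₙ_)
  import Data.Rational.Properties as ℚ
  open import Data.Product using (_,_)
  open import Data.Sum as Sum using (_⊎_; inj₁; inj₂)
  open import Relation.Nullary using (Dec; yes; no; contradiction)
  open import Relation.Binary.PropositionalEquality

  lg-^ : ∀ n k → lg (n ^ k) ≤ k * lg n
  lg-^ n zero = ℕ.≤-reflexive lg-1
  lg-^ n (suc k) = ℕ.≤-trans (lg-* n (n ^ k)) (ℕ.+-monoʳ-≤ (lg n) (lg-^ n k))

  lg-^-≥ : ∀ {n} k → 1 ≤ n → k * lg n ≤ lg (n ^ k) + 2 * k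
  lg-^-≥ zero _ = z≤n
  lg-^-≥ {n} (suc k) 1≤n = begin
    lg n + k * lg n                ≤⟨ ℕ.+-monoʳ-≤ (lg n) (lg-^-≥ k 1≤n) ⟩
    lg n + (lg (n ^ k) + 2 * k)    ≡⟨ ℕ.+-assoc (lg n) _ _ ⟨
    lg n + lg (n ^ k) + 2 * k      ≤⟨ ℕ.+-monoˡ-≤ (2 * k) (lg-*-≥ n (n ^ k) 1≤n (ℕ.m^n>0 n {{ℕ.>-nonZero 1≤n}} k)) ⟩
    lg (n * n ^ k) + 2 + 2 * k     ≡⟨ rearrange (lg (n * n ^ k)) k ⟩
    lg (n * n ^ k) + 2 * suc k     ∎
    where
    open ℕ.≤-Reasoning
    rearrange : ∀ a k → a + 2 + 2 * k ≡ a + 2 * (1 + k)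
    rearrange = solve-∀

  h : Pt → ℕ
  h A = lg (height A)

  h-O : h O ≡ 0
  h-O = lg-1

  -- The archimedean contribution to the height.
  size : Pt → ℕ
  size O = 0
  size (aff x _) = ∣ ↥ x ∣ / ↧ₙ x

  size-bound : ∀ x → size (aff x 0ℚ) * ↧ₙ x ≤ ∣ ↥ x ∣
  size-bound x = m/n*n≤m ∣ ↥ x ∣ (↧ₙ x)

  -- Splits the height into the finite places, through the denominator, and the archimedean place.
  h≤denominator+size : ∀ A → h A ≤ lg (denominator A) + lg (suc (size A))
  h≤denominator+size O = ℕ.≤-trans (ℕ.≤-reflexive h-O) z≤n
  h≤denominator+size (aff x _) = ℕ.≤-trans (lg-mono (ℕ.⊔-lub numerator≤ (ℕ.m≤m*n (↧ₙ x) (suc (∣ ↥ x ∣ / ↧ₙ x))))) (lg-* (↧ₙ x) _)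
    where
    numerator≤ : ∣ ↥ x ∣ ≤ ↧ₙ x * suc (∣ ↥ x ∣ / ↧ₙ x)
    numerator≤ = begin
      ∣ ↥ x ∣                                         ≡⟨ m≡m%n+[m/n]*n ∣ ↥ x ∣ (↧ₙ x) ⟩
      _ + ∣ ↥ x ∣ / ↧ₙ x * ↧ₙ x                       ≤⟨ ℕ.+-monoˡ-≤ _ (ℕ.<⇒≤ (m%n<n ∣ ↥ x ∣ (↧ₙ x))) ⟩
      ↧ₙ x + ∣ ↥ x ∣ / ↧ₙ x * ↧ₙ x                    ≡⟨ ℕ.*-comm (suc (∣ ↥ x ∣ / ↧ₙ x)) (↧ₙ x) ⟩
      ↧ₙ x * suc (∣ ↥ x ∣ / ↧ₙ x)                     ∎
      where open ℕ.≤-Reasoning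

  h-opposite : ∀ A → h (opposite A) ≡ h A
  h-opposite O = refl
  h-opposite (aff _ _) = refl

  denominator≤height : ∀ A → A ≢ O → denominator A ≤ height A
  denominator≤height O A≢O = contradiction refl A≢O
  denominator≤height (aff x _) _ = ℕ.m≤n⊔m _ _

  module _ (E : Curve) where

    open Bounds E

    double-upper : ∀ A → OnCurve E A → h (add E A A) ≤ 4 * h A + lg (norm F + norm G)
    double-upper O _ = ℕ.≤-trans (ℕ.≤-reflexive h-O) z≤n
    double-upper (aff x y) on = ℕ.≤-trans (lg-mono (Duplication.upper {x} {y} on)) (ℕ.≤-trans (lg-* (norm F + norm G) (H x ^ 4))
      (ℕ.≤-trans (ℕ.+-monoʳ-≤ _ (lg-^ (H x) 4)) (ℕ.≤-reflexive (ℕ.+-comm (lg (norm F + norm G)) _))))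

    double-lower : ∀ A → OnCurve E A → 4 * h A ≤ h (add E A A) + (lg c₂ + 8)
    double-lower O _ = ℕ.≤-trans (ℕ.≤-reflexive (cong (4 *_) h-O)) z≤n
    double-lower A@(aff x y) on = begin
      4 * lg (H x)                       ≤⟨ lg-^-≥ 4 (1≤H x) ⟩
      lg (H x ^ 4) + 8                   ≤⟨ ℕ.+-monoˡ-≤ 8 (ℕ.≤-trans (lg-mono (Duplication.lower {x} {y} on)) (lg-* c₂ _)) ⟩
      lg c₂ + h (add E A A) + 8          ≡⟨ rearrange (lg c₂) (h (add E A A)) ⟩
      h (add E A A) + (lg c₂ + 8)        ∎
      where
      open ℕ.≤-Reasoning
      rearrange : ∀ a b → a + b + 8 ≡ b + (a + 8)
      rearrange = solve-∀

    -- The first summand serves equal abscissae, where one of A + B and A - B is `O` and the other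
    -- the double of A; the second serves distinct ones, with the 2 coming from rounding in
    -- `lg-*-≥`.
    parallelogram-constant : ℕ
    parallelogram-constant = lg (norm F + norm G) + (lg (2 * κ) + 2)

    parallelogram-upper : ∀ A B → OnCurve E A → OnCurve E B →
      h (add E A B) + h (sub E A B) ≤ 2 * h A + 2 * h B + parallelogram-constant
    parallelogram-upper O B _ _ = ℕ.≤-trans (ℕ.≤-reflexive (cong (h B ℕ.+_) (trans (h-opposite B) (sym (ℕ.+-identityʳ (h B))))))
      (ℕ.≤-trans (ℕ.m≤n+m (2 * h B) (2 * h O)) (ℕ.m≤m+n _ _))
    parallelogram-upper A@(aff _ _) O _ _ = ℕ.≤-trans (ℕ.≤-reflexive (lemma (h A))) (ℕ.≤-trans (ℕ.m≤m+n (2 * h A) (2 * h O)) (ℕ.m≤m+n _ parallelogram-constant))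
      where
      lemma : ∀ a → a + a ≡ 2 * a
      lemma = solve-∀
    parallelogram-upper A@(aff x₁ y₁) B@(aff x₂ y₂) h₁ h₂ = by (x₁ ℚ.≟ x₂)
      where
      open ℕ.≤-Reasoning
      C C′ : ℕ
      C = lg (norm F + norm G)
      C′ = lg (2 * κ) + 2
      Goal : Set
      Goal = h (add E A B) + h (sub E A B) ≤ 2 * h A + 2 * h B + (C + C′)
      from-double : ∀ {R S} → R ≡ O → S ≡ add E A A → h B ≡ h A → h R + h S ≤ 2 * h A + 2 * h B + (C + C′)
      from-double refl refl hB = ℕ.≤-trans (ℕ.≤-trans (ℕ.≤-reflexive (cong (_+ h (add E A A)) h-O)) (double-upper A h₁)) (ℕ.≤-trans (ℕ.+-monoʳ-≤ (4 * h A) (ℕ.m≤m+n C C′))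
        (ℕ.≤-reflexive (cong (_+ (C + C′)) (trans (four (h A)) (cong (λ b → 2 * h A + 2 * b) (sym hB))))))
        where
        four : ∀ a → 4 * a ≡ 2 * a + 2 * a
        four = solve-∀
      swap : h (sub E A B) + h (add E A B) ≤ 2 * h A + 2 * h B + (C + C′) → Goal
      swap = ℕ.≤-trans (ℕ.≤-reflexive (ℕ.+-comm (h (add E A B)) _))
      equal-x : x₁ ≡ x₂ → y₁ ≡ y₂ ⊎ y₁ ℚ.+ y₂ ≡ 0ℚ → Goal
      equal-x refl (inj₁ refl) = swap (from-double (add-inverseʳ E A) refl refl)
      equal-x refl (inj₂ q) = from-double (add-opposite E {x₁} y₁ y₂ refl q) (cong (λ y → add E A (aff x₁ y)) (neg-unique q)) refl
      by : Dec (x₁ ≡ x₂) → Goal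
      by (yes x=) = equal-x x= (curve-± {ℤ→ℚ (a E)} {ℤ→ℚ (b E)} {x₁} h₁ h₂ x=)
      by (no x≢) = let X , _ , X′ , _ , e , e′ , sd = sum-difference E {x₁} {y₁} {x₂} {y₂} h₁ h₂ x≢ in
        subst₂ (λ R S → h R + h S ≤ 2 * h A + 2 * h B + (C + C′)) (sym e) (sym e′) (generic {X} {X′} sd x≢)
        where
        generic : ∀ {X X′} → SumDifference E x₁ x₂ X X′ → x₁ ≢ x₂ → lg (H X) + lg (H X′) ≤ 2 * h A + 2 * h B + (C + C′)
        generic {X} {X′} sd x≢ = begin
          lg (H X) + lg (H X′)                                   ≤⟨ lg-*-≥ (H X) (H X′) (1≤H X) (1≤H X′) ⟩
          lg (H X * H X′) + 2                                    ≤⟨ ℕ.+-monoˡ-≤ 2 (lg-mono (sum-difference-height {x₁} {x₂} {X} {X′} x≢ sd)) ⟩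
          lg (2 * κ * (H x₁ ^ 2 * H x₂ ^ 2)) + 2                 ≤⟨ ℕ.+-monoˡ-≤ 2 (ℕ.≤-trans (lg-* (2 * κ) _) (ℕ.+-monoʳ-≤ (lg (2 * κ)) (ℕ.≤-trans (lg-* (H x₁ ^ 2) (H x₂ ^ 2)) (ℕ.+-mono-≤ (lg-^ (H x₁) 2) (lg-^ (H x₂) 2))))) ⟩
          lg (2 * κ) + (2 * h A + 2 * h B) + 2                   ≡⟨ rearrange (lg (2 * κ)) (2 * h A + 2 * h B) ⟩
          2 * h A + 2 * h B + C′                                 ≤⟨ ℕ.+-monoʳ-≤ (2 * h A + 2 * h B) (ℕ.m≤n+m C′ C) ⟩
          2 * h A + 2 * h B + (C + C′)                           ∎
          where
          rearrange : ∀ a b → a + b + 2 ≡ b + (a + 2)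
          rearrange = solve-∀

    sum+difference : ∀ A B → OnCurve E A → OnCurve E B → add E (add E A B) (sub E A B) ≡ add E A A
    sum+difference A B hA hB = begin
      add E (add E A B) T                      ≡⟨ cong (λ u → add E u T) (add-comm E A B hA hB) ⟩
      add E (add E B A) T                      ≡⟨ add-comm E (add E B A) T (add-on E B A hB hA) hT ⟩
      add E T (add E B A)                      ≡⟨ add-assoc E T B A hT hB hA ⟨
      add E (add E T B) A                      ≡⟨ cong (λ u → add E u A) T+B ⟩
      add E A A                                ∎
      where
      open ≡-Reasoning
      T : Pt
      T = sub E A B
      hB′ : OnCurve E (opposite B)
      hB′ = opposite-on E {B} hB
      hT : OnCurve E T
      hT = add-on E A (opposite B) hA hB′
      T+B : add E T B ≡ A
      T+B = trans (cong (add E T) (sym (opposite-involutive B))) (cancelʳ E A (opposite B) hA hB′)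

    sum-difference′ : ∀ A B → OnCurve E A → OnCurve E B → sub E (add E A B) (sub E A B) ≡ add E B B
    sum-difference′ A B hA hB = begin
      sub E S (sub E A B)                         ≡⟨ cong (add E S) (opposite-add E A (opposite B) hA (opposite-on E {B} hB)) ⟩
      add E S (add E (opposite A) (opposite (opposite B))) ≡⟨ cong (λ u → add E S (add E (opposite A) u)) (opposite-involutive B) ⟩
      add E S (add E (opposite A) B)              ≡⟨ add-assoc E S (opposite A) B (add-on E A B hA hB) (opposite-on E {A} hA) hB ⟨
      add E (add E S (opposite A)) B              ≡⟨ cong (λ u → add E (add E u (opposite A)) B) (add-comm E A B hA hB) ⟩
      add E (add E (add E B A) (opposite A)) B    ≡⟨ cong (λ u → add E u B) (cancelʳ E B A hB hA) ⟩
      add E B B                                   ∎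
      where
      open ≡-Reasoning
      S : Pt
      S = add E A B

    lower-constant : ℕ
    lower-constant = parallelogram-constant + 2 * (lg c₂ + 8)

    -- Apply the upper bound to A + B and A - B, whose sum and difference are 2A and 2B.
    parallelogram-lower : ∀ A B → OnCurve E A → OnCurve E B →
      2 * h A + 2 * h B ≤ h (add E A B) + h (sub E A B) + lower-constant
    parallelogram-lower A B hA hB = ℕ.*-cancelˡ-≤ 2 (begin
      2 * (2 * h A + 2 * h B)               ≡⟨ lemma₁ (h A) (h B) ⟩
      4 * h A + 4 * h B                     ≤⟨ ℕ.+-mono-≤ (double-lower A hA) (double-lower B hB) ⟩
      (h (add E A A) + D) + (h (add E B B) + D) ≡⟨ lemma₂ (h (add E A A)) (h (add E B B)) D ⟩
      (h (add E A A) + h (add E B B)) + 2 * D ≡⟨ cong₂ (λ u v → (h u + h v) + 2 * D) S+D S-D ⟨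
      (h (add E S T) + h (sub E S T)) + 2 * D ≤⟨ ℕ.+-monoˡ-≤ (2 * D) (parallelogram-upper S T hS hT) ⟩
      2 * h S + 2 * h T + C + 2 * D         ≤⟨ ℕ.m≤m+n _ (C + 2 * D) ⟩
      2 * h S + 2 * h T + C + 2 * D + (C + 2 * D) ≡⟨ lemma₃ (h S) (h T) C D ⟩
      2 * (h S + h T + (C + 2 * D))         ∎)
      where
      open ℕ.≤-Reasoning
      S T : Pt
      S = add E A B
      T = sub E A B
      C D : ℕ
      C = parallelogram-constant
      D = lg c₂ + 8
      hB′ : OnCurve E (opposite B)
      hB′ = opposite-on E {B} hB
      hS : OnCurve E S
      hS = add-on E A B hA hB
      hT : OnCurve E T
      hT = add-on E A (opposite B) hA hB′
      S+D : add E S T ≡ add E A A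
      S+D = sum+difference A B hA hB
      S-D : sub E S T ≡ add E B B
      S-D = sum-difference′ A B hA hB
      lemma₁ : ∀ a b → 2 * (2 * a + 2 * b) ≡ 4 * a + 4 * b
      lemma₁ = solve-∀
      lemma₂ : ∀ a b d → (a + d) + (b + d) ≡ (a + b) + 2 * d
      lemma₂ = solve-∀
      lemma₃ : ∀ s t c d → 2 * s + 2 * t + c + 2 * d + (c + 2 * d) ≡ 2 * (s + t + (c + 2 * d))
      lemma₃ = solve-∀

    archimedean-lg : ∀ A B → OnCurve E A → OnCurve E B → A ≢ O → B ≢ O → sub E A B ≢ O →
      lg (suc (size A)) ⊓ lg (suc (size B)) ≤ lg (suc (archimedean-constant E)) + 2 * h (sub E A B)
    archimedean-lg O _ _ _ A≢O _ _ = contradiction refl A≢O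
    archimedean-lg (aff _ _) O _ _ _ B≢O _ = contradiction refl B≢O
    archimedean-lg A@(aff x₁ y₁) B@(aff x₂ y₂) h₁ h₂ _ _ A-B≢O = begin
      lg (suc (size A)) ⊓ lg (suc (size B)) ≤⟨ min≤ ⟩
      lg (suc T)                            ≤⟨ lg-mono (ℕ.≤-trans (s≤s T≤) (ℕ.+-monoˡ-≤ _ (ℕ.m^n>0 (height R) {{ℕ.>-nonZero (1≤height R)}} 2))) ⟩
      lg (suc C * height R ^ 2)             ≤⟨ lg-* (suc C) (height R ^ 2) ⟩
      lg (suc C) + lg (height R ^ 2)        ≤⟨ ℕ.+-monoʳ-≤ (lg (suc C)) (lg-^ (height R) 2) ⟩
      lg (suc C) + 2 * h R                  ∎
      where
      open ℕ.≤-Reasoning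
      R : Pt
      R = sub E A B
      C T : ℕ
      C = archimedean-constant E
      T = size A ⊓ size B
      T≤ : T ≤ C * height R ^ 2
      T≤ = archimedean E {x₁} {y₁} {x₂} {y₂} h₁ h₂ (ℕ.≤-trans (ℕ.*-monoˡ-≤ (↧ₙ x₁) (ℕ.m⊓n≤m (size A) (size B))) (size-bound x₁))
                                                   (ℕ.≤-trans (ℕ.*-monoˡ-≤ (↧ₙ x₂) (ℕ.m⊓n≤n (size A) (size B))) (size-bound x₂)) A-B≢O
      min≤ : lg (suc (size A)) ⊓ lg (suc (size B)) ≤ lg (suc T)
      min≤ = Sum.[ (λ e → ℕ.≤-trans (ℕ.m⊓n≤m _ _) (ℕ.≤-reflexive (cong (λ t → lg (suc t)) (sym e))))
                 , (λ e → ℕ.≤-trans (ℕ.m⊓n≤n _ _) (ℕ.≤-reflexive (cong (λ t → lg (suc t)) (sym e)))) ]′ (ℕ.⊓-sel (size A) (size B))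

-- Quadratic growth of heights along multiples and translates

module Growth where

  open import Defs
  open GroupLaw
  open Denominators
  open Heights
  open Archimedean
  open LogHeights
  open BinaryLog
  open CollinearTriples using (curve-±)
  open import Data.Nat as ℕ using (ℕ; zero; suc; _≤_; _<_; z≤n; s≤s; _+_; _*_; _^_; _∸_; _≤?_)
  import Data.Nat.Properties as ℕ
  open import Data.Nat.DivMod using (_/_; _%_; m≡m%n+[m/n]*n; m%n<n)
  open import Data.Nat.Divisibility using (_∣_)
  open import Data.Nat.Tactic.RingSolver using (solve-∀)
  open import Data.Integer as ℤ using (ℤ; +_; -[1+_]; ∣_∣)
  open import Data.Rational as ℚ using (ℚ; 0ℚ; ↥_; ↧ₙ_)
  import Data.Rational.Properties as ℚ
  open import Data.Fin as Fin using (Fin; toℕ; fromℕ<; combine)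
  import Data.Fin.Properties as Fin
  open import Data.Product using (_,_; _×_; ∃; ∃₂; proj₁; proj₂)
  open import Data.Sum as Sum using (_⊎_; inj₁; inj₂)
  open import Relation.Nullary using (Dec; yes; no; contradiction; ¬_)
  open import Relation.Binary.PropositionalEquality

  sum-below : (ℕ → ℕ) → ℕ → ℕ
  sum-below f zero = 0
  sum-below f (suc n) = f n + sum-below f n

  ≤-sum-below : ∀ f {i n} → i < n → f i ≤ sum-below f n
  ≤-sum-below f {i} {suc n} i<1+n with ℕ.m≤n⇒m<n∨m≡n (ℕ.≤-pred i<1+n)
  ... | inj₁ i<n = ℕ.≤-trans (≤-sum-below f i<n) (ℕ.m≤n+m _ (f n))
  ... | inj₂ refl = ℕ.m≤m+n (f n) _

  module _ (f : ℕ → ℕ) (convex : ∀ j → 2 * f (suc j) + 1 ≤ f (suc (suc j)) + f j) where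

    private
      slope : ∀ j → f j + f 1 + j ≤ f (suc j) + f 0
      slope zero = ℕ.≤-reflexive (trans (ℕ.+-identityʳ _) (ℕ.+-comm (f 0) (f 1)))
      slope (suc j) = ℕ.+-cancelʳ-≤ (f j + f (suc j)) _ _ (begin
        (f (suc j) + f 1 + suc j) + (f j + f (suc j))      ≡⟨ lemma₁ (f j) (f 1) j (f (suc j)) ⟩
        (2 * f (suc j) + 1) + (f j + f 1 + j)              ≤⟨ ℕ.+-mono-≤ (convex j) (slope j) ⟩
        (f (suc (suc j)) + f j) + (f (suc j) + f 0)        ≡⟨ lemma₂ (f (suc (suc j))) (f j) (f (suc j)) (f 0) ⟩
        (f (suc (suc j)) + f 0) + (f j + f (suc j))        ∎)
        where
        open ℕ.≤-Reasoning
        lemma₁ : ∀ a b j c → (c + b + (1 + j)) + (a + c) ≡ (2 * c + 1) + (a + b + j)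
        lemma₁ = solve-∀
        lemma₂ : ∀ a b c d → (a + b) + (c + d) ≡ (a + d) + (b + c)
        lemma₂ = solve-∀

    -- Summing second differences of at least 1 twice gives `j (j - 1) / 2`. To stay in ℕ, the loss
    -- due to the initial value is moved to the right.
    convex-growth : ∀ j → j * j ≤ 2 * f j + j * (2 * f 0 + 1)
    convex-growth zero = z≤n
    convex-growth (suc j) = begin
      suc j * suc j                                    ≡⟨ lemma₁ j ⟩
      j * j + (2 * j + 1)                              ≤⟨ ℕ.+-monoˡ-≤ _ (convex-growth j) ⟩
      2 * f j + j * (2 * f 0 + 1) + (2 * j + 1)        ≤⟨ ℕ.m≤m+n _ (2 * f 1) ⟩
      2 * f j + j * (2 * f 0 + 1) + (2 * j + 1) + 2 * f 1 ≡⟨ lemma₂ (f j) j (f 0) (f 1) ⟩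
      2 * (f j + f 1 + j) + (j * (2 * f 0 + 1) + 1)    ≤⟨ ℕ.+-monoˡ-≤ _ (ℕ.*-monoʳ-≤ 2 (slope j)) ⟩
      2 * (f (suc j) + f 0) + (j * (2 * f 0 + 1) + 1)  ≡⟨ lemma₃ (f (suc j)) j (f 0) ⟩
      2 * f (suc j) + suc j * (2 * f 0 + 1)            ∎
      where
      open ℕ.≤-Reasoning
      lemma₁ : ∀ j → (1 + j) * (1 + j) ≡ j * j + (2 * j + 1)
      lemma₁ = solve-∀
      lemma₂ : ∀ a j z b → 2 * a + j * (2 * z + 1) + (2 * j + 1) + 2 * b ≡ 2 * (a + b + j) + (j * (2 * z + 1) + 1)
      lemma₂ = solve-∀
      lemma₃ : ∀ a j z → 2 * (a + z) + (j * (2 * z + 1) + 1) ≡ 2 * a + (1 + j) * (2 * z + 1)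
      lemma₃ = solve-∀

  -- Either `2w` is at most `j` and the linear term is at most half of `j²`, or `j²` is bounded by
  -- `4w²` outright.
  absorb-linear : ∀ {j u w} → j * j ≤ 2 * u + j * w → j * j ≤ 4 * u + 4 * (w * w)
  absorb-linear {j} {u} {w} h with 2 * w ≤? j
  ... | no ¬p = ℕ.≤-trans (ℕ.*-mono-≤ (ℕ.<⇒≤ (ℕ.≰⇒> ¬p)) (ℕ.<⇒≤ (ℕ.≰⇒> ¬p))) (ℕ.≤-trans (ℕ.≤-reflexive (lemma w)) (ℕ.m≤n+m _ (4 * u)))
    where
    lemma : ∀ w → 2 * w * (2 * w) ≡ 4 * (w * w)
    lemma = solve-∀
  ... | yes p = ℕ.≤-trans (ℕ.+-cancelʳ-≤ (j * j) _ _ (begin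
      j * j + j * j            ≡⟨ lemma₁ j ⟩
      2 * (j * j)              ≤⟨ ℕ.*-monoʳ-≤ 2 h ⟩
      2 * (2 * u + j * w)      ≡⟨ lemma₂ u j w ⟩
      4 * u + j * (2 * w)      ≤⟨ ℕ.+-monoʳ-≤ (4 * u) (ℕ.*-monoʳ-≤ j p) ⟩
      4 * u + j * j            ∎)) (ℕ.m≤m+n (4 * u) _)
    where
    open ℕ.≤-Reasoning
    lemma₁ : ∀ j → j * j + j * j ≡ 2 * (j * j)
    lemma₁ = solve-∀
    lemma₂ : ∀ u j w → 2 * (2 * u + j * w) ≡ 4 * u + j * (2 * w)
    lemma₂ = solve-∀

  -- Along each residue class modulo `m` the function is convex with second differences at least 1.
  quadratic-growth : ∀ (f : ℕ → ℕ) m → 1 ≤ m → (∀ n → 2 * f (m + n) + 1 ≤ f (m + (m + n)) + f n) →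
    ∃ λ κ → ∀ n → n * n ≤ κ * (f n + 1)
  quadratic-growth f m@(suc _) 1≤m convex = m * m * (8 * (W * W) + 10) , bound
    where
    -- Bounds `2 * f r + 1` for every residue `r` below `m`, so one constant serves all classes.
    W : ℕ
    W = 2 * sum-below f m + 1
    bound : ∀ n → n * n ≤ m * m * (8 * (W * W) + 10) * (f n + 1)
    bound n = begin
      n * n                                        ≤⟨ ℕ.*-mono-≤ n≤ n≤ ⟩
      m * suc j * (m * suc j)                      ≡⟨ lemma₁ m j ⟩
      m * m * (j * j + (2 * j + 1))                ≤⟨ ℕ.*-monoʳ-≤ (m * m) (ℕ.+-monoʳ-≤ (j * j) (ℕ.+-monoˡ-≤ 1 2j≤)) ⟩
      m * m * (j * j + (j * j + 1 + 1))            ≡⟨ cong (m * m *_) (lemma₂ (j * j)) ⟩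
      m * m * (2 * (j * j) + 2)                    ≤⟨ ℕ.*-monoʳ-≤ (m * m) (ℕ.+-monoˡ-≤ 2 (ℕ.*-monoʳ-≤ 2 j²≤)) ⟩
      m * m * (2 * (4 * f n + 4 * (W * W)) + 2)    ≤⟨ ℕ.*-monoʳ-≤ (m * m) (ℕ.m≤m+n _ (8 * (W * W) * f n + 2 * f n + 8)) ⟩
      m * m * (2 * (4 * f n + 4 * (W * W)) + 2 + (8 * (W * W) * f n + 2 * f n + 8)) ≡⟨ lemma₃ (m * m) (f n) (W * W) ⟩
      m * m * (8 * (W * W) + 10) * (f n + 1)       ∎
      where
      open ℕ.≤-Reasoning
      r j : ℕ
      r = n % m
      j = n / m
      u : ℕ → ℕ
      u i = f (i * m + r)
      shift : ∀ i → suc i * m + r ≡ m + (i * m + r)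
      shift i = ℕ.+-assoc m (i * m) r
      u-convex : ∀ i → 2 * u (suc i) + 1 ≤ u (suc (suc i)) + u i
      u-convex i = subst₂ (λ p q → 2 * f p + 1 ≤ f q + u i) (sym (shift i)) (sym (trans (shift (suc i)) (cong (λ p → m + p) (shift i)))) (convex (i * m + r))
      n≡ : j * m + r ≡ n
      n≡ = trans (ℕ.+-comm (j * m) r) (sym (m≡m%n+[m/n]*n n m))
      r<m : r < m
      r<m = m%n<n n m
      n≤ : n ≤ m * suc j
      n≤ = ℕ.≤-trans (ℕ.≤-reflexive (sym n≡)) (ℕ.≤-trans (ℕ.+-monoʳ-≤ (j * m) (ℕ.<⇒≤ r<m)) (ℕ.≤-reflexive (lemma j m)))
        where
        lemma : ∀ j m → j * m + m ≡ m * (1 + j)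
        lemma = solve-∀
      j²≤ : j * j ≤ 4 * f n + 4 * (W * W)
      j²≤ = absorb-linear {j} {f n} (subst (λ p → j * j ≤ 2 * f p + j * W) n≡ (ℕ.≤-trans (convex-growth u u-convex j)
        (ℕ.+-monoʳ-≤ (2 * u j) (ℕ.*-monoʳ-≤ j (ℕ.+-monoˡ-≤ 1 (ℕ.*-monoʳ-≤ 2 (≤-sum-below f r<m)))))))
      2j≤ : 2 * j ≤ j * j + 1
      2j≤ = go j
        where
        go : ∀ j → 2 * j ≤ j * j + 1
        go zero = z≤n
        go (suc i) = ℕ.≤-trans (ℕ.m≤m+n (2 * suc i) (i * i)) (ℕ.≤-reflexive (lemma i))
          where
          lemma : ∀ i → 2 * (1 + i) + i * i ≡ (1 + i) * (1 + i) + 1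
          lemma = solve-∀
      lemma₁ : ∀ m j → m * (1 + j) * (m * (1 + j)) ≡ m * m * (j * j + (2 * j + 1))
      lemma₁ = solve-∀
      lemma₂ : ∀ q → q + (q + 1 + 1) ≡ 2 * q + 2
      lemma₂ = solve-∀
      lemma₃ : ∀ m f w → m * (2 * (4 * f + 4 * w) + 2 + (8 * w * f + 2 * f + 8)) ≡ m * (8 * w + 10) * (f + 1)
      lemma₃ = solve-∀

  private
    -- The increments grow by at most `K` per step. The condition at 0 is what permits a purely
    -- quadratic bound, with no constant term.
    concave-growth : ∀ (f : ℕ → ℕ) K → f 0 ≡ 0 → (∀ m → f (suc (suc m)) + f m ≤ 2 * f (suc m) + K) → ∀ m → f m ≤ (f 1 + K) * (m * m)
    concave-growth f K f0 concave zero = subst (_≤ (f 1 + K) * 0) (sym f0) z≤n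
    concave-growth f K f0 concave (suc m) = begin
      f (suc m)                                ≤⟨ step m ⟩
      f m + (f 1 + m * K)                      ≤⟨ ℕ.+-monoˡ-≤ _ (concave-growth f K f0 concave m) ⟩
      (f 1 + K) * (m * m) + (f 1 + m * K)      ≤⟨ ℕ.m≤m+n _ (2 * m * f 1 + m * K + K) ⟩
      (f 1 + K) * (m * m) + (f 1 + m * K) + (2 * m * f 1 + m * K + K) ≡⟨ lemma (f 1) K m ⟩
      (f 1 + K) * (suc m * suc m)              ∎
      where
      open ℕ.≤-Reasoning
      lemma : ∀ a K m → (a + K) * (m * m) + (a + m * K) + (2 * m * a + m * K + K) ≡ (a + K) * ((1 + m) * (1 + m))
      lemma = solve-∀
      step : ∀ m → f (suc m) ≤ f m + (f 1 + m * K)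
      step zero = ℕ.≤-trans (ℕ.m≤m+n (f 1) 0) (ℕ.m≤n+m _ (f 0))
      step (suc m) = ℕ.+-cancelʳ-≤ (f m) _ _ (begin
        f (suc (suc m)) + f m                  ≤⟨ concave m ⟩
        2 * f (suc m) + K                      ≡⟨ lemma₁ (f (suc m)) K ⟩
        f (suc m) + (f (suc m) + K)            ≤⟨ ℕ.+-monoʳ-≤ (f (suc m)) (ℕ.+-monoˡ-≤ K (step m)) ⟩
        f (suc m) + (f m + (f 1 + m * K) + K)  ≡⟨ lemma₂ (f (suc m)) (f m) (f 1) m K ⟩
        f (suc m) + (f 1 + suc m * K) + f m    ∎)
        where
        lemma₁ : ∀ a K → 2 * a + K ≡ a + (a + K)
        lemma₁ = solve-∀
        lemma₂ : ∀ a b c m K → a + (b + (c + m * K) + K) ≡ a + (c + (1 + m) * K) + b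
        lemma₂ = solve-∀

  module Orbit (E : Curve) (P : Pt) (hP : OnCurve E P) (nontorsion : NonTorsion E P) where

    infix 25 _·P
    _·P : ℕ → Pt
    m ·P = mul E m P

    on : ∀ m → OnCurve E (m ·P)
    on m = mul-on E {P} m hP

    multiples-upper : ∃ λ K → ∀ m → h (m ·P) ≤ K * (m * m)
    multiples-upper = h (1 ·P) + K , concave-growth (λ m → h (m ·P)) K h-O concave
      where
      K : ℕ
      K = 2 * h P + parallelogram-constant E
      concave : ∀ m → h (suc (suc m) ·P) + h (m ·P) ≤ 2 * h (suc m ·P) + K
      concave m = ℕ.≤-trans (ℕ.≤-reflexive (cong₂ (λ R S → h R + h S) (add-comm E P (suc m ·P) hP (on (suc m))) (sym difference)))
        (ℕ.≤-trans (parallelogram-upper E (suc m ·P) P (on (suc m)) hP) (ℕ.≤-reflexive (ℕ.+-assoc (2 * h (suc m ·P)) _ _)))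
        where
        difference : sub E (suc m ·P) P ≡ m ·P
        difference = trans (cong (λ R → sub E R P) (add-comm E P (m ·P) hP (on m))) (add-sub E (m ·P) P (on m) hP)

    distinct : ∀ i d → i ·P ≢ (suc d + i) ·P
    distinct i d e = nontorsion d (trans (sym (add-sub E (suc d ·P) (i ·P) (on (suc d)) (on i)))
      (trans (cong (λ R → sub E R (i ·P)) (trans (sym (mul-+ E {P} (suc d) i hP)) (sym e))) (add-inverseʳ E (i ·P))))

    not-opposite : ∀ i j → suc i ·P ≢ opposite (j ·P)
    not-opposite i j e = nontorsion (i + j) (trans (mul-+ E {P} (suc i) j hP) (trans (cong (add E (suc i ·P)) (trans (sym (opposite-involutive (j ·P))) (cong opposite (sym e))))
      (add-inverseʳ E (suc i ·P))))

    private
      sign : ℤ → Fin 2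
      sign (+ _) = Fin.zero
      sign -[1+ _ ] = Fin.suc Fin.zero

      sign-abs : ∀ {i j} → sign i ≡ sign j → ∣ i ∣ ≡ ∣ j ∣ → i ≡ j
      sign-abs {+ _} {+ _} _ refl = refl
      sign-abs { -[1+ _ ]} { -[1+ _ ]} _ refl = refl

      same-abscissa : ∀ A B → OnCurve E A → OnCurve E B → A ≢ O → B ≢ O → ↥ xcoord A ≡ ↥ xcoord B → ↧ₙ xcoord A ≡ ↧ₙ xcoord B → A ≡ B ⊎ A ≡ opposite B
      same-abscissa O _ _ _ A≢O _ _ _ = contradiction refl A≢O
      same-abscissa (aff _ _) O _ _ _ B≢O _ _ = contradiction refl B≢O
      same-abscissa (aff x₁ y₁) (aff x₂ y₂) h₁ h₂ _ _ n= d= = by x= (curve-± {ℤ→ℚ (a E)} {ℤ→ℚ (b E)} {x₁} h₁ h₂ x=)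
        where
        x= : x₁ ≡ x₂
        x= = ℚ.≃⇒≡ (ℚ.*≡* (cong₂ ℤ._*_ n= (cong +_ (sym d=))))
        by : x₁ ≡ x₂ → y₁ ≡ y₂ ⊎ y₁ ℚ.+ y₂ ≡ 0ℚ → aff x₁ y₁ ≡ aff x₂ y₂ ⊎ aff x₁ y₁ ≡ opposite (aff x₂ y₂)
        by refl (inj₁ refl) = inj₁ refl
        by refl (inj₂ q) = inj₂ (cong (aff x₁) (sym (neg-unique q)))

      abs≤height : ∀ A → ∣ ↥ xcoord A ∣ ≤ height A × ↧ₙ xcoord A ≤ height A
      abs≤height O = z≤n , s≤s z≤n
      abs≤height (aff x _) = ℕ.m≤m⊔n _ _ , ℕ.m≤n⊔m _ _

    -- Northcott's pigeonhole principle.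
    large-multiple : ∀ B → ∃ λ m → 1 ≤ m × B < h (m ·P)
    large-multiple B = find (Fin.any? (λ i → B ℕ.<? h (suc (toℕ i) ·P)))
      where
      Y N : ℕ
      Y = suc (2 ^ B)
      -- One more than the number of triples of sign, numerator and denominator below `Y`. The
      -- positive multiples are pairwise neither equal nor opposite, so their abscissae are
      -- distinct.
      N = suc (2 * (Y * Y))
      find : Dec (∃ λ (i : Fin N) → B < h (suc (toℕ i) ·P)) → ∃ λ m → 1 ≤ m × B < h (m ·P)
      find (yes (i , B<)) = suc (toℕ i) , s≤s z≤n , B<
      find (no none) = contradiction (Fin.pigeonhole (ℕ.n<1+n (2 * (Y * Y))) code) absurd
        where
        x : Fin N → ℚ
        x i = xcoord (suc (toℕ i) ·P)
        small : ∀ i → height (suc (toℕ i) ·P) < Y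
        small i = s≤s (ℕ.≤-trans (≤2^lg _) (ℕ.^-monoʳ-≤ 2 (ℕ.≮⇒≥ (λ B< → none (i , B<)))))
        n<Y : ∀ i → ∣ ↥ x i ∣ < Y
        n<Y i = ℕ.≤-<-trans (proj₁ (abs≤height (suc (toℕ i) ·P))) (small i)
        d<Y : ∀ i → ↧ₙ x i < Y
        d<Y i = ℕ.≤-<-trans (proj₂ (abs≤height (suc (toℕ i) ·P))) (small i)
        code : Fin N → Fin (2 * (Y * Y))
        code i = combine (sign (↥ x i)) (combine (fromℕ< (n<Y i)) (fromℕ< (d<Y i)))
        same : ∀ i j → toℕ i < toℕ j → ↥ x i ≡ ↥ x j → ↧ₙ x i ≡ ↧ₙ x j → _
        same i j i<j n= d= = Sum.[ equal , not-opposite (toℕ i) (suc (toℕ j)) ]′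
            (same-abscissa (suc (toℕ i) ·P) (suc (toℕ j) ·P) (on (suc (toℕ i))) (on (suc (toℕ j))) (nontorsion (toℕ i)) (nontorsion (toℕ j)) n= d=)
          where
          equal : suc (toℕ i) ·P ≢ suc (toℕ j) ·P
          equal e = distinct (suc (toℕ i)) (toℕ j ∸ suc (toℕ i)) (trans e (cong _·P (sym (trans (sym (ℕ.+-suc (toℕ j ∸ suc (toℕ i)) (suc (toℕ i)))) (trans (ℕ.+-suc (toℕ j ∸ suc (toℕ i)) (suc (toℕ i))) (cong suc (ℕ.m∸n+n≡m i<j)))))))
        absurd : ¬ (∃₂ λ i j → i Fin.< j × code i ≡ code j)
        absurd (i , j , i<j , e) with Fin.combine-injective (sign (↥ x i)) _ (sign (↥ x j)) _ e
        ... | s= , e′ with Fin.combine-injective (fromℕ< (n<Y i)) _ (fromℕ< (n<Y j)) _ e′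
        ...   | n= , d= = same i j i<j (sign-abs s= (Fin.fromℕ<-injective _ _ (n<Y i) (n<Y j) n=)) (Fin.fromℕ<-injective _ _ (d<Y i) (d<Y j) d=)

    module Translates (Q : Pt) (hQ : OnCurve E Q) where

      R : ℕ → Pt
      R n = add E (n ·P) Q

      on-R : ∀ n → OnCurve E (R n)
      on-R n = add-on E (n ·P) Q (on n) hQ

      R-+ : ∀ m n → R (m + n) ≡ add E (m ·P) (R n)
      R-+ m n = translate E {P} {Q} m n hP hQ

      R-sub : ∀ m n → sub E (R (m + n)) (R n) ≡ m ·P
      R-sub m n = trans (cong (λ S → sub E S (R n)) (R-+ m n)) (add-sub E (m ·P) (R n) (on m) (on-R n))

      -- Once the height of `m ·P` exceeds the error of the parallelogram law, the heights of the
      -- translates have second differences at least 1 along steps of `m`.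
      translates-lower : ∃ λ κ → ∀ n → n * n ≤ κ * (h (R n) + 1)
      translates-lower = by (large-multiple (lower-constant E))
        where
        by : (∃ λ m → 1 ≤ m × lower-constant E < h (m ·P)) → ∃ λ κ → ∀ n → n * n ≤ κ * (h (R n) + 1)
        by (m , 1≤m , large) = quadratic-growth (λ n → h (R n)) m 1≤m convex
          where
          convex : ∀ n → 2 * h (R (m + n)) + 1 ≤ h (R (m + (m + n))) + h (R n)
          convex n = ℕ.+-cancelʳ-≤ (lower-constant E) _ _ (begin
            2 * h (R (m + n)) + 1 + lower-constant E                 ≡⟨ ℕ.+-assoc (2 * h (R (m + n))) 1 _ ⟩
            2 * h (R (m + n)) + suc (lower-constant E)               ≤⟨ ℕ.+-monoʳ-≤ (2 * h (R (m + n))) (ℕ.≤-trans large (ℕ.m≤m+n (h (m ·P)) _)) ⟩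
            2 * h (R (m + n)) + 2 * h (m ·P)                         ≤⟨ parallelogram-lower E (R (m + n)) (m ·P) (on-R (m + n)) (on m) ⟩
            h (add E (R (m + n)) (m ·P)) + h (sub E (R (m + n)) (m ·P)) + lower-constant E ≡⟨ cong₂ (λ S T → h S + h T + lower-constant E) sum difference ⟩
            h (R (m + (m + n))) + h (R n) + lower-constant E         ∎)
            where
            open ℕ.≤-Reasoning
            sum : add E (R (m + n)) (m ·P) ≡ R (m + (m + n))
            sum = trans (add-comm E (R (m + n)) (m ·P) (on-R (m + n)) (on m)) (sym (R-+ m (m + n)))
            difference : sub E (R (m + n)) (m ·P) ≡ R n
            difference = trans (cong (λ S → sub E S (m ·P)) (trans (R-+ m n) (add-comm E (m ·P) (R n) (on m) (on-R n)))) (add-sub E (R n) (m ·P) (on-R n) (on m))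

-- Counting points supported at few places

module SmoothCount where

  open import Data.Nat
  open import Data.Nat.Properties
  open import Data.Nat.Tactic.RingSolver using (solve-∀)
  open import Data.List using (List; []; _∷_; _++_; length; filter)
  open import Data.List.Properties using (filter-++; length-++)
  open import Data.List.Membership.Propositional using (_∈_)
  open import Data.List.Relation.Unary.Any using (here; there)
  open import Data.Product using (_,_; _×_; ∃)
  open import Data.Sum using (_⊎_; inj₁; inj₂; [_,_]′)
  open import Relation.Nullary using (yes; no; contradiction)
  open import Relation.Unary using (Decidable)
  open import Relation.Binary.PropositionalEquality

  range : ℕ → ℕ → List ℕ
  range x zero = []
  range x (suc n) = x ∷ range (suc x) n

  range-+ : ∀ x m n → range x (m + n) ≡ range x m ++ range (x + m) n
  range-+ x zero n = cong (λ y → range y n) (sym (+-identityʳ x))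
  range-+ x (suc m) n = cong (x ∷_) (trans (range-+ (suc x) m n) (cong (λ y → range (suc x) m ++ range y n) (sym (+-suc x m))))

  ∈-range : ∀ {x n y} → x ≤ y → y < x + n → y ∈ range x n
  ∈-range {x} {zero} x≤y y< = contradiction (subst (_ <_) (+-identityʳ x) y<) (≤⇒≯ x≤y)
  ∈-range {x} {suc n} {y} x≤y y< with m≤n⇒m<n∨m≡n x≤y
  ... | inj₁ x<y = there (∈-range x<y (subst (y <_) (+-suc x n) y<))
  ... | inj₂ refl = here refl

  range-bounds : ∀ {x n y} → y ∈ range x n → x ≤ y × y < x + n
  range-bounds {x} {suc n} (here refl) = ≤-refl , m<m+n x (s≤s z≤n)
  range-bounds {x} {suc n} {y} (there h) with range-bounds h
  ... | x<y , y< = <⇒≤ x<y , subst (y <_) (sym (+-suc x n)) y<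

  length-range : ∀ x n → length (range x n) ≡ n
  length-range x zero = refl
  length-range x (suc n) = cong suc (length-range (suc x) n)

  sum-range : (ℕ → ℕ) → ℕ → ℕ → ℕ
  sum-range g x zero = 0
  sum-range g x (suc n) = g x + sum-range g (suc x) n

  sum-range-+ : ∀ g x m n → sum-range g x (m + n) ≡ sum-range g x m + sum-range g (x + m) n
  sum-range-+ g x zero n = cong (λ y → sum-range g y n) (sym (+-identityʳ x))
  sum-range-+ g x (suc m) n = trans (cong (g x +_) (trans (sum-range-+ g (suc x) m n) (cong (λ y → sum-range g (suc x) m + sum-range g y n) (sym (+-suc x m)))))
    (sym (+-assoc (g x) _ _))

  sum-range-add : ∀ f g x n → sum-range (λ i → f i + g i) x n ≡ sum-range f x n + sum-range g x n
  sum-range-add f g x zero = refl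
  sum-range-add f g x (suc n) = trans (cong (f x + g x +_) (sum-range-add f g (suc x) n)) (lemma (f x) (g x) _ _)
    where
    lemma : ∀ a b c d → a + b + (c + d) ≡ (a + c) + (b + d)
    lemma = solve-∀

  sum-over : {A : Set} → List A → (A → ℕ) → ℕ
  sum-over [] f = 0
  sum-over (a ∷ as) f = f a + sum-over as f

  sum-swap : {A : Set} (as : List A) (g : A → ℕ → ℕ) → ∀ x n B → (∀ a → sum-range (g a) x n ≤ B) →
    sum-range (λ i → sum-over as (λ a → g a i)) x n ≤ length as * B
  sum-swap [] g x n B h = ≤-reflexive (zeros x n)
    where
    zeros : ∀ x n → sum-range (λ _ → 0) x n ≡ 0
    zeros x zero = refl
    zeros x (suc n) = zeros (suc x) n
  sum-swap (a ∷ as) g x n B h = ≤-trans (≤-reflexive (sum-range-add (g a) (λ i → sum-over as (λ a → g a i)) x n)) (+-mono-≤ (h a) (sum-swap as g x n B h))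

  module _ {P : ℕ → Set} (P? : Decidable P) where

    count : ℕ → ℕ → ℕ
    count x n = length (filter P? (range x n))

    count-+ : ∀ x m n → count x (m + n) ≡ count x m + count (x + m) n
    count-+ x m n = trans (cong (λ l → length (filter P? l)) (range-+ x m n))
      (trans (cong length (filter-++ P? (range x m) (range (x + m) n))) (length-++ (filter P? (range x m))))

    count≤ : ∀ x n → count x n ≤ n
    count≤ x zero = z≤n
    count≤ x (suc n) with P? x
    ... | yes _ = s≤s (count≤ (suc x) n)
    ... | no _ = m≤n⇒m≤1+n (count≤ (suc x) n)

    count-markov : ∀ (g : ℕ → ℕ) h x n → (∀ i → x ≤ i → P i → h ≤ g i) → count x n * h ≤ sum-range g x n
    count-markov g h x zero _ = z≤n
    count-markov g h x (suc n) H with P? x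
    ... | yes p = +-mono-≤ (H x ≤-refl p) (count-markov g h (suc x) n (λ i x<i → H i (<⇒≤ x<i)))
    ... | no _ = ≤-trans (count-markov g h (suc x) n (λ i x<i → H i (<⇒≤ x<i))) (m≤n+m _ (g x))

  -- Of two values at distance d one is at most c d². Splitting an interval into halves,
  -- all values but the largest one sum to at most 2 c times the square of its length.
  dyadic-sum : ∀ (g : ℕ → ℕ) c → (∀ i d → g i ⊓ g (suc d + i) ≤ c * (suc d * suc d)) →
    ∀ k x → ∃ λ y → x ≤ y × y < x + 2 ^ k × sum-range g x (2 ^ k) ≤ g y + 2 * c * (2 ^ k * 2 ^ k)
  dyadic-sum g c sep zero x = x , ≤-refl , m<m+n x (s≤s z≤n) , ≤-trans (≤-reflexive (+-identityʳ (g x))) (m≤m+n (g x) _)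
  dyadic-sum g c sep (suc k) x with dyadic-sum g c sep k x | dyadic-sum g c sep k (x + 2 ^ k)
  ... | y₁ , x≤y₁ , y₁< , s₁ | y₂ , ≤y₂ , y₂< , s₂ = choose (⊔-sel (g y₁) (g y₂))
    where
    open ≤-Reasoning
    L : ℕ
    L = 2 ^ k
    d : ℕ
    d = y₂ ∸ suc y₁
    y₁<y₂ : y₁ < y₂
    y₁<y₂ = <-≤-trans y₁< ≤y₂
    d≡ : suc d + y₁ ≡ y₂
    d≡ = trans (sym (+-suc d y₁)) (m∸n+n≡m y₁<y₂)
    2L : x + 2 ^ suc k ≡ x + L + L
    2L = lemma x L
      where
      lemma : ∀ x L → x + 2 * L ≡ x + L + L
      lemma = solve-∀
    d≤ : suc d ≤ L + L
    d≤ = +-cancelʳ-≤ y₁ (suc d) (L + L) (begin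
      suc d + y₁      ≡⟨ d≡ ⟩
      y₂              ≤⟨ <⇒≤ y₂< ⟩
      x + L + L       ≤⟨ +-monoˡ-≤ L (+-monoˡ-≤ L x≤y₁) ⟩
      y₁ + L + L      ≡⟨ lemma y₁ L ⟩
      L + L + y₁      ∎)
      where
      lemma : ∀ y L → y + L + L ≡ L + L + y
      lemma = solve-∀
    min≤ : g y₁ ⊓ g y₂ ≤ c * ((L + L) * (L + L))
    min≤ = ≤-trans (subst (λ z → g y₁ ⊓ g z ≤ c * (suc d * suc d)) d≡ (sep y₁ d)) (*-monoʳ-≤ c (*-mono-≤ d≤ d≤))
    -- The errors of the two halves make `4 c L²`, and the smaller of the two exceptional values
    -- adds at most `c (2L)²`; together this is `2 c (2L)²`, which fixes the constant 2.
    total : sum-range g x (2 ^ suc k) ≤ (g y₁ ⊔ g y₂) + 2 * c * (2 ^ suc k * 2 ^ suc k)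
    total = begin
      sum-range g x (2 * L)                            ≡⟨ cong (λ n → sum-range g x (L + n)) (+-identityʳ L) ⟩
      sum-range g x (L + L)                            ≡⟨ sum-range-+ g x L L ⟩
      sum-range g x L + sum-range g (x + L) L          ≤⟨ +-mono-≤ s₁ s₂ ⟩
      (g y₁ + 2 * c * (L * L)) + (g y₂ + 2 * c * (L * L)) ≡⟨ lemma₁ (g y₁) (g y₂) c L ⟩
      (g y₁ + g y₂) + 4 * c * (L * L)                  ≡⟨ cong (_+ 4 * c * (L * L)) (min+max (g y₁) (g y₂)) ⟩
      (g y₁ ⊔ g y₂) + (g y₁ ⊓ g y₂) + 4 * c * (L * L)  ≤⟨ +-monoˡ-≤ (4 * c * (L * L)) (+-monoʳ-≤ (g y₁ ⊔ g y₂) min≤) ⟩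
      (g y₁ ⊔ g y₂) + c * ((L + L) * (L + L)) + 4 * c * (L * L) ≡⟨ lemma₂ (g y₁ ⊔ g y₂) c L ⟩
      (g y₁ ⊔ g y₂) + 2 * c * (2 * L * (2 * L))        ∎
      where
      lemma₁ : ∀ a b c L → (a + 2 * c * (L * L)) + (b + 2 * c * (L * L)) ≡ (a + b) + 4 * c * (L * L)
      lemma₁ = solve-∀
      lemma₂ : ∀ m c L → m + c * ((L + L) * (L + L)) + 4 * c * (L * L) ≡ m + 2 * c * (2 * L * (2 * L))
      lemma₂ = solve-∀
      min+max : ∀ a b → a + b ≡ (a ⊔ b) + (a ⊓ b)
      min+max a b = [ (λ a≤b → trans (+-comm a b) (cong₂ _+_ (sym (m≤n⇒m⊔n≡n a≤b)) (sym (m≤n⇒m⊓n≡m a≤b))))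
                    , (λ b≤a → cong₂ _+_ (sym (m≥n⇒m⊔n≡m b≤a)) (sym (m≥n⇒m⊓n≡n b≤a))) ]′ (≤-total a b)
    choose : g y₁ ⊔ g y₂ ≡ g y₁ ⊎ g y₁ ⊔ g y₂ ≡ g y₂ → _
    choose (inj₁ e) = y₁ , x≤y₁ , <-≤-trans y₁< (≤-trans (m≤m+n (x + L) L) (≤-reflexive (sym 2L))) ,
      subst (λ z → sum-range g x (2 ^ suc k) ≤ z + 2 * c * (2 ^ suc k * 2 ^ suc k)) e total
    choose (inj₂ e) = y₂ , ≤-trans (m≤m+n x L) ≤y₂ , subst (y₂ <_) (sym 2L) y₂< ,
      subst (λ z → sum-range g x (2 ^ suc k) ≤ z + 2 * c * (2 ^ suc k * 2 ^ suc k)) e total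

  -- Either some term alone reaches `h` and keeps the full value `h`, or no term is changed by the
  -- truncation.
  sum-over-⊓ : ∀ {A : Set} (as : List A) (f : A → ℕ) h → h ≤ sum-over as f → h ≤ sum-over as (λ a → f a ⊓ h)
  sum-over-⊓ [] f h p = p
  sum-over-⊓ (a ∷ as) f h p with ≤-total (f a) h
  ... | inj₂ h≤f = ≤-trans (≤-reflexive (sym (m≥n⇒m⊓n≡n h≤f))) (m≤m+n (f a ⊓ h) _)
  ... | inj₁ f≤h = ≤-trans (m≤n+m∸n h (f a)) (+-mono-≤ (≤-reflexive (sym (m≤n⇒m⊓n≡m f≤h)))
          (≤-trans (sum-over-⊓ as f (h ∸ f a) (m≤n+o⇒m∸n≤o h (f a) p)) (mono as)))
    where
    mono : ∀ as → sum-over as (λ b → f b ⊓ (h ∸ f a)) ≤ sum-over as (λ b → f b ⊓ h)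
    mono [] = z≤n
    mono (b ∷ as) = +-mono-≤ (⊓-monoʳ-≤ (f b) (m∸n≤m h (f a))) (mono as)

  sum-over-*ˡ : ∀ {A : Set} (as : List A) (f : A → ℕ) κ → κ * sum-over as f ≡ sum-over as (λ a → κ * f a)
  sum-over-*ˡ [] f κ = *-zeroʳ κ
  sum-over-*ˡ (a ∷ as) f κ = trans (*-distribˡ-+ κ (f a) _) (cong (κ * f a +_) (sum-over-*ˡ as f κ))

  -- Each place a contributes f a n to the height of the n-th point; the total is at least
  -- n² / κ, but two points at distance d share at most c d² at each place.
  module _ {A : Set} (places : List A) {P : ℕ → Set} (P? : Decidable P) (f : A → ℕ → ℕ) (κ c : ℕ)
    (separation : ∀ a i d → P i → P (suc d + i) → f a i ⊓ f a (suc d + i) ≤ c * (suc d * suc d))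
    (total : ∀ n → P n → n * n ≤ κ * sum-over places (λ a → f a n)) where

    private
      -- Indices in this block are at least `L`, whatever `M` is, so each counted one carries total
      -- weight at least `L²`; a single place has only `O(L²)` to give to the whole block.
      block : ∀ k M → count P? (suc M + 2 ^ k) (2 ^ k) ≤ length places * (1 + 2 * (κ * c))
      block k M = *-cancelʳ-≤ _ _ (L * L) {{>-nonZero (*-mono-≤ (m^n>0 2 k) (m^n>0 2 k))}} (begin
        count P? (suc M + L) L * (L * L)                  ≤⟨ count-markov P? (λ n → sum-over places (λ a → g a n)) (L * L) (suc M + L) L large ⟩
        sum-range (λ n → sum-over places (λ a → g a n)) (suc M + L) L ≤⟨ sum-swap places g (suc M + L) L _ each ⟩
        length places * (L * L + 2 * (κ * c) * (L * L))   ≡⟨ lemma (length places) (κ * c) (L * L) ⟩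
        length places * (1 + 2 * (κ * c)) * (L * L)       ∎)
        where
        open ≤-Reasoning
        L : ℕ
        L = 2 ^ k
        lemma : ∀ p e q → p * (q + 2 * e * q) ≡ p * (1 + 2 * e) * q
        lemma = solve-∀
        -- Zero off `P`, where `separation` gives nothing, and truncated at `L²`, so that the
        -- exceptional value left by `dyadic-sum` costs no more than the error term.
        g : A → ℕ → ℕ
        g a n with P? n
        ... | yes _ = κ * f a n ⊓ (L * L)
        ... | no _ = 0
        g≤ : ∀ a n → g a n ≤ L * L
        g≤ a n with P? n
        ... | yes _ = m⊓n≤n (κ * f a n) (L * L)
        ... | no _ = z≤n
        sep : ∀ a i d → g a i ⊓ g a (suc d + i) ≤ κ * c * (suc d * suc d)
        sep a i d with P? i | P? (suc d + i)
        ... | no _ | _ = z≤n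
        ... | yes _ | no _ = ≤-trans (m⊓n≤n (κ * f a i ⊓ (L * L)) 0) z≤n
        ... | yes p | yes q = begin
          (κ * f a i ⊓ (L * L)) ⊓ (κ * f a (suc d + i) ⊓ (L * L)) ≤⟨ ⊓-mono-≤ (m⊓n≤m _ (L * L)) (m⊓n≤m _ (L * L)) ⟩
          κ * f a i ⊓ (κ * f a (suc d + i))               ≡⟨ *-distribˡ-⊓ κ (f a i) (f a (suc d + i)) ⟨
          κ * (f a i ⊓ f a (suc d + i))                   ≤⟨ *-monoʳ-≤ κ (separation a i d p q) ⟩
          κ * (c * (suc d * suc d))                       ≡⟨ *-assoc κ c _ ⟨
          κ * c * (suc d * suc d)                         ∎
        each : ∀ a → sum-range (g a) (suc M + L) L ≤ L * L + 2 * (κ * c) * (L * L)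
        each a with dyadic-sum (g a) (κ * c) (sep a) k (suc M + L)
        ... | y , _ , _ , s = ≤-trans s (+-monoˡ-≤ _ (g≤ a y))
        large : ∀ n → suc M + L ≤ n → P n → L * L ≤ sum-over places (λ a → g a n)
        large n ≤n p = ≤-trans (sum-over-⊓ places (λ a → κ * f a n) (L * L) (begin
            L * L                                    ≤⟨ *-mono-≤ L≤n L≤n ⟩
            n * n                                    ≤⟨ total n p ⟩
            κ * sum-over places (λ a → f a n)        ≡⟨ sum-over-*ˡ places (λ a → f a n) κ ⟩
            sum-over places (λ a → κ * f a n)        ∎)) (same places)
          where
          L≤n : L ≤ n
          L≤n = ≤-trans (m≤n+m L (suc M)) ≤n
          same : ∀ as → sum-over as (λ a → κ * f a n ⊓ (L * L)) ≤ sum-over as (λ a → g a n)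
          same [] = z≤n
          same (a ∷ as) = +-mono-≤ here≤ (same as)
            where
            here≤ : κ * f a n ⊓ (L * L) ≤ g a n
            here≤ with P? n
            ... | yes _ = ≤-refl
            ... | no ¬p = contradiction p ¬p

    -- The initial `2 ^ j` indices are counted trivially, and every doubling of the interval adds
    -- one block.
    count-bound : ∀ M j i → count P? (suc M) (2 ^ (i + j)) ≤ 2 ^ j + i * (length places * (1 + 2 * (κ * c)))
    count-bound M j zero = ≤-trans (count≤ P? (suc M) (2 ^ j)) (m≤m+n (2 ^ j) 0)
    count-bound M j (suc i) = begin
      count P? (suc M) (2 ^ suc (i + j))         ≡⟨ cong (λ n → count P? (suc M) (2 ^ (i + j) + n)) (+-identityʳ (2 ^ (i + j))) ⟩
      count P? (suc M) (2 ^ (i + j) + 2 ^ (i + j)) ≡⟨ count-+ P? (suc M) (2 ^ (i + j)) (2 ^ (i + j)) ⟩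
      count P? (suc M) (2 ^ (i + j)) + count P? (suc M + 2 ^ (i + j)) (2 ^ (i + j)) ≤⟨ +-mono-≤ (count-bound M j i) (block (i + j) M) ⟩
      2 ^ j + i * K + K                          ≡⟨ lemma (2 ^ j) i K ⟩
      2 ^ j + suc i * K                          ∎
      where
      open ≤-Reasoning
      K : ℕ
      K = length places * (1 + 2 * (κ * c))
      lemma : ∀ a i K → a + i * K + K ≡ a + (1 + i) * K
      lemma = solve-∀

-- Valuations on ℕ and ℚ

module Valuation where

  open RingIdentity using (_⊕_; _⊗_; ⊝_; _⊖_; #_; _⊜_)
  open import Data.List using ([]; _∷_)
  open import Defs
  open Rationals using (*-≢0; ÷'-*)
  open Integers using (_+_; _*_; _-_; -_; identityℤ; module Linearℤ; +-def; *-zeroʳ)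
  open import Data.Nat as ℕ using (ℕ; zero; suc; _≤_; _<_; z≤n; s≤s; _^_)
  import Data.Nat.Properties as ℕ
  open import Data.Nat.Tactic.RingSolver using (solve-∀)
  open import Data.Nat.Divisibility as ℕ∣ using (_∣_; divides; _∣?_)
  open import Data.Nat.Primality using (Prime; euclidsLemma; prime⇒nonTrivial; prime⇒nonZero)
  open import Data.Nat.GCD using (gcd; gcd[m,n]∣n)
  open import Data.Integer as ℤ using (ℤ; +_; -[1+_]; ∣_∣)
  import Data.Integer.Properties as ℤ
  import Data.Integer.GCD as ℤ
  open import Data.Rational as ℚ using (ℚ; mkℚ; 0ℚ; 1ℚ; ↥_; ↧_; ↧ₙ_)
  import Data.Rational.Properties as ℚ
  open import Data.Fin using (Fin; zero; suc)
  open import Data.Product using (_,_; _×_; ∃)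
  import Data.Sum as Sum
  open import Relation.Nullary using (yes; no; contradiction; ¬_)
  open import Relation.Binary.PropositionalEquality
  open Linearℤ

  private
    strip : ℕ → ℕ → ℕ → ℕ
    strip zero p n = 0
    strip (suc fuel) p n with p ∣? n
    ... | yes (divides q _) = suc (strip fuel p q)
    ... | no _ = 0

  -- The exponent of p in n; junk for n = 0 or p ≤ 1.
  ord : ℕ → ℕ → ℕ
  ord p n = strip n p n

  module _ {p : ℕ} (p-prime : Prime p) where

    private
      1<p : 1 < p
      1<p = ℕ.nonTrivial⇒n>1 p {{prime⇒nonTrivial p-prime}}

      strip-spec : ∀ fuel n → 1 ≤ n → n ≤ fuel → ∃ λ m → n ≡ p ^ strip fuel p n ℕ.* m × ¬ p ∣ m
      strip-spec zero zero () _
      strip-spec zero (suc n) _ ()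
      strip-spec (suc fuel) n 1≤n n≤ with p ∣? n
      ... | no p∤n = n , sym (ℕ.*-identityˡ n) , p∤n
      ... | yes (divides zero refl) = contradiction 1≤n λ ()
      ... | yes (divides q@(suc _) refl) = let m , q= , p∤m = strip-spec fuel q (s≤s z≤n) q≤ in
        m , trans (ℕ.*-comm q p) (trans (cong (p ℕ.*_) q=) (sym (ℕ.*-assoc p _ m))) , p∤m
        where
        q≤ : q ≤ fuel
        q≤ = ℕ.≤-pred (ℕ.<-≤-trans (ℕ.m<m*n q p 1<p) n≤)

    ord-spec : ∀ n → n ≢ 0 → ∃ λ m → n ≡ p ^ ord p n ℕ.* m × ¬ p ∣ m
    ord-spec n n≢0 = strip-spec n n (ℕ.n≢0⇒n>0 n≢0) ℕ.≤-refl

    p^ord∣ : ∀ n → p ^ ord p n ∣ n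
    p^ord∣ zero = ℕ∣._∣0 _
    p^ord∣ n@(suc _) = let m , n= , _ = ord-spec n (λ ()) in divides m (trans n= (ℕ.*-comm _ m))

    private
      unique : ∀ v w {m m′} → p ^ v ℕ.* m ≡ p ^ w ℕ.* m′ → ¬ p ∣ m → ¬ p ∣ m′ → v ≡ w
      unique zero zero _ _ _ = refl
      unique zero (suc w) {m} {m′} e p∤m _ = contradiction (divides (p ^ w ℕ.* m′) (trans (sym (ℕ.*-identityˡ m)) (trans e (lemma p (p ^ w) m′)))) p∤m
        where
        lemma : ∀ p q m → p ℕ.* q ℕ.* m ≡ q ℕ.* m ℕ.* p
        lemma = solve-∀
      unique (suc v) zero {m} {m′} e _ p∤m′ = contradiction (divides (p ^ v ℕ.* m) (trans (sym (ℕ.*-identityˡ m′)) (trans (sym e) (lemma p (p ^ v) m)))) p∤m′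
        where
        lemma : ∀ p q m → p ℕ.* q ℕ.* m ≡ q ℕ.* m ℕ.* p
        lemma = solve-∀
      unique (suc v) (suc w) e p∤m p∤m′ = cong suc (unique v w
        (ℕ.*-cancelˡ-≡ _ _ p {{prime⇒nonZero p-prime}} (trans (sym (ℕ.*-assoc p (p ^ v) _)) (trans e (ℕ.*-assoc p (p ^ w) _)))) p∤m p∤m′)

    ord-unique : ∀ v m → ¬ p ∣ m → ord p (p ^ v ℕ.* m) ≡ v
    ord-unique v zero p∤m = contradiction (ℕ∣._∣0 p) p∤m
    ord-unique v m@(suc _) p∤m = let m′ , e , p∤m′ = ord-spec (p ^ v ℕ.* m) ≢0 in sym (unique v _ e p∤m p∤m′)
      where
      ≢0 : p ^ v ℕ.* m ≢ 0
      ≢0 e = Sum.[ (λ h → ℕ.m^n≢0 p v {{prime⇒nonZero p-prime}} ⟨ ℕ.≢-nonZero⁻¹ _ ⟩ h) , (λ ()) ]′ (ℕ.m*n≡0⇒m≡0∨n≡0 (p ^ v) e)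
        where
        _⟨_⟩_ : ∀ {n} → ℕ.NonZero n → (.{{_ : ℕ.NonZero n}} → n ≢ 0) → n ≡ 0 → _
        nz ⟨ f ⟩ h = f {{nz}} h

    ord-* : ∀ m n → m ≢ 0 → n ≢ 0 → ord p (m ℕ.* n) ≡ ord p m ℕ.+ ord p n
    ord-* m n m≢0 n≢0 = let m′ , m= , p∤m′ = ord-spec m m≢0; n′ , n= , p∤n′ = ord-spec n n≢0 in
      trans (cong (ord p) (trans (cong₂ ℕ._*_ m= n=) (trans (rearrange (p ^ ord p m) m′ (p ^ ord p n) n′)
        (cong (ℕ._* (m′ ℕ.* n′)) (sym (ℕ.^-distribˡ-+-* p (ord p m) (ord p n)))))))
        (ord-unique (ord p m ℕ.+ ord p n) (m′ ℕ.* n′) (λ h → Sum.[ p∤m′ , p∤n′ ]′ (euclidsLemma m′ n′ p-prime h)))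
      where
      rearrange : ∀ a b c d → a ℕ.* b ℕ.* (c ℕ.* d) ≡ a ℕ.* c ℕ.* (b ℕ.* d)
      rearrange = solve-∀

    p∤⇒ord≡0 : ∀ n → ¬ p ∣ n → ord p n ≡ 0
    p∤⇒ord≡0 n p∤n = trans (cong (ord p) (sym (ℕ.*-identityˡ n))) (ord-unique 0 n p∤n)

    ord≡0⇒p∤ : ∀ n → n ≢ 0 → ord p n ≡ 0 → ¬ p ∣ n
    ord≡0⇒p∤ n n≢0 e p∣n = let m , n= , p∤m = ord-spec n n≢0 in
      p∤m (subst (p ∣_) (trans n= (trans (cong (λ v → p ^ v ℕ.* m) e) (ℕ.*-identityˡ m))) p∣n)

    ordℚ : ℚ → ℤ
    ordℚ x = + ord p ∣ ↥ x ∣ - + ord p (↧ₙ x)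

    private
      ↥≢0 : ∀ {x} → x ≢ 0ℚ → ∣ ↥ x ∣ ≢ 0
      ↥≢0 {x} x≢0 e = x≢0 (ℚ.↥p≡0⇒p≡0 x (ℤ.∣i∣≡0⇒i≡0 e))

      split : ∀ {q r s t} → q ≢ 0 → r ≢ 0 → q ℕ.* r ≡ s ℕ.* t → s ≢ 0 → t ≢ 0 → + ord p q + + ord p r ≡ + ord p s + + ord p t
      split {q} {r} {s} {t} q≢0 r≢0 e s≢0 t≢0 = trans (sym (+-def (+ ord p q) (+ ord p r)))
        (trans (cong +_ (trans (sym (ord-* q r q≢0 r≢0)) (trans (cong (ord p) e) (ord-* s t s≢0 t≢0)))) (+-def (+ ord p s) (+ ord p t)))

    -- Normalising a product divides numerator and denominator by the same `nf`, whose valuation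
    -- cancels in the difference.
    ordℚ-* : ∀ x y → x ≢ 0ℚ → y ≢ 0ℚ → ordℚ (x ℚ.* y) ≡ ordℚ x + ordℚ y
    ordℚ-* x y x≢0 y≢0 = combine {+ ord p ∣ ↥ (x ℚ.* y) ∣} {+ ord p nf} {+ ord p (↧ₙ (x ℚ.* y))} (split (↥≢0 (*-≢0 x≢0 y≢0)) nf≢0 ↥= (↥≢0 x≢0) (↥≢0 y≢0)) (split (λ ()) nf≢0 ↧= (λ ()) (λ ()))
      where
      nfℤ : ℤ
      nfℤ = ℤ.gcd (↥ x ℤ.* ↥ y) (↧ x ℤ.* ↧ y)
      nf : ℕ
      nf = ∣ nfℤ ∣
      ↥= : ∣ ↥ (x ℚ.* y) ∣ ℕ.* nf ≡ ∣ ↥ x ∣ ℕ.* ∣ ↥ y ∣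
      ↥= = trans (sym (ℤ.abs-* (↥ (x ℚ.* y)) nfℤ)) (trans (cong ∣_∣ (ℚ.↥-* x y)) (ℤ.abs-* (↥ x) (↥ y)))
      ↧= : ↧ₙ (x ℚ.* y) ℕ.* nf ≡ ↧ₙ x ℕ.* ↧ₙ y
      ↧= = trans (sym (ℤ.abs-* (↧ (x ℚ.* y)) nfℤ)) (trans (cong ∣_∣ (ℚ.↧-* x y)) (ℤ.abs-* (↧ x) (↧ y)))
      nf≢0 : nf ≢ 0
      nf≢0 e = contradiction (trans (sym (ℕ.*-zeroʳ (↧ₙ (x ℚ.* y)))) (trans (cong (↧ₙ (x ℚ.* y) ℕ.*_) (sym e)) ↧=)) (↧≢0 x y)
        where
        ↧≢0 : ∀ x y → 0 ≢ ↧ₙ x ℕ.* ↧ₙ y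
        ↧≢0 (mkℚ _ _ _) (mkℚ _ _ _) ()
      combine : ∀ {a f b c d c′ d′ : ℤ} → a + f ≡ c + d → b + f ≡ c′ + d′ → a - b ≡ (c - c′) + (d - d′)
      combine {a} {f} {b} {c} {d} {c′} {d′} h k = linear (+ 1 · h ⊞ (- (+ 1)) · k)
        (identityℤ (a ∷ b ∷ c ∷ c′ ∷ d ∷ d′ ∷ f ∷ []) (λ a b c c′ d d′ f →
            a ⊖ b ⊖ (c ⊖ c′ ⊕ (d ⊖ d′))
            ⊜ # 1 ⊗ (a ⊕ f ⊖ (c ⊕ d)) ⊕ ⊝ # 1 ⊗ (b ⊕ f ⊖ (c′ ⊕ d′))) refl)

    ordℚ-1 : ordℚ 1ℚ ≡ + 0
    ordℚ-1 = trans (cong₂ (λ u v → + u - + v) (p∤⇒ord≡0 1 p∤1) (p∤⇒ord≡0 1 p∤1)) zero-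
      where
      p∤1 : ¬ p ∣ 1
      p∤1 h = ℕ.<⇒≢ 1<p (sym (ℕ∣.∣1⇒≡1 h))
      zero- : + 0 - + 0 ≡ + 0
      zero- = identityℤ [] (# 0 ⊖ # 0 ⊜ # 0) refl

    ^ℕ≢0 : ∀ {x} n → x ≢ 0ℚ → x ^ℕ n ≢ 0ℚ
    ^ℕ≢0 zero _ = ℚ.1≢0
    ^ℕ≢0 (suc n) x≢0 = *-≢0 x≢0 (^ℕ≢0 n x≢0)

    ordℚ-^ℕ : ∀ x n → x ≢ 0ℚ → ordℚ (x ^ℕ n) ≡ + n * ordℚ x
    ordℚ-^ℕ x zero _ = trans ordℚ-1 (zero-* (ordℚ x))
      where
      zero-* : ∀ i → + 0 ≡ + 0 * i
      zero-* i = identityℤ (i ∷ []) (λ i → # 0 ⊜ # 0 ⊗ i) refl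
    ordℚ-^ℕ x (suc n) x≢0 = trans (ordℚ-* x (x ^ℕ n) x≢0 (^ℕ≢0 n x≢0)) (trans (cong (λ i → ordℚ x + i) (ordℚ-^ℕ x n x≢0)) (step (ordℚ x) (+ n) (+-def (+ 1) (+ n))))
      where
      step : ∀ i n {m} → m ≡ + 1 + n → i + n * i ≡ m * i
      step i n refl = identityℤ (i ∷ n ∷ []) (λ i n → i ⊕ n ⊗ i ⊜ (# 1 ⊕ n) ⊗ i) refl

    inverse≢0 : ∀ {x} → x ≢ 0ℚ → 1ℚ ÷' x ≢ 0ℚ
    inverse≢0 {x} x≢0 e = ℚ.1≢0 (trans (sym (÷'-* 1ℚ x≢0)) (trans (cong (ℚ._* x) e) (ℚ.*-zeroˡ x)))

    ^ℤ≢0 : ∀ {x} k → x ≢ 0ℚ → x ^ℤ k ≢ 0ℚ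
    ^ℤ≢0 (+ n) x≢0 = ^ℕ≢0 n x≢0
    ^ℤ≢0 -[1+ n ] x≢0 = inverse≢0 (^ℕ≢0 (suc n) x≢0)

    ordℚ-^ℤ : ∀ x k → x ≢ 0ℚ → ordℚ (x ^ℤ k) ≡ k * ordℚ x
    ordℚ-^ℤ x (+ n) x≢0 = ordℚ-^ℕ x n x≢0
    ordℚ-^ℤ x -[1+ n ] x≢0 = invert {ordℚ (1ℚ ÷' y)} {ordℚ y} (trans (sym (ordℚ-* (1ℚ ÷' y) y (inverse≢0 y≢0) y≢0)) (trans (cong ordℚ (÷'-* 1ℚ y≢0)) ordℚ-1)) (ordℚ-^ℕ x (suc n) x≢0) (negative (suc n))
      where
      y : ℚ
      y = x ^ℕ suc n
      y≢0 : y ≢ 0ℚ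
      y≢0 = ^ℕ≢0 (suc n) x≢0
      negative : ∀ n → ℤ.- (+ n) ≡ - (+ n)
      negative n = Integers.neg-def (+ n)
      invert : ∀ {i j n k o : ℤ} → i + j ≡ + 0 → j ≡ n * o → k ≡ - n → i ≡ k * o
      invert {i} {j} {n} {k} {o = o} h e e′ = linear (+ 1 · h ⊞ (- (+ 1)) · e ⊞ (- o) · e′)
        (identityℤ (i ∷ k ∷ o ∷ j ∷ n ∷ []) (λ i k o j n → i ⊖ k ⊗ o ⊜ # 1 ⊗ (i ⊕ j ⊖ # 0) ⊕ ⊝ # 1 ⊗ (j ⊖ n ⊗ o) ⊕ ⊝ o ⊗ (k ⊖ ⊝ n)) refl)

  sumℤ : (s : ℕ) → (Fin s → ℤ) → ℤ
  sumℤ zero f = + 0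
  sumℤ (suc s) f = f zero + sumℤ s (λ i → f (suc i))

  ordℚ-prodFin : ∀ {p} (p-prime : Prime p) s (γ : Fin s → ℚ) (k : Fin s → ℤ) → (∀ i → γ i ≢ 0ℚ) →
    prodFin s (λ i → γ i ^ℤ k i) ≢ 0ℚ × ordℚ p-prime (prodFin s (λ i → γ i ^ℤ k i)) ≡ sumℤ s (λ i → k i * ordℚ p-prime (γ i))
  ordℚ-prodFin p-prime zero γ k _ = ℚ.1≢0 , ordℚ-1 p-prime
  ordℚ-prodFin p-prime (suc s) γ k γ≢0 =
    let ≢0 , e = ordℚ-prodFin p-prime s (λ i → γ (suc i)) (λ i → k (suc i)) (λ i → γ≢0 (suc i)); first = ^ℤ≢0 p-prime (k zero) (γ≢0 zero) in
    *-≢0 first ≢0 , trans (ordℚ-* p-prime (γ zero ^ℤ k zero) _ first ≢0) (cong₂ _+_ (ordℚ-^ℤ p-prime (γ zero) (k zero) (γ≢0 zero)) e)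

  ordℚ-ℕ : ∀ {p} (p-prime : Prime p) d → ordℚ p-prime (ℕ→ℚ d) ≡ + ord p d
  ordℚ-ℕ {p} p-prime d = trans (cong₂ (λ u v → + ord p u - + v) ↥= (trans (cong (ord p) ↧=) (p∤⇒ord≡0 p-prime 1 p∤1))) (minus-zero (+ ord p d))
    where
    p∤1 : ¬ p ∣ 1
    p∤1 h = ℕ.<⇒≢ (ℕ.nonTrivial⇒n>1 p {{prime⇒nonTrivial p-prime}}) (sym (ℕ∣.∣1⇒≡1 h))
    minus-zero : ∀ i → i - + 0 ≡ i
    minus-zero i = identityℤ (i ∷ []) (λ i → i ⊖ # 0 ⊜ i) refl
    g≡1 : gcd d 1 ≡ 1
    g≡1 = ℕ∣.∣1⇒≡1 (gcd[m,n]∣n d 1)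
    ↥= : ∣ ↥ ℕ→ℚ d ∣ ≡ d
    ↥= = trans (sym (ℕ.*-identityʳ _)) (trans (cong (∣ ↥ ℕ→ℚ d ∣ ℕ.*_) (sym g≡1)) (trans (sym (ℤ.abs-* (↥ ℕ→ℚ d) (+ gcd d 1))) (cong ∣_∣ (ℚ.↥-/ (+ d) 1))))
    ↧= : ↧ₙ ℕ→ℚ d ≡ 1
    ↧= = trans (sym (ℕ.*-identityʳ _)) (trans (cong (↧ₙ ℕ→ℚ d ℕ.*_) (sym g≡1)) (trans (sym (ℤ.abs-* (↧ ℕ→ℚ d) (+ gcd d 1))) (cong ∣_∣ (ℚ.↧-/ (+ d) 1))))

-- Enumerating dependent tuples by exponent vectors

module Covering where

  open RingIdentity using (_⊕_; _⊗_; ⊝_; _⊖_; #_; _⊜_)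
  open Integers using (_+_; _*_; _-_; -_; identityℤ; module Linearℤ; *-zeroʳ; *-zero-splitℤ)
  open Valuation using (sumℤ)
  open import Data.Nat as ℕ using (ℕ; zero; suc; _≤_; z≤n; s≤s; _^_)
  import Data.Nat.Properties as ℕ
  open import Data.Nat.Tactic.RingSolver using (solve-∀)
  open import Data.Integer as ℤ using (ℤ; +_)
  open import Data.Fin as Fin using (Fin; zero; suc)
  import Data.Fin.Properties as Fin
  open import Data.Maybe using (Maybe; just; nothing; maybe; fromMaybe)
  open import Data.List using (List; []; _∷_; _++_; length; concatMap; allFin)
  open import Data.List.Properties using (length-++; length-tabulate)
  open import Data.List.Membership.Propositional using (_∈_; lose; find)
  open import Data.List.Membership.Propositional.Properties using (∈-++⁺ˡ; ∈-++⁺ʳ; ∈-allFin)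
  open import Data.List.Relation.Unary.Any as Any using (Any; here; there; any?)
  open import Data.List.Relation.Unary.Any.Properties using (concatMap⁺)
  open import Data.Vec using (Vec; tabulate)
  open import Data.Vec.Properties using (tabulate-cong)
  open import Data.Product using (_,_; _×_; ∃; proj₁; proj₂)
  import Data.Sum as Sum
  open import Function using (_∘_)
  open import Relation.Nullary using (Dec; yes; no; contradiction; ¬?; _×-dec_)
  open import Relation.Nullary.Decidable using (decidable-stable)
  open import Relation.Binary.PropositionalEquality
  open Linearℤ

  sumℤ-cong : ∀ s {f g : Fin s → ℤ} → (∀ i → f i ≡ g i) → sumℤ s f ≡ sumℤ s g
  sumℤ-cong zero h = refl
  sumℤ-cong (suc s) h = cong₂ _+_ (h zero) (sumℤ-cong s (λ i → h (suc i)))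

  sumℤ-update : ∀ s (f g : Fin s → ℤ) i → f i ≡ + 0 → (∀ j → j ≢ i → g j ≡ f j) → sumℤ s g ≡ sumℤ s f + g i
  sumℤ-update (suc s) f g zero f0 same = lemma f0 (sumℤ-cong s (λ j → same (suc j) (λ ())))
    where
    lemma : ∀ {x y u v} → x ≡ + 0 → u ≡ v → y + u ≡ (x + v) + y
    lemma {x} {y} {u} {v} h k = linear ((- (+ 1)) · h ⊞ + 1 · k)
      (identityℤ (y ∷ u ∷ x ∷ v ∷ []) (λ y u x v → y ⊕ u ⊖ (x ⊕ v ⊕ y) ⊜ ⊝ # 1 ⊗ (x ⊖ # 0) ⊕ # 1 ⊗ (u ⊖ v)) refl)
  sumℤ-update (suc s) f g (suc i) fi same = lemma (same zero (λ ())) (sumℤ-update s (f ∘ suc) (g ∘ suc) i fi (λ j j≢i → same (suc j) (j≢i ∘ Fin.suc-injective)))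
    where
    lemma : ∀ {x y u v w} → y ≡ x → u ≡ v + w → y + u ≡ (x + v) + w
    lemma {x} {y} {u} {v} {w} h k = linear (+ 1 · h ⊞ + 1 · k)
      (identityℤ (y ∷ u ∷ x ∷ v ∷ w ∷ []) (λ y u x v w → y ⊕ u ⊖ (x ⊕ v ⊕ w) ⊜ # 1 ⊗ (y ⊖ x) ⊕ # 1 ⊗ (u ⊖ (v ⊕ w))) refl)

  sumℤ-linear : ∀ s (a : ℤ) (f g h : Fin s → ℤ) (b : ℤ) → (∀ i → f i ≡ a * g i - b * h i) → sumℤ s f ≡ a * sumℤ s g - b * sumℤ s h
  sumℤ-linear zero a f g h b _ = lemma a b
    where
    lemma : ∀ a b → + 0 ≡ a * + 0 - b * + 0
    lemma a b = identityℤ (a ∷ b ∷ []) (λ a b → # 0 ⊜ a ⊗ # 0 ⊖ b ⊗ # 0) refl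
  sumℤ-linear (suc s) a f g h b e = lemma (e zero) (sumℤ-linear s a (f ∘ suc) (g ∘ suc) (h ∘ suc) b (e ∘ suc))
    where
    lemma : ∀ {x a y b z u v w} → x ≡ a * y - b * z → u ≡ a * v - b * w → x + u ≡ a * (y + v) - b * (z + w)
    lemma {x} {a} {y} {b} {z} {u} {v} {w} h k = linear (+ 1 · h ⊞ + 1 · k)
      (identityℤ (x ∷ u ∷ a ∷ y ∷ v ∷ b ∷ z ∷ w ∷ []) (λ x u a y v b z w →
          x ⊕ u ⊖ (a ⊗ (y ⊕ v) ⊖ b ⊗ (z ⊕ w))
          ⊜ # 1 ⊗ (x ⊖ (a ⊗ y ⊖ b ⊗ z)) ⊕ # 1 ⊗ (u ⊖ (a ⊗ v ⊖ b ⊗ w))) refl)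

  -- Gaussian elimination: s coordinates suffice to detect whether a combination of
  -- s vectors vanishes.
  pivots : ∀ s → (Fin s → ℕ → ℤ) → List ℕ → List ℕ
  pivots zero u U = []
  pivots (suc s) u U with any? (λ p → ¬? (u zero p ℤ.≟ + 0)) U
  ... | no _ = pivots s (u ∘ suc) U
  ... | yes h = let p₀ = proj₁ (find h) in
    p₀ ∷ pivots s (λ i p → u zero p₀ * u (suc i) p - u (suc i) p₀ * u zero p) U

  length-pivots : ∀ s u U → length (pivots s u U) ≤ s
  length-pivots zero u U = z≤n
  length-pivots (suc s) u U with any? (λ p → ¬? (u zero p ℤ.≟ + 0)) U
  ... | no _ = ℕ.m≤n⇒m≤1+n (length-pivots s (u ∘ suc) U)
  ... | yes h = s≤s (length-pivots s _ U)

  pivots⊆ : ∀ s u U {p} → p ∈ pivots s u U → p ∈ U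
  pivots⊆ (suc s) u U p∈ with any? (λ p → ¬? (u zero p ℤ.≟ + 0)) U
  ... | no _ = pivots⊆ s (u ∘ suc) U p∈
  pivots⊆ (suc s) u U (here refl) | yes h = proj₁ (proj₂ (find h))
  pivots⊆ (suc s) u U (there p∈) | yes h = pivots⊆ s _ U p∈

  combination : ∀ s → (Fin s → ℤ) → (Fin s → ℕ → ℤ) → ℕ → ℤ
  combination s k u p = sumℤ s (λ i → k i * u i p)

  -- The equation at the pivot `p₀` eliminates the first coefficient. Cross-multiplication keeps the
  -- vectors integral, and the nonzero pivot entry is cancelled at the end. Since the pivots do not
  -- depend on `k`, they can be listed before the relation is known.
  pivots-detect : ∀ s u U k → (∀ p → p ∈ pivots s u U → combination s k u p ≡ + 0) → ∀ p → p ∈ U → combination s k u p ≡ + 0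
  pivots-detect zero u U k _ p _ = refl
  pivots-detect (suc s) u U k vanish p p∈U with any? (λ p → ¬? (u zero p ℤ.≟ + 0)) U
  ... | no none = lemma (zero-on p∈U) (pivots-detect s (u ∘ suc) U (k ∘ suc) (λ q q∈ → tail (zero-on (pivots⊆ s (u ∘ suc) U q∈)) (vanish q q∈)) p p∈U)
    where
    zero-on : ∀ {q} → q ∈ U → u zero q ≡ + 0
    zero-on {q} q∈U = decidable-stable (u zero q ℤ.≟ + 0) (λ ≢0 → none (lose q∈U ≢0))
    lemma : ∀ {k x y} → x ≡ + 0 → y ≡ + 0 → k * x + y ≡ + 0
    lemma {k} {x} {y} h h′ = linear (k · h ⊞ + 1 · h′) (identityℤ (k ∷ x ∷ y ∷ []) (λ k x y → k ⊗ x ⊕ y ⊖ # 0 ⊜ k ⊗ (x ⊖ # 0) ⊕ # 1 ⊗ (y ⊖ # 0)) refl)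
    tail : ∀ {k x y} → x ≡ + 0 → k * x + y ≡ + 0 → y ≡ + 0
    tail {k} {x} {y} h h′ = linear ((- k) · h ⊞ + 1 · h′) (identityℤ (y ∷ k ∷ x ∷ []) (λ y k x → y ⊖ # 0 ⊜ ⊝ k ⊗ (x ⊖ # 0) ⊕ # 1 ⊗ (k ⊗ x ⊕ y ⊖ # 0)) refl)
  ... | yes h = cancel {a} (proj₂ (proj₂ (find h))) (reduced p (vanish p₀ (here refl)) (pivots-detect s u′ U (k ∘ suc) (λ q q∈ → back q (vanish p₀ (here refl)) (vanish q (there q∈))) p p∈U))
    where
    p₀ : ℕ
    p₀ = proj₁ (find h)
    a : ℤ
    a = u zero p₀
    u′ : Fin s → ℕ → ℤ
    u′ i q = a * u (suc i) q - u (suc i) p₀ * u zero q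
    W S : ℕ → ℤ
    W = combination (suc s) k u
    S = combination s (k ∘ suc) (u ∘ suc)
    eliminate : ∀ q → combination s (k ∘ suc) u′ q ≡ a * S q - u zero q * S p₀
    eliminate q = sumℤ-linear s a _ (λ i → k (suc i) * u (suc i) q) (λ i → k (suc i) * u (suc i) p₀) (u zero q) (λ i → lemma (k (suc i)) a (u (suc i) q) (u (suc i) p₀) (u zero q))
      where
      lemma : ∀ k a x y z → k * (a * x - y * z) ≡ a * (k * x) - z * (k * y)
      lemma k a x y z = identityℤ (k ∷ a ∷ x ∷ y ∷ z ∷ []) (λ k a x y z → k ⊗ (a ⊗ x ⊖ y ⊗ z) ⊜ a ⊗ (k ⊗ x) ⊖ z ⊗ (k ⊗ y)) refl
    back : ∀ q → W p₀ ≡ + 0 → W q ≡ + 0 → combination s (k ∘ suc) u′ q ≡ + 0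
    back q h₀ h₁ = trans (eliminate q) (lemma {k zero} {a} {u zero q} h₀ h₁)
      where
      lemma : ∀ {k a z x y} → k * a + y ≡ + 0 → k * z + x ≡ + 0 → a * x - z * y ≡ + 0
      lemma {k} {a} {z} {x} {y} h h′ = linear ((- z) · h ⊞ a · h′)
        (identityℤ (a ∷ x ∷ z ∷ y ∷ k ∷ []) (λ a x z y k → a ⊗ x ⊖ z ⊗ y ⊖ # 0 ⊜ ⊝ z ⊗ (k ⊗ a ⊕ y ⊖ # 0) ⊕ a ⊗ (k ⊗ z ⊕ x ⊖ # 0)) refl)
    reduced : ∀ q → W p₀ ≡ + 0 → combination s (k ∘ suc) u′ q ≡ + 0 → a * W q ≡ + 0
    reduced q h₀ h₁ = lemma {k zero} {a} {u zero q} h₀ (trans (sym (eliminate q)) h₁)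
      where
      lemma : ∀ {k a z x y} → k * a + y ≡ + 0 → a * x - z * y ≡ + 0 → a * (k * z + x) ≡ + 0
      lemma {k} {a} {z} {x} {y} h h′ = linear (z · h ⊞ + 1 · h′)
        (identityℤ (a ∷ k ∷ z ∷ x ∷ y ∷ []) (λ a k z x y → a ⊗ (k ⊗ z ⊕ x) ⊖ # 0 ⊜ z ⊗ (k ⊗ a ⊕ y ⊖ # 0) ⊕ # 1 ⊗ (a ⊗ x ⊖ z ⊗ y ⊖ # 0)) refl)
    cancel : ∀ {a x} → a ≢ + 0 → a * x ≡ + 0 → x ≡ + 0
    cancel {a} a≢0 e = Sum.[ (λ h → contradiction h a≢0) , (λ h → h) ]′ (*-zero-splitℤ a e)

  State : ℕ → Set
  State s = Fin s → Maybe ℕ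

  missing : ∀ s → State s → ℕ
  missing zero A = 0
  missing (suc s) A = maybe (λ _ → 0) 1 (A zero) ℕ.+ missing s (A ∘ suc)

  missing-cong : ∀ s {A B : State s} → (∀ i → A i ≡ B i) → missing s A ≡ missing s B
  missing-cong zero h = refl
  missing-cong (suc s) h = cong₂ ℕ._+_ (cong (maybe (λ _ → 0) 1) (h zero)) (missing-cong s (h ∘ suc))

  missing-update : ∀ s {A B : State s} i {n} → A i ≡ nothing → B i ≡ just n → (∀ j → j ≢ i → B j ≡ A j) → missing s A ≡ suc (missing s B)
  missing-update (suc s) {A} {B} zero Ai Bi same = cong₂ ℕ._+_ (cong (maybe (λ _ → 0) 1) Ai)
    (trans (missing-cong s (λ j → sym (same (suc j) (λ ())))) (cong (ℕ._+ missing s (B ∘ suc)) (cong (maybe (λ _ → 0) 1) (sym Bi))))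
  missing-update (suc s) {A} {B} (suc i) Ai Bi same = trans (cong₂ ℕ._+_ (cong (maybe (λ _ → 0) 1) (sym (same zero (λ ())))) (missing-update s i Ai Bi (λ j j≢i → same (suc j) (j≢i ∘ Fin.suc-injective))))
    (ℕ.+-suc _ _)

  missing≡0 : ∀ s (A : State s) → missing s A ≡ 0 → ∀ i → A i ≢ nothing
  missing≡0 (suc s) A e zero Ai = contradiction (trans (cong (ℕ._+ missing s (A ∘ suc)) (cong (maybe (λ _ → 0) 1) (sym Ai))) e) λ ()
  missing≡0 (suc s) A e (suc i) = missing≡0 s (A ∘ suc) (ℕ.m+n≡0⇒n≡0 (maybe (λ _ → 0) 1 (A zero)) e) i

  update : ∀ {s} → State s → Fin s → ℕ → State s
  update A i n j with j Fin.≟ i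
  ... | yes _ = just n
  ... | no _ = A j

  update-same : ∀ {s} (A : State s) i n → update A i n i ≡ just n
  update-same A i n with i Fin.≟ i
  ... | yes _ = refl
  ... | no i≢i = contradiction refl i≢i

  update-other : ∀ {s} (A : State s) i n j → j ≢ i → update A i n j ≡ A j
  update-other A i n j j≢i with j Fin.≟ i
  ... | yes j≡i = contradiction j≡i j≢i
  ... | no _ = refl

  length-concatMap : ∀ {X Y : Set} (f : X → List Y) xs B → (∀ x → length (f x) ≤ B) → length (concatMap f xs) ≤ length xs ℕ.* B
  length-concatMap f [] B h = z≤n
  length-concatMap f (x ∷ xs) B h = ℕ.≤-trans (ℕ.≤-reflexive (length-++ (f x))) (ℕ.+-mono-≤ (h x) (length-concatMap f xs B h))

  ∈-concatMap : ∀ {X Y : Set} (f : X → List Y) {xs x y} → x ∈ xs → y ∈ f x → y ∈ concatMap f xs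
  ∈-concatMap f x∈ y∈ = concatMap⁺ f (lose x∈ y∈)

  -- The exponent vectors of a dependent tuple are w i nᵢ. Coordinates are chosen one at a
  -- time. While the combination of the vectors chosen so far is nonzero, it is nonzero at one
  -- of few primes, at which some further coordinate must have nonzero exponent, so that this
  -- coordinate is confined to a short list `class`. When the combination vanishes, a new
  -- coordinate is either in the short list `smooth` or is chosen freely, and then the next
  -- coordinate is confined: at least half of the nonsmooth coordinates are.
  module Cover (s : ℕ) (w : Fin s → ℕ → ℕ → ℤ) (supp : Fin s → ℕ → List ℕ)
    (w-supp : ∀ i n p → w i n p ≢ + 0 → p ∈ supp i n)
    (box : List ℕ) (smooth : Fin s → List ℕ) (class : Fin s → ℕ → List ℕ) where

    vectors : State s → Fin s → ℕ → ℤ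
    vectors A i p = maybe (λ n → w i n p) (+ 0) (A i)

    support : State s → List ℕ
    support A = concatMap (λ i → maybe (supp i) [] (A i)) (allFin s)

    primes : State s → List ℕ
    primes A = pivots s (vectors A) (support A)

    complete : State s → Vec ℕ s
    complete A = tabulate (λ i → fromMaybe 0 (A i))

    confined : (State s → List (Vec ℕ s)) → State s → List (Vec ℕ s)
    confined next A = concatMap (λ p → concatMap (λ j → concatMap (λ n → next (update A j n)) (class j p)) (allFin s)) (primes A)

    step : (next next² : State s → List (Vec ℕ s)) → State s → List (Vec ℕ s)
    step next next² A = complete A ∷ concatMap (λ i → concatMap (λ n → next (update A i n)) (smooth i)) (allFin s)
      ++ confined next A
      ++ concatMap (λ i → concatMap (λ n → confined next² (update A i n)) box) (allFin s)

    cover : ℕ → State s → List (Vec ℕ s)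
    cover zero A = complete A ∷ []
    -- With one coordinate missing, no confined coordinate could follow a free one, so that branch
    -- is empty.
    cover (suc zero) A = step (cover zero) (λ _ → []) A
    cover (suc (suc r)) A = step (cover (suc r)) (cover r) A

    module Length (c T ζ : ℕ) (1≤T : 1 ≤ T) (smooth≤ : ∀ i → length (smooth i) ≤ c ℕ.* T) (class≤ζ : ∀ i p → length (class i p) ≤ ζ)
      (ζ≤ : ζ ≤ c ℕ.* T) (boxζ≤ : length box ℕ.* ζ ≤ c ℕ.* (T ℕ.* T)) where

      -- The summands belong, in this order, to the completed tuple, the smooth, the confined and
      -- the free branches of `step`.
      constant : ℕ
      constant = 1 ℕ.+ s ℕ.* c ℕ.+ s ℕ.* (s ℕ.* c) ℕ.+ s ℕ.* (s ℕ.* (s ℕ.* c))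

      private
        length-allFin : length (allFin s) ≡ s
        length-allFin = length-tabulate (λ i → i)

        confined≤ : ∀ next X → (∀ A → length (next A) ≤ X) → ∀ A → length (confined next A) ≤ s ℕ.* (s ℕ.* (ζ ℕ.* X))
        confined≤ next X h A = ℕ.≤-trans (length-concatMap _ (primes A) (s ℕ.* (ζ ℕ.* X)) (λ p →
          ℕ.≤-trans (length-concatMap _ (allFin s) (ζ ℕ.* X) (λ j → ℕ.≤-trans (length-concatMap _ (class j p) X (λ n → h _)) (ℕ.*-monoˡ-≤ X (class≤ζ j p))))
            (ℕ.≤-reflexive (cong (ℕ._* (ζ ℕ.* X)) length-allFin)))) (ℕ.*-monoˡ-≤ _ (length-pivots s (vectors A) (support A)))

        -- A smooth or confined coordinate costs a factor of order `T`. A free one is charged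
        -- together with the confined one after it, at order `T * T`; hence `Y` bounds the
        -- completions with two more coordinates assigned.
        step≤ : ∀ next next² X Y → (∀ A → length (next A) ≤ X) → (∀ A → length (next² A) ≤ Y) → 1 ≤ T ℕ.* X → T ℕ.* Y ≤ X →
          ∀ A → length (step next next² A) ≤ constant ℕ.* T ℕ.* X
        step≤ next next² X Y h h² 1≤ Y≤ A = begin
          length (step next next² A)             ≡⟨ cong suc (trans (length-++ loops) (cong (length loops ℕ.+_) (length-++ (confined next A)))) ⟩
          1 ℕ.+ (length loops ℕ.+ (length (confined next A) ℕ.+ length free)) ≤⟨ ℕ.+-mono-≤ 1≤ (ℕ.+-mono-≤ loops≤ (ℕ.+-mono-≤ confined≤′ free≤)) ⟩
          T ℕ.* X ℕ.+ (s ℕ.* (c ℕ.* T ℕ.* X) ℕ.+ (s ℕ.* (s ℕ.* (c ℕ.* T ℕ.* X)) ℕ.+ s ℕ.* (s ℕ.* (s ℕ.* (c ℕ.* T ℕ.* X))))) ≡⟨ lemma s c T X ⟩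
          constant ℕ.* T ℕ.* X                   ∎
          where
          open ℕ.≤-Reasoning
          lemma : ∀ s c T X → T ℕ.* X ℕ.+ (s ℕ.* (c ℕ.* T ℕ.* X) ℕ.+ (s ℕ.* (s ℕ.* (c ℕ.* T ℕ.* X)) ℕ.+ s ℕ.* (s ℕ.* (s ℕ.* (c ℕ.* T ℕ.* X)))))
            ≡ (1 ℕ.+ s ℕ.* c ℕ.+ s ℕ.* (s ℕ.* c) ℕ.+ s ℕ.* (s ℕ.* (s ℕ.* c))) ℕ.* T ℕ.* X
          lemma = solve-∀
          loops free : List (Vec ℕ s)
          loops = concatMap (λ i → concatMap (λ n → next (update A i n)) (smooth i)) (allFin s)
          free = concatMap (λ i → concatMap (λ n → confined next² (update A i n)) box) (allFin s)
          loops≤ : length loops ≤ s ℕ.* (c ℕ.* T ℕ.* X)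
          loops≤ = ℕ.≤-trans (length-concatMap _ (allFin s) (c ℕ.* T ℕ.* X) (λ i → ℕ.≤-trans (length-concatMap _ (smooth i) X (λ n → h _)) (ℕ.*-monoˡ-≤ X (smooth≤ i))))
            (ℕ.≤-reflexive (cong (ℕ._* (c ℕ.* T ℕ.* X)) length-allFin))
          confined≤′ : length (confined next A) ≤ s ℕ.* (s ℕ.* (c ℕ.* T ℕ.* X))
          confined≤′ = ℕ.≤-trans (confined≤ next X h A) (ℕ.*-monoʳ-≤ s (ℕ.*-monoʳ-≤ s (ℕ.*-monoˡ-≤ X ζ≤)))
          free≤ : length free ≤ s ℕ.* (s ℕ.* (s ℕ.* (c ℕ.* T ℕ.* X)))
          free≤ = begin
            length free                                                ≤⟨ length-concatMap _ (allFin s) _ (λ i → length-concatMap _ box _ (λ n → confined≤ next² Y h² (update A i n))) ⟩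
            length (allFin s) ℕ.* (length box ℕ.* (s ℕ.* (s ℕ.* (ζ ℕ.* Y)))) ≡⟨ cong (ℕ._* (length box ℕ.* (s ℕ.* (s ℕ.* (ζ ℕ.* Y))))) length-allFin ⟩
            s ℕ.* (length box ℕ.* (s ℕ.* (s ℕ.* (ζ ℕ.* Y))))           ≡⟨ lemma₁ s (length box) ζ Y ⟩
            s ℕ.* (s ℕ.* (s ℕ.* (length box ℕ.* ζ ℕ.* Y)))             ≤⟨ ℕ.*-monoʳ-≤ s (ℕ.*-monoʳ-≤ s (ℕ.*-monoʳ-≤ s (ℕ.*-monoˡ-≤ Y boxζ≤))) ⟩
            s ℕ.* (s ℕ.* (s ℕ.* (c ℕ.* (T ℕ.* T) ℕ.* Y)))              ≡⟨ cong (λ z → s ℕ.* (s ℕ.* (s ℕ.* z))) (lemma₂ c T Y) ⟩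
            s ℕ.* (s ℕ.* (s ℕ.* (c ℕ.* T ℕ.* (T ℕ.* Y))))              ≤⟨ ℕ.*-monoʳ-≤ s (ℕ.*-monoʳ-≤ s (ℕ.*-monoʳ-≤ s (ℕ.*-monoʳ-≤ (c ℕ.* T) Y≤))) ⟩
            s ℕ.* (s ℕ.* (s ℕ.* (c ℕ.* T ℕ.* X)))                      ∎
            where
            lemma₁ : ∀ s b ζ Y → s ℕ.* (b ℕ.* (s ℕ.* (s ℕ.* (ζ ℕ.* Y)))) ≡ s ℕ.* (s ℕ.* (s ℕ.* (b ℕ.* ζ ℕ.* Y)))
            lemma₁ = solve-∀
            lemma₂ : ∀ c T Y → c ℕ.* (T ℕ.* T) ℕ.* Y ≡ c ℕ.* T ℕ.* (T ℕ.* Y)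
            lemma₂ = solve-∀

        positive : ∀ r → 1 ≤ (constant ℕ.* T) ^ r
        positive r = ℕ.m^n>0 (constant ℕ.* T) {{ℕ.>-nonZero (ℕ.*-mono-≤ (s≤s (z≤n {s ℕ.* c ℕ.+ s ℕ.* (s ℕ.* c) ℕ.+ s ℕ.* (s ℕ.* (s ℕ.* c))})) 1≤T)}} r

      length-cover : ∀ r A → length (cover r A) ≤ (constant ℕ.* T) ^ r
      length-cover zero A = ℕ.≤-refl
      length-cover (suc zero) A = ℕ.≤-trans (step≤ (cover zero) (λ _ → []) 1 0 (length-cover zero) (λ _ → z≤n)
        (ℕ.≤-trans 1≤T (ℕ.≤-reflexive (sym (ℕ.*-identityʳ T)))) (ℕ.≤-trans (ℕ.≤-reflexive (ℕ.*-zeroʳ T)) z≤n) A) ℕ.≤-refl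
      length-cover (suc (suc r)) A = step≤ (cover (suc r)) (cover r) ((constant ℕ.* T) ^ suc r) ((constant ℕ.* T) ^ r) (length-cover (suc r)) (length-cover r)
        (ℕ.*-mono-≤ 1≤T (positive (suc r))) (ℕ.*-monoˡ-≤ ((constant ℕ.* T) ^ r) (ℕ.m≤n*m T constant)) A

    module Correct (v : Fin s → ℕ) (k : Fin s → ℤ) (k≢0 : ∀ i → k i ≢ + 0)
      (relation : ∀ p → sumℤ s (λ i → k i * w i (v i) p) ≡ + 0)
      (in-box : ∀ i → v i ∈ box)
      (in-smooth : ∀ i → (∀ p → w i (v i) p ≡ + 0) → v i ∈ smooth i)
      (in-class : ∀ i p → w i (v i) p ≢ + 0 → v i ∈ class i p) where

      Agrees : State s → Set
      Agrees A = ∀ j n → A j ≡ just n → n ≡ v j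

      agrees-update : ∀ {A} i → Agrees A → Agrees (update A i (v i))
      agrees-update i agrees j n e with j Fin.≟ i
      agrees-update i agrees j _ refl | yes refl = refl
      ... | no _ = agrees j n e

      W : State s → ℕ → ℤ
      W A = combination s k (vectors A)

      private
        vectors-assigned : ∀ {A} → Agrees A → ∀ {i n} → A i ≡ just n → ∀ p → vectors A i p ≡ w i (v i) p
        vectors-assigned agrees {i} {n} e p = trans (cong (maybe (λ n → w i n p) (+ 0)) e) (cong (λ n → w i n p) (agrees i n e))

        -- The full relation vanishes at `p` while its assigned part does not, so an unassigned
        -- coordinate must contribute.
        next-prime : ∀ {A} → Agrees A → ∀ p → W A p ≢ + 0 → ∃ λ j → A j ≡ nothing × w j (v j) p ≢ + 0
        next-prime {A} agrees p W≢0 with Fin.any? (λ j → is-nothing? (A j) ×-dec ¬? (w j (v j) p ℤ.≟ + 0))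
          where
          is-nothing? : (m : Maybe ℕ) → Dec (m ≡ nothing)
          is-nothing? nothing = yes refl
          is-nothing? (just _) = no λ ()
        ... | yes h = h
        ... | no none = contradiction (trans (sumℤ-cong s same) (relation p)) W≢0
          where
          by : ∀ i (m : Maybe ℕ) → A i ≡ m → vectors A i p ≡ w i (v i) p
          by i (just n) e = vectors-assigned {A} agrees e p
          by i nothing e = trans (cong (maybe (λ n → w i n p) (+ 0)) e) (sym (decidable-stable (w i (v i) p ℤ.≟ + 0) (λ w≢0 → none (i , e , w≢0))))
          same : ∀ i → k i * vectors A i p ≡ k i * w i (v i) p
          same i = cong (λ z → k i * z) (by i (A i) refl)

        supported : ∀ A p → W A p ≢ + 0 → p ∈ support A
        supported A p W≢0 with any? (λ q → q ℕ.≟ p) (support A)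
        ... | yes h = Any.map sym h
        ... | no none = contradiction (trans (sumℤ-cong s (λ i → zero-term i (A i) refl)) (sumℤ-zero s)) W≢0
          where
          sumℤ-zero : ∀ s → sumℤ s (λ _ → + 0) ≡ + 0
          sumℤ-zero zero = refl
          sumℤ-zero (suc s) = trans (cong (λ z → + 0 + z) (sumℤ-zero s)) 0+0
            where
            0+0 : + 0 + + 0 ≡ + 0
            0+0 = identityℤ [] (# 0 ⊕ # 0 ⊜ # 0) refl
          zero-term : ∀ i (m : Maybe ℕ) → A i ≡ m → k i * vectors A i p ≡ + 0
          zero-term i nothing e = trans (cong (λ z → k i * z) (cong (maybe (λ n → w i n p) (+ 0)) e)) (*-zeroʳ (k i))
          zero-term i (just n) e = trans (cong (λ z → k i * z) (trans (cong (maybe (λ n → w i n p) (+ 0)) e) w≡0)) (*-zeroʳ (k i))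
            where
            w≡0 : w i n p ≡ + 0
            w≡0 = decidable-stable (w i n p ℤ.≟ + 0) λ w≢0 → none (Any.map sym
              (∈-concatMap (λ i → maybe (supp i) [] (A i)) (∈-allFin i) (subst (λ m → p ∈ maybe (supp i) [] m) (sym e) (w-supp i n p w≢0))))

        pivot : ∀ A p → W A p ≢ + 0 → ∃ λ q → q ∈ primes A × W A q ≢ + 0
        pivot A p W≢0 with any? (λ q → ¬? (W A q ℤ.≟ + 0)) (primes A)
        ... | yes h = find h
        ... | no none = contradiction (pivots-detect s (vectors A) (support A) k
                (λ q q∈ → decidable-stable (W A q ℤ.≟ + 0) (λ ≢0 → none (lose q∈ ≢0))) p (supported A p W≢0)) W≢0

        confined-∈ : ∀ {next A} → Agrees A → ∀ p → W A p ≢ + 0 →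
          (∀ j → A j ≡ nothing → tabulate v ∈ next (update A j (v j))) → tabulate v ∈ confined next A
        confined-∈ {next} {A} agrees p W≢0 h = let q , q∈ , Wq = pivot A p W≢0; j , Aj , w≢0 = next-prime {A} agrees q Wq in
          ∈-concatMap (λ p → concatMap (λ j → concatMap (λ n → next (update A j n)) (class j p)) (allFin s)) q∈
            (∈-concatMap (λ j → concatMap (λ n → next (update A j n)) (class j q)) (∈-allFin j)
              (∈-concatMap (λ n → next (update A j n)) (in-class j q w≢0) (h j Aj)))

        W-update : ∀ {A} i p → A i ≡ nothing → W (update A i (v i)) p ≡ W A p + k i * w i (v i) p
        W-update {A} i p Ai = trans (sumℤ-update s (λ j → k j * vectors A j p) (λ j → k j * vectors (update A i (v i)) j p) i
            (trans (cong (λ z → k i * z) (cong (maybe (λ n → w i n p) (+ 0)) Ai)) (*-zeroʳ (k i)))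
            (λ j j≢i → cong (λ m → k j * maybe (λ n → w j n p) (+ 0) m) (update-other A i (v i) j j≢i)))
          (cong (λ m → W A p + k i * maybe (λ n → w i n p) (+ 0) m) (update-same A i (v i)))

        missing-step : ∀ {A} i {r} → A i ≡ nothing → missing s A ≤ suc r → missing s (update A i (v i)) ≤ r
        missing-step {A} i Ai h = ℕ.≤-pred (subst (_≤ _) (missing-update s i Ai (update-same A i (v i)) (update-other A i (v i))) h)

        complete-∈ : ∀ {A} → Agrees A → (∀ i → A i ≢ nothing) → tabulate v ≡ complete A
        complete-∈ {A} agrees full = tabulate-cong λ i → by i (A i) refl
          where
          by : ∀ i (m : Maybe ℕ) → A i ≡ m → v i ≡ fromMaybe 0 (A i)
          by i nothing e = contradiction e (full i)
          by i (just n) e = trans (sym (agrees i n e)) (sym (cong (fromMaybe 0) e))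

        nothing? : (A : State s) → Dec (∃ λ i → A i ≡ nothing)
        nothing? A = Fin.any? (λ i → dec (A i))
          where
          dec : (m : Maybe ℕ) → Dec (m ≡ nothing)
          dec nothing = yes refl
          dec (just _) = no λ ()

        step-∈ : ∀ {next next² A} → Agrees A →
          (∀ i → A i ≡ nothing → tabulate v ∈ next (update A i (v i))) →
          (∀ i j → A i ≡ nothing → update A i (v i) j ≡ nothing → tabulate v ∈ next² (update (update A i (v i)) j (v j))) →
          tabulate v ∈ step next next² A
        step-∈ {next} {next²} {A} agrees h h² = by (nothing? A)
          where
          loops : List (Vec ℕ s)
          loops = concatMap (λ i → concatMap (λ n → next (update A i n)) (smooth i)) (allFin s)
          by : Dec (∃ λ i → A i ≡ nothing) → tabulate v ∈ step next next² A
          by (no full) = here (complete-∈ {A} agrees (λ i e → full (i , e)))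
          by (yes (i , Ai)) = by′ (any? (λ q → ¬? (W A q ℤ.≟ + 0)) (support A))
            where
            by′ : Dec (Any (λ q → W A q ≢ + 0) (support A)) → tabulate v ∈ step next next² A
            by′ (yes found) = let p , _ , W≢0 = find found in there (∈-++⁺ʳ loops (∈-++⁺ˡ (confined-∈ {next} {A} agrees p W≢0 h)))
            by′ (no none) = by″ (any? (λ q → ¬? (w i (v i) q ℤ.≟ + 0)) (supp i (v i)))
              where
              W≡0 : ∀ p → W A p ≡ + 0
              W≡0 p = decidable-stable (W A p ℤ.≟ + 0) (λ W≢0 → none (lose (supported A p W≢0) W≢0))
              by″ : Dec (Any (λ q → w i (v i) q ≢ + 0) (supp i (v i))) → tabulate v ∈ step next next² A
              by″ (no zero-w) = there (∈-++⁺ˡ (∈-concatMap (λ i → concatMap (λ n → next (update A i n)) (smooth i)) (∈-allFin i)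
                (∈-concatMap (λ n → next (update A i n)) (in-smooth i (λ p → decidable-stable (w i (v i) p ℤ.≟ + 0) (λ w≢0 → zero-w (lose (w-supp i (v i) p w≢0) w≢0)))) (h i Ai))))
              -- The combination vanished before, so the new coordinate, having a nonzero
              -- coefficient and a nonzero exponent at `p`, makes it nonzero there. A confined
              -- coordinate must follow.
              by″ (yes found) = let p , _ , w≢0 = find found in
                there (∈-++⁺ʳ loops (∈-++⁺ʳ (confined next A) (∈-concatMap (λ i → concatMap (λ n → confined next² (update A i n)) box) (∈-allFin i)
                  (∈-concatMap (λ n → confined next² (update A i n)) (in-box i)
                    (confined-∈ {next²} {update A i (v i)} (agrees-update {A} i agrees) p (λ W′≡0 → Sum.[ k≢0 i , w≢0 ]′ (*-zero-splitℤ (k i) (cancel (W≡0 p) (trans (sym (W-update {A} i p Ai)) W′≡0))))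
                      (λ j Aj → h² i j Ai Aj))))))
                where
                cancel : ∀ {x y} → x ≡ + 0 → x + y ≡ + 0 → y ≡ + 0
                cancel {x} {y} h h′ = linear ((- (+ 1)) · h ⊞ + 1 · h′)
                  (identityℤ (y ∷ x ∷ []) (λ y x → y ⊖ # 0 ⊜ ⊝ # 1 ⊗ (x ⊖ # 0) ⊕ # 1 ⊗ (x ⊕ y ⊖ # 0)) refl)

      cover-∈ : ∀ r {A} → Agrees A → missing s A ≤ r → tabulate v ∈ cover r A
      cover-∈ zero {A} agrees m = here (complete-∈ {A} agrees (missing≡0 s A (ℕ.n≤0⇒n≡0 m)))
      cover-∈ (suc zero) {A} agrees m = step-∈ {cover zero} {λ _ → []} {A} agrees (λ i Ai → cover-∈ zero (agrees-update {A} i agrees) (missing-step {A} i Ai m))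
        (λ i j Ai Aj → contradiction Aj (missing≡0 s _ (ℕ.n≤0⇒n≡0 (missing-step {A} i Ai m)) j))
      cover-∈ (suc (suc r)) {A} agrees m = step-∈ {cover (suc r)} {cover r} {A} agrees (λ i Ai → cover-∈ (suc r) (agrees-update {A} i agrees) (missing-step {A} i Ai m))
        (λ i j Ai Aj → cover-∈ r (agrees-update {update A i (v i)} j (agrees-update {A} i agrees)) (missing-step {update A i (v i)} j Aj (missing-step {A} i Ai m)))

-- The number of prime divisors and factorisation of logarithms

module PrimeDivisors where

  open BinaryLog
  open SmoothCount using (sum-over)
  open Valuation
  open import Data.Nat
  open import Data.Nat.Properties
  open import Data.Nat.Divisibility
  open import Data.Nat.Primality
  open import Data.Nat.Primality.Factorisation using (factorise)
  open import Data.List using (List; []; _∷_; _++_; length; filter; upTo)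
  open import Data.Nat.ListAction using (product)
  open import Data.List.Properties using (length-upTo)
  open import Data.List.Membership.Propositional using (_∈_)
  open import Data.List.Membership.Propositional.Properties using (∈-filter⁺; ∈-filter⁻; ∈-upTo⁺; ∈-∃++; ∈-++⁺ˡ; ∈-++⁺ʳ; ∈-++⁻)
  open import Data.List.Relation.Unary.Any using (here; there)
  open import Data.List.Relation.Unary.All as All using (All; []; _∷_)
  import Data.List.Relation.Unary.All.Properties as All
  open import Data.List.Relation.Unary.AllPairs using ([]; _∷_)
  open import Data.List.Relation.Unary.Unique.Propositional using (Unique)
  import Data.List.Relation.Unary.Unique.Propositional.Properties as Unique
  open import Data.Product using (_,_; _×_; proj₁; proj₂)
  open import Data.Sum using (inj₁; inj₂; [_,_]′)
  open import Relation.Nullary using (yes; no; contradiction; ¬_; ¬?; _×-dec_)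
  open import Relation.Unary using (Decidable)
  open import Relation.Binary.PropositionalEquality

  unique-length : {A : Set} {xs ys : List A} → Unique xs → (∀ {x} → x ∈ xs → x ∈ ys) → length xs ≤ length ys
  unique-length {xs = []} _ _ = z≤n
  unique-length {xs = x ∷ xs} (x∉ ∷ u) sub with ∈-∃++ (sub (here refl))
  ... | ys₁ , ys₂ , refl = ≤-trans (s≤s (unique-length u inside)) (≤-reflexive (removed ys₁))
    where
    inside : ∀ {y} → y ∈ xs → y ∈ ys₁ ++ ys₂
    inside y∈ with ∈-++⁻ ys₁ (sub (there y∈))
    ... | inj₁ h = ∈-++⁺ˡ h
    ... | inj₂ (here refl) = contradiction refl (All.lookup x∉ y∈)
    ... | inj₂ (there h) = ∈-++⁺ʳ ys₁ h
    removed : ∀ ys₁ → suc (length (ys₁ ++ ys₂)) ≡ length (ys₁ ++ x ∷ ys₂)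
    removed [] = refl
    removed (_ ∷ ys₁) = cong suc (removed ys₁)

  opaque
    primeDivisors : ℕ → List ℕ
    primeDivisors n = filter (λ p → prime? p ×-dec (p ∣? n)) (upTo (suc n))

    ∈-primeDivisors : ∀ {n p} → n ≢ 0 → Prime p → p ∣ n → p ∈ primeDivisors n
    ∈-primeDivisors {n} n≢0 pp p∣n = ∈-filter⁺ (λ p → prime? p ×-dec (p ∣? n)) (∈-upTo⁺ (s≤s (∣⇒≤ {{≢-nonZero n≢0}} p∣n))) (pp , p∣n)

    ∈-primeDivisors⁻ : ∀ {n p} → p ∈ primeDivisors n → Prime p × p ∣ n
    ∈-primeDivisors⁻ {n} p∈ = proj₂ (∈-filter⁻ (λ p → prime? p ×-dec (p ∣? n)) {xs = upTo (suc n)} p∈)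

    unique-primeDivisors : ∀ n → Unique (primeDivisors n)
    unique-primeDivisors n = Unique.filter⁺ (λ p → prime? p ×-dec (p ∣? n)) (Unique.upTo⁺ (suc n))

  private
    product-∣ : ∀ {n} ps → Unique ps → All (λ p → Prime p × p ∣ n) ps → n ≢ 0 → product ps ∣ n
    product-∣ [] _ _ _ = 1∣ _
    product-∣ (p ∷ ps) (p∉ ∷ u) ((pp , divides q refl) ∷ hs) n≢0 = subst (_∣ q * p) (*-comm (product ps) p)
      (*-monoˡ-∣ p (product-∣ ps u (All.tabulate λ {r} r∈ → let rp , r∣ = All.lookup hs r∈ in rp , [ (λ h → h) , (λ r∣p → contradiction (same-prime rp r∣p) (λ e → All.lookup p∉ r∈ (sym e))) ]′ (euclidsLemma q p rp r∣))
        (λ { refl → n≢0 refl })))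
      where
      same-prime : ∀ {r} → Prime r → r ∣ p → r ≡ p
      same-prime rp r∣p with prime⇒irreducible pp r∣p
      ... | inj₁ refl = contradiction rp ¬prime[1]
      ... | inj₂ e = e

    power≤product : ∀ b ps → All (b ≤_) ps → b ^ length ps ≤ product ps
    power≤product b [] [] = ≤-refl
    power≤product b (p ∷ ps) (h ∷ hs) = *-mono-≤ h (power≤product b ps hs)

    split-length : {P : ℕ → Set} (P? : Decidable P) (xs : List ℕ) → length xs ≡ length (filter P? xs) + length (filter (λ x → ¬? (P? x)) xs)
    split-length P? [] = refl
    split-length P? (x ∷ xs) with P? x
    ... | yes _ = cong suc (split-length P? xs)
    ... | no _ = trans (cong suc (split-length P? xs)) (sym (+-suc _ _))

  -- The product of distinct prime divisors divides `n`, and here it is at least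
  -- `2 ^ (k * length ps)`.
  count-large-primes : ∀ {n} k ps → n ≢ 0 → Unique ps → All (λ p → Prime p × p ∣ n) ps → All (2 ^ k ≤_) ps → k * length ps ≤ lg n
  count-large-primes {n} k ps n≢0 u hs large = ≤-trans (≤-reflexive (sym (lg-2^ (k * length ps)))) (lg-mono (begin
    2 ^ (k * length ps)      ≡⟨ ^-*-assoc 2 k (length ps) ⟨
    (2 ^ k) ^ length ps      ≤⟨ power≤product (2 ^ k) ps large ⟩
    product ps               ≤⟨ ∣⇒≤ {{≢-nonZero n≢0}} (product-∣ ps u hs n≢0) ⟩
    n                        ∎))
    where open ≤-Reasoning

  length-primeDivisors : ∀ n → n ≢ 0 → length (primeDivisors n) ≤ lg n
  length-primeDivisors n n≢0 = subst (_≤ lg n) (*-identityˡ _) (count-large-primes 1 (primeDivisors n) n≢0 (unique-primeDivisors n)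
    (All.tabulate ∈-primeDivisors⁻) (All.tabulate λ p∈ → nonTrivial⇒n>1 _ {{prime⇒nonTrivial (proj₁ (∈-primeDivisors⁻ p∈))}}))

  -- Only 2 ^ k primes are smaller than 2 ^ k.
  weighted-primeDivisors : ∀ n k → n ≢ 0 → k * length (primeDivisors n) ≤ k * 2 ^ k + lg n
  weighted-primeDivisors n k n≢0 = begin
    k * length ps                            ≡⟨ cong (k *_) (split-length small? ps) ⟩
    k * (length small + length large)        ≡⟨ *-distribˡ-+ k (length small) (length large) ⟩
    k * length small + k * length large      ≤⟨ +-mono-≤ (*-monoʳ-≤ k small≤) (count-large-primes k large n≢0 (Unique.filter⁺ large? (unique-primeDivisors n))
                                                   (All.tabulate λ p∈ → ∈-primeDivisors⁻ (proj₁ (∈-filter⁻ large? {xs = ps} p∈)))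
                                                   (All.tabulate λ p∈ → ≮⇒≥ (proj₂ (∈-filter⁻ large? {xs = ps} p∈)))) ⟩
    k * 2 ^ k + lg n                         ∎
    where
    open ≤-Reasoning
    ps small large : List ℕ
    ps = primeDivisors n
    small? : Decidable (_< 2 ^ k)
    small? p = p <? 2 ^ k
    large? : Decidable (λ p → ¬ p < 2 ^ k)
    large? p = ¬? (small? p)
    small = filter small? ps
    large = filter large? ps
    small≤ : length small ≤ 2 ^ k
    small≤ = ≤-trans (unique-length (Unique.filter⁺ small? (unique-primeDivisors n)) (λ p∈ → ∈-upTo⁺ (proj₂ (∈-filter⁻ small? {xs = ps} p∈)))) (≤-reflexive (length-upTo (2 ^ k)))

  ord-∣-≤ : ∀ {q} (q-prime : Prime q) m n → m * n ≢ 0 → ord q n ≤ ord q (m * n)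
  ord-∣-≤ {q} q-prime m n mn≢0 = subst (ord q n ≤_) (sym (ord-* q-prime m n (λ { refl → mn≢0 refl }) (λ { refl → mn≢0 (*-zeroʳ m) }))) (m≤n+m (ord q n) (ord q m))

  no-prime-divisor : ∀ n → n ≢ 0 → (∀ p → Prime p → ¬ p ∣ n) → n ≡ 1
  no-prime-divisor n n≢0 none with factorise n {{≢-nonZero n≢0}}
  ... | record { factors = [] ; isFactorisation = e } = e
  ... | record { factors = p ∷ ps ; isFactorisation = refl ; factorsPrime = pp ∷ _ } = contradiction (divides (product ps) (*-comm p _)) (none p pp)

  -- Removing the power of one prime leaves a cofactor whose exponents are no larger. The list may
  -- contain further primes, so one list serves all smooth values.
  lg≤sum-ord : ∀ ps n → n ≢ 0 → All Prime ps → (∀ p → Prime p → p ∣ n → p ∈ ps) → lg n ≤ sum-over ps (λ p → lg (p ^ ord p n))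
  lg≤sum-ord [] n n≢0 _ all = ≤-trans (≤-reflexive (trans (cong lg (no-prime-divisor n n≢0 (λ p pp p∣n → contradiction (all p pp p∣n) λ ()))) lg-1)) z≤n
  lg≤sum-ord (p ∷ ps) n n≢0 (pp ∷ pps) all with ord-spec pp n n≢0
  ... | m , n= , p∤m = begin
    lg n                                            ≡⟨ cong lg n= ⟩
    lg (p ^ ord p n * m)                            ≤⟨ lg-* (p ^ ord p n) m ⟩
    lg (p ^ ord p n) + lg m                         ≤⟨ +-monoʳ-≤ _ (lg≤sum-ord ps m m≢0 pps rest) ⟩
    lg (p ^ ord p n) + sum-over ps (λ q → lg (q ^ ord q m)) ≤⟨ +-monoʳ-≤ _ (mono ps pps) ⟩
    lg (p ^ ord p n) + sum-over ps (λ q → lg (q ^ ord q n)) ∎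
    where
    open ≤-Reasoning
    pm≢0 : p ^ ord p n * m ≢ 0
    pm≢0 e = n≢0 (trans n= e)
    m≢0 : m ≢ 0
    m≢0 e = pm≢0 (trans (cong (p ^ ord p n *_) e) (*-zeroʳ (p ^ ord p n)))
    rest : ∀ q → Prime q → q ∣ m → q ∈ ps
    rest q qp q∣m with all q qp (subst (q ∣_) (sym n=) (∣n⇒∣m*n (p ^ ord p n) q∣m))
    ... | here refl = contradiction q∣m p∤m
    ... | there q∈ = q∈
    mono : ∀ qs → All Prime qs → sum-over qs (λ q → lg (q ^ ord q m)) ≤ sum-over qs (λ q → lg (q ^ ord q n))
    mono [] [] = z≤n
    mono (q ∷ qs) (qp ∷ qps) = +-mono-≤ (lg-mono (^-monoʳ-≤ q {{prime⇒nonZero qp}} (subst (λ z → ord q m ≤ ord q z) (sym n=) (ord-∣-≤ qp (p ^ ord p n) m pm≢0)))) (mono qs qps)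

  ord≢0⇒≤ : ∀ {p} → Prime p → ∀ n → ord p n ≢ 0 → p ≤ n
  ord≢0⇒≤ pp zero h = contradiction refl h
  ord≢0⇒≤ pp n@(suc _) h = ≮⇒≥ λ n<p → h (p∤⇒ord≡0 pp n (λ p∣n → <⇒≱ n<p (∣⇒≤ p∣n)))

-- Denominators as squares, and relations from dependence of maximal rank

module Dependence where

  open import Defs
  open Rationals using (*-↧)
  open RingIdentity
  open Integers
  open GroupLaw
  open Denominators
  open Heights
  open Valuation
  open import Data.Bool using (Bool; true; false; if_then_else_)
  open import Data.Nat as ℕ using (ℕ; zero; suc; _≤_; _≤ᵇ_)
  import Data.Nat.Properties as ℕ
  open import Data.Nat.Tactic.RingSolver using (solve-∀)
  open import Data.Nat.Divisibility as ℕ∣ using (_∣_; divides)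
  open import Data.Nat.Coprimality as Coprime using (Coprime; coprime-divisor)
  open import Data.Nat.Primality using (Prime)
  open import Data.Integer using (ℤ; +_; ∣_∣)
  open import Data.Rational as ℚ using (ℚ; 0ℚ; ↥_; ↧_; ↧ₙ_)
  open import Data.Fin as Fin using (Fin; zero; suc)
  open import Data.List using ([]; _∷_)
  open import Data.Product using (_,_; ∃; proj₂)
  open import Data.Unit using (tt)
  open import Data.Sum using (inj₁; inj₂)
  open import Relation.Nullary using (yes; no; contradiction; does)
  open import Relation.Binary.PropositionalEquality
  open Linearℤ

  -- The auxiliary function of isqrt is local to its definition; abstracting suc n
  -- separates its two arguments, so that unification can name it.
  private
    mutual
      search : ℕ → ℕ → ℕ
      search = _

      isqrt-suc : ∀ n → isqrt (suc n) ≡ (if suc n ℕ.* suc n ≤ᵇ suc n then suc n else search (suc n) n)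
      isqrt-suc n with suc n
      ... | _ = refl

    search-square : ∀ d k → d ≤ k → search (d ℕ.* d) k ≡ d
    search-square zero zero _ = refl
    search-square d (suc k) d≤1+k with suc k ℕ.* suc k ≤ᵇ d ℕ.* d in eq
    ... | true = ℕ.≤-antisym (ℕ.≮⇒≥ λ d<1+k → ℕ.<⇒≱ (ℕ.*-mono-< d<1+k d<1+k) (ℕ.≤ᵇ⇒≤ (suc k ℕ.* suc k) (d ℕ.* d) (subst Data.Bool.T (sym eq) tt))) d≤1+k
    ... | false with ℕ.m≤n⇒m<n∨m≡n d≤1+k
    ...   | inj₁ d<1+k = search-square d k (ℕ.≤-pred d<1+k)
    ...   | inj₂ refl = contradiction (subst Data.Bool.T eq (ℕ.≤⇒≤ᵇ (ℕ.≤-refl {suc k ℕ.* suc k}))) λ ()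

  isqrt-square : ∀ d → isqrt (d ℕ.* d) ≡ d
  isqrt-square zero = refl
  isqrt-square d@(suc _) = search-square d (d ℕ.* d) (ℕ.m≤m*n d d)

  square-∣ : ∀ {m t} → t ≢ 0 → m ℕ.* m ∣ t ℕ.* t → m ∣ t
  square-∣ {m} {t} t≢0 h with gcd-split m t t≢0
  ... | g , m′ , t′ , g≢0 , refl , refl , c = subst (λ z → z ℕ.* g ∣ t′ ℕ.* g) (sym m′≡1) (ℕ∣.*-monoˡ-∣ g (ℕ∣.1∣ t′))
    where
    reduced : m′ ℕ.* m′ ∣ t′ ℕ.* t′
    reduced = ℕ∣.*-cancelʳ-∣ (g ℕ.* g) {{ℕ.m*n≢0 g g {{ℕ.≢-nonZero g≢0}} {{ℕ.≢-nonZero g≢0}}}} (subst₂ _∣_ (lemma m′ g) (lemma t′ g) h)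
      where
      lemma : ∀ m g → m ℕ.* g ℕ.* (m ℕ.* g) ≡ m ℕ.* m ℕ.* (g ℕ.* g)
      lemma = solve-∀
    m′≡1 : m′ ≡ 1
    m′≡1 = ℕ∣.∣1⇒≡1 (coprime-divisor c (coprime-divisor c (subst (m′ ∣_) (cong (t′ ℕ.*_) (sym (ℕ.*-identityʳ t′))) (ℕ∣.m*n∣⇒m∣ m′ m′ reduced))))

  -- `m²` divides `t²`, so `t = k m`, and cancelling `m²` leaves `m = k²`.
  cube≡square : ∀ {m t} → t ≢ 0 → m ℕ.* (m ℕ.* m) ≡ t ℕ.* t → ∃ λ k → m ≡ k ℕ.* k
  cube≡square {zero} _ _ = 0 , refl
  cube≡square {m@(suc _)} {t} t≢0 e with square-∣ {m} t≢0 (divides m (sym e))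
  ... | divides k refl = k , ℕ.*-cancelʳ-≡ m (k ℕ.* k) (m ℕ.* m) (trans e (lemma k m))
    where
    lemma : ∀ k m → k ℕ.* m ℕ.* (k ℕ.* m) ≡ k ℕ.* k ℕ.* (m ℕ.* m)
    lemma = solve-∀

  module _ (E : Curve) where

    private
      integral-equation : ∀ {x y} → OnCurve E (aff x y) →
        ↥ y * ↥ y * (↧ x * (↧ x * ↧ x)) ≡ ↧ y * ↧ y * (↥ x * (↥ x * ↥ x) + a E * ↥ x * ↧ x * ↧ x + b E * ↧ x * ↧ x * ↧ x)
      integral-equation {x} {y} h = transfer-ℚ (a E ∷ b E ∷ ↥ x ∷ ↧ x ∷ ↥ y ∷ ↧ y ∷ [])
        (indet 4 ⊗ indet 4 ⊗ (indet 3 ⊗ (indet 3 ⊗ indet 3)))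
        (indet 5 ⊗ indet 5 ⊗ (indet 2 ⊗ (indet 2 ⊗ indet 2) ⊕ indet 0 ⊗ indet 2 ⊗ indet 3 ⊗ indet 3 ⊕ indet 1 ⊗ indet 3 ⊗ indet 3 ⊗ indet 3))
        (clear {ℤ→ℚ (a E)} {ℤ→ℚ (b E)} {x} {_} {_} {y} (*-↧ x) (*-↧ y) h)
        where
        open Rationals using (identityℚ) renaming (linear to linearℚ; _·_ to _·ℚ_)
        clear : ∀ {a b x m n y t r} → x ℚ.* m ≡ n → y ℚ.* t ≡ r → y ℚ.* y ≡ x ℚ.* x ℚ.* x ℚ.+ a ℚ.* x ℚ.+ b →
          r ℚ.* r ℚ.* (m ℚ.* (m ℚ.* m)) ≡ t ℚ.* t ℚ.* (n ℚ.* (n ℚ.* n) ℚ.+ a ℚ.* n ℚ.* m ℚ.* m ℚ.+ b ℚ.* m ℚ.* m ℚ.* m)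
        clear {a} {b} {x} {m} {_} {y} {t} refl refl h = linearℚ ((t ℚ.* t ℚ.* (m ℚ.* (m ℚ.* m))) ·ℚ h)
          (identityℚ (y ∷ t ∷ m ∷ x ∷ a ∷ b ∷ []) (λ y t m x a b →
              y ⊗ t ⊗ (y ⊗ t) ⊗ (m ⊗ (m ⊗ m)) ⊖ t ⊗ t ⊗ (x ⊗ m ⊗ (x ⊗ m ⊗ (x ⊗ m)) ⊕ a ⊗ (x ⊗ m) ⊗ m ⊗ m ⊕ b ⊗ m ⊗ m ⊗ m)
              ⊜ t ⊗ t ⊗ (m ⊗ (m ⊗ m)) ⊗ (y ⊗ y ⊖ (x ⊗ x ⊗ x ⊕ a ⊗ x ⊕ b))) refl)

    -- In the equation cleared of denominators, `t²` is coprime to the square of the numerator of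
    -- `y`, and the cleared cubic `c` is congruent to the cube of the numerator of `x` modulo `m`.
    -- Hence `m³` and `t²` divide each other.
    denominator-square : ∀ {x y} → OnCurve E (aff x y) → ∃ λ d → ↧ₙ x ≡ d ℕ.* d
    denominator-square {x} {y} h = cube≡square {↧ₙ x} {↧ₙ y} (λ ()) (ℕ∣.∣-antisym m³∣t² t²∣m³)
      where
      m t : ℕ
      m = ↧ₙ x
      t = ↧ₙ y
      c : ℤ
      c = ↥ x * (↥ x * ↥ x) + a E * ↥ x * ↧ x * ↧ x + b E * ↧ x * ↧ x * ↧ x
      equation : ∣ ↥ y ∣ ℕ.* ∣ ↥ y ∣ ℕ.* (m ℕ.* (m ℕ.* m)) ≡ t ℕ.* t ℕ.* ∣ c ∣
      equation = trans (sym (trans (abs-* (↥ y * ↥ y) _) (cong₂ ℕ._*_ (abs-* (↥ y) (↥ y)) (trans (abs-* (↧ x) _) (cong (m ℕ.*_) (abs-* (↧ x) (↧ x)))))))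
        (trans (cong ∣_∣ (integral-equation {x} {y} h)) (trans (abs-* (↧ y * ↧ y) c) (cong (ℕ._* ∣ c ∣) (abs-* (↧ y) (↧ y)))))
      t⊥r : Coprime (t ℕ.* t) (∣ ↥ y ∣ ℕ.* ∣ ↥ y ∣)
      t⊥r = Coprime.sym (coprime-* {∣ ↥ y ∣} r⊥t² r⊥t²)
        where
        r⊥t² : Coprime (∣ ↥ y ∣) (t ℕ.* t)
        r⊥t² = Coprime.sym (coprime-* {t} (Coprime.sym (↥↧-coprime y)) (Coprime.sym (↥↧-coprime y)))
      t²∣m³ : t ℕ.* t ∣ m ℕ.* (m ℕ.* m)
      t²∣m³ = coprime-divisor t⊥r (subst (t ℕ.* t ∣_) (sym equation) (ℕ∣.m∣m*n (∣ c ∣)))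
      m⊥c : Coprime m (∣ c ∣)
      m⊥c {d} (d∣m , d∣c) = ℕ∣.∣1⇒≡1 (coprime-divisor d⊥n (coprime-divisor d⊥n (coprime-divisor d⊥n (subst (d ∣_) cube d∣n³))))
        where
        d⊥n : Coprime d (∣ ↥ x ∣)
        d⊥n (e∣d , e∣n) = ↥↧-coprime x (e∣n , ℕ∣.∣-trans e∣d d∣m)
        d∣n³ : d ∣ℤ ↥ x * (↥ x * ↥ x)
        d∣n³ = ∣ℤ-+-cancelʳ _ _ (∣ℤ-+-cancelʳ _ _ d∣c (∣ℤ-*ˡ {d} {↧ x} _ d∣m)) (∣ℤ-*ˡ {d} {↧ x} _ d∣m)
        cube : ∣ ↥ x * (↥ x * ↥ x) ∣ ≡ ∣ ↥ x ∣ ℕ.* (∣ ↥ x ∣ ℕ.* (∣ ↥ x ∣ ℕ.* 1))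
        cube = trans (abs-* (↥ x) _) (cong (∣ ↥ x ∣ ℕ.*_) (trans (abs-* (↥ x) (↥ x)) (cong (∣ ↥ x ∣ ℕ.*_) (sym (ℕ.*-identityʳ (∣ ↥ x ∣))))))
      c⊥m : Coprime (∣ c ∣) (m ℕ.* (m ℕ.* m))
      c⊥m = Coprime.sym (coprime-* {m} m⊥c (coprime-* {m} m⊥c m⊥c))
      m³∣t² : m ℕ.* (m ℕ.* m) ∣ t ℕ.* t
      m³∣t² = coprime-divisor {n = ∣ c ∣} (Coprime.sym c⊥m) (subst (m ℕ.* (m ℕ.* m) ∣_) (trans equation (ℕ.*-comm (t ℕ.* t) (∣ c ∣))) (ℕ∣.n∣m*n (∣ ↥ y ∣ ℕ.* ∣ ↥ y ∣)))

    -- The rounded root in the definition of `den` is exact on the curve, so `den` and `denominator`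
    -- have the same prime divisors.
    den-square : ∀ A → OnCurve E A → denominator A ≡ den A ℕ.* den A
    den-square O _ = refl
    den-square (aff x y) h = let d , e = denominator-square {x} {y} h in
      trans e (cong (λ z → z ℕ.* z) (sym (trans (cong isqrt e) (isqrt-square d))))

  -- By maximality of the rank no exponent vanishes.
  record Relation (s : ℕ) (γ : Fin s → ℚ) : Set where
    field
      k : Fin s → ℤ
      k≢0 : ∀ i → k i ≢ + 0
      γ≢0 : ∀ i → γ i ≢ 0ℚ
      linear-relation : ∀ {p} (p-prime : Prime p) → sumℤ s (λ i → k i * ordℚ p-prime (γ i)) ≡ + 0

  maximal-rank⇒relation : ∀ {s γ} → MaxRankDep s γ → Relation s γ
  maximal-rank⇒relation {s} {γ} (γ≢0 , (k , _ , nontrivial , relation) , maximal) = record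
    { k = k
    -- With a zero exponent at `i`, the same exponents would relate the sub-tuple that omits `i`.
    ; k≢0 = λ i k≡0 → maximal (others i) (i , self i) (k , outside i k≡0 , nontrivial , relation)
    ; γ≢0 = γ≢0
    ; linear-relation = λ p-prime → trans (sym (proj₂ (ordℚ-prodFin p-prime s γ k γ≢0))) (trans (cong (ordℚ p-prime) relation) (ordℚ-1 p-prime))
    }
    where
    others : Fin s → Fin s → Bool
    others i j = Data.Bool.not (does (i Fin.≟ j))
    self : ∀ i → others i i ≡ false
    self i with i Fin.≟ i
    ... | yes _ = refl
    ... | no i≢i = contradiction refl i≢i
    outside : ∀ i → k i ≡ + 0 → ∀ j → others i j ≡ false → k j ≡ + 0
    outside i k≡0 j e with i Fin.≟ j
    ... | yes refl = k≡0
    outside i k≡0 j () | no _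

-- Smooth points and divisibility classes on a single curve

module CurveCounts where

  open import Defs
  open BinaryLog
  open SmoothCount
  open PrimeDivisors
  open Valuation
  open GroupLaw
  open Denominators
  open Archimedean
  open LogHeights
  open Growth
  open import Data.Nat as ℕ using (ℕ; zero; suc; _≤_; _<_; z≤n; s≤s; _+_; _*_; _^_; _∸_; _⊓_)
  import Data.Nat.Properties as ℕ
  open import Data.Nat.Tactic.RingSolver using (solve-∀)
  open import Data.Nat.Divisibility using (_∣_; _∣?_; ∣⇒≤; ∣-trans; divides)
  open import Data.Nat.Primality using (Prime; prime?)
  open import Data.Integer using (∣_∣)
  open import Data.Rational using (↥_)
  open import Data.List using (List; []; _∷_; length; map)
  open import Data.List.Properties using (length-map)
  open import Data.List.Relation.Unary.All as All using (All; []; _∷_; all?)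
  open import Data.Maybe using (Maybe; just; nothing)
  open import Data.Product using (_,_; _×_; ∃; proj₁; proj₂)
  open import Data.Sum using ([_,_]′)
  open import Relation.Nullary using (Dec; yes; no; contradiction; ¬_; ¬?; _×-dec_)
  open import Relation.Unary using (Decidable)
  open import Relation.Binary.PropositionalEquality

  O? : ∀ A → Dec (A ≡ O)
  O? O = yes refl
  O? (aff _ _) = no λ ()

  ^-∣ : ∀ p {v w} → v ≤ w → p ^ v ∣ p ^ w
  ^-∣ p {v} {w} h = divides (p ^ (w ∸ v)) (trans (cong (p ^_) (sym (ℕ.m∸n+n≡m h))) (ℕ.^-distribˡ-+-* p (w ∸ v) v))

  denominator≢0 : ∀ {A} → A ≢ O → denominator A ≢ 0
  denominator≢0 {O} A≢O = contradiction refl A≢O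
  denominator≢0 {aff _ _} _ = λ ()

  module _ {P : ℕ → Set} (P? : Decidable P) where

    count-none : ∀ x n → (∀ i → x ≤ i → i < x + n → ¬ P i) → count P? x n ≡ 0
    count-none x zero _ = refl
    count-none x (suc n) none with P? x
    ... | yes p = contradiction p (none x ℕ.≤-refl (ℕ.m<m+n x (s≤s z≤n)))
    ... | no _ = count-none (suc x) n (λ i x<i i< → none i (ℕ.<⇒≤ x<i) (subst (i <_) (sym (ℕ.+-suc x n)) i<))

    count-one : ∀ x n → (∀ i j → x ≤ i → i < j → j < x + n → P i → P j → ¬ P j) → count P? x n ≤ 1
    count-one x zero _ = z≤n
    count-one x (suc n) pair with P? x
    ... | yes p = s≤s (ℕ.≤-reflexive (count-none (suc x) n (λ j x<j j< pj → pair x j ℕ.≤-refl x<j (subst (j <_) (sym (ℕ.+-suc x n)) j<) p pj pj)))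
    ... | no _ = count-one (suc x) n (λ i j x<i i<j j< → pair i j (ℕ.<⇒≤ x<i) i<j (subst (j <_) (sym (ℕ.+-suc x n)) j<))

    count-two : ∀ x n → (∀ i j l → x ≤ i → i < j → j < l → l < x + n → P i → P j → ¬ P l) → count P? x n ≤ 2
    count-two x zero _ = z≤n
    count-two x (suc n) triple with P? x
    ... | yes p = s≤s (count-one (suc x) n (λ i j x<i i<j j< pi _ → triple x i j ℕ.≤-refl x<i i<j (subst (j <_) (sym (ℕ.+-suc x n)) j<) p pi))
    ... | no _ = count-two (suc x) n (λ i j l x<i i<j j<l l< → triple i j l (ℕ.<⇒≤ x<i) i<j j<l (subst (l <_) (sym (ℕ.+-suc x n)) l<))

    count-windows : ∀ c w → (∀ x → count P? x w ≤ c) → ∀ q x → count P? x (q * w) ≤ q * c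
    count-windows c w window zero x = z≤n
    count-windows c w window (suc q) x = ℕ.≤-trans (ℕ.≤-reflexive (count-+ P? x w (q * w))) (ℕ.+-mono-≤ (window x) (count-windows c w window q (x + w)))

  module Counts (E : Curve) (P Q : Pt) (hP : OnCurve E P) (nontorsion : NonTorsion E P) (hQ : OnCurve E Q) where

    open Orbit E P hP nontorsion
    open Translates Q hQ

    D : ℕ → ℕ
    D n = denominator (R n)

    K κ : ℕ
    K = proj₁ multiples-upper
    κ = proj₁ translates-lower

    ·P≢O : ∀ d → suc d ·P ≢ O
    ·P≢O = nontorsion

    lg-denominator : ∀ d → lg (denominator (suc d ·P)) ≤ K * (suc d * suc d)
    lg-denominator d = ℕ.≤-trans (lg-mono (denominator≤height (suc d ·P) (·P≢O d))) (proj₂ multiples-upper (suc d))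

    R-difference : ∀ {i j} → i < j → ∃ λ d → suc d + i ≡ j × sub E (R j) (R i) ≡ suc d ·P
    R-difference {i} {j} i<j = j ∸ suc i , e , subst (λ l → sub E (R l) (R i) ≡ suc (j ∸ suc i) ·P) e (R-sub (suc (j ∸ suc i)) i)
      where
      e : suc (j ∸ suc i) + i ≡ j
      e = trans (sym (ℕ.+-suc (j ∸ suc i) i)) (ℕ.m∸n+n≡m i<j)

    Smooth : ℕ → ℕ → Set
    Smooth W n = R n ≢ O × All (_∣ W) (primeDivisors (D n))

    smooth? : ∀ W → Decidable (Smooth W)
    smooth? W n = ¬? (O? (R n)) ×-dec all? (_∣? W) (primeDivisors (D n))

    -- `nothing` is the archimedean place. Its additional 1 provides the 1 added to the height in
    -- `translates-lower`.
    contribution : Maybe ℕ → ℕ → ℕ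
    contribution nothing n = lg (suc (size (R n))) + 1
    contribution (just p) n with prime? p
    ... | yes _ = lg (p ^ ord p (D n))
    ... | no _ = 0

    separation-constant : ℕ
    separation-constant = lg (suc (archimedean-constant E)) + 2 * K + 1

    private
      common-power : ∀ {p} → Prime p → ∀ i d → lg (p ^ ord p (D i)) ⊓ lg (p ^ ord p (D (suc d + i))) ≤ K * (suc d * suc d)
      common-power {p} pp i d = [ low , high ]′ (ℕ.≤-total (ord p (D i)) (ord p (D (suc d + i))))
        where
        both : ∀ v → p ^ v ∣ D i → p ^ v ∣ D (suc d + i) → lg (p ^ v) ≤ K * (suc d * suc d)
        both v h h′ = ℕ.≤-trans (lg-mono (∣⇒≤ {{ℕ.≢-nonZero (denominator≢0 (·P≢O d))}} (subst (λ S → p ^ v ∣ denominator S) (R-sub (suc d) i)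
          (denominator-sub E (R (suc d + i)) (R i) (on-R (suc d + i)) (on-R i) h′ h)))) (lg-denominator d)
        low : ord p (D i) ≤ ord p (D (suc d + i)) → _
        low h = ℕ.≤-trans (ℕ.m⊓n≤m (lg (p ^ ord p (D i))) _) (both (ord p (D i)) (p^ord∣ pp (D i)) (∣-trans (^-∣ p h) (p^ord∣ pp (D (suc d + i)))))
        high : ord p (D (suc d + i)) ≤ ord p (D i) → _
        high h = ℕ.≤-trans (ℕ.m⊓n≤n (lg (p ^ ord p (D i))) _) (both (ord p (D (suc d + i))) (∣-trans (^-∣ p h) (p^ord∣ pp (D i))) (p^ord∣ pp (D (suc d + i))))

    separation : ∀ W a i d → Smooth W i → Smooth W (suc d + i) → contribution a i ⊓ contribution a (suc d + i) ≤ separation-constant * (suc d * suc d)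
    separation W (just p) i d _ _ with prime? p
    ... | no _ = z≤n
    ... | yes pp = ℕ.≤-trans (common-power pp i d) (ℕ.*-monoˡ-≤ (suc d * suc d) (ℕ.≤-trans (ℕ.m≤m+n K (K + 0)) (ℕ.≤-trans (ℕ.m≤n+m (2 * K) (lg (suc (archimedean-constant E)))) (ℕ.m≤m+n _ 1))))
    separation W nothing i d (Ri , _) (Rj , _) = begin
      (lg (suc (size (R i))) + 1) ⊓ (lg (suc (size (R j))) + 1) ≡⟨ ℕ.+-distribʳ-⊓ 1 (lg (suc (size (R i)))) (lg (suc (size (R j)))) ⟨
      lg (suc (size (R i))) ⊓ lg (suc (size (R j))) + 1         ≡⟨ cong (_+ 1) (ℕ.⊓-comm (lg (suc (size (R i)))) _) ⟩
      lg (suc (size (R j))) ⊓ lg (suc (size (R i))) + 1         ≤⟨ ℕ.+-monoˡ-≤ 1 (archimedean-lg E (R j) (R i) (on-R j) (on-R i) Rj Ri (λ e → ·P≢O d (trans (sym (R-sub (suc d) i)) e))) ⟩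
      c + 2 * h (sub E (R j) (R i)) + 1                         ≡⟨ cong (λ S → c + 2 * h S + 1) (R-sub (suc d) i) ⟩
      c + 2 * h (suc d ·P) + 1                                  ≤⟨ ℕ.+-monoˡ-≤ 1 (ℕ.+-monoʳ-≤ c (ℕ.*-monoʳ-≤ 2 (proj₂ multiples-upper (suc d)))) ⟩
      c + 2 * (K * (suc d * suc d)) + 1                         ≤⟨ ℕ.m≤m+n _ ((c + 1) * (d * d + 2 * d)) ⟩
      c + 2 * (K * (suc d * suc d)) + 1 + (c + 1) * (d * d + 2 * d) ≡⟨ lemma c K d ⟩
      separation-constant * (suc d * suc d)                     ∎
      where
      open ℕ.≤-Reasoning
      j c : ℕ
      j = suc d + i
      c = lg (suc (archimedean-constant E))
      lemma : ∀ c K d → c + 2 * (K * ((1 + d) * (1 + d))) + 1 + (c + 1) * (d * d + 2 * d) ≡ (c + 2 * K + 1) * ((1 + d) * (1 + d))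
      lemma = solve-∀

    places : ℕ → List (Maybe ℕ)
    places W = nothing ∷ map just (primeDivisors W)

    smooth-total : ∀ W → W ≢ 0 → ∀ n → Smooth W n → n * n ≤ κ * sum-over (places W) (λ a → contribution a n)
    smooth-total W W≢0 n (Rn≢O , smooth) = ℕ.≤-trans (proj₂ translates-lower n) (ℕ.*-monoʳ-≤ κ (begin
      h (R n) + 1                                                ≤⟨ ℕ.+-monoˡ-≤ 1 (h≤denominator+size (R n)) ⟩
      lg (D n) + lg (suc (size (R n))) + 1                       ≡⟨ lemma (lg (D n)) (lg (suc (size (R n)))) ⟩
      lg (suc (size (R n))) + 1 + lg (D n)                       ≤⟨ ℕ.+-monoʳ-≤ _ (lg≤sum-ord (primeDivisors W) (D n) (denominator≢0 Rn≢O) all-prime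
                                                                      (λ p pp p∣D → ∈-primeDivisors W≢0 pp (All.lookup smooth (∈-primeDivisors (denominator≢0 Rn≢O) pp p∣D)))) ⟩
      lg (suc (size (R n))) + 1 + sum-over (primeDivisors W) (λ p → lg (p ^ ord p (D n))) ≡⟨ cong (lg (suc (size (R n))) + 1 +_) (as-places (primeDivisors W) all-prime) ⟩
      sum-over (places W) (λ a → contribution a n)               ∎))
      where
      open ℕ.≤-Reasoning
      all-prime : All Prime (primeDivisors W)
      all-prime = All.tabulate (λ p∈ → proj₁ (∈-primeDivisors⁻ p∈))
      lemma : ∀ a b → a + b + 1 ≡ b + 1 + a
      lemma = solve-∀
      as-places : ∀ ps → All Prime ps → sum-over ps (λ p → lg (p ^ ord p (D n))) ≡ sum-over (map just ps) (λ a → contribution a n)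
      as-places [] [] = refl
      as-places (p ∷ ps) (pp ∷ pps) = cong₂ _+_ (by (prime? p)) (as-places ps pps)
        where
        by : Dec (Prime p) → lg (p ^ ord p (D n)) ≡ contribution (just p) n
        by _ with prime? p
        ... | yes _ = refl
        ... | no ¬pp = contradiction pp ¬pp

    smooth-count : ∀ W → W ≢ 0 → ∀ M j i → count (smooth? W) (suc M) (2 ^ (i + j)) ≤ 2 ^ j + i * ((1 + length (primeDivisors W)) * (1 + 2 * (κ * separation-constant)))
    smooth-count W W≢0 M j i = subst (λ l → count (smooth? W) (suc M) (2 ^ (i + j)) ≤ 2 ^ j + i * (suc l * (1 + 2 * (κ * separation-constant)))) (length-map just (primeDivisors W))
      (count-bound (places W) (smooth? W) contribution κ separation-constant (separation W) (smooth-total W W≢0) M j i)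

    -- Expresses on one curve that `p` lies outside `S`; the multiple 0, with denominator 0, is left
    -- out.
    Rough : ℕ → ℕ → Set
    Rough p w = ∀ d → suc d ≤ w → ¬ p ∣ denominator (suc d ·P)

    private
      close : ∀ {x w i j d} → x ≤ i → j < x + w → suc d + i ≡ j → suc d ≤ w
      close {x} {w} {i} {_} {d} x≤i j< refl = ℕ.+-cancelʳ-≤ i (suc d) w (ℕ.≤-trans (ℕ.<⇒≤ j<) (ℕ.≤-trans (ℕ.+-monoˡ-≤ w x≤i) (ℕ.≤-reflexive (ℕ.+-comm i w))))

      rough-difference : ∀ {p w x} → Rough p w → ∀ i j → x ≤ i → i < j → j < x + w → ¬ p ∣ denominator (sub E (R j) (R i))
      rough-difference {p} rough i j x≤i i<j j< h = let d , e , diff = R-difference i<j in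
        rough d (close x≤i j< e) (subst (λ S → p ∣ denominator S) diff h)

    denominator-count : ∀ {p w} → Rough p w → ∀ q x → count (λ n → p ∣? D n) x (q * w) ≤ q * 1
    denominator-count {p} {w} rough = count-windows (λ n → p ∣? D n) 1 w λ x → count-one (λ n → p ∣? D n) x w
      λ i j x≤i i<j j< h h′ _ → rough-difference rough i j x≤i i<j j< (denominator-sub E (R j) (R i) (on-R j) (on-R i) h′ h)

    Numerator : ℕ → ℕ → Set
    Numerator p n = R n ≢ O × p ∣ ∣ ↥ xcoord (R n) ∣

    numerator? : ∀ p → Decidable (Numerator p)
    numerator? p n = ¬? (O? (R n)) ×-dec (p ∣? ∣ ↥ xcoord (R n) ∣)

    private
      sub-translate : ∀ A B C → OnCurve E A → OnCurve E B → OnCurve E C → sub E (add E A C) (add E B C) ≡ sub E A B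
      sub-translate A B C hA hB hC = begin
        sub E (add E A C) (add E B C)                        ≡⟨ cong (λ S → sub E (add E A C) S) (add-comm E B C hB hC) ⟩
        sub E (add E A C) (add E C B)                        ≡⟨ cong (add E (add E A C)) (opposite-add E C B hC hB) ⟩
        add E (add E A C) (add E (opposite C) (opposite B))  ≡⟨ add-assoc E (add E A C) (opposite C) (opposite B) (add-on E A C hA hC) (opposite-on E {C} hC) (opposite-on E {B} hB) ⟨
        add E (add E (add E A C) (opposite C)) (opposite B)  ≡⟨ cong (λ S → add E S (opposite B)) (cancelʳ E A C hA hC) ⟩
        sub E A B                                            ∎
        where open ≡-Reasoning

    -- Suppose `p` divides the numerators at three indices of a window. It divides no denominator of
    -- a difference there, so it divides those of the sums of the first point with the other two,
    -- hence that of the difference of these two. So two indices per window is the limit.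
    numerator-count : ∀ {p w} → Prime p → ¬ p ∣ 2 * ∣ b E ∣ → Rough p w → ∀ q x → count (numerator? p) x (q * w) ≤ q * 2
    numerator-count {p} {w} pp p∤2b rough = count-windows (numerator? p) 2 w λ x → count-two (numerator? p) x w
      λ i j l x≤i i<j j<l l< ni nj nl →
        let i<l = ℕ.<-trans i<j j<l
            sum j x≤i i<j j< nj = [ (λ h → h) , (λ h → contradiction h (rough-difference rough i j x≤i i<j j<)) ]′
              (numerator-sum-difference E (R j) (R i) (on-R j) (on-R i) pp p∤2b (proj₂ nj) (proj₂ ni) (proj₁ nj) (proj₁ ni))
        in rough-difference rough j l (ℕ.≤-trans x≤i (ℕ.<⇒≤ i<j)) j<l l< (subst (λ S → p ∣ denominator S) (sub-translate (R l) (R j) (R i) (on-R l) (on-R j) (on-R i))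
          (denominator-sub E (add E (R l) (R i)) (add E (R j) (R i)) (add-on E (R l) (R i) (on-R l) (on-R i)) (add-on E (R j) (R i) (on-R j) (on-R i))
            (sum l x≤i i<l l< nl) (sum j x≤i i<j (ℕ.<-trans j<l l<) nj)))

-- Choice of scales and the common bound

module Assembly where

  open RingIdentity using (_⊕_; _⊖_; #_; _⊜_)
  open import Defs
  open BinaryLog
  open SmoothCount
  open PrimeDivisors
  open Valuation
  open Dependence
  open Covering
  open CurveCounts
  open GroupLaw
  open Denominators using (denominator)
  open import Data.Nat as ℕ using (ℕ; zero; suc; _≤_; _<_; z≤n; s≤s; _+_; _*_; _^_; _≤?_)
  import Data.Nat.Properties as ℕ
  open import Data.Nat.Tactic.RingSolver using (solve-∀)
  open import Data.Nat.Divisibility using (_∣_; _∣?_; ∣-trans; m∣m*n; ∣m⇒∣m*n; ∣n⇒∣m*n)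
  open import Data.Nat.Primality using (Prime; prime?)
  open import Data.Integer using (ℤ; +_; ∣_∣)
  open import Data.Rational using (ℚ; 0ℚ; ↥_; ↧ₙ_)
  open import Data.Fin using (Fin; zero; suc)
  open import Data.Vec using (Vec; lookup; tabulate)
  open import Data.Vec.Properties using (tabulate∘lookup)
  open import Data.Maybe using (nothing)
  open import Data.List using (List; []; length; filter; upTo)
  open import Data.List.Membership.Propositional using (_∈_)
  open import Data.List.Membership.Propositional.Properties using (∈-filter⁺; ∈-upTo⁺)
  open import Data.List.Relation.Unary.All as All using (All)
  open import Data.List.Relation.Unary.Unique.Propositional using (Unique)
  open import Data.Product using (_,_; _×_; ∃; Σ; proj₁; proj₂)
  open import Data.Sum using (inj₁; inj₂; [_,_]′)
  open import Function using (_∘_)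
  open import Relation.Nullary using (Dec; yes; no; contradiction; ¬_)
  open import Relation.Unary using (Decidable)
  open import Relation.Binary.PropositionalEquality

  sumFin productFin : (s : ℕ) → (Fin s → ℕ) → ℕ
  sumFin zero f = 0
  sumFin (suc s) f = f zero + sumFin s (f ∘ suc)
  productFin zero f = 1
  productFin (suc s) f = f zero * productFin s (f ∘ suc)

  ≤-sumFin : ∀ s f i → f i ≤ sumFin s f
  ≤-sumFin (suc s) f zero = ℕ.m≤m+n (f zero) _
  ≤-sumFin (suc s) f (suc i) = ℕ.≤-trans (≤-sumFin s (f ∘ suc) i) (ℕ.m≤n+m _ (f zero))

  ∣-productFin : ∀ s f i → f i ∣ productFin s f
  ∣-productFin (suc s) f zero = m∣m*n _
  ∣-productFin (suc s) f (suc i) = ∣n⇒∣m*n (f zero) (∣-productFin s (f ∘ suc) i)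

  *-≢0ℕ : ∀ {m n} → m ≢ 0 → n ≢ 0 → m * n ≢ 0
  *-≢0ℕ {m} m≢0 n≢0 e = [ m≢0 , n≢0 ]′ (ℕ.m*n≡0⇒m≡0∨n≡0 m e)

  productFin≢0 : ∀ s f → (∀ i → f i ≢ 0) → productFin s f ≢ 0
  productFin≢0 zero f _ = λ ()
  productFin≢0 (suc s) f h = *-≢0ℕ (h zero) (productFin≢0 s (f ∘ suc) (h ∘ suc))

  lg-productFin : ∀ s f g X → (∀ i → lg (f i) ≤ g i * X) → lg (productFin s f) ≤ sumFin s g * X
  lg-productFin zero f g X h = ℕ.≤-reflexive lg-1
  lg-productFin (suc s) f g X h = ℕ.≤-trans (lg-* (f zero) _) (ℕ.≤-trans (ℕ.+-mono-≤ (h zero) (lg-productFin s (f ∘ suc) (g ∘ suc) X (h ∘ suc)))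
    (ℕ.≤-reflexive (sym (ℕ.*-distribʳ-+ X (g zero) _))))

  product-below : (ℕ → ℕ) → ℕ → ℕ
  product-below f zero = 1
  product-below f (suc n) = f n * product-below f n

  ∣-product-below : ∀ f {d n} → d < n → f d ∣ product-below f n
  ∣-product-below f {d} {suc n} d<1+n with ℕ.m≤n⇒m<n∨m≡n (ℕ.≤-pred d<1+n)
  ... | inj₁ d<n = ∣n⇒∣m*n (f n) (∣-product-below f d<n)
  ... | inj₂ refl = m∣m*n _

  product-below≢0 : ∀ f n → (∀ d → f d ≢ 0) → product-below f n ≢ 0
  product-below≢0 f zero _ = λ ()
  product-below≢0 f (suc n) h = *-≢0ℕ (h n) (product-below≢0 f n h)

  lg-product-below : ∀ f n Y → (∀ d → d < n → lg (f d) ≤ Y) → lg (product-below f n) ≤ n * Y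
  lg-product-below f zero Y h = ℕ.≤-reflexive lg-1
  lg-product-below f (suc n) Y h = ℕ.≤-trans (lg-* (f n) _) (ℕ.+-mono-≤ (h n ℕ.≤-refl) (lg-product-below f n Y (λ d d<n → h d (ℕ.m<n⇒m<1+n d<n))))

  n≤2^n : ∀ n → n ≤ 2 ^ n
  n≤2^n zero = z≤n
  n≤2^n (suc n) = ℕ.≤-trans (ℕ.+-mono-≤ (ℕ.m^n>0 2 n) (n≤2^n n)) (ℕ.≤-reflexive (cong (λ z → 2 ^ n + z) (sym (ℕ.+-identityʳ (2 ^ n)))))

  -- Replaces `N` by a seventh power of `2 ^ k`; the loss of a factor `2 ^ 7` goes into the
  -- constants.
  scale : ∀ N → 1 ≤ N → ∃ λ k → 2 ^ (7 * k) ≤ N × N < 2 ^ (7 * k + 7)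
  scale (suc zero) _ = 0 , s≤s z≤n , s≤s (s≤s z≤n)
  scale (suc N@(suc _)) _ with scale N (s≤s z≤n)
  ... | k , lo , hi with suc (suc N) ≤? 2 ^ (7 * k + 7)
  ...   | yes h = k , ℕ.m≤n⇒m≤1+n lo , h
  ...   | no ¬h = suc k , ℕ.≤-trans (ℕ.≤-reflexive (cong (2 ^_) (shift k))) (ℕ.≤-pred (ℕ.≰⇒> ¬h)) ,
          ℕ.≤-<-trans hi (ℕ.<-≤-trans (ℕ.^-monoʳ-< 2 (s≤s (s≤s z≤n)) (ℕ.m<m+n (7 * k + 7) (s≤s (z≤n {6})))) (ℕ.≤-reflexive (cong (λ e → 2 ^ (e + 7)) (sym (shift k)))))
    where
    shift : ∀ k → 7 * suc k ≡ 7 * k + 7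
    shift = lemma
      where
      lemma : ∀ k → 7 * (1 + k) ≡ 7 * k + 7
      lemma = solve-∀

  ^-distribʳ-* : ∀ k m n → (m * n) ^ k ≡ m ^ k * n ^ k
  ^-distribʳ-* zero m n = refl
  ^-distribʳ-* (suc k) m n = trans (cong (m * n *_) (^-distribʳ-* k m n)) (lemma m n (m ^ k) (n ^ k))
    where
    lemma : ∀ a b c d → a * b * (c * d) ≡ a * c * (b * d)
    lemma = solve-∀

  opaque
    -- `β * (q * 3)` is `2 ^ 14 * 3` times `T * T`: twice the rounding of `N` by `2 ^ 7`, and three
    -- indices per window.
    window-constant : ℕ
    window-constant = 2 ^ 14 * 3

    window-constant-bounds : 2 ^ 7 * 3 ≤ window-constant × 2 ^ 14 * 3 ≤ window-constant
    window-constant-bounds = ℕ.*-monoˡ-≤ 3 (ℕ.^-monoʳ-≤ 2 (ℕ.m≤m+n 7 7)) , ℕ.≤-refl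

  missing-all : ∀ s → missing s (λ _ → nothing) ≡ s
  missing-all zero = refl
  missing-all (suc s) = cong suc (missing-all s)

  -- The common part of the counts for denominators and for abscissae, for numbers γ i n
  -- attached to the points n Pᵢ + Qᵢ.
  module Count (s : ℕ) (E : Fin s → Curve) (P Q : Fin s → Pt) (hP : ∀ i → OnCurve (E i) (P i)) (nontorsion : ∀ i → NonTorsion (E i) (P i))
    (hQ : ∀ i → OnCurve (E i) (Q i)) where

    module C (i : Fin s) = Counts (E i) (P i) (Q i) (hP i) (nontorsion i) (hQ i)

    R : Fin s → ℕ → Pt
    R i n = add (E i) (mul (E i) n (P i)) (Q i)

    module _ (γ : Fin s → ℕ → ℚ) (extra : ℕ) (extra≢0 : extra ≢ 0)
      {Class : Fin s → ℕ → ℕ → Set} (class? : ∀ i p → Decidable (Class i p))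
      (class-count : ∀ i {p w} → Prime p → ¬ p ∣ extra → C.Rough i p w → ∀ q x → count (class? i p) x (q * w) ≤ q * 3)
      (ord-class : ∀ i n {p} (pp : Prime p) → γ i n ≢ 0ℚ → ordℚ pp (γ i n) ≢ + 0 → Class i p n)
      (ord-smooth : ∀ i n {p} (pp : Prime p) → γ i n ≢ 0ℚ → ordℚ pp (γ i n) ≡ + 0 → ¬ p ∣ denominator (R i n))
      (γ≢0⇒≢O : ∀ i n → γ i n ≢ 0ℚ → R i n ≢ O) where

      private
        Λ Cw c constant : ℕ
        Λ = sumFin s (λ i → 1 + 2 * (C.κ i * C.separation-constant i))
        Cw = lg extra + sumFin s C.K
        c = window-constant + (1 + (9 + 8 * Cw) * Λ)
        constant = 1 + s * c + s * (s * c) + s * (s * (s * c))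

        multiple : Fin s → ℕ → ℕ
        multiple i d = denominator (mul (E i) (suc d) (P i))

        module Scale (k M : ℕ) where

          -- With `B = 2 ^ k`: `T` is `B⁶`, `w` is the window `B²`, and the box of length
          -- `β = 2⁷ B⁷` consists of `q` windows. `S` is the set of prime divisors of `W`.
          T w q β W : ℕ
          T = 2 ^ (6 * k)
          w = 2 ^ (2 * k)
          q = 2 ^ (5 * k + 7)
          β = 2 ^ (k + 7 + 6 * k)
          W = extra * productFin s (λ i → product-below (multiple i) w)

          β≡q*w : β ≡ q * w
          β≡q*w = trans (cong (2 ^_) (lemma k)) (ℕ.^-distribˡ-+-* 2 (5 * k + 7) (2 * k))
            where
            lemma : ∀ k → k + 7 + 6 * k ≡ 5 * k + 7 + 2 * k
            lemma = solve-∀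

          T≡w³ : w * (w * w) ≡ T
          T≡w³ = trans (cong (w *_) (sym (ℕ.^-distribˡ-+-* 2 (2 * k) (2 * k)))) (trans (sym (ℕ.^-distribˡ-+-* 2 (2 * k) (2 * k + 2 * k))) (cong (2 ^_) (lemma k)))
            where
            lemma : ∀ k → 2 * k + (2 * k + 2 * k) ≡ 6 * k
            lemma = solve-∀

          1≤T : 1 ≤ T
          1≤T = ℕ.m^n>0 2 (6 * k)

          W≢0 : W ≢ 0
          W≢0 = *-≢0ℕ extra≢0 (productFin≢0 s _ (λ i → product-below≢0 (multiple i) w (λ d → denominator≢0 (nontorsion i d))))

          -- On each curve there are `w` multiples with logarithms `O(w²)`, and `w³` is `T`.
          lgW≤ : lg W ≤ Cw * T
          lgW≤ = ℕ.≤-trans (lg-* extra _) (ℕ.≤-trans (ℕ.+-mono-≤ (ℕ.m≤m*n (lg extra) T {{ℕ.>-nonZero 1≤T}}) (lg-productFin s _ C.K T each)) (ℕ.≤-reflexive (sym (ℕ.*-distribʳ-+ T (lg extra) _))))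
            where
            each : ∀ i → lg (product-below (multiple i) w) ≤ C.K i * T
            each i = ℕ.≤-trans (lg-product-below (multiple i) w (C.K i * (w * w)) (λ d d<w → ℕ.≤-trans (C.lg-denominator i d) (ℕ.*-monoʳ-≤ (C.K i) (ℕ.*-mono-≤ d<w d<w))))
              (ℕ.≤-reflexive (trans (lemma w (C.K i)) (cong (C.K i *_) T≡w³)))
              where
              lemma : ∀ w K → w * (K * (w * w)) ≡ K * (w * (w * w))
              lemma = solve-∀

          rough : ∀ i {p} → ¬ p ∣ W → C.Rough i p w
          rough i p∤W d d<w p∣ = p∤W (∣n⇒∣m*n extra (∣-trans p∣ (∣-trans (∣-product-below (multiple i) d<w) (∣-productFin s (λ i → product-below (multiple i) w) i))))

          p∤extra : ∀ {p} → ¬ p ∣ W → ¬ p ∣ extra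
          p∤extra p∤W h = p∤W (∣m⇒∣m*n _ h)

          box : List ℕ
          box = range (suc M) β

          smooth : Fin s → List ℕ
          smooth i = filter (C.smooth? i W) box

          -- The number `k + 7` of doublings is of the order of `log N`. It costs nothing: the `k`
          -- is absorbed by `weighted-primeDivisors`, and the 7 by the crude bound on the number of
          -- primes.
          primes≤ : (k + 7) * (1 + length (primeDivisors W)) ≤ (9 + 8 * Cw) * T
          primes≤ = begin
            (k + 7) * (1 + S)                              ≡⟨ lemma₁ k S ⟩
            k + 7 + (k * S + 7 * S)                        ≤⟨ ℕ.+-mono-≤ (ℕ.+-mono-≤ k≤T (ℕ.*-monoʳ-≤ 7 1≤T)) (ℕ.+-mono-≤ (weighted-primeDivisors W k W≢0) (ℕ.*-monoʳ-≤ 7 (length-primeDivisors W W≢0))) ⟩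
            T + 7 * T + (k * 2 ^ k + lg W + 7 * lg W)      ≤⟨ ℕ.+-monoʳ-≤ (T + 7 * T) (ℕ.+-mono-≤ (ℕ.+-mono-≤ kB≤T lgW≤) (ℕ.*-monoʳ-≤ 7 lgW≤)) ⟩
            T + 7 * T + (T + Cw * T + 7 * (Cw * T))        ≡⟨ lemma₂ T Cw ⟩
            (9 + 8 * Cw) * T                               ∎
            where
            open ℕ.≤-Reasoning
            S : ℕ
            S = length (primeDivisors W)
            k≤T : k ≤ T
            k≤T = ℕ.≤-trans (n≤2^n k) (ℕ.^-monoʳ-≤ 2 (ℕ.m≤m+n k (5 * k)))
            kB≤T : k * 2 ^ k ≤ T
            kB≤T = ℕ.≤-trans (ℕ.*-monoˡ-≤ (2 ^ k) (n≤2^n k)) (ℕ.≤-trans (ℕ.≤-reflexive (sym (ℕ.^-distribˡ-+-* 2 k k))) (ℕ.^-monoʳ-≤ 2 (ℕ.+-monoʳ-≤ k (ℕ.m≤m+n k (4 * k)))))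
            lemma₁ : ∀ k S → (k + 7) * (1 + S) ≡ k + 7 + (k * S + 7 * S)
            lemma₁ = solve-∀
            lemma₂ : ∀ T C → T + 7 * T + (T + C * T + 7 * (C * T)) ≡ (9 + 8 * C) * T
            lemma₂ = solve-∀

          smooth≤ : ∀ i → length (smooth i) ≤ c * T
          smooth≤ i = begin
            -- The first `T` indices are counted trivially; `k + 7` doublings then reach the length
            -- `β`.
            length (smooth i)                              ≤⟨ C.smooth-count i W W≢0 M (6 * k) (k + 7) ⟩
            T + (k + 7) * ((1 + S) * Λᵢ)                   ≡⟨ cong (λ z → T + z) (sym (ℕ.*-assoc (k + 7) (1 + S) Λᵢ)) ⟩
            T + (k + 7) * (1 + S) * Λᵢ                     ≤⟨ ℕ.+-monoʳ-≤ T (ℕ.*-mono-≤ primes≤ (≤-sumFin s (λ i → 1 + 2 * (C.κ i * C.separation-constant i)) i)) ⟩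
            T + (9 + 8 * Cw) * T * Λ                       ≤⟨ ℕ.m≤n+m _ (window-constant * T) ⟩
            window-constant * T + (T + (9 + 8 * Cw) * T * Λ)         ≡⟨ lemma window-constant T (9 + 8 * Cw) Λ ⟩
            c * T                                          ∎
            where
            open ℕ.≤-Reasoning
            S Λᵢ : ℕ
            S = length (primeDivisors W)
            Λᵢ = 1 + 2 * (C.κ i * C.separation-constant i)
            lemma : ∀ n T e L → n * T + (T + e * T * L) ≡ (n + (1 + e * L)) * T
            lemma = solve-∀

          if-rough : ∀ {p} {A : Set} → Dec (Prime p) → Dec (p ∣ W) → (Prime p → A) → A → A
          if-rough (yes pp) (no _) x _ = x pp
          if-rough _ _ _ y = y

          -- Exponents at primes dividing `W` are set to zero. A relation survives this, and a
          -- coordinate whose vector vanishes is smooth.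
          exponent : Fin s → ℕ → ℕ → ℤ
          exponent i n p = if-rough (prime? p) (p ∣? W) (λ pp → ordℚ pp (γ i n)) (+ 0)

          class : Fin s → ℕ → List ℕ
          class i p = if-rough (prime? p) (p ∣? W) (λ _ → filter (class? i p) box) []

          class≤ : ∀ i p → length (class i p) ≤ q * 3
          class≤ i p with prime? p | p ∣? W
          ... | yes pp | no p∤W = subst (λ l → length (filter (class? i p) (range (suc M) l)) ≤ q * 3) (sym β≡q*w) (class-count i pp (p∤extra p∤W) (rough i p∤W) q (suc M))
          ... | yes _ | yes _ = z≤n
          ... | no _ | _ = z≤n

          -- A crude finite range holding every prime that can occur; `primes` retains at most `s`
          -- elements of the combined support.
          supp : Fin s → ℕ → List ℕ
          supp i n = upTo (suc (∣ ↥ γ i n ∣ + ↧ₙ γ i n))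

          exponent-supp : ∀ i n p → exponent i n p ≢ + 0 → p ∈ supp i n
          exponent-supp i n p h with prime? p | p ∣? W
          ... | yes _ | yes _ = contradiction refl h
          ... | no _ | _ = contradiction refl h
          ... | yes pp | no _ = ∈-upTo⁺ (s≤s (by (ord p ∣ ↥ γ i n ∣ ℕ.≟ 0) (ord p (↧ₙ γ i n) ℕ.≟ 0)))
            where
            0-0 : + 0 Integers.- + 0 ≡ + 0
            0-0 = Integers.identityℤ [] (# 0 ⊖ # 0 ⊜ # 0) refl
            by : Dec (ord p ∣ ↥ γ i n ∣ ≡ 0) → Dec (ord p (↧ₙ γ i n) ≡ 0) → p ≤ ∣ ↥ γ i n ∣ + ↧ₙ γ i n
            by (no u) _ = ℕ.≤-trans (ord≢0⇒≤ pp (∣ ↥ γ i n ∣) u) (ℕ.m≤m+n _ _)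
            by _ (no u) = ℕ.≤-trans (ord≢0⇒≤ pp (↧ₙ γ i n) u) (ℕ.m≤n+m _ (∣ ↥ γ i n ∣))
            by (yes u) (yes v) = contradiction (trans (cong₂ (λ x y → + x Integers.- + y) u v) 0-0) h

          ζ≤ : q * 3 ≤ c * T
          ζ≤ = begin
            2 ^ (5 * k + 7) * 3            ≡⟨ trans (cong (_* 3) (ℕ.^-distribˡ-+-* 2 (5 * k) 7)) (ℕ.*-assoc (2 ^ (5 * k)) (2 ^ 7) 3) ⟩
            2 ^ (5 * k) * (2 ^ 7 * 3)      ≤⟨ ℕ.*-mono-≤ (ℕ.^-monoʳ-≤ 2 (ℕ.*-monoˡ-≤ k (ℕ.n≤1+n 5))) (proj₁ window-constant-bounds) ⟩
            T * window-constant            ≤⟨ ℕ.*-monoʳ-≤ T (ℕ.m≤m+n window-constant _) ⟩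
            T * c                          ≡⟨ ℕ.*-comm T c ⟩
            c * T                          ∎
            where open ℕ.≤-Reasoning

          boxζ≤ : length box * (q * 3) ≤ c * (T * T)
          boxζ≤ = begin
            length box * (q * 3)                         ≡⟨ cong (_* (q * 3)) (length-range (suc M) β) ⟩
            β * (q * 3)                                  ≡⟨ ℕ.*-assoc β q 3 ⟨
            β * q * 3                                    ≡⟨ cong (_* 3) (sym (ℕ.^-distribˡ-+-* 2 (k + 7 + 6 * k) (5 * k + 7))) ⟩
            2 ^ (k + 7 + 6 * k + (5 * k + 7)) * 3        ≡⟨ cong (λ e → 2 ^ e * 3) (lemma k) ⟩
            2 ^ (6 * k + 6 * k + 14) * 3                 ≡⟨ cong (_* 3) (trans (ℕ.^-distribˡ-+-* 2 (6 * k + 6 * k) 14) (cong (_* 2 ^ 14) (ℕ.^-distribˡ-+-* 2 (6 * k) (6 * k)))) ⟩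
            T * T * 2 ^ 14 * 3                           ≡⟨ ℕ.*-assoc (T * T) (2 ^ 14) 3 ⟩
            T * T * (2 ^ 14 * 3)                         ≤⟨ ℕ.*-monoʳ-≤ (T * T) (ℕ.≤-trans (proj₂ window-constant-bounds) (ℕ.m≤m+n window-constant _)) ⟩
            T * T * c                                    ≡⟨ ℕ.*-comm (T * T) c ⟩
            c * (T * T)                                  ∎
            where
            open ℕ.≤-Reasoning
            lemma : ∀ k → k + 7 + 6 * k + (5 * k + 7) ≡ 6 * k + 6 * k + 14
            lemma = solve-∀

          open Cover s exponent supp exponent-supp box smooth class

          candidates : List (Vec ℕ s)
          candidates = cover s (λ _ → nothing)

          length-candidates : length candidates ≤ (constant * T) ^ s
          length-candidates = Length.length-cover c T (q * 3) 1≤T smooth≤ class≤ ζ≤ boxζ≤ s (λ _ → nothing)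

          candidate : ∀ v → (∀ i → M < lookup v i × lookup v i < suc M + β) → Relation s (λ i → γ i (lookup v i)) → v ∈ candidates
          candidate v inbox rel = subst (_∈ candidates) (tabulate∘lookup v)
            (Correct.cover-∈ (lookup v) k′ k≢0 relation in-box in-smooth in-class s {λ _ → nothing} (λ _ _ ()) (ℕ.≤-reflexive (missing-all s)))
            where
            open Relation rel renaming (k to k′)
            in-box : ∀ i → lookup v i ∈ box
            in-box i = ∈-range (proj₁ (inbox i)) (proj₂ (inbox i))
            zeros : ∀ s (k : Fin s → ℤ) → sumℤ s (λ i → k i Integers.* + 0) ≡ + 0
            zeros zero k = refl
            zeros (suc s) k = trans (cong₂ Integers._+_ (Integers.*-zeroʳ (k zero)) (zeros s (k ∘ suc))) 0+0
              where
              0+0 : + 0 Integers.+ + 0 ≡ + 0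
              0+0 = Integers.identityℤ [] (# 0 ⊕ # 0 ⊜ # 0) refl
            relation : ∀ p → sumℤ s (λ i → k′ i Integers.* exponent i (lookup v i) p) ≡ + 0
            relation p with prime? p | p ∣? W
            ... | yes pp | no _ = linear-relation pp
            ... | yes _ | yes _ = zeros s k′
            ... | no _ | _ = zeros s k′
            in-class : ∀ i p → exponent i (lookup v i) p ≢ + 0 → lookup v i ∈ class i p
            in-class i p h with prime? p | p ∣? W
            ... | yes pp | no _ = ∈-filter⁺ (class? i p) (in-box i) (ord-class i (lookup v i) pp (γ≢0 i) h)
            ... | yes _ | yes _ = contradiction refl h
            ... | no _ | _ = contradiction refl h
            in-smooth : ∀ i → (∀ p → exponent i (lookup v i) p ≡ + 0) → lookup v i ∈ smooth i
            in-smooth i h = ∈-filter⁺ (C.smooth? i W) (in-box i) (γ≢0⇒≢O i (lookup v i) (γ≢0 i) , All.tabulate divides-W)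
              where
              divides-W : ∀ {p} → p ∈ primeDivisors (C.D i (lookup v i)) → p ∣ W
              divides-W {p} p∈ = let pp , p∣D = ∈-primeDivisors⁻ p∈ in by pp p∣D (h p)
                where
                by : Prime p → p ∣ denominator (R i (lookup v i)) → exponent i (lookup v i) p ≡ + 0 → p ∣ W
                by pp p∣D e with prime? p | p ∣? W
                ... | _ | yes p∣W = p∣W
                ... | no ¬pp | no _ = contradiction pp ¬pp
                ... | yes pp′ | no _ = contradiction p∣D (ord-smooth i (lookup v i) pp′ (γ≢0 i) e)

      -- Seventh powers replace the fractional exponent: `T ^ 7 = (2 ^ (7 * k)) ^ 6` is at most
      -- `N ^ 6`. The candidates are constructed before `L` is considered, and a duplicate-free `L`
      -- is no longer than a list containing it.
      bound : Σ ℕ λ C → (M N : ℕ) → 1 ≤ N → (L : List (Vec ℕ s)) → Unique L →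
        All (λ v → InBox M N v × Relation s (λ i → γ i (lookup v i))) L → length L ^ 7 ≤ C * N ^ (6 * s)
      bound = constant ^ (s * 7) , λ M N 1≤N L unique all → let k , lo , hi = scale N 1≤N in by M N L unique all k lo hi
        where
        by : ∀ M N L → Unique L → All (λ v → InBox M N v × Relation s (λ i → γ i (lookup v i))) L →
          ∀ k → 2 ^ (7 * k) ≤ N → N < 2 ^ (7 * k + 7) → length L ^ 7 ≤ constant ^ (s * 7) * N ^ (6 * s)
        by M N L unique all k lo hi = begin
          length L ^ 7                           ≤⟨ ℕ.^-monoˡ-≤ 7 (ℕ.≤-trans (unique-length unique inside) length-candidates) ⟩
          ((constant * T) ^ s) ^ 7               ≡⟨ ℕ.^-*-assoc (constant * T) s 7 ⟩
          (constant * T) ^ (s * 7)               ≡⟨ ^-distribʳ-* (s * 7) constant T ⟩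
          constant ^ (s * 7) * T ^ (s * 7)       ≤⟨ ℕ.*-monoʳ-≤ (constant ^ (s * 7)) T≤ ⟩
          constant ^ (s * 7) * N ^ (6 * s)       ∎
          where
          open ℕ.≤-Reasoning
          open Scale k M
          N≤β : N ≤ β
          N≤β = ℕ.≤-trans (ℕ.<⇒≤ hi) (ℕ.≤-reflexive (cong (2 ^_) (lemma k)))
            where
            lemma : ∀ k → 7 * k + 7 ≡ k + 7 + 6 * k
            lemma = solve-∀
          inside : ∀ {v} → v ∈ L → v ∈ candidates
          inside {v} v∈ = let inbox , rel = All.lookup all v∈ in
            candidate v (λ i → proj₁ (inbox i) , s≤s (ℕ.≤-trans (proj₂ (inbox i)) (ℕ.+-monoʳ-≤ M N≤β))) rel
          T≤ : T ^ (s * 7) ≤ N ^ (6 * s)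
          T≤ = begin
            (2 ^ (6 * k)) ^ (s * 7)       ≡⟨ ℕ.^-*-assoc 2 (6 * k) (s * 7) ⟩
            2 ^ (6 * k * (s * 7))         ≡⟨ cong (2 ^_) (lemma k s) ⟩
            2 ^ (7 * k * (6 * s))         ≡⟨ ℕ.^-*-assoc 2 (7 * k) (6 * s) ⟨
            (2 ^ (7 * k)) ^ (6 * s)       ≤⟨ ℕ.^-monoˡ-≤ (6 * s) lo ⟩
            N ^ (6 * s)                   ∎
            where
            lemma : ∀ k s → 6 * k * (s * 7) ≡ 7 * k * (6 * s)
            lemma = solve-∀

-- Application to denominators and to abscissae

module Theorem where

  open import Defs

  open GroupLaw
  open Denominators using (denominator; ↥↧-coprime)
  open SmoothCount
  open Valuation
  open Dependence
  open CurveCounts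
  open Assembly
  open RingIdentity using (#_; _⊖_; _⊜_)
  open import Data.Nat as ℕ using (ℕ; zero; suc; _≤_; z≤n; s≤s; _+_; _*_; _^_)
  import Data.Nat.Properties as ℕ
  open import Data.Nat.Divisibility using (_∣_; _∣?_; ∣-trans; ∣m⇒∣m*n)
  open import Data.Nat.Primality using (Prime; euclidsLemma; prime⇒nonTrivial)
  open import Data.Integer as ℤ using (ℤ; +_; ∣_∣)
  import Data.Integer.Properties as ℤ
  open import Data.Rational using (ℚ; 0ℚ; ↥_; ↧ₙ_)
  open import Data.Fin using (Fin; zero; suc)
  open import Data.Vec using (Vec)
  open import Data.List using (List; []; length)
  open import Data.List.Relation.Unary.All as All using (All)
  open import Data.List.Relation.Unary.Unique.Propositional using (Unique)
  open import Data.Product using (Σ; _×_; _,_)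
  open import Data.Sum using (_⊎_; inj₁; inj₂; [_,_]′)
  open import Relation.Nullary using (Dec; yes; no; contradiction; ¬_; _⊎-dec_)
  open import Relation.Nullary.Decidable using (decidable-stable)
  open import Relation.Unary using (Decidable)
  open import Relation.Binary.PropositionalEquality using (_≡_; _≢_; refl; sym; trans; cong; cong₂; subst)

  count-⊎ : ∀ {A B : ℕ → Set} (A? : Decidable A) (B? : Decidable B) x n → count (λ i → A? i ⊎-dec B? i) x n ≤ count A? x n + count B? x n
  count-⊎ A? B? x zero = z≤n
  count-⊎ A? B? x (suc n) with A? x | B? x
  ... | yes _ | yes _ = s≤s (ℕ.≤-trans (count-⊎ A? B? (suc x) n) (ℕ.+-monoʳ-≤ _ (ℕ.n≤1+n _)))
  ... | yes _ | no _ = s≤s (count-⊎ A? B? (suc x) n)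
  ... | no _ | yes _ = ℕ.≤-trans (s≤s (count-⊎ A? B? (suc x) n)) (ℕ.≤-reflexive (sym (ℕ.+-suc _ _)))
  ... | no _ | no _ = count-⊎ A? B? (suc x) n

  module _ (s : ℕ) (E : Fin s → Curve) (P Q : Fin s → Pt) (hP : (i : Fin s) → OnCurve (E i) (P i))
    (nontorsion : (i : Fin s) → NonTorsion (E i) (P i)) (hQ : (i : Fin s) → OnCurve (E i) (Q i)) where

    open Count s E P Q hP nontorsion hQ

    private
      on-R : ∀ i n → OnCurve (E i) (R i n)
      on-R i n = add-on (E i) (mul (E i) n (P i)) (Q i) (mul-on (E i) {P i} n (hP i)) (hQ i)

      nonzero-ord : ∀ {p n} (pp : Prime p) → + ord p n ≢ + 0 → p ∣ n
      nonzero-ord {p} {n} pp h = decidable-stable (p ∣? n) (λ p∤n → h (cong +_ (p∤⇒ord≡0 pp n p∤n)))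

    denominators : Σ ℕ λ C → (M N : ℕ) → 1 ≤ N → (L : List (Vec ℕ s)) → Unique L →
      All (λ v → InBox M N v × DStarProp E P Q v) L → length L ^ 7 ≤ C * N ^ (6 * s)
    -- No prime is put into `S` beforehand: a prime outside `S` divides at most one denominator per
    -- window, within the three allowed.
    denominators = let C , h = bound γ 1 (λ ()) (λ i p n → p ∣? denominator (R i n))
                                 (λ i {p} pp _ rough q x → ℕ.≤-trans (C.denominator-count i rough q x) (ℕ.*-monoʳ-≤ q (s≤s z≤n)))
                                 ord-class ord-smooth γ≢0⇒≢O
      in C , λ M N 1≤N L unique all → h M N 1≤N L unique (All.map (λ (inbox , dep) → inbox , maximal-rank⇒relation dep) all)
      where
      γ : Fin s → ℕ → ℚ
      γ i n = ℕ→ℚ (den (R i n))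
      ord-class : ∀ i n {p} (pp : Prime p) → γ i n ≢ 0ℚ → ordℚ pp (γ i n) ≢ + 0 → p ∣ denominator (R i n)
      ord-class i n {p} pp _ h = subst (p ∣_) (sym (den-square (E i) (R i n) (on-R i n)))
        (∣m⇒∣m*n {m = den (R i n)} (den (R i n)) (nonzero-ord {n = den (R i n)} pp (λ e → h (trans (ordℚ-ℕ pp (den (R i n))) e))))
      γ≢0⇒≢O : ∀ i n → γ i n ≢ 0ℚ → R i n ≢ O
      γ≢0⇒≢O i n γ≢0 e = γ≢0 (cong (λ A → ℕ→ℚ (den A)) e)
      ord-smooth : ∀ i n {p} (pp : Prime p) → γ i n ≢ 0ℚ → ordℚ pp (γ i n) ≡ + 0 → ¬ p ∣ denominator (R i n)
      ord-smooth i n {p} pp γ≢0 e p∣D = ord≡0⇒p∤ pp (den (R i n)) (λ d≡0 → γ≢0 (cong ℕ→ℚ d≡0))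
        (ℤ.+-injective (trans (sym (ordℚ-ℕ pp (den (R i n)))) e))
        ([ (λ h → h) , (λ h → h) ]′ (euclidsLemma (den (R i n)) (den (R i n)) pp (subst (p ∣_) (den-square (E i) (R i n) (on-R i n)) p∣D)))

    abscissae : ((i : Fin s) → b (E i) ≢ + 0) →
      Σ ℕ λ C → (M N : ℕ) → 1 ≤ N → (L : List (Vec ℕ s)) → Unique L →
        All (λ v → InBox M N v × XStarProp E P Q v) L → length L ^ 7 ≤ C * N ^ (6 * s)
    abscissae b≢0 = let C , h = bound γ extra extra≢0 (λ i p n → (p ∣? denominator (R i n)) ⊎-dec C.numerator? i p n) class-count ord-class ord-smooth γ≢0⇒≢O
      in C , λ M N 1≤N L unique all → h M N 1≤N L unique (All.map (λ (inbox , dep) → inbox , maximal-rank⇒relation dep) all)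
      where
      -- The argument on numerators excludes the primes dividing `2 b`; they are put into `S`, which
      -- is possible because no `b` vanishes.
      extra : ℕ
      extra = productFin s (λ i → 2 * ∣ b (E i) ∣)
      extra≢0 : extra ≢ 0
      extra≢0 = productFin≢0 s _ (λ i → *-≢0ℕ {2} (λ ()) (λ e → b≢0 i (ℤ.∣i∣≡0⇒i≡0 e)))
      γ : Fin s → ℕ → ℚ
      γ i n = xcoord (R i n)
      γ≢0⇒≢O : ∀ i n → γ i n ≢ 0ℚ → R i n ≢ O
      γ≢0⇒≢O i n γ≢0 e = γ≢0 (cong xcoord e)
      -- One index per window from the denominator and two from the numerator make the three that
      -- `bound` allows.
      class-count : ∀ i {p w} → Prime p → ¬ p ∣ extra → C.Rough i p w → ∀ q x →
        count (λ n → (p ∣? denominator (R i n)) ⊎-dec C.numerator? i p n) x (q * w) ≤ q * 3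
      class-count i {p} {w} pp p∤ rough q x = ℕ.≤-trans (count-⊎ (λ n → p ∣? denominator (R i n)) (C.numerator? i p) x (q * w))
        (ℕ.≤-trans (ℕ.+-mono-≤ (C.denominator-count i rough q x) (C.numerator-count i pp (λ h → p∤ (∣-trans h (∣-productFin s (λ i → 2 * ∣ b (E i) ∣) i))) rough q x))
          (ℕ.≤-reflexive (sym (ℕ.*-distribˡ-+ q 1 2))))
      by-coordinates : ∀ {p} (pp : Prime p) A → A ≢ O → ordℚ pp (xcoord A) ≢ + 0 → (p ∣ denominator A) ⊎ (A ≢ O × p ∣ ∣ ↥ xcoord A ∣)
      by-coordinates pp O A≢O _ = contradiction refl A≢O
      by-coordinates {p} pp A@(aff x _) A≢O h = by (p ∣? ↧ₙ x) (p ∣? (∣ ↥ x ∣))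
        where
        by : Dec (p ∣ ↧ₙ x) → Dec (p ∣ (∣ ↥ x ∣)) → (p ∣ ↧ₙ x) ⊎ (A ≢ O × p ∣ (∣ ↥ x ∣))
        by (yes d) _ = inj₁ d
        by (no _) (yes n) = inj₂ (A≢O , n)
        by (no ¬d) (no ¬n) = contradiction (trans (cong₂ (λ u v → + u Integers.- + v) (p∤⇒ord≡0 pp (∣ ↥ x ∣) ¬n) (p∤⇒ord≡0 pp (↧ₙ x) ¬d)) 0-0) h
          where
          0-0 : + 0 Integers.- + 0 ≡ + 0
          0-0 = Integers.identityℤ [] (# 0 ⊖ # 0 ⊜ # 0) refl
      ord-class : ∀ i n {p} (pp : Prime p) → γ i n ≢ 0ℚ → ordℚ pp (γ i n) ≢ + 0 → (p ∣ denominator (R i n)) ⊎ C.Numerator i p n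
      ord-class i n pp γ≢0 h = by-coordinates pp (R i n) (γ≢0⇒≢O i n γ≢0) h
      -- In lowest terms a prime in the denominator cannot be compensated by the numerator, so a
      -- zero valuation excludes it.
      coprime-ord : ∀ {p} (pp : Prime p) A → A ≢ O → ordℚ pp (xcoord A) ≡ + 0 → ¬ p ∣ denominator A
      coprime-ord pp O A≢O _ _ = A≢O refl
      coprime-ord {p} pp (aff x _) _ e p∣d = ord≡0⇒p∤ pp (↧ₙ x) (λ ()) (ℤ.+-injective (sym (Integers.i-j≡0⇒i≡j (+ 0) (+ ord p (↧ₙ x))
          (trans (cong (λ u → + u Integers.- + ord p (↧ₙ x)) (sym (p∤⇒ord≡0 pp (∣ ↥ x ∣) p∤n))) e)))) p∣d
        where
        p∤n : ¬ p ∣ ∣ ↥ x ∣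
        p∤n p∣n = ℕ.<⇒≢ (ℕ.nonTrivial⇒n>1 p {{prime⇒nonTrivial pp}}) (sym (↥↧-coprime x (p∣n , p∣d)))
      ord-smooth : ∀ i n {p} (pp : Prime p) → γ i n ≢ 0ℚ → ordℚ pp (γ i n) ≡ + 0 → ¬ p ∣ denominator (R i n)
      ord-smooth i n pp γ≢0 e = coprime-ord pp (R i n) (γ≢0⇒≢O i n γ≢0) e

open import Defs
open import Data.Nat using (ℕ; _≤_; _*_; _^_; NonZero)
open import Data.Integer using (ℤ; +_)
open import Data.Fin using (Fin)
open import Data.Vec using (Vec)
open import Data.List using (List; length)
open import Data.List.Relation.Unary.All using (All)
open import Data.List.Relation.Unary.Unique.Propositional using (Unique)
open import Data.Product using (Σ; _×_)
open import Relation.Binary.PropositionalEquality using (_≢_)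

open import Data.Product using (_,_)

theorem2p1 : (s : ℕ) → 2 ≤ s →
    (E : Fin s → Curve) (P Q : Fin s → Pt) →
    ((i : Fin s) → OnCurve (E i) (P i)) →
    ((i : Fin s) → NonTorsion (E i) (P i)) →
    ((i : Fin s) → OnCurve (E i) (Q i)) →
    (Σ ℕ λ C → (M N : ℕ) → 1 ≤ N → (L : List (Vec ℕ s)) → Unique L →
    All (λ v → InBox M N v × DStarProp E P Q v) L →
    length L ^ 7 ≤ C * N ^ (6 * s))
    ×
    (((i : Fin s) → b (E i) ≢ + 0) →
    Σ ℕ λ C → (M N : ℕ) → 1 ≤ N → (L : List (Vec ℕ s)) → Unique L →
    All (λ v → InBox M N v × XStarProp E P Q v) L →
    length L ^ 7 ≤ C * N ^ (6 * s))
theorem2p1 s _ E P Q hP nontorsion hQ =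
  Theorem.denominators s E P Q hP nontorsion hQ , Theorem.abscissae s E P Q hP nontorsion hQ
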